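{- Let $\Gamma(x,y,z)=\sum_{r,c,\nu\ge 0}\frac{\Gamma_{r,c,\nu}}{(r+\nu)!}x^ry^cz^\nu$ be the generating function for the number of central graphs, where $\Gamma_{r,c,\nu}$ is the number of central graphs of rank $r$ and cardinality $c$ with $\nu$ bipartite components. Then $$ \begin{aligned} \Gamma(x,y,z) ={}& \exp\left[\left(\frac12\log\left(1+\sum_{n\ge1,\,k\ge0}\ \sum_{i=0}^n\binom ni\binom{i(n-i)}{k}\frac1{n!}x^ny^k\right)-x\right)\frac zx\right]\\ &\cdot\left(\sum_{r=0}^\infty\frac{2^r}{r!}x^ry^r\right)\cdot\exp\left(\sum_{r,c\ge1}\left(\sum_{t=1}^{c-r+1}2\,\bar\gamma^{(0)}_{r-1,c-t}\binom rt\right)\frac1{r!}x^ry^c\right)\\ &\cdot\left(\exp\left(\log\left(1+\sum_{n\ge1,\,k\ge0}\binom{\binom n2}{k}\frac1{n!}x^ny^k\right)-x\right)-\sum_{n\ge2,\,k\ge1}\bar b_{n,k}\frac1{n!}x^ny^k\right). \end{aligned} $$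
   Context: Graphs are simple and labeled. A $3$-colored graph is a graph each of whose vertices has one of the colors $0$, $1$, $*$; a vertex is colored if its color is $0$ or $1$, and non-colored if its color is $*$; a graph is non-colored if all its vertices are. A $3$-colored graph $G$ corresponds to the hyperplane arrangement consisting of $\{x_i+x_j=1\}$ for each edge $\{i,j\}$, $\{x_i=0\}$ for each vertex $i$ of color $0$, and $\{x_i=1\}$ for each vertex $i$ of color $1$; the vertices of $G$ are exactly the indices involved in these hyperplanes, so $G$ has no isolated non-colored vertices. $G$ is central if these hyperplanes have nonempty common intersection. The rank of $G$ is the dimension of the span of the normal vectors of the hyperplanes, and the cardinality of $G$ is the number of hyperplanes. The graphs counted by $\Gamma_{r,c,\nu}$ have vertex set $\{1,\dots,r+\nu\}$. $\bar b_{n,k}$ is the number of connected bipartite graphs of order $n$ (number of vertices) and size $k$ (number of edges). $\bar\gamma^{(0)}_{r,c}$ is the number of connected, non-colored, bipartite graphs without isolated vertices of rank $r$ and cardinality $c$ (a connected bipartite graph has rank one less than its order).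
   Formalization: As printed the last factor is wrong: at x^4y^2 the right side is 1/8 (two disjoint edges) while Γ_{4,2,0}=0. Proved instead with the sum over b̄_{n,k} subtracted inside the exponential: exp((log(…)−x) − Σ b̄_{n,k} x^n y^k/n!). -}

module Defs where

open import Algebra.Bundles using (CommutativeRing)
open import Data.Bool.Base using (Bool; true; false; T; if_then_else_; _∧_)
open import Data.Bool.Properties as Bool using (T?)
open import Data.Empty using (⊥-elim)
open import Data.Fin.Base using (Fin; zero; suc; toℕ)
import Data.Fin.Properties as Fin
open import Data.Fin.Subset as Subset using (Subset; _∈_; Nonempty)
open import Data.Fin.Subset.Properties using (_∈?_; nonempty?; anySubset?)
import Data.Integer.Base as ℤ
open import Data.List.Base as List
  using (List; []; _∷_; [_]; _++_; length; filter; concatMap; allFin;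
         cartesianProduct; cartesianProductWith)
import Data.List.Membership.Propositional as List using (_∈_)
open import Data.List.Membership.Propositional.Properties using (∈-allFin; ∈-lookup)
open import Data.List.Relation.Unary.All as All using (All; []; _∷_)
open import Data.List.Relation.Unary.Any using (here; there)
open import Data.Nat.Base as ℕ using (ℕ; zero; suc; _≤ᵇ_; _∸_; _!)
import Data.Nat.Properties as ℕ
open import Data.Product.Base using (∃; Σ-syntax; _×_; _,_; proj₁; proj₂; map₂)
open import Data.Rational.Base
  using (ℚ; 0ℚ; 1ℚ; _+_; _*_; _-_; -_; _/_; 1/_; NonZero; ≢-nonZero)
import Data.Rational.Properties as ℚ
open import Data.Rational.Solver using (module +-*-Solver)
open import Data.Sum.Base using (_⊎_; inj₁; inj₂)
open import Data.Vec.Base as Vec using (Vec; []; _∷_)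
open import Data.Vec.Functional as Vector using (Vector)
open import Function.Base using (_∘_; id)
open import Level using (Level)
open import Relation.Binary.Construct.Closure.ReflexiveTransitive
  using (Star; ε; _◅_; _◅◅_)
open import Relation.Binary.PropositionalEquality
  using (_≡_; _≢_; refl; sym; trans; cong; cong₂; module ≡-Reasoning)
open import Relation.Nullary using (Dec; yes; no; ¬_; does)
open import Relation.Nullary.Decidable
  using (¬?; _×-dec_; _⊎-dec_; _→-dec_) renaming (map′ to mapDec)
open import Relation.Unary using (Pred; Decidable)

open import Algebra.Properties.Semiring.Sum
  (CommutativeRing.semiring ℚ.+-*-commutativeRing) public
  using (sum; sum-syntax; sum-cong-≗; sum-replicate-zero; *-distribˡ-sum)

private variable
  a p : Level
  X : Set a
  m n : ℕ

fromℕ : ℕ → ℚ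
fromℕ k = ℤ.+ k / 1

infixl 7 _/!_
_/!_ : ℚ → ℕ → ℚ
q /! k = q * ((ℤ.+ 1 / k !) {{k ℕ.!≢0}})

count : {P : Pred X p} → Decidable P → List X → ℕ
count P? = length ∘ filter P?

allVecs : List X → ∀ n → List (Vec X n)
allVecs xs zero    = [ [] ]
allVecs xs (suc n) = cartesianProductWith _∷_ xs (allVecs xs n)

infix 8 _∙_
_∙_ : Vector ℚ n → Vector ℚ n → ℚ
u ∙ v = sum (λ i → u i * v i)

∙-zeroˡ : (v : Vector ℚ n) → (λ _ → 0ℚ) ∙ v ≡ 0ℚ
∙-zeroˡ {n} v = trans (sum-cong-≗ (λ i → ℚ.*-zeroˡ (v i))) (sum-replicate-zero n)

∙-elim : (r : ℚ) (u w x : Vector ℚ n) →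
         (λ j → u j - r * w j) ∙ x ≡ u ∙ x - r * w ∙ x
∙-elim {zero}  r u w x =
  solve 1 (λ r → con 0ℚ := con 0ℚ :- r :* con 0ℚ) refl r
  where open +-*-Solver
∙-elim {suc n} r u w x = begin
  (u₀ - r * w₀) * x₀ + (λ j → u′ j - r * w′ j) ∙ x′
    ≡⟨ cong ((u₀ - r * w₀) * x₀ +_) (∙-elim r u′ w′ x′) ⟩
  (u₀ - r * w₀) * x₀ + (u′ ∙ x′ - r * w′ ∙ x′)
    ≡⟨ solve 6 (λ r u w x s t →
         (u :- r :* w) :* x :+ (s :- r :* t) :=
         (u :* x :+ s) :- r :* (w :* x :+ t)) refl r u₀ w₀ x₀ (u′ ∙ x′) (w′ ∙ x′) ⟩
  (u₀ * x₀ + u′ ∙ x′) - r * (w₀ * x₀ + w′ ∙ x′) ∎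
  where
  open ≡-Reasoning
  open +-*-Solver
  u₀ = u zero
  w₀ = w zero
  x₀ = x zero
  u′ = Vector.tail u
  w′ = Vector.tail w
  x′ = Vector.tail x

Solvable : (Fin m → Vector ℚ n) → Vector ℚ m → Set
Solvable {n = n} A b = Σ[ x ∈ Vector ℚ n ] (∀ i → A i ∙ x ≡ b i)

-- Gaussian elimination on the columns of A.
solvable? : (A : Fin m → Vector ℚ n) (b : Vector ℚ m) → Dec (Solvable A b)
solvable? {n = zero}  A b =
  mapDec (λ 0≡b → (λ ()) , 0≡b) proj₂ (Fin.all? (λ i → 0ℚ ℚ.≟ b i))
solvable? {n = suc n} A b with Fin.any? (λ i → ¬? (A i zero ℚ.≟ 0ℚ))
... | no ¬pivot = mapDec to from (solvable? (Vector.tail ∘ A) b)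
  where
  open +-*-Solver
  col≡0 : ∀ i → A i zero ≡ 0ℚ
  col≡0 i with A i zero ℚ.≟ 0ℚ
  ... | yes eq = eq
  ... | no neq = ⊥-elim (¬pivot (i , neq))
  drop : ∀ i x₀ s → A i zero * x₀ + s ≡ s
  drop i x₀ s = trans (cong (λ t → t * x₀ + s) (col≡0 i))
    (solve 2 (λ x s → con 0ℚ :* x :+ s := s) refl x₀ s)
  to : Solvable (Vector.tail ∘ A) b → Solvable A b
  to (x , eq) = (0ℚ Vector.∷ x) , λ i → trans (drop i 0ℚ (Vector.tail (A i) ∙ x)) (eq i)
  from : Solvable A b → Solvable (Vector.tail ∘ A) b
  from (x , eq) = Vector.tail x ,
    λ i → trans (sym (drop i (x zero) (Vector.tail (A i) ∙ Vector.tail x))) (eq i)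
... | yes (l , Al≢0) = mapDec to from (solvable? A′ b′)
  where
  open ≡-Reasoning
  open +-*-Solver
  instance
    pivot≢0 : NonZero (A l zero)
    pivot≢0 = ≢-nonZero Al≢0
  q : ℚ
  q = 1/ A l zero
  r : Vector ℚ _
  r i = A i zero * q
  A′ : Fin _ → Vector ℚ n
  A′ i j = A i (suc j) - r i * A l (suc j)
  b′ : Vector ℚ _
  b′ i = b i - r i * b l
  S : Fin _ → Vector ℚ n → ℚ
  S i x = Vector.tail (A i) ∙ x
  to : Solvable A′ b′ → Solvable A b
  to (x , eq) = (q * (b l - S l x) Vector.∷ x) , λ i → begin
    A i zero * (q * (b l - S l x)) + S i x
      ≡⟨ solve 5 (λ a q b s t → a :* (q :* (b :- s)) :+ t :=
           (t :- (a :* q) :* s) :+ (a :* q) :* b) refl (A i zero) q (b l) (S l x) (S i x) ⟩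
    (S i x - r i * S l x) + r i * b l
      ≡⟨ cong (_+ r i * b l) (trans (sym (∙-elim (r i) (Vector.tail (A i)) (Vector.tail (A l)) x)) (eq i)) ⟩
    (b i - r i * b l) + r i * b l
      ≡⟨ solve 2 (λ b c → (b :- c) :+ c := b) refl (b i) (r i * b l) ⟩
    b i ∎
  from : Solvable A b → Solvable A′ b′
  from (x , eq) = x′ , λ i → begin
    A′ i ∙ x′
      ≡⟨ ∙-elim (r i) (Vector.tail (A i)) (Vector.tail (A l)) x′ ⟩
    S i x′ - r i * S l x′
      ≡⟨ solve 6 (λ a q x s t p → s :- (a :* q) :* t :=
           ((a :* x :+ s) :- (a :* q) :* (p :* x :+ t)) :+ a :* x :* (q :* p :- con 1ℚ))
           refl (A i zero) q x₀ (S i x′) (S l x′) (A l zero) ⟩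
    ((A i zero * x₀ + S i x′) - r i * (A l zero * x₀ + S l x′)) + A i zero * x₀ * (q * A l zero - 1ℚ)
      ≡⟨ cong₂ _+_ (cong₂ (λ s t → s - r i * t) (eq i) (eq l))
           (cong (λ t → A i zero * x₀ * (t - 1ℚ)) (ℚ.*-inverseˡ (A l zero))) ⟩
    (b i - r i * b l) + A i zero * x₀ * (1ℚ - 1ℚ)
      ≡⟨ solve 2 (λ s t → s :+ t :* con 0ℚ := s) refl (b i - r i * b l) (A i zero * x₀) ⟩
    b i - r i * b l ∎
    where
    x₀ = x zero
    x′ = Vector.tail x

lincomb : (vs : List (Vector ℚ n)) → Vector ℚ (length vs) → Vector ℚ n
lincomb vs c i = (λ j → List.lookup vs j i) ∙ c

Span : List (Vector ℚ n) → Pred (Vector ℚ n) _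
Span vs v = Σ[ c ∈ Vector ℚ (length vs) ] (∀ i → lincomb vs c i ≡ v i)

Independent : List (Vector ℚ n) → Set
Independent vs =
  (c : Vector ℚ (length vs)) → (∀ i → lincomb vs c i ≡ 0ℚ) → ∀ j → c j ≡ 0ℚ

record BasisOfSpan {n} (vs : List (Vector ℚ n)) : Set where
  field
    basis       : List (Vector ℚ n)
    independent : Independent basis
    contained   : All (Span vs) basis
    spanning    : All (Span basis) vs

span? : (vs : List (Vector ℚ n)) → Decidable (Span vs)
span? vs v = solvable? (λ i j → List.lookup vs j i) v

weaken : ∀ (v : Vector ℚ n) vs {w} → Span vs w → Span (v ∷ vs) w
weaken v vs (c , eq) = (0ℚ Vector.∷ c) , λ i →
  trans (solve 2 (λ v s → v :* con 0ℚ :+ s := s) refl (v i) (lincomb vs c i)) (eq i)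
  where open +-*-Solver

head∈span : ∀ (v : Vector ℚ n) vs → Span (v ∷ vs) v
head∈span v vs = (1ℚ Vector.∷ λ _ → 0ℚ) , λ i → begin
  v i * 1ℚ + (λ j → List.lookup vs j i) ∙ (λ _ → 0ℚ)
    ≡⟨ cong (v i * 1ℚ +_) (trans (sum-cong-≗ (λ j → ℚ.*-zeroʳ (List.lookup vs j i)))
                                 (sum-replicate-zero (length vs))) ⟩
  v i * 1ℚ + 0ℚ  ≡⟨ solve 1 (λ v → v :* con 1ℚ :+ con 0ℚ := v) refl (v i) ⟩
  v i            ∎
  where
  open ≡-Reasoning
  open +-*-Solver

extend : ∀ (v : Vector ℚ n) vs → ¬ Span vs v → Independent vs → Independent (v ∷ vs)
extend v vs v∉ ind c eq with c zero ℚ.≟ 0ℚ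
... | yes c₀≡0 = all≡0
  where
  open +-*-Solver
  tail≡0 : ∀ i → lincomb vs (Vector.tail c) i ≡ 0ℚ
  tail≡0 i = trans
    (solve 2 (λ v s → s := v :* con 0ℚ :+ s) refl (v i) (lincomb vs (Vector.tail c) i))
    (trans (cong (λ t → v i * t + lincomb vs (Vector.tail c) i) (sym c₀≡0)) (eq i))
  all≡0 : ∀ j → c j ≡ 0ℚ
  all≡0 zero    = c₀≡0
  all≡0 (suc j) = ind (Vector.tail c) tail≡0 j
... | no c₀≢0 = ⊥-elim (v∉ ((λ j → - q * c′ j) , λ i → begin
    (λ j → List.lookup vs j i) ∙ (λ j → - q * c′ j)
      ≡⟨ sum-cong-≗ (λ j → solve 3 (λ u q c → u :* (:- q :* c) := :- q :* (u :* c))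
           refl (List.lookup vs j i) q (c′ j)) ⟩
    sum (λ j → - q * (List.lookup vs j i * c′ j))
      ≡⟨ *-distribˡ-sum (- q) (λ j → List.lookup vs j i * c′ j) ⟨
    - q * lincomb vs c′ i
      ≡⟨ solve 4 (λ q v c s → :- q :* s := :- q :* (v :* c :+ s) :+ v :* (q :* c))
           refl q (v i) (c zero) (lincomb vs c′ i) ⟩
    - q * (v i * c zero + lincomb vs c′ i) + v i * (q * c zero)
      ≡⟨ cong₂ (λ s t → - q * s + v i * t) (eq i) (ℚ.*-inverseˡ (c zero)) ⟩
    - q * 0ℚ + v i * 1ℚ
      ≡⟨ solve 2 (λ q v → :- q :* con 0ℚ :+ v :* con 1ℚ := v) refl q (v i) ⟩
    v i ∎))
  where
  open ≡-Reasoning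
  open +-*-Solver
  instance
    c₀-nonZero : NonZero (c zero)
    c₀-nonZero = ≢-nonZero c₀≢0
  q : ℚ
  q = 1/ c zero
  c′ : Vector ℚ (length vs)
  c′ = Vector.tail c

basisOfSpan : (vs : List (Vector ℚ n)) → BasisOfSpan vs
basisOfSpan []       = record
  { basis = [] ; independent = λ _ _ () ; contained = [] ; spanning = [] }
basisOfSpan (v ∷ vs) with basisOfSpan vs
... | record { basis = bs ; independent = ind ; contained = con ; spanning = spn }
  with span? bs v
...   | yes v∈ = record
  { basis       = bs
  ; independent = ind
  ; contained   = All.map (weaken v vs) con
  ; spanning    = v∈ ∷ spn
  }
...   | no v∉ = record
  { basis       = v ∷ bs
  ; independent = extend v bs v∉ ind
  ; contained   = head∈span v vs ∷ All.map (weaken v vs) con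
  ; spanning    = head∈span v bs ∷ All.map (weaken v bs) spn
  }

dimSpan : List (Vector ℚ n) → ℕ
dimSpan = length ∘ BasisOfSpan.basis ∘ basisOfSpan

-- The hyperplane { x | normal ∙ x = offset }.
record Hyperplane (n : ℕ) : Set where
  constructor hyperplane
  field
    normal : Vector ℚ n
    offset : ℚ

open Hyperplane

_OnHyperplane_ : Vector ℚ n → Hyperplane n → Set
x OnHyperplane H = normal H ∙ x ≡ offset H

HasCommonPoint : List (Hyperplane n) → Set
HasCommonPoint {n} Hs = Σ[ x ∈ Vector ℚ n ] All (x OnHyperplane_) Hs

hasCommonPoint? : Decidable (HasCommonPoint {n})
hasCommonPoint? Hs = mapDec
  (map₂ fromIndices)
  (map₂ (λ on i → All.lookup on (∈-lookup i)))
  (solvable? (normal ∘ List.lookup Hs) (offset ∘ List.lookup Hs))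
  where
  fromIndices : ∀ {xs : List X} {P : Pred X p} → (∀ i → P (List.lookup xs i)) → All P xs
  fromIndices {xs = []}     f = []
  fromIndices {xs = x ∷ xs} f = f zero ∷ fromIndices (f ∘ suc)

coordinate : Fin n → Vector ℚ n
coordinate i k = if does (i Fin.≟ k) then 1ℚ else 0ℚ

Graph : ℕ → Set
Graph n = Vec (Vec Bool n) n

Adj : Graph n → Fin n → Fin n → Set
Adj A i j = T (Vec.lookup (Vec.lookup A i) j)

adj? : (A : Graph n) → ∀ i j → Dec (Adj A i j)
adj? A i j = T? _

IsSimple : Graph n → Set
IsSimple A = (∀ i j → Adj A i j → Adj A j i) × (∀ i → ¬ Adj A i i)

isSimple? : Decidable (IsSimple {n})
isSimple? A =
  Fin.all? (λ i → Fin.all? λ j → adj? A i j →-dec adj? A j i)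
  ×-dec Fin.all? (λ i → ¬? (adj? A i i))

simpleGraphs : ∀ n → List (Graph n)
simpleGraphs n = filter isSimple? (allVecs (allVecs (true ∷ false ∷ []) n) n)

edges : Graph n → List (Fin n × Fin n)
edges {n} A = filter (λ (i , j) → (i Fin.<? j) ×-dec adj? A i j)
                     (cartesianProduct (allFin n) (allFin n))

size : Graph n → ℕ
size = length ∘ edges

NonIsolated : Graph n → Fin n → Set
NonIsolated A i = ∃ λ j → Adj A i j

nonIsolated? : (A : Graph n) → Decidable (NonIsolated A)
nonIsolated? A i = Fin.any? (adj? A i)

Reachable : Graph n → Fin n → Fin n → Set
Reachable A = Star (Adj A)

module _ (A : Graph n) where

  -- Walks whose interior vertices are drawn from the list.
  Via : List (Fin n) → Fin n → Fin n → Set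
  Via []       i j = i ≡ j ⊎ Adj A i j
  Via (k ∷ ks) i j = Via ks i j ⊎ (Via ks i k × Via ks k j)

  via? : ∀ ks i j → Dec (Via ks i j)
  via? []       i j = (i Fin.≟ j) ⊎-dec adj? A i j
  via? (k ∷ ks) i j = via? ks i j ⊎-dec (via? ks i k ×-dec via? ks k j)

  via⇒reachable : ∀ ks {i j} → Via ks i j → Reachable A i j
  via⇒reachable []       (inj₁ refl)    = ε
  via⇒reachable []       (inj₂ e)       = e ◅ ε
  via⇒reachable (k ∷ ks) (inj₁ w)       = via⇒reachable ks w
  via⇒reachable (k ∷ ks) (inj₂ (v , w)) = via⇒reachable ks v ◅◅ via⇒reachable ks w

  via-base : ∀ ks {i j} → i ≡ j ⊎ Adj A i j → Via ks i j
  via-base []       e = e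
  via-base (k ∷ ks) e = inj₁ (via-base ks e)

  via-trans : ∀ ks {i k j} → k List.∈ ks → Via ks i k → Via ks k j → Via ks i j
  via-trans (l ∷ ks) (here refl) v w = inj₂ (left v , right w)
    where
    left : ∀ {i} → Via (l ∷ ks) i l → Via ks i l
    left (inj₁ v)       = v
    left (inj₂ (v , _)) = v
    right : ∀ {j} → Via (l ∷ ks) l j → Via ks l j
    right (inj₁ w)       = w
    right (inj₂ (_ , w)) = w
  via-trans (l ∷ ks) (there k∈) (inj₁ v)        (inj₁ w)        = inj₁ (via-trans ks k∈ v w)
  via-trans (l ∷ ks) (there k∈) (inj₁ v)        (inj₂ (w , w′)) = inj₂ (via-trans ks k∈ v w , w′)
  via-trans (l ∷ ks) (there k∈) (inj₂ (v , v′)) (inj₁ w)        = inj₂ (v , via-trans ks k∈ v′ w)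
  via-trans (l ∷ ks) (there k∈) (inj₂ (v , _))  (inj₂ (_ , w′)) = inj₂ (v , w′)

  reachable⇒via : ∀ {i j} → Reachable A i j → Via (allFin n) i j
  reachable⇒via ε                   = via-base (allFin n) (inj₁ refl)
  reachable⇒via (_◅_ {j = k} e es)  =
    via-trans (allFin n) (∈-allFin k) (via-base (allFin n) (inj₂ e)) (reachable⇒via es)

reachable? : (A : Graph n) → ∀ i j → Dec (Reachable A i j)
reachable? {n} A i j = mapDec (via⇒reachable A (allFin n)) (reachable⇒via A) (via? A (allFin n) i j)

Connected : Graph n → Set
Connected A = ∀ i j → Reachable A i j

connected? : Decidable (Connected {n})
connected? A = Fin.all? λ i → Fin.all? λ j → reachable? A i j

-- The subgraph induced on S is bipartite.
BipartiteOn : Graph n → Subset n → Set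
BipartiteOn {n} A S = ∃ λ (side : Subset n) →
  ∀ i → i ∈ S → ∀ j → j ∈ S → Adj A i j → Vec.lookup side i ≢ Vec.lookup side j

bipartiteOn? : (A : Graph n) → Decidable (BipartiteOn A)
bipartiteOn? A S = anySubset? λ side →
  Fin.all? λ i → (i ∈? S) →-dec Fin.all? λ j → (j ∈? S) →-dec
    (adj? A i j →-dec ¬? (Vec.lookup side i Bool.≟ Vec.lookup side j))

Bipartite : Graph n → Set
Bipartite A = BipartiteOn A Subset.⊤

bipartite? : Decidable (Bipartite {n})
bipartite? A = bipartiteOn? A Subset.⊤

IsComponent : Graph n → Subset n → Set
IsComponent A S = Nonempty S ×
  (∀ i → i ∈ S → ∀ j → (j ∈ S → Reachable A i j) × (Reachable A i j → j ∈ S))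

isComponent? : (A : Graph n) → Decidable (IsComponent A)
isComponent? A S = nonempty? S ×-dec
  (Fin.all? λ i → (i ∈? S) →-dec Fin.all? λ j →
    ((j ∈? S) →-dec reachable? A i j) ×-dec (reachable? A i j →-dec (j ∈? S)))

data Colour : Set where
  𝟎 𝟏 ∗ : Colour

record ColouredGraph (n : ℕ) : Set where
  constructor colouredGraph
  field
    graph  : Graph n
    colour : Vec Colour n

open ColouredGraph

colouredGraphs : ∀ n → List (ColouredGraph n)
colouredGraphs n =
  cartesianProductWith colouredGraph (simpleGraphs n) (allVecs (𝟎 ∷ 𝟏 ∷ ∗ ∷ []) n)

NonColoured : ColouredGraph n → Fin n → Set
NonColoured G i = Vec.lookup (colour G) i ≡ ∗

nonColoured? : (G : ColouredGraph n) → Decidable (NonColoured G)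
nonColoured? G i with Vec.lookup (colour G) i
... | 𝟎 = no λ ()
... | 𝟏 = no λ ()
... | ∗ = yes refl

vertexHyperplane : ColouredGraph n → Fin n → List (Hyperplane n)
vertexHyperplane G i with Vec.lookup (colour G) i
... | 𝟎 = [ hyperplane (coordinate i) 0ℚ ]
... | 𝟏 = [ hyperplane (coordinate i) 1ℚ ]
... | ∗ = []

edgeHyperplane : Fin n × Fin n → Hyperplane n
edgeHyperplane (i , j) = hyperplane (λ k → coordinate i k + coordinate j k) 1ℚ

-- For a simple graph the hyperplanes listed are pairwise distinct.
arrangement : ColouredGraph n → List (Hyperplane n)
arrangement {n} G =
  List.map edgeHyperplane (edges (graph G)) ++ concatMap (vertexHyperplane G) (allFin n)

Central : ColouredGraph n → Set
Central G = HasCommonPoint (arrangement G)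

rank : ColouredGraph n → ℕ
rank = dimSpan ∘ List.map normal ∘ arrangement

cardinality : ColouredGraph n → ℕ
cardinality = length ∘ arrangement

-- Every vertex is an index of some hyperplane of the arrangement.
NoIsolatedNonColoured : ColouredGraph n → Set
NoIsolatedNonColoured G = ∀ i → NonColoured G i → NonIsolated (graph G) i

-- A coloured component contributes its full order to the rank, so it is the
-- non-coloured bipartite components that make up the difference ν between the
-- order r + ν and the rank r of a central graph.
BipartiteComponent : ColouredGraph n → Subset n → Set
BipartiteComponent G S =
  IsComponent (graph G) S × BipartiteOn (graph G) S × (∀ i → i ∈ S → NonColoured G i)

bipartiteComponent? : (G : ColouredGraph n) → Decidable (BipartiteComponent G)
bipartiteComponent? G S =
  isComponent? (graph G) S ×-dec bipartiteOn? (graph G) S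
  ×-dec Fin.all? (λ i → (i ∈? S) →-dec nonColoured? G i)

bipartiteComponents : ColouredGraph n → ℕ
bipartiteComponents {n} G = count (bipartiteComponent? G) (allVecs (true ∷ false ∷ []) n)

IsΓ : (r c ν : ℕ) → ColouredGraph n → Set
IsΓ r c ν G = NoIsolatedNonColoured G × Central G ×
  rank G ≡ r × cardinality G ≡ c × bipartiteComponents G ≡ ν

isΓ? : (r c ν : ℕ) → Decidable (IsΓ {n} r c ν)
isΓ? r c ν G =
  Fin.all? (λ i → nonColoured? G i →-dec nonIsolated? (graph G) i)
  ×-dec hasCommonPoint? (arrangement G)
  ×-dec (rank G ℕ.≟ r) ×-dec (cardinality G ℕ.≟ c) ×-dec (bipartiteComponents G ℕ.≟ ν)

Γ : (r c ν : ℕ) → ℕ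
Γ r c ν = count (isΓ? r c ν) (colouredGraphs (r ℕ.+ ν))

-- The generating series of b̄ is to be subtracted inside the exponential that
-- counts the non-coloured components without bipartite ones: the difference
-- exp(log(1 + …) - x) - Σ b̄_{n,k} xⁿyᵏ/n! would keep x⁴y²/8 from the graphs
-- formed by two disjoint edges, although no central graph has rank 4 and
-- cardinality 2.
b̄ : (n k : ℕ) → ℕ
b̄ n k = count (λ A → connected? A ×-dec bipartite? A ×-dec (size A ℕ.≟ k)) (simpleGraphs n)

Isγ̄ : (r c : ℕ) → ColouredGraph n → Set
Isγ̄ r c G = Connected (graph G) × (∀ i → NonColoured G i) × Bipartite (graph G) ×
  (∀ i → NonIsolated (graph G) i) × rank G ≡ r × cardinality G ≡ c

isγ̄? : (r c : ℕ) → Decidable (Isγ̄ {n} r c)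
isγ̄? r c G =
  connected? (graph G) ×-dec Fin.all? (nonColoured? G) ×-dec bipartite? (graph G)
  ×-dec Fin.all? (nonIsolated? (graph G)) ×-dec (rank G ℕ.≟ r) ×-dec (cardinality G ℕ.≟ c)

-- A connected bipartite non-coloured graph of rank r has order r + 1.
γ̄⁽⁰⁾ : (r c : ℕ) → ℕ
γ̄⁽⁰⁾ r c = count (isγ̄? r c) (colouredGraphs (suc r))

-- F a b c is the coefficient of xᵃ yᵇ zᶜ.
Series : Set
Series = ℕ → ℕ → ℕ → ℚ

infix 4 _≋_
_≋_ : Series → Series → Set
F ≋ G = ∀ a b c → F a b c ≡ G a b c

-- Σ_{n ≥ n₀, k ≥ k₀} f n k xⁿ yᵏ
∑xⁿyᵏ : (n₀ k₀ : ℕ) → (ℕ → ℕ → ℚ) → Series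
∑xⁿyᵏ n₀ k₀ f n k zero    = if (n₀ ≤ᵇ n) ∧ (k₀ ≤ᵇ k) then f n k else 0ℚ
∑xⁿyᵏ n₀ k₀ f n k (suc _) = 0ℚ

-- Σ_{r ≥ 0} f r xʳ yʳ
∑xʳyʳ : (ℕ → ℚ) → Series
∑xʳyʳ f a b zero    = if does (a ℕ.≟ b) then f a else 0ℚ
∑xʳyʳ f a b (suc _) = 0ℚ

∑xʳyᶜzᵛ : (ℕ → ℕ → ℕ → ℚ) → Series
∑xʳyᶜzᵛ = id

𝟙 𝕩 𝕫 : Series
𝟙 0 0 0 = 1ℚ
𝟙 _ _ _ = 0ℚ
𝕩 1 0 0 = 1ℚ
𝕩 _ _ _ = 0ℚ
𝕫 0 0 1 = 1ℚ
𝕫 _ _ _ = 0ℚ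

infixl 6 _⊕_ _⊖_
infixl 7 _⊗_ _·_
infix  7 _/𝕩
infixr 8 _^ˢ_

_⊕_ _⊖_ _⊗_ : Series → Series → Series
(F ⊕ G) a b c = F a b c + G a b c
(F ⊖ G) a b c = F a b c - G a b c
(F ⊗ G) a b c =
  ∑[ i < suc a ] ∑[ j < suc b ] ∑[ k < suc c ]
    (F (toℕ i) (toℕ j) (toℕ k) * G (a ∸ toℕ i) (b ∸ toℕ j) (c ∸ toℕ k))

_·_ : ℚ → Series → Series
(q · F) a b c = q * F a b c

-- The quotient by x of a series all of whose terms are divisible by x.
_/𝕩 : Series → Series
(F /𝕩) a b c = F (suc a) b c

_^ˢ_ : Series → ℕ → Series
F ^ˢ zero  = 𝟙
F ^ˢ suc m = F ⊗ F ^ˢ m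

-- exp F = Σ_{m ≥ 0} Fᵐ / m!, for F without constant term; then Fᵐ has no term
-- of total degree below m, so that m ≤ a + b + c suffices.
exp : Series → Series
exp F a b c = ∑[ m < suc (a ℕ.+ b ℕ.+ c) ] ((F ^ˢ toℕ m) a b c /! toℕ m)

-- log F = Σ_{m ≥ 1} (-1)ᵐ⁻¹ (F - 1)ᵐ / m, for F with constant term 1; the
-- summation index below is m - 1.
log : Series → Series
log F a b c = ∑[ m < a ℕ.+ b ℕ.+ c ]
  (((ℤ.-1ℤ ℤ.^ toℕ m) / suc (toℕ m)) * ((F ⊖ 𝟙) ^ˢ suc (toℕ m)) a b c)

{-# OPTIONS --safe #-}
module Submission where

-- Let D multiply the coefficient of xᵃ yᵇ zᶜ by the order a + c.  A series F with
-- D F = P F is determined by its terms of order 0, so both sides are compared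
-- through their logarithmic derivatives.  Splitting off the component of vertex 0
-- shows D T = D C · T for the exponential generating functions T of all and C of
-- the connected graphs under a weight that is multiplicative on disjoint unions.
-- For plain graphs and for graphs with a proper 2-colouring this evaluates the two
-- logarithms, as a connected bipartite graph has exactly two proper 2-colourings.
-- For central graphs it leaves the connected ones: those without colours, and
-- those given by a proper 2-colouring and a nonempty set of coloured vertices.
--
-- The weight is multiplicative since the rank is the order minus the number ν of
-- non-coloured bipartite components: the vectors that are ±1 on the two sides of
-- such a component and 0 elsewhere form a basis of the vectors orthogonal to all
-- normals.

-- Comparing logarithmic derivatives avoids proving exp (log F) = F or that exp turns sums into
-- products: apart from their terms of order 0, `exp` and `log` enter only through D (exp F) = D F ·
-- exp F and D (log F) = D F / F. Counting the order as a + c, and not the rank alone, makes this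
-- fit the statement: replacing a factor x by z, as z/x in the first exponential does, leaves the
-- order unchanged, so that rank n - 1 with ν = 1 and rank n with ν = 0 both belong to order n.
--
-- In a connected bipartite graph of order n each of the two proper 2-colourings prescribes the
-- colour that a vertex may get, so t coloured vertices can be chosen in 2 C(n, t) ways. This is the
-- summand 2 γ̄ C(r, t), cut off at t = c - r + 1 because a connected graph of order r has at least
-- r - 1 edges. Since γ̄⁽⁰⁾ excludes isolated vertices, n = 1 is accounted for separately: it
-- contributes 2xy, whose exponential is the sum of 2^r x^r y^r / r!. The terms - x remove the lone
-- non-coloured vertex.

module PowerSeries where

  open import Algebra.Bundles using (CommutativeRing)
  import Algebra.Properties.CommutativeSemigroup as CS
  open import Data.Nat.Base as ℕ using (ℕ; zero; suc; _∸_)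
  open import Data.Fin.Base using (toℕ)
  open import Data.Product.Base using (_,_)
  open import Function.Base using (_∘_)
  open import Level using (0ℓ)
  import Relation.Binary.Reasoning.Setoid as SetoidReasoning

  -- Formal power series in one variable over a commutative ring.

  module Convolution (K : CommutativeRing 0ℓ 0ℓ) where

    open CommutativeRing K
    open CS +-commutativeSemigroup using (interchange; x∙yz≈y∙xz)
    open import Algebra.Properties.Semiring.Sum semiring using (sum)
    open SetoidReasoning setoid

    Coefficients : Set
    Coefficients = ℕ → Carrier

    infix 4 _≐_
    _≐_ : Coefficients → Coefficients → Set
    f ≐ g = ∀ n → f n ≈ g n

    -- The Cauchy product by recursion on the degree, peeling off the constant term of the first
    -- factor. The ring laws then follow by induction without reindexing double sums; `conv-sum`
    -- recovers the usual finite sum.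
    conv : Coefficients → Coefficients → Coefficients
    conv f g zero    = f 0 * g 0
    conv f g (suc n) = f 0 * g (suc n) + conv (f ∘ suc) g n

    one : Coefficients
    one zero    = 1#
    one (suc _) = 0#

    conv-cong : ∀ {f f′ g g′} → f ≐ f′ → g ≐ g′ → conv f g ≐ conv f′ g′
    conv-cong p q zero    = *-cong (p 0) (q 0)
    conv-cong p q (suc n) = +-cong (*-cong (p 0) (q (suc n))) (conv-cong (p ∘ suc) q n)

    conv-distribʳ : ∀ f g h n → conv (λ i → f i + g i) h n ≈ conv f h n + conv g h n
    conv-distribʳ f g h zero    = distribʳ (h 0) (f 0) (g 0)
    conv-distribʳ f g h (suc n) = begin
      (f 0 + g 0) * h (suc n) + conv (λ i → f (suc i) + g (suc i)) h n
        ≈⟨ +-cong (distribʳ _ _ _) (conv-distribʳ (f ∘ suc) (g ∘ suc) h n) ⟩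
      (f 0 * h (suc n) + g 0 * h (suc n)) + (conv (f ∘ suc) h n + conv (g ∘ suc) h n)
        ≈⟨ interchange _ _ _ _ ⟩
      (f 0 * h (suc n) + conv (f ∘ suc) h n) + (g 0 * h (suc n) + conv (g ∘ suc) h n) ∎

    conv-scale : ∀ r f g n → conv (λ i → r * f i) g n ≈ r * conv f g n
    conv-scale r f g zero    = *-assoc _ _ _
    conv-scale r f g (suc n) =
      trans (+-cong (*-assoc _ _ _) (conv-scale r (f ∘ suc) g n)) (sym (distribˡ _ _ _))

    -- The shift of `conv f g` is by definition the sum of a multiple of the shift of g and of the
    -- product of the shifted f with g, so distributivity reduces the claim to the shifted f.
    conv-assoc : ∀ f g h n → conv (conv f g) h n ≈ conv f (conv g h) n
    conv-assoc f g h zero    = *-assoc _ _ _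
    conv-assoc f g h (suc n) = begin
      f 0 * g 0 * h (suc n) + conv (λ i → f 0 * g (suc i) + conv (f ∘ suc) g i) h n
        ≈⟨ +-cong (*-assoc _ _ _)
             (trans (conv-distribʳ (λ i → f 0 * g (suc i)) (conv (f ∘ suc) g) h n)
                    (+-cong (conv-scale (f 0) (g ∘ suc) h n) (conv-assoc (f ∘ suc) g h n))) ⟩
      f 0 * (g 0 * h (suc n)) + (f 0 * conv (g ∘ suc) h n + conv (f ∘ suc) (conv g h) n)
        ≈⟨ +-assoc _ _ _ ⟨
      f 0 * (g 0 * h (suc n)) + f 0 * conv (g ∘ suc) h n + conv (f ∘ suc) (conv g h) n
        ≈⟨ +-congʳ (distribˡ _ _ _) ⟨
      f 0 * conv g h (suc n) + conv (f ∘ suc) (conv g h) n ∎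

    -- The mirror image of the defining equation, which peels off the constant term of the second
    -- factor; commutativity is the comparison of the two.
    conv-last : ∀ f g n → conv f g (suc n) ≈ f (suc n) * g 0 + conv f (g ∘ suc) n
    conv-last f g zero    = +-comm _ _
    conv-last f g (suc n) = trans (+-congˡ (conv-last (f ∘ suc) g n)) (x∙yz≈y∙xz _ _ _)

    conv-comm : ∀ f g n → conv f g n ≈ conv g f n
    conv-comm f g zero    = *-comm _ _
    conv-comm f g (suc n) = begin
      f 0 * g (suc n) + conv (f ∘ suc) g n  ≈⟨ +-cong (*-comm _ _) (conv-comm (f ∘ suc) g n) ⟩
      g (suc n) * f 0 + conv g (f ∘ suc) n  ≈⟨ conv-last g f n ⟨
      conv g f (suc n)                      ∎

    conv-zeroˡ : ∀ g n → conv (λ _ → 0#) g n ≈ 0#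
    conv-zeroˡ g zero    = zeroˡ _
    conv-zeroˡ g (suc n) = trans (+-cong (zeroˡ _) (conv-zeroˡ g n)) (+-identityˡ _)

    conv-identityˡ : ∀ g n → conv one g n ≈ g n
    conv-identityˡ g zero    = *-identityˡ _
    conv-identityˡ g (suc n) = trans (+-cong (*-identityˡ _) (conv-zeroˡ g n)) (+-identityʳ _)

    -- In the nested rings, y and z are constants with respect to the outer variables; this strips
    -- those variables off a product.
    conv-const : ∀ {f} g → (∀ n → f (suc n) ≈ 0#) → ∀ n → conv f g n ≈ f 0 * g n
    conv-const g p zero    = refl
    conv-const g p (suc n) = trans (+-congˡ (trans (conv-cong p (λ _ → refl) n) (conv-zeroˡ g n))) (+-identityʳ _)

    -- The hypotheses say that f is the variable itself, up to the equality of the coefficient ring.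
    conv-shift : ∀ {f} g → f 0 ≈ 0# → (∀ n → f (suc n) ≈ one n) → ∀ n → conv f g (suc n) ≈ g n
    conv-shift g p q n = trans (+-cong (trans (*-congʳ p) (zeroˡ _)) (trans (conv-cong q (λ _ → refl) n) (conv-identityˡ g n)))
      (+-identityˡ _)

    conv-sum : ∀ f g n → conv f g n ≈ sum {suc n} (λ i → f (toℕ i) * g (n ∸ toℕ i))
    conv-sum f g zero    = sym (+-identityʳ _)
    conv-sum f g (suc n) = +-congˡ (conv-sum (f ∘ suc) g n)

  powerSeries : CommutativeRing 0ℓ 0ℓ → CommutativeRing 0ℓ 0ℓ
  powerSeries K = record
    { Carrier = Coefficients
    ; _≈_ = _≐_
    ; _+_ = λ f g n → f n + g n
    ; _*_ = conv
    ; -_ = λ f n → - f n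
    ; 0# = λ _ → 0#
    ; 1# = one
    ; isCommutativeRing = record
      { isRing = record
        { +-isAbelianGroup = record
          { isGroup = record
            { isMonoid = record
              { isSemigroup = record
                { isMagma = record
                  { isEquivalence = record
                    { refl = λ _ → refl
                    ; sym = λ p n → sym (p n)
                    ; trans = λ p q n → trans (p n) (q n)
                    }
                  ; ∙-cong = λ p q n → +-cong (p n) (q n)
                  }
                ; assoc = λ f g h n → +-assoc (f n) (g n) (h n)
                }
              ; identity = (λ f n → +-identityˡ (f n)) , (λ f n → +-identityʳ (f n))
              }
            ; inverse = (λ f n → -‿inverseˡ (f n)) , (λ f n → -‿inverseʳ (f n))
            ; ⁻¹-cong = λ p n → -‿cong (p n)
            }
          ; comm = λ f g n → +-comm (f n) (g n)
          }
        ; *-cong = conv-cong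
        ; *-assoc = conv-assoc
        ; *-identity = conv-identityˡ , (λ f n → trans (conv-comm f one n) (conv-identityˡ f n))
        ; distrib = (λ h f g n → trans (conv-comm h (λ i → f i + g i) n)
                       (trans (conv-distribʳ f g h n) (+-cong (conv-comm f h n) (conv-comm g h n))))
                  , (λ h f g n → conv-distribʳ f g h n)
        }
      ; *-comm = conv-comm
      }
    }
    where
    open CommutativeRing K
    open Convolution K

-- The ring of series in x, y, z.

module SeriesRing where

  open import Defs
  open import Algebra.Bundles using (CommutativeRing)
  open import Data.Fin.Base as Fin using (Fin; toℕ)
  open import Data.Nat.Base as ℕ using (ℕ; zero; suc; _∸_)
  open import Data.Product.Base using (_,_)
  open import Data.Rational.Base using (ℚ; 0ℚ; 1ℚ; _+_; _*_; -_)
  import Data.Rational.Properties as ℚ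
  open import Level using (0ℓ)
  open import Relation.Binary.PropositionalEquality
  open PowerSeries
  import Algebra.Properties.Semiring.Sum as Sum

  -- Iterating the one-variable construction makes `Series` the carrier of `PS₃` on the nose, with x
  -- as outermost and z as innermost variable.
  PS₁ PS₂ PS₃ : CommutativeRing 0ℓ 0ℓ
  PS₁ = powerSeries ℚ.+-*-commutativeRing
  PS₂ = powerSeries PS₁
  PS₃ = powerSeries PS₂

  private
    module C₁ = Convolution ℚ.+-*-commutativeRing
    module C₂ = Convolution PS₁
    module C₃ = Convolution PS₂
    module R₂ = CommutativeRing PS₂
    module R₃ = CommutativeRing PS₃
    module S₁ = Sum (CommutativeRing.semiring PS₁)
    module S₂ = Sum (CommutativeRing.semiring PS₂)

  sum-pointwise₁ : ∀ n (f : Fin n → ℕ → ℚ) c → S₁.sum f c ≡ sum (λ i → f i c)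
  sum-pointwise₁ zero    f c = refl
  sum-pointwise₁ (suc n) f c = cong (f Fin.zero c +_) (sum-pointwise₁ n (λ i → f (Fin.suc i)) c)

  sum-pointwise₂ : ∀ n (f : Fin n → ℕ → ℕ → ℚ) b c → S₂.sum f b c ≡ sum (λ i → f i b c)
  sum-pointwise₂ zero    f b c = refl
  sum-pointwise₂ (suc n) f b c = cong (f Fin.zero b c +_) (sum-pointwise₂ n (λ i → f (Fin.suc i)) b c)

  -- The bridge over which every ring law of `_⊗_` is transported from `PS₃`, instead of being
  -- proved on triple sums.
  ⊗≋conv : ∀ F G → F ⊗ G ≋ C₃.conv F G
  ⊗≋conv F G a b c = sym (begin
    C₃.conv F G a b c
      ≡⟨ C₃.conv-sum F G a b c ⟩
    S₂.sum {suc a} (λ i → C₂.conv (F (toℕ i)) (G (a ∸ toℕ i))) b c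
      ≡⟨ sum-pointwise₂ (suc a) (λ i → C₂.conv (F (toℕ i)) (G (a ∸ toℕ i))) b c ⟩
    sum {suc a} (λ i → C₂.conv (F (toℕ i)) (G (a ∸ toℕ i)) b c)
      ≡⟨ sum-cong-≗ {suc a} (λ i → inner (F (toℕ i)) (G (a ∸ toℕ i))) ⟩
    (F ⊗ G) a b c ∎)
    where
    open ≡-Reasoning
    inner : ∀ (f g : ℕ → ℕ → ℚ) → C₂.conv f g b c ≡
      ∑[ j < suc b ] ∑[ k < suc c ] (f (toℕ j) (toℕ k) * g (b ∸ toℕ j) (c ∸ toℕ k))
    inner f g = begin
      C₂.conv f g b c
        ≡⟨ C₂.conv-sum f g b c ⟩
      S₁.sum {suc b} (λ j → C₁.conv (f (toℕ j)) (g (b ∸ toℕ j))) c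
        ≡⟨ sum-pointwise₁ (suc b) (λ j → C₁.conv (f (toℕ j)) (g (b ∸ toℕ j))) c ⟩
      sum {suc b} (λ j → C₁.conv (f (toℕ j)) (g (b ∸ toℕ j)) c)
        ≡⟨ sum-cong-≗ {suc b} (λ j → C₁.conv-sum (f (toℕ j)) (g (b ∸ toℕ j)) c) ⟩
      sum {suc b} (λ j → sum {suc c} (λ k → f (toℕ j) (toℕ k) * g (b ∸ toℕ j) (c ∸ toℕ k))) ∎

  𝟙≋one : 𝟙 ≋ R₃.1#
  𝟙≋one zero    zero    zero    = refl
  𝟙≋one zero    zero    (suc c) = refl
  𝟙≋one zero    (suc b) c       = refl
  𝟙≋one (suc a) b       c       = refl

  ≋-trans : ∀ {F G H} → F ≋ G → G ≋ H → F ≋ H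
  ≋-trans p q a b c = trans (p a b c) (q a b c)

  ≋-sym : ∀ {F G} → F ≋ G → G ≋ F
  ≋-sym p a b c = sym (p a b c)

  ⊗-comm : ∀ F G → F ⊗ G ≋ G ⊗ F
  ⊗-comm F G = ≋-trans (⊗≋conv F G) (≋-trans (C₃.conv-comm F G) (≋-sym (⊗≋conv G F)))

  ⊗-cong : ∀ {F F′ G G′} → F ≋ F′ → G ≋ G′ → F ⊗ G ≋ F′ ⊗ G′
  ⊗-cong {F} {F′} {G} {G′} p q =
    ≋-trans (⊗≋conv F G) (≋-trans (C₃.conv-cong p q) (≋-sym (⊗≋conv F′ G′)))

  ⊗-assoc : ∀ F G H → (F ⊗ G) ⊗ H ≋ F ⊗ (G ⊗ H)
  ⊗-assoc F G H = ≋-trans (⊗≋conv (F ⊗ G) H) (≋-trans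
    (C₃.conv-cong (⊗≋conv F G) (λ a b c → refl)) (≋-trans (C₃.conv-assoc F G H) (≋-sym
    (≋-trans (⊗≋conv F (G ⊗ H)) (C₃.conv-cong {F} {F} (λ a b c → refl) (⊗≋conv G H))))))

  ⊗-identityˡ : ∀ F → 𝟙 ⊗ F ≋ F
  ⊗-identityˡ F = ≋-trans (⊗≋conv 𝟙 F)
    (≋-trans (C₃.conv-cong {𝟙} {R₃.1#} {F} {F} 𝟙≋one (λ a b c → refl)) (C₃.conv-identityˡ F))

  ⊗-distribʳ : ∀ H F G → (F ⊕ G) ⊗ H ≋ F ⊗ H ⊕ G ⊗ H
  ⊗-distribʳ H F G = ≋-trans (⊗≋conv (F ⊕ G) H) (≋-trans (C₃.conv-distribʳ F G H)
    (λ a b c → cong₂ _+_ (sym (⊗≋conv F H a b c)) (sym (⊗≋conv G H a b c))))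

  𝕪 : Series
  𝕪 0 1 0 = 1ℚ
  𝕪 _ _ _ = 0ℚ

  module _ (F : Series) where

    private
      module R₁ = CommutativeRing PS₁
      x₀ : ∀ b c → 𝕩 0 b c ≡ 0ℚ
      x₀ b c = refl
      x₁ : ∀ a b c → 𝕩 (suc a) b c ≡ C₃.one a b c
      x₁ zero    zero    zero    = refl
      x₁ zero    zero    (suc c) = refl
      x₁ zero    (suc b) c       = refl
      x₁ (suc a) b       c       = refl
      y₀ : ∀ c → 𝕪 0 0 c ≡ 0ℚ
      y₀ c = refl
      y₁ : ∀ b c → 𝕪 0 (suc b) c ≡ C₂.one b c
      y₁ zero    zero    = refl
      y₁ zero    (suc c) = refl
      y₁ (suc b) c       = refl
      y₂ : ∀ a b c → 𝕪 (suc a) b c ≡ 0ℚ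
      y₂ a b c = refl
      z₁ : ∀ c → 𝕫 0 0 (suc c) ≡ C₁.one c
      z₁ zero    = refl
      z₁ (suc c) = refl
      z₂ : ∀ b c → 𝕫 0 (suc b) c ≡ 0ℚ
      z₂ b c = refl
      z₃ : ∀ a b c → 𝕫 (suc a) b c ≡ 0ℚ
      z₃ a b c = refl

      𝕪-conv : ∀ a b c → (𝕪 ⊗ F) a b c ≡ C₂.conv (𝕪 0) (F a) b c
      𝕪-conv a b c = trans (⊗≋conv 𝕪 F a b c) (C₃.conv-const {𝕪} F y₂ a b c)

      𝕫-conv : ∀ a b c → (𝕫 ⊗ F) a b c ≡ C₁.conv (𝕫 0 0) (F a b) c
      𝕫-conv a b c = trans (⊗≋conv 𝕫 F a b c)
        (trans (C₃.conv-const {𝕫} F z₃ a b c) (C₂.conv-const {𝕫 0} (F a) z₂ b c))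

    𝕩-zero : ∀ b c → (𝕩 ⊗ F) 0 b c ≡ 0ℚ
    𝕩-zero b c = trans (⊗≋conv 𝕩 F 0 b c) (trans (R₂.*-congʳ {F 0} {𝕩 0} {R₂.0#} x₀ b c) (R₂.zeroˡ (F 0) b c))

    𝕩-suc : ∀ a b c → (𝕩 ⊗ F) (suc a) b c ≡ F a b c
    𝕩-suc a b c = trans (⊗≋conv 𝕩 F (suc a) b c) (C₃.conv-shift {𝕩} F x₀ x₁ a b c)

    𝕪-zero : ∀ a c → (𝕪 ⊗ F) a 0 c ≡ 0ℚ
    𝕪-zero a c = trans (𝕪-conv a 0 c) (trans (R₁.*-congʳ {F a 0} {𝕪 0 0} {R₁.0#} y₀ c) (R₁.zeroˡ (F a 0) c))

    𝕪-suc : ∀ a b c → (𝕪 ⊗ F) a (suc b) c ≡ F a b c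
    𝕪-suc a b c = trans (𝕪-conv a (suc b) c) (C₂.conv-shift {𝕪 0} (F a) y₀ y₁ b c)

    𝕫-zero : ∀ a b → (𝕫 ⊗ F) a b 0 ≡ 0ℚ
    𝕫-zero a b = trans (𝕫-conv a b 0) (ℚ.*-zeroˡ (F a b 0))

    𝕫-suc : ∀ a b c → (𝕫 ⊗ F) a b (suc c) ≡ F a b c
    𝕫-suc a b c = trans (𝕫-conv a b (suc c)) (C₁.conv-shift {𝕫 0 0} (F a b) refl z₁ c)

  -- A record rather than a function type, so that the sides of an equation can
  -- be inferred.
  infix 4 _≈_
  record _≈_ (F G : Series) : Set where
    constructor pointwise
    field
      at : F ≋ G

  open _≈_ public

  seriesRing : CommutativeRing 0ℓ 0ℓ
  seriesRing = record
    { Carrier = Series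
    ; _≈_ = _≈_
    ; _+_ = _⊕_
    ; _*_ = _⊗_
    ; -_ = λ F a b c → - F a b c
    ; 0# = λ _ _ _ → 0ℚ
    ; 1# = 𝟙
    ; isCommutativeRing = record
      { isRing = record
        { +-isAbelianGroup = record
          { isGroup = record
            { isMonoid = record
              { isSemigroup = record
                { isMagma = record
                  { isEquivalence = record
                    { refl = pointwise λ a b c → refl
                    ; sym = λ p → pointwise (≋-sym (at p))
                    ; trans = λ p q → pointwise (≋-trans (at p) (at q))
                    }
                  ; ∙-cong = λ p q → pointwise λ a b c → cong₂ _+_ (at p a b c) (at q a b c)
                  }
                ; assoc = λ F G H → pointwise (R₃.+-assoc F G H)
                }
              ; identity = (λ F → pointwise (R₃.+-identityˡ F)) , (λ F → pointwise (R₃.+-identityʳ F))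
              }
            ; inverse = (λ F → pointwise (R₃.-‿inverseˡ F)) , (λ F → pointwise (R₃.-‿inverseʳ F))
            ; ⁻¹-cong = λ p → pointwise λ a b c → cong -_ (at p a b c)
            }
          ; comm = λ F G → pointwise (R₃.+-comm F G)
          }
        ; *-cong = λ p q → pointwise (⊗-cong (at p) (at q))
        ; *-assoc = λ F G H → pointwise (⊗-assoc F G H)
        ; *-identity = (λ F → pointwise (⊗-identityˡ F))
                     , (λ F → pointwise (≋-trans (⊗-comm F 𝟙) (⊗-identityˡ F)))
        ; distrib = (λ H F G → pointwise (≋-trans (⊗-comm H (F ⊕ G)) (≋-trans (⊗-distribʳ H F G)
                       (λ a b c → cong₂ _+_ (⊗-comm F H a b c) (⊗-comm G H a b c)))))
                  , (λ H F G → pointwise (⊗-distribʳ H F G))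
        }
      ; *-comm = λ F G → pointwise (⊗-comm F G)
      }
    }

-- Rational arithmetic with natural numbers and inverse factorials.

module Scalars where

  open import Defs using (fromℕ)
  import Data.Integer.Base as ℤ
  import Data.Integer.Properties as ℤ
  open import Data.Integer.Tactic.RingSolver using (solve-∀)
  open import Data.Nat.Base as ℕ using (ℕ; suc; _!)
  import Data.Nat.Properties as ℕ
  open import Data.Rational.Base
  import Data.Rational.Properties as ℚ
  open import Data.Rational.Solver using (module +-*-Solver)
  open import Data.Rational.Unnormalised.Base as ℚᵘ using (mkℚᵘ; *≡*)
  import Data.Rational.Unnormalised.Properties as ℚᵘ
  open import Relation.Binary.PropositionalEquality

  private
    -- Forming z / suc d divides out a common factor; returning to the unnormalised fraction leaves
    -- only cross-multiplications to check.
    un : ∀ z d → toℚᵘ (z / suc d) ℚᵘ.≃ mkℚᵘ z d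
    un z d = ℚ.toℚᵘ-fromℚᵘ (mkℚᵘ z d)

  /1-homo-+ : ∀ z w → (z ℤ.+ w) / 1 ≡ z / 1 + w / 1
  /1-homo-+ z w = ℚ.toℚᵘ-injective (ℚᵘ.≃-trans (un (z ℤ.+ w) 0) (ℚᵘ.≃-sym
    (ℚᵘ.≃-trans (ℚ.toℚᵘ-homo-+ (z / 1) (w / 1))
    (ℚᵘ.≃-trans (ℚᵘ.+-cong (un z 0) (un w 0)) (*≡* (lemma z w))))))
    where
    lemma : ∀ z w → (z ℤ.* ℤ.1ℤ ℤ.+ w ℤ.* ℤ.1ℤ) ℤ.* ℤ.1ℤ ≡ (z ℤ.+ w) ℤ.* ℤ.1ℤ
    lemma = solve-∀

  /-homo-* : ∀ z w d → (z ℤ.* w) / suc d ≡ z / 1 * (w / suc d)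
  /-homo-* z w d = ℚ.toℚᵘ-injective (ℚᵘ.≃-trans (un (z ℤ.* w) d) (ℚᵘ.≃-sym
    (ℚᵘ.≃-trans (ℚ.toℚᵘ-homo-* (z / 1) (w / suc d))
    (ℚᵘ.≃-trans (ℚᵘ.*-cong (un z 0) (un w d))
      (*≡* (cong (λ k → z ℤ.* w ℤ.* ℤ.+ suc k) (sym (ℕ.+-identityʳ d))))))))

  fromℕ-+ : ∀ m n → fromℕ (m ℕ.+ n) ≡ fromℕ m + fromℕ n
  fromℕ-+ m n = /1-homo-+ (ℤ.+ m) (ℤ.+ n)

  fromℕ-* : ∀ m n → fromℕ (m ℕ.* n) ≡ fromℕ m * fromℕ n
  fromℕ-* m n = trans (cong (_/ 1) (ℤ.pos-* m n)) (/-homo-* (ℤ.+ m) (ℤ.+ n) 0)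

  suc*/suc : ∀ n z → fromℕ (suc n) * (z / suc n) ≡ z / 1
  suc*/suc n z = trans (sym (/-homo-* (ℤ.+ suc n) z n))
    (ℚ.fromℚᵘ-cong {mkℚᵘ (ℤ.+ suc n ℤ.* z) n} {mkℚᵘ z 0}
      (*≡* (trans (ℤ.*-identityʳ _) (ℤ.*-comm (ℤ.+ suc n) z))))

  n*1/n : ∀ n .{{_ : ℕ.NonZero n}} → fromℕ n * (ℤ.+ 1 / n) ≡ 1ℚ
  n*1/n (suc n) = suc*/suc n (ℤ.+ 1)

  cancel-suc : ∀ n {p q} → fromℕ (suc n) * p ≡ fromℕ (suc n) * q → p ≡ q
  cancel-suc n {p} {q} eq = begin
    p                ≡⟨ recover p ⟩
    r * (s * p)      ≡⟨ cong (r *_) eq ⟩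
    r * (s * q)      ≡⟨ recover q ⟨
    q                ∎
    where
    open ≡-Reasoning
    r = ℤ.+ 1 / suc n
    s = fromℕ (suc n)
    recover : ∀ p → p ≡ r * (s * p)
    recover p = sym (trans (sym (ℚ.*-assoc r s p))
      (trans (cong (_* p) (trans (ℚ.*-comm r s) (n*1/n (suc n)))) (ℚ.*-identityˡ p)))

  1/! : ℕ → ℚ
  1/! k = (ℤ.+ 1 / k !) {{k ℕ.!≢0}}

  k!*1/k! : ∀ k → fromℕ (k !) * 1/! k ≡ 1ℚ
  k!*1/k! k = n*1/n (k !) {{k ℕ.!≢0}}

  suc*1/! : ∀ k → fromℕ (suc k) * 1/! (suc k) ≡ 1/! k
  suc*1/! k = begin
    s * i′                 ≡⟨ ℚ.*-identityʳ _ ⟨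
    s * i′ * 1ℚ            ≡⟨ cong (s * i′ *_) (k!*1/k! k) ⟨
    s * i′ * (f * i)       ≡⟨ solve 4 (λ s i′ f i → s :* i′ :* (f :* i) := s :* f :* i′ :* i) refl s i′ f i ⟩
    s * f * i′ * i         ≡⟨ cong (λ t → t * i′ * i) (sym (fromℕ-* (suc k) (k !))) ⟩
    fromℕ (suc k !) * i′ * i  ≡⟨ cong (_* i) (k!*1/k! (suc k)) ⟩
    1ℚ * i                 ≡⟨ ℚ.*-identityˡ i ⟩
    i                      ∎
    where
    open ≡-Reasoning
    open +-*-Solver
    s = fromℕ (suc k)
    i′ = 1/! (suc k)
    f = fromℕ (k !)
    i = 1/! k

-- The derivation D, and exp and log as solutions of differential equations.

module SeriesCalculus where

  open import Defs
  open import Algebra.Bundles using (CommutativeRing)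
  open import Data.Fin.Base as Fin using (Fin; toℕ)
  import Data.Fin.Properties as Fin
  import Data.Integer.Base as ℤ
  import Data.Integer.Properties as ℤ
  open import Data.Nat.Base as ℕ using (ℕ; zero; suc; _∸_; _≤_; _<_; z≤n; s≤s)
  import Data.Nat.Properties as ℕ
  open import Data.Rational.Base using (ℚ; 0ℚ; 1ℚ; _+_; _*_; _-_; -_; _/_)
  import Data.Rational.Properties as ℚ
  open import Data.Rational.Solver using (module +-*-Solver)
  open import Data.Sum.Base using (_⊎_; inj₁; inj₂)
  open import Function.Base using (_∘_)
  open import Relation.Binary.PropositionalEquality hiding (J)
  open import Relation.Nullary using (yes; no)
  import Relation.Binary.Reasoning.Setoid as SetoidReasoning
  open import Algebra.Properties.Semiring.Sum (CommutativeRing.semiring ℚ.+-*-commutativeRing)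
    using (∑-distrib-+)
  open Scalars
  open SeriesRing
  module S = CommutativeRing seriesRing
  module ≈-Reasoning = SetoidReasoning S.setoid

  ∑³ : (a b c : ℕ) → (ℕ → ℕ → ℕ → ℚ) → ℚ
  ∑³ a b c f = ∑[ i < suc a ] ∑[ j < suc b ] ∑[ k < suc c ] f (toℕ i) (toℕ j) (toℕ k)

  ∑³-cong : ∀ a b c {f g} → (∀ i j k → i ≤ a → j ≤ b → k ≤ c → f i j k ≡ g i j k) →
            ∑³ a b c f ≡ ∑³ a b c g
  ∑³-cong a b c eq = sum-cong-≗ {suc a} λ i → sum-cong-≗ {suc b} λ j → sum-cong-≗ {suc c} λ k →
    eq (toℕ i) (toℕ j) (toℕ k) (Fin.toℕ≤pred[n] i) (Fin.toℕ≤pred[n] j) (Fin.toℕ≤pred[n] k)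

  ∑³-zero : ∀ a b c {f} → (∀ i j k → i ≤ a → j ≤ b → k ≤ c → f i j k ≡ 0ℚ) → ∑³ a b c f ≡ 0ℚ
  ∑³-zero a b c eq = trans (∑³-cong a b c eq) (trans
    (sum-cong-≗ {suc a} λ i → trans
      (sum-cong-≗ {suc b} λ j → sum-replicate-zero (suc c)) (sum-replicate-zero (suc b)))
    (sum-replicate-zero (suc a)))

  ∑³-scale : ∀ a b c q f → q * ∑³ a b c f ≡ ∑³ a b c (λ i j k → q * f i j k)
  ∑³-scale a b c q f = trans
    (*-distribˡ-sum {suc a} q (λ i → ∑[ j < suc b ] ∑[ k < suc c ] f (toℕ i) (toℕ j) (toℕ k)))
    (sum-cong-≗ {suc a} λ i → trans
      (*-distribˡ-sum {suc b} q (λ j → ∑[ k < suc c ] f (toℕ i) (toℕ j) (toℕ k)))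
      (sum-cong-≗ {suc b} λ j → *-distribˡ-sum {suc c} q (λ k → f (toℕ i) (toℕ j) (toℕ k))))

  ∑³-+ : ∀ a b c f g → ∑³ a b c (λ i j k → f i j k + g i j k) ≡ ∑³ a b c f + ∑³ a b c g
  ∑³-+ a b c f g = trans
    (sum-cong-≗ {suc a} λ i → trans
      (sum-cong-≗ {suc b} λ j →
        ∑-distrib-+ {suc c} (λ k → f (toℕ i) (toℕ j) (toℕ k)) (λ k → g (toℕ i) (toℕ j) (toℕ k)))
      (∑-distrib-+ {suc b} (λ j → ∑[ k < suc c ] f (toℕ i) (toℕ j) (toℕ k))
                           (λ j → ∑[ k < suc c ] g (toℕ i) (toℕ j) (toℕ k))))
    (∑-distrib-+ {suc a} (λ i → ∑[ j < suc b ] ∑[ k < suc c ] f (toℕ i) (toℕ j) (toℕ k))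
                         (λ i → ∑[ j < suc b ] ∑[ k < suc c ] g (toℕ i) (toℕ j) (toℕ k)))

  module _ (F G : Series) (a b c : ℕ) where

    ⊗-cong-at : ∀ F′ G′ → (∀ i j k → i ≤ a → j ≤ b → k ≤ c →
                  F i j k * G (a ∸ i) (b ∸ j) (c ∸ k) ≡ F′ i j k * G′ (a ∸ i) (b ∸ j) (c ∸ k)) →
                (F ⊗ G) a b c ≡ (F′ ⊗ G′) a b c
    ⊗-cong-at F′ G′ = ∑³-cong a b c {λ i j k → F i j k * G (a ∸ i) (b ∸ j) (c ∸ k)}
                                    {λ i j k → F′ i j k * G′ (a ∸ i) (b ∸ j) (c ∸ k)}

    ⊗-zero-at : (∀ i j k → i ≤ a → j ≤ b → k ≤ c → F i j k * G (a ∸ i) (b ∸ j) (c ∸ k) ≡ 0ℚ) →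
                (F ⊗ G) a b c ≡ 0ℚ
    ⊗-zero-at = ∑³-zero a b c {λ i j k → F i j k * G (a ∸ i) (b ∸ j) (c ∸ k)}

  sum-last : ∀ n (f : ℕ → ℚ) → ∑[ i < suc n ] f (toℕ i) ≡ ∑[ i < n ] f (toℕ i) + f n
  sum-last zero    f = ℚ.+-comm (f 0) 0ℚ
  sum-last (suc n) f = trans (cong (f 0 +_) (sum-last n (f ∘ suc)))
    (sym (ℚ.+-assoc (f 0) (∑[ i < n ] f (suc (toℕ i))) (f (suc n))))

  ·-⊗ : ∀ q F G → (q · F) ⊗ G ≈ q · (F ⊗ G)
  ·-⊗ q F G = pointwise λ a b c → sym (trans (∑³-scale a b c q (λ i j k → F i j k * G (a ∸ i) (b ∸ j) (c ∸ k)))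
    (∑³-cong a b c λ i j k _ _ _ → sym (ℚ.*-assoc q (F i j k) (G (a ∸ i) (b ∸ j) (c ∸ k)))))

  ⊗-· : ∀ q F G → F ⊗ (q · G) ≈ q · (F ⊗ G)
  ⊗-· q F G = pointwise λ a b c → trans (⊗-comm F (q · G) a b c)
    (trans (at (·-⊗ q G F) a b c) (cong (q *_) (⊗-comm G F a b c)))

  ·-cong : ∀ q {F G} → F ≈ G → q · F ≈ q · G
  ·-cong q F≈G = pointwise λ a b c → cong (q *_) (at F≈G a b c)

  -- The order of a graph counted by xᵃ yᵇ zᶜ is a + c, so D is the operation
  -- of pointing a vertex.
  D : Series → Series
  D F a b c = fromℕ (a ℕ.+ c) * F a b c

  D-cong : ∀ {F G} → F ≈ G → D F ≈ D G
  D-cong p = pointwise λ a b c → cong (fromℕ (a ℕ.+ c) *_) (at p a b c)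

  D-⊕ : ∀ F G → D (F ⊕ G) ≈ D F ⊕ D G
  D-⊕ F G = pointwise λ a b c → ℚ.*-distribˡ-+ (fromℕ (a ℕ.+ c)) (F a b c) (G a b c)

  D-· : ∀ q F → D (q · F) ≈ q · D F
  D-· q F = pointwise λ a b c →
    solve 3 (λ d q f → d :* (q :* f) := q :* (d :* f)) refl (fromℕ (a ℕ.+ c)) q (F a b c)
    where open +-*-Solver

  D-𝟙 : D 𝟙 ≈ S.0#
  D-𝟙 = pointwise λ where
    zero    zero    zero    → refl
    zero    zero    (suc c) → ℚ.*-zeroʳ (fromℕ (suc c))
    zero    (suc b) c       → ℚ.*-zeroʳ (fromℕ c)
    (suc a) b       c       → ℚ.*-zeroʳ (fromℕ (suc a ℕ.+ c))

  split-order : ∀ {a c i k} → i ≤ a → k ≤ c → a ℕ.+ c ≡ (i ℕ.+ k) ℕ.+ ((a ∸ i) ℕ.+ (c ∸ k))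
  split-order {a} {c} {i} {k} i≤a k≤c = sym (begin
    (i ℕ.+ k) ℕ.+ ((a ∸ i) ℕ.+ (c ∸ k))  ≡⟨ interchange i k (a ∸ i) (c ∸ k) ⟩
    (i ℕ.+ (a ∸ i)) ℕ.+ (k ℕ.+ (c ∸ k))  ≡⟨ cong₂ ℕ._+_ (ℕ.m+[n∸m]≡n i≤a) (ℕ.m+[n∸m]≡n k≤c) ⟩
    a ℕ.+ c ∎)
    where
    open ≡-Reasoning
    open import Algebra.Properties.CommutativeSemigroup ℕ.+-commutativeSemigroup using (interchange)

  -- Each summand of a product coefficient splits the order a + c between its two factors, by
  -- `split-order`, so the Leibniz rule holds summand by summand.
  D-⊗ : ∀ F G → D (F ⊗ G) ≈ D F ⊗ G ⊕ F ⊗ D G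
  D-⊗ F G = pointwise λ a b c → trans
    (∑³-scale a b c (fromℕ (a ℕ.+ c)) (λ i j k → F i j k * G (a ∸ i) (b ∸ j) (c ∸ k)))
    (trans (∑³-cong a b c λ i j k i≤a _ k≤c → leibniz a b c i j k i≤a k≤c)
      (∑³-+ a b c (λ i j k → D F i j k * G (a ∸ i) (b ∸ j) (c ∸ k))
                  (λ i j k → F i j k * D G (a ∸ i) (b ∸ j) (c ∸ k))))
    where
    open +-*-Solver
    leibniz : ∀ a b c i j k → i ≤ a → k ≤ c →
      fromℕ (a ℕ.+ c) * (F i j k * G (a ∸ i) (b ∸ j) (c ∸ k)) ≡
      D F i j k * G (a ∸ i) (b ∸ j) (c ∸ k) + F i j k * D G (a ∸ i) (b ∸ j) (c ∸ k)
    leibniz a b c i j k i≤a k≤c = trans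
      (cong (_* (F i j k * G (a ∸ i) (b ∸ j) (c ∸ k)))
        (trans (cong fromℕ (split-order i≤a k≤c)) (fromℕ-+ (i ℕ.+ k) ((a ∸ i) ℕ.+ (c ∸ k)))))
      (solve 4 (λ m n f g → (m :+ n) :* (f :* g) := m :* f :* g :+ f :* (n :* g)) refl
        (fromℕ (i ℕ.+ k)) (fromℕ ((a ∸ i) ℕ.+ (c ∸ k))) (F i j k) (G (a ∸ i) (b ∸ j) (c ∸ k)))

  D-^ : ∀ F m → D (F ^ˢ suc m) ≈ fromℕ (suc m) · (D F ⊗ F ^ˢ m)
  D-^ F zero    = begin
    D (F ⊗ 𝟙)                ≈⟨ D-cong (S.*-identityʳ F) ⟩
    D F                      ≈⟨ S.*-identityʳ (D F) ⟨
    D F ⊗ 𝟙                  ≈⟨ pointwise (λ a b c → ℚ.*-identityˡ _) ⟨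
    fromℕ 1 · (D F ⊗ 𝟙)      ∎
    where open ≈-Reasoning
  D-^ F (suc m) = begin
    D (F ⊗ F ^ˢ suc m)
      ≈⟨ D-⊗ F (F ^ˢ suc m) ⟩
    D F ⊗ F ^ˢ suc m ⊕ F ⊗ D (F ^ˢ suc m)
      ≈⟨ S.+-congˡ {D F ⊗ F ^ˢ suc m} (S.trans (S.*-congˡ {F} (D-^ F m)) (⊗-· (fromℕ (suc m)) F (D F ⊗ F ^ˢ m))) ⟩
    D F ⊗ F ^ˢ suc m ⊕ fromℕ (suc m) · (F ⊗ (D F ⊗ F ^ˢ m))
      ≈⟨ S.+-congˡ {D F ⊗ F ^ˢ suc m} (·-cong (fromℕ (suc m)) (x∙yz≈y∙xz F (D F) (F ^ˢ m))) ⟩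
    D F ⊗ F ^ˢ suc m ⊕ fromℕ (suc m) · (D F ⊗ F ^ˢ suc m)
      ≈⟨ pointwise (λ a b c → trans (solve 2 (λ n x → x :+ n :* x := (con 1ℚ :+ n) :* x) refl
            (fromℕ (suc m)) ((D F ⊗ F ^ˢ suc m) a b c))
            (cong (_* (D F ⊗ F ^ˢ suc m) a b c) (sym (fromℕ-+ 1 (suc m))))) ⟩
    fromℕ (suc (suc m)) · (D F ⊗ F ^ˢ suc m) ∎
    where
    open ≈-Reasoning
    open +-*-Solver
    open import Algebra.Properties.CommutativeSemigroup S.*-commutativeSemigroup using (x∙yz≈y∙xz)

  -- The total degree is used here, and not the order: the sums defining `exp` and `log` have a
  -- length depending on a + b + c, and powers of a series without constant term leave any given
  -- total degree.
  VanishesBelow : ℕ → Series → Set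
  VanishesBelow N F = ∀ a b c → a ℕ.+ b ℕ.+ c < N → F a b c ≡ 0ℚ

  split-degree : ∀ {a b c i j k} → i ≤ a → j ≤ b → k ≤ c →
    a ℕ.+ b ℕ.+ c ≡ (i ℕ.+ j ℕ.+ k) ℕ.+ ((a ∸ i) ℕ.+ (b ∸ j) ℕ.+ (c ∸ k))
  split-degree {a} {b} {c} {i} {j} {k} i≤a j≤b k≤c = begin
    a ℕ.+ b ℕ.+ c                                        ≡⟨ cong (ℕ._+ c) (split-order i≤a j≤b) ⟩
    (i ℕ.+ j) ℕ.+ ((a ∸ i) ℕ.+ (b ∸ j)) ℕ.+ c            ≡⟨ split-order
      {i = i ℕ.+ j} {k = k} (ℕ.m≤m+n _ _) k≤c ⟩
    (i ℕ.+ j ℕ.+ k) ℕ.+ (((i ℕ.+ j) ℕ.+ ((a ∸ i) ℕ.+ (b ∸ j)) ∸ (i ℕ.+ j)) ℕ.+ (c ∸ k))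
      ≡⟨ cong (λ t → (i ℕ.+ j ℕ.+ k) ℕ.+ (t ℕ.+ (c ∸ k))) (ℕ.m+n∸m≡n (i ℕ.+ j) _) ⟩
    (i ℕ.+ j ℕ.+ k) ℕ.+ ((a ∸ i) ℕ.+ (b ∸ j) ℕ.+ (c ∸ k)) ∎
    where open ≡-Reasoning

  <-+-split : ∀ {m n p q} → p ℕ.+ q < m ℕ.+ n → p < m ⊎ q < n
  <-+-split {m} {n} {p} {q} lt with p ℕ.<? m
  ... | yes p<m = inj₁ p<m
  ... | no p≮m = inj₂ (ℕ.≰⇒> λ n≤q → ℕ.<⇒≱ lt (ℕ.+-mono-≤ (ℕ.≮⇒≥ p≮m) n≤q))

  VanishesBelow-⊗ : ∀ {m n F G} → VanishesBelow m F → VanishesBelow n G → VanishesBelow (m ℕ.+ n) (F ⊗ G)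
  VanishesBelow-⊗ {m} {n} {F} {G} F₀ G₀ a b c lt = ⊗-zero-at F G a b c go
    where
    go : ∀ i j k → i ≤ a → j ≤ b → k ≤ c → F i j k * G (a ∸ i) (b ∸ j) (c ∸ k) ≡ 0ℚ
    go i j k i≤a j≤b k≤c with <-+-split (subst (_< m ℕ.+ n) (split-degree i≤a j≤b k≤c) lt)
    ... | inj₁ lt₁ = trans (cong (_* G (a ∸ i) (b ∸ j) (c ∸ k)) (F₀ i j k lt₁)) (ℚ.*-zeroˡ (G (a ∸ i) (b ∸ j) (c ∸ k)))
    ... | inj₂ lt₂ = trans (cong (F i j k *_) (G₀ (a ∸ i) (b ∸ j) (c ∸ k) lt₂)) (ℚ.*-zeroʳ (F i j k))

  VanishesBelow-^ : ∀ {F} → VanishesBelow 1 F → ∀ m → VanishesBelow m (F ^ˢ m)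
  VanishesBelow-^ F₀ zero    a b c ()
  VanishesBelow-^ F₀ (suc m) = VanishesBelow-⊗ F₀ (VanishesBelow-^ F₀ m)

  -- This allows an infinite series to be exchanged for a truncation inside a product, as long as
  -- one coefficient is looked at.
  ⊗-congˡ-below : ∀ F G G′ a b c → (∀ i j k → i ≤ a → j ≤ b → k ≤ c → G i j k ≡ G′ i j k) →
                  (F ⊗ G) a b c ≡ (F ⊗ G′) a b c
  ⊗-congˡ-below F G G′ a b c eq = ⊗-cong-at F G a b c F G′ λ i j k _ _ _ →
    cong (F i j k *_) (eq (a ∸ i) (b ∸ j) (c ∸ k) (ℕ.m∸n≤m a i) (ℕ.m∸n≤m b j) (ℕ.m∸n≤m c k))

  module _ (t : ℕ → ℚ) (F : ℕ → Series) where

    partial : ℕ → Series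
    partial M a b c = ∑[ m < M ] (t (toℕ m) * F (toℕ m) a b c)

    partial-suc : ∀ M → partial (suc M) ≈ partial M ⊕ t M · F M
    partial-suc M = pointwise λ a b c → sum-last M (λ m → t m * F m a b c)

    -- Term m vanishes below total degree m, so all terms from N on are invisible at this
    -- coefficient. Hence one uniform truncation can replace a sum whose length varies with the
    -- coefficient.
    partial-stable : (∀ m → VanishesBelow m (F m)) → ∀ {N} a b c → a ℕ.+ b ℕ.+ c < N →
                     ∀ d → partial (d ℕ.+ N) a b c ≡ partial N a b c
    partial-stable F₀ a b c lt zero    = refl
    partial-stable F₀ {N} a b c lt (suc d) = begin
      partial (suc d ℕ.+ N) a b c
        ≡⟨ at (partial-suc (d ℕ.+ N)) a b c ⟩
      partial (d ℕ.+ N) a b c + t (d ℕ.+ N) * F (d ℕ.+ N) a b c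
        ≡⟨ cong₂ (λ p q → p + t (d ℕ.+ N) * q) (partial-stable F₀ a b c lt d)
             (F₀ (d ℕ.+ N) a b c (ℕ.<-≤-trans lt (ℕ.m≤n+m N d))) ⟩
      partial N a b c + t (d ℕ.+ N) * 0ℚ
        ≡⟨ cong (partial N a b c +_) (ℚ.*-zeroʳ (t (d ℕ.+ N))) ⟩
      partial N a b c + 0ℚ
        ≡⟨ ℚ.+-identityʳ _ ⟩
      partial N a b c ∎
      where open ≡-Reasoning

    partial-stable′ : (∀ m → VanishesBelow m (F m)) → ∀ {M N} a b c → a ℕ.+ b ℕ.+ c < N → N ≤ M →
                      partial M a b c ≡ partial N a b c
    partial-stable′ F₀ {M} {N} a b c lt N≤M =
      trans (cong (λ K → partial K a b c) (sym (ℕ.m∸n+n≡m N≤M))) (partial-stable F₀ a b c lt (M ∸ N))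

  module _ {F : Series} (F₀ : VanishesBelow 1 F) where

    private
      E : ℕ → Series
      E = partial 1/! (F ^ˢ_)

      exp≡E : ∀ {M} a b c → a ℕ.+ b ℕ.+ c < M → exp F a b c ≡ E M a b c
      exp≡E {M} a b c lt = trans
        (sum-cong-≗ {suc (a ℕ.+ b ℕ.+ c)} λ m → ℚ.*-comm ((F ^ˢ toℕ m) a b c) (1/! (toℕ m)))
        (sym (partial-stable′ 1/! (F ^ˢ_) (VanishesBelow-^ F₀) a b c ℕ.≤-refl lt))

      -- As for the exponential polynomial: differentiation turns the term F^(m+1)/(m+1)! into D F ·
      -- F^m/m!, and the truncation loses one term.
      D-E : ∀ M → D (E (suc M)) ≈ D F ⊗ E M
      D-E zero = begin
        D (E 1)          ≈⟨ D-cong (S.trans (partial-suc 1/! (F ^ˢ_) 0) (S.+-identityˡ _)) ⟩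
        D (1/! 0 · 𝟙)    ≈⟨ D-cong (pointwise λ a b c → ℚ.*-identityˡ _) ⟩
        D 𝟙              ≈⟨ D-𝟙 ⟩
        S.0#             ≈⟨ S.zeroʳ (D F) ⟨
        D F ⊗ S.0#       ∎
        where open ≈-Reasoning
      D-E (suc M) = begin
        D (E (suc (suc M)))
          ≈⟨ S.trans (D-cong (partial-suc 1/! (F ^ˢ_) (suc M))) (D-⊕ (E (suc M)) (1/! (suc M) · F ^ˢ suc M)) ⟩
        D (E (suc M)) ⊕ D (1/! (suc M) · F ^ˢ suc M)
          ≈⟨ S.+-cong (D-E M) (S.trans (D-· (1/! (suc M)) (F ^ˢ suc M)) (·-cong (1/! (suc M)) (D-^ F M))) ⟩
        D F ⊗ E M ⊕ 1/! (suc M) · (fromℕ (suc M) · (D F ⊗ F ^ˢ M))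
          ≈⟨ S.+-congˡ {D F ⊗ E M} (pointwise λ a b c → trans (sym (ℚ.*-assoc (1/! (suc M)) (fromℕ (suc M)) _))
               (cong (_* (D F ⊗ F ^ˢ M) a b c)
                 (trans (ℚ.*-comm (1/! (suc M)) (fromℕ (suc M))) (suc*1/! M)))) ⟩
        D F ⊗ E M ⊕ 1/! M · (D F ⊗ F ^ˢ M)
          ≈⟨ S.+-congˡ {D F ⊗ E M} (⊗-· (1/! M) (D F) (F ^ˢ M)) ⟨
        D F ⊗ E M ⊕ D F ⊗ (1/! M · F ^ˢ M)
          ≈⟨ S.distribˡ (D F) (E M) (1/! M · F ^ˢ M) ⟨
        D F ⊗ (E M ⊕ 1/! M · F ^ˢ M)
          ≈⟨ S.*-congˡ {D F} (partial-suc 1/! (F ^ˢ_) M) ⟨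
        D F ⊗ E (suc M) ∎
        where open ≈-Reasoning

    D-exp : D (exp F) ≈ D F ⊗ exp F
    D-exp = pointwise λ a b c → let M = suc (a ℕ.+ b ℕ.+ c) in begin
      D (exp F) a b c          ≡⟨ cong (fromℕ (a ℕ.+ c) *_) (exp≡E a b c (ℕ.m≤n⇒m≤1+n ℕ.≤-refl)) ⟩
      D (E (suc M)) a b c      ≡⟨ at (D-E M) a b c ⟩
      (D F ⊗ E M) a b c        ≡⟨ ⊗-congˡ-below (D F) (exp F) (E M) a b c (λ i j k i≤a j≤b k≤c →
        exp≡E i j k (s≤s (ℕ.+-mono-≤ (ℕ.+-mono-≤ i≤a j≤b) k≤c))) ⟨
      (D F ⊗ exp F) a b c      ∎
      where open ≡-Reasoning

  private
    ι : ℤ.ℤ → ℚ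
    ι z = z / 1

    sgn : ℕ → ℚ
    sgn m = ι (ℤ.-1ℤ ℤ.^ m)

    sgn-suc : ∀ m → sgn (suc m) ≡ - sgn m
    sgn-suc m = trans (/-homo-* ℤ.-1ℤ (ℤ.-1ℤ ℤ.^ m) 0)
      (trans (sym (ℚ.neg-distribˡ-* 1ℚ (sgn m))) (cong -_ (ℚ.*-identityˡ (sgn m))))

    t : ℕ → ℚ
    t m = (ℤ.-1ℤ ℤ.^ m) / suc m

    module _ (U : Series) where

      J L : ℕ → Series
      J = partial sgn (U ^ˢ_)
      L = partial t (λ m → U ^ˢ suc m)

      -- `J` is the truncated geometric series for 1/(1 + U); the product telescopes to 1 - (-U)^M.
      telescope : ∀ M → (𝟙 ⊕ U) ⊗ J M ≈ 𝟙 ⊖ sgn M · U ^ˢ M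
      telescope zero    = S.trans (S.zeroʳ (𝟙 ⊕ U))
        (pointwise λ a b c → solve 1 (λ x → con 0ℚ := x :- con 1ℚ :* x) refl (𝟙 a b c))
        where open +-*-Solver
      telescope (suc M) = begin
        (𝟙 ⊕ U) ⊗ J (suc M)
          ≈⟨ S.*-congˡ {𝟙 ⊕ U} (partial-suc sgn (U ^ˢ_) M) ⟩
        (𝟙 ⊕ U) ⊗ (J M ⊕ sgn M · U ^ˢ M)
          ≈⟨ S.distribˡ (𝟙 ⊕ U) (J M) (sgn M · U ^ˢ M) ⟩
        (𝟙 ⊕ U) ⊗ J M ⊕ (𝟙 ⊕ U) ⊗ (sgn M · U ^ˢ M)
          ≈⟨ S.+-cong (telescope M) (S.trans (⊗-· (sgn M) (𝟙 ⊕ U) (U ^ˢ M)) (·-cong (sgn M)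
               (S.trans (S.distribʳ (U ^ˢ M) 𝟙 U) (S.+-congʳ (S.*-identityˡ (U ^ˢ M)))))) ⟩
        (𝟙 ⊖ sgn M · U ^ˢ M) ⊕ sgn M · (U ^ˢ M ⊕ U ^ˢ suc M)
          ≈⟨ pointwise (λ a b c → trans
               (solve 4 (λ o s u v → (o :- s :* u) :+ s :* (u :+ v) := o :- (:- s) :* v) refl
                 (𝟙 a b c) (sgn M) ((U ^ˢ M) a b c) ((U ^ˢ suc M) a b c))
               (cong (λ s → 𝟙 a b c - s * (U ^ˢ suc M) a b c) (sym (sgn-suc M)))) ⟩
        𝟙 ⊖ sgn (suc M) · U ^ˢ suc M ∎
        where
        open ≈-Reasoning
        open +-*-Solver

      D-L : ∀ M → D (L M) ≈ D U ⊗ J M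
      D-L zero    = S.trans (pointwise λ a b c → ℚ.*-zeroʳ (fromℕ (a ℕ.+ c))) (S.sym (S.zeroʳ (D U)))
      D-L (suc M) = begin
        D (L (suc M))
          ≈⟨ S.trans (D-cong (partial-suc t (λ m → U ^ˢ suc m) M)) (D-⊕ (L M) (t M · U ^ˢ suc M)) ⟩
        D (L M) ⊕ D (t M · U ^ˢ suc M)
          ≈⟨ S.+-cong (D-L M) (S.trans (D-· (t M) (U ^ˢ suc M)) (·-cong (t M) (D-^ U M))) ⟩
        D U ⊗ J M ⊕ t M · (fromℕ (suc M) · (D U ⊗ U ^ˢ M))
          ≈⟨ S.+-congˡ {D U ⊗ J M} (pointwise λ a b c → trans (sym (ℚ.*-assoc (t M) (fromℕ (suc M)) _))
               (cong (_* (D U ⊗ U ^ˢ M) a b c)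
                 (trans (ℚ.*-comm (t M) (fromℕ (suc M))) (suc*/suc M (ℤ.-1ℤ ℤ.^ M))))) ⟩
        D U ⊗ J M ⊕ sgn M · (D U ⊗ U ^ˢ M)
          ≈⟨ S.+-congˡ {D U ⊗ J M} (⊗-· (sgn M) (D U) (U ^ˢ M)) ⟨
        D U ⊗ J M ⊕ D U ⊗ (sgn M · U ^ˢ M)
          ≈⟨ S.distribˡ (D U) (J M) (sgn M · U ^ˢ M) ⟨
        D U ⊗ (J M ⊕ sgn M · U ^ˢ M)
          ≈⟨ S.*-congˡ {D U} (partial-suc sgn (U ^ˢ_) M) ⟨
        D U ⊗ J (suc M) ∎
        where open ≈-Reasoning

  -- Given as an implication, so that no inverse of F appears: with U = F - 1, the derivative of the
  -- truncated logarithm is D F · `J`, and X · F · `J` collapses to X up to a multiple of U^M of too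
  -- high a degree to matter.
  D-log : ∀ {F} X → VanishesBelow 1 (F ⊖ 𝟙) → D F ≈ X ⊗ F → D (log F) ≈ X
  D-log {F} X F₀ DF = pointwise go
    where
    open +-*-Solver
    U = F ⊖ 𝟙
    F≈ : F ≈ 𝟙 ⊕ U
    F≈ = pointwise λ a b c → solve 2 (λ f o → f := o :+ (f :- o)) refl (F a b c) (𝟙 a b c)
    DU : D U ≈ D F
    DU = pointwise λ a b c → trans
      (solve 3 (λ n f o → n :* (f :- o) := n :* f :- n :* o) refl (fromℕ (a ℕ.+ c)) (F a b c) (𝟙 a b c))
      (trans (cong (λ q → D F a b c - q) (at D-𝟙 a b c)) (solve 1 (λ x → x :- con 0ℚ := x) refl (D F a b c)))
    D-L≈ : ∀ M → D (L U M) ≈ X ⊗ (𝟙 ⊖ sgn M · U ^ˢ M)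
    D-L≈ M = begin
      D (L U M)                        ≈⟨ D-L U M ⟩
      D U ⊗ J U M                      ≈⟨ S.*-congʳ {J U M} (S.trans DU DF) ⟩
      (X ⊗ F) ⊗ J U M                  ≈⟨ S.*-assoc X F (J U M) ⟩
      X ⊗ (F ⊗ J U M)                  ≈⟨ S.*-congˡ {X} (S.*-congʳ {J U M} F≈) ⟩
      X ⊗ ((𝟙 ⊕ U) ⊗ J U M)            ≈⟨ S.*-congˡ {X} (telescope U M) ⟩
      X ⊗ (𝟙 ⊖ sgn M · U ^ˢ M)         ∎
      where open ≈-Reasoning
    go : ∀ a b c → D (log F) a b c ≡ X a b c
    go a b c = begin
      D (log F) a b c
        -- The logarithm stops after N terms, but the error term must be U^(N+1) to vanish at total
        -- degree N. One more term, itself a multiple of U^(N+1), is added at no cost.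
        ≡⟨ cong (fromℕ (a ℕ.+ c) *_) (sym (trans (at (partial-suc t (λ m → U ^ˢ suc m) N) a b c)
             (trans (cong (λ q → L U N a b c + t N * q) (VanishesBelow-^ F₀ (suc N) a b c ℕ.≤-refl))
             (trans (cong (L U N a b c +_) (ℚ.*-zeroʳ (t N))) (ℚ.+-identityʳ (L U N a b c)))))) ⟩
      D (L U M) a b c
        ≡⟨ at (D-L≈ M) a b c ⟩
      (X ⊗ (𝟙 ⊖ sgn M · U ^ˢ M)) a b c
        ≡⟨ ⊗-congˡ-below X (𝟙 ⊖ sgn M · U ^ˢ M) 𝟙 a b c (λ i j k i≤a j≤b k≤c → trans
             (cong (λ q → 𝟙 i j k - sgn M * q) (VanishesBelow-^ F₀ M i j k
               (s≤s (ℕ.+-mono-≤ (ℕ.+-mono-≤ i≤a j≤b) k≤c))))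
             (solve 2 (λ o s → o :- s :* con 0ℚ := o) refl (𝟙 i j k) (sgn M))) ⟩
      (X ⊗ 𝟙) a b c
        ≡⟨ at (S.*-identityʳ X) a b c ⟩
      X a b c ∎
      where
      open ≡-Reasoning
      N = a ℕ.+ b ℕ.+ c
      M = suc N

  -- The initial condition of the differential equation. The terms of order 0 are those with a = c =
  -- 0 and any power of y, so it prescribes a whole series in y.
  Unital : Series → Set
  Unital F = ∀ b → F 0 b 0 ≡ 𝟙 0 b 0

  Unital-⊗ : ∀ {F G} → Unital F → Unital G → Unital (F ⊗ G)
  Unital-⊗ {F} {G} F₁ G₁ b = trans (⊗-cong-at F G 0 b 0 𝟙 𝟙 λ { zero j zero _ _ _ → cong₂ _*_ (F₁ j) (G₁ (b ∸ j)) })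
    (at (S.*-identityˡ 𝟙) 0 b 0)

  Unital-exp : ∀ {F} → (∀ b → F 0 b 0 ≡ 0ℚ) → Unital (exp F)
  Unital-exp {F} F₀ b = begin
    exp F 0 b 0
      ≡⟨⟩
    𝟙 0 b 0 * 1ℚ + ∑[ m < b ℕ.+ 0 ] ((F ^ˢ suc (toℕ m)) 0 b 0 /! suc (toℕ m))
      ≡⟨ cong₂ _+_ (ℚ.*-identityʳ (𝟙 0 b 0)) (trans
           (sum-cong-≗ {b ℕ.+ 0} λ m → trans (cong (_/! suc (toℕ m)) (power (toℕ m))) (ℚ.*-zeroˡ (1/! (suc (toℕ m)))))
           (sum-replicate-zero (b ℕ.+ 0))) ⟩
    𝟙 0 b 0 + 0ℚ
      ≡⟨ ℚ.+-identityʳ (𝟙 0 b 0) ⟩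
    𝟙 0 b 0 ∎
    where
    open ≡-Reasoning
    power : ∀ m → (F ^ˢ suc m) 0 b 0 ≡ 0ℚ
    power m = ⊗-zero-at F (F ^ˢ m) 0 b 0 λ { zero j zero _ _ _ →
      trans (cong (_* (F ^ˢ m) 0 (b ∸ j) 0) (F₀ j)) (ℚ.*-zeroˡ ((F ^ˢ m) 0 (b ∸ j) 0)) }

  D-product : ∀ {F G P Q} → D F ≈ P ⊗ F → D G ≈ Q ⊗ G → D (F ⊗ G) ≈ (P ⊕ Q) ⊗ (F ⊗ G)
  D-product {F} {G} {P} {Q} DF DG = begin
    D (F ⊗ G)                       ≈⟨ D-⊗ F G ⟩
    D F ⊗ G ⊕ F ⊗ D G               ≈⟨ S.+-cong (S.*-congʳ {G} DF) (S.*-congˡ {F} DG) ⟩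
    (P ⊗ F) ⊗ G ⊕ F ⊗ (Q ⊗ G)       ≈⟨ S.+-cong (S.*-assoc P F G) (x∙yz≈y∙xz F Q G) ⟩
    P ⊗ (F ⊗ G) ⊕ Q ⊗ (F ⊗ G)       ≈⟨ S.distribʳ (F ⊗ G) P Q ⟨
    (P ⊕ Q) ⊗ (F ⊗ G)               ∎
    where
    open ≈-Reasoning
    open import Algebra.Properties.CommutativeSemigroup S.*-commutativeSemigroup using (x∙yz≈y∙xz)

  -- Since P has no terms of order 0, the equation expresses n times a coefficient of order n
  -- through coefficients of smaller order, and n can be cancelled unless it is 0.
  uniqueness : ∀ P {F G} → (∀ b → P 0 b 0 ≡ 0ℚ) → D F ≈ P ⊗ F → D G ≈ P ⊗ G →
               Unital F → Unital G → F ≈ G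
  uniqueness P {F} {G} P₀ DF DG F₁ G₁ = pointwise λ a b c → go (suc (a ℕ.+ c)) a b c ℕ.≤-refl
    where
    step : ∀ a b c n → a ℕ.+ c ≡ suc n → (∀ i j k → i ℕ.+ k < a ℕ.+ c → F i j k ≡ G i j k) → F a b c ≡ G a b c
    step a b c n eq below = cancel-suc n (begin
      fromℕ (suc n) * F a b c  ≡⟨ cong (λ m → fromℕ m * F a b c) eq ⟨
      D F a b c                ≡⟨ at DF a b c ⟩
      (P ⊗ F) a b c            ≡⟨ ⊗-cong-at P F a b c P G smaller ⟩
      (P ⊗ G) a b c            ≡⟨ at DG a b c ⟨
      D G a b c                ≡⟨ cong (λ m → fromℕ m * G a b c) eq ⟩
      fromℕ (suc n) * G a b c  ∎)
      where
      open ≡-Reasoning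
      lt : ∀ {i k} → i ≤ a → k ≤ c → 0 < i ℕ.+ k → (a ∸ i) ℕ.+ (c ∸ k) < a ℕ.+ c
      lt {i} {k} i≤a k≤c pos = subst ((a ∸ i) ℕ.+ (c ∸ k) <_) (sym (split-order i≤a k≤c))
        (ℕ.m<n+m ((a ∸ i) ℕ.+ (c ∸ k)) pos)
      smaller : ∀ i j k → i ≤ a → j ≤ b → k ≤ c →
        P i j k * F (a ∸ i) (b ∸ j) (c ∸ k) ≡ P i j k * G (a ∸ i) (b ∸ j) (c ∸ k)
      -- The only summands in which F and G still occur at the full order; there P vanishes.
      smaller zero    j zero    _ _ _ = trans (cong (_* F a (b ∸ j) c) (P₀ j)) (trans (ℚ.*-zeroˡ (F a (b ∸ j) c))
        (sym (trans (cong (_* G a (b ∸ j) c) (P₀ j)) (ℚ.*-zeroˡ (G a (b ∸ j) c)))))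
      smaller zero    j (suc k) i≤a _ k≤c = cong (P zero j (suc k) *_) (below _ (b ∸ j) _ (lt i≤a k≤c (s≤s z≤n)))
      smaller (suc i) j k       i≤a _ k≤c = cong (P (suc i) j k *_) (below _ (b ∸ j) _ (lt i≤a k≤c (s≤s z≤n)))
    go : ∀ N a b c → a ℕ.+ c < N → F a b c ≡ G a b c
    go (suc N) zero    b zero    _        = trans (F₁ b) (sym (G₁ b))
    go (suc N) zero    b (suc c) (s≤s lt) = step zero b (suc c) c refl
      (λ i j k lt′ → go N i j k (ℕ.<-≤-trans lt′ lt))
    go (suc N) (suc a) b c       (s≤s lt) = step (suc a) b c (a ℕ.+ c) refl
      (λ i j k lt′ → go N i j k (ℕ.<-≤-trans lt′ lt))

-- Sums over lists and indicators in a commutative semiring.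

module Enumeration where

  open import Defs using (allVecs)
  open import Algebra.Bundles using (CommutativeSemiring)
  import Algebra.Properties.CommutativeSemigroup as CS
  open import Data.Bool.Base using (Bool; true; false; if_then_else_)
  import Data.Bool.Properties as Bool
  open import Data.Fin.Base using (Fin; zero; suc)
  open import Data.List.Base using (List; []; _∷_; map; filter; _++_; cartesianProductWith; cartesianProduct; allFin; concatMap)
  import Data.List.Properties as List
  open import Data.Nat.Base using (zero; suc)
  open import Data.Product.Base using (_×_; _,_; proj₁; proj₂)
  import Data.Product.Properties as Product
  open import Data.Vec.Base using (Vec; []; _∷_)
  import Data.Vec.Properties as Vec
  open import Data.Empty using (⊥-elim)
  open import Function.Base using (_∘_; id)
  open import Level using (0ℓ)
  open import Relation.Binary.Definitions using (DecidableEquality)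
  open import Relation.Binary.PropositionalEquality as ≡ using (_≡_; cong)
  open import Relation.Nullary using (Dec; yes; no; ¬_; does)
  open import Relation.Nullary.Decidable using (_×-dec_)
  open import Relation.Unary using (Pred; Decidable)

  module ListSum (R : CommutativeSemiring 0ℓ 0ℓ) where

    open CommutativeSemiring R hiding (zero)
    open CS +-commutativeSemigroup using (interchange)
    import Relation.Binary.Reasoning.Setoid as SetoidReasoning
    open SetoidReasoning setoid

    private variable
      A B : Set
      P Q : Set

    ∑ : List A → (A → Carrier) → Carrier
    ∑ []       f = 0#
    ∑ (x ∷ xs) f = f x + ∑ xs f

    ∑-cong : ∀ (xs : List A) {f g} → (∀ x → f x ≈ g x) → ∑ xs f ≈ ∑ xs g
    ∑-cong []       p = refl
    ∑-cong (x ∷ xs) p = +-cong (p x) (∑-cong xs p)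

    ∑-zero : ∀ (xs : List A) {f} → (∀ x → f x ≈ 0#) → ∑ xs f ≈ 0#
    ∑-zero []       p = refl
    ∑-zero (x ∷ xs) p = trans (+-cong (p x) (∑-zero xs p)) (+-identityˡ _)

    ∑-+ : ∀ (xs : List A) f g → ∑ xs (λ x → f x + g x) ≈ ∑ xs f + ∑ xs g
    ∑-+ []       f g = sym (+-identityˡ _)
    ∑-+ (x ∷ xs) f g = trans (+-congˡ (∑-+ xs f g)) (interchange _ _ _ _)

    *-∑ : ∀ (xs : List A) r f → r * ∑ xs f ≈ ∑ xs (λ x → r * f x)
    *-∑ []       r f = zeroʳ r
    *-∑ (x ∷ xs) r f = trans (distribˡ _ _ _) (+-congˡ (*-∑ xs r f))

    ∑-* : ∀ (xs : List A) f r → ∑ xs f * r ≈ ∑ xs (λ x → f x * r)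
    ∑-* []       f r = zeroˡ r
    ∑-* (x ∷ xs) f r = trans (distribʳ _ _ _) (+-congˡ (∑-* xs f r))

    ∑-swap : ∀ (xs : List A) (ys : List B) (f : A → B → Carrier) →
             ∑ xs (λ x → ∑ ys (f x)) ≈ ∑ ys (λ y → ∑ xs (λ x → f x y))
    ∑-swap []       ys f = sym (∑-zero ys λ _ → refl)
    ∑-swap (x ∷ xs) ys f = trans (+-congˡ (∑-swap xs ys f)) (sym (∑-+ ys _ _))

    ∑-++ : ∀ (xs ys : List A) f → ∑ (xs ++ ys) f ≈ ∑ xs f + ∑ ys f
    ∑-++ []       ys f = sym (+-identityˡ _)
    ∑-++ (x ∷ xs) ys f = trans (+-congˡ (∑-++ xs ys f)) (sym (+-assoc _ _ _))

    ∑-map : ∀ (h : A → B) xs f → ∑ (map h xs) f ≈ ∑ xs (f ∘ h)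
    ∑-map h []       f = refl
    ∑-map h (x ∷ xs) f = +-congˡ (∑-map h xs f)

    ∑-product : ∀ {C : Set} (h : A → B → C) xs ys f →
                ∑ (cartesianProductWith h xs ys) f ≈ ∑ xs (λ x → ∑ ys (λ y → f (h x y)))
    ∑-product h []       ys f = refl
    ∑-product h (x ∷ xs) ys f =
      trans (∑-++ (map (h x) ys) _ f) (+-cong (∑-map (h x) ys f) (∑-product h xs ys f))

    ∑-concatMap : ∀ (h : A → List B) xs f → ∑ (concatMap h xs) f ≈ ∑ xs (λ x → ∑ (h x) f)
    ∑-concatMap h []       f = refl
    ∑-concatMap h (x ∷ xs) f = trans (∑-++ (h x) _ f) (+-congˡ (∑-concatMap h xs f))

    ∑-allFin-suc : ∀ n (f : Fin (suc n) → Carrier) →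
                   ∑ (allFin (suc n)) f ≈ f zero + ∑ (allFin n) (f ∘ suc)
    ∑-allFin-suc n f = +-congˡ (trans (reflexive (cong (λ xs → ∑ xs f) (≡.sym (List.map-tabulate id suc))))
      (∑-map suc (allFin n) f))

    ⟦_⟧ : Dec P → Carrier
    ⟦ d ⟧ = if does d then 1# else 0#

    ⟦⟧-yes : (d : Dec P) → P → ⟦ d ⟧ ≈ 1#
    ⟦⟧-yes (yes _) p = refl
    ⟦⟧-yes (no ¬p) p = ⊥-elim (¬p p)

    ⟦⟧-no : (d : Dec P) → ¬ P → ⟦ d ⟧ ≈ 0#
    ⟦⟧-no (yes p) ¬p = ⊥-elim (¬p p)
    ⟦⟧-no (no _)  ¬p = refl

    ⟦⟧-cong : (d : Dec P) (e : Dec Q) → (P → Q) → (Q → P) → ⟦ d ⟧ ≈ ⟦ e ⟧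
    ⟦⟧-cong (yes p) e f g = sym (⟦⟧-yes e (f p))
    ⟦⟧-cong (no ¬p) e f g = sym (⟦⟧-no e (¬p ∘ g))

    ⟦⟧-× : (d : Dec P) (e : Dec Q) → ⟦ d ×-dec e ⟧ ≈ ⟦ d ⟧ * ⟦ e ⟧
    ⟦⟧-× (yes p) (yes q) = sym (*-identityˡ _)
    ⟦⟧-× (yes p) (no q)  = sym (zeroʳ _)
    ⟦⟧-× (no p)  e       = sym (zeroˡ _)

    ⟦⟧-guard : (d : Dec P) {r s : Carrier} → (P → r ≈ s) → ⟦ d ⟧ * r ≈ ⟦ d ⟧ * s
    ⟦⟧-guard (yes p) eq = *-congˡ (eq p)
    ⟦⟧-guard (no ¬p) eq = trans (zeroˡ _) (sym (zeroˡ _))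

    ∑-filter : ∀ {P : Pred A 0ℓ} (P? : Decidable P) xs f →
               ∑ (filter P? xs) f ≈ ∑ xs (λ x → ⟦ P? x ⟧ * f x)
    ∑-filter P? []       f = refl
    ∑-filter P? (x ∷ xs) f with P? x
    ... | yes _ = +-cong (sym (*-identityˡ _)) (∑-filter P? xs f)
    ... | no _  = trans (∑-filter P? xs f) (sym (trans (+-congʳ (zeroˡ _)) (+-identityˡ _)))

    -- Every element occurs exactly once, expressed by a sum of indicators so that it can be used
    -- inside calculations. Quantifying over the decision procedure makes it applicable whatever
    -- test the indicators contain.
    Enumerates : List A → Set
    Enumerates {A} xs = ∀ a (a≟ : ∀ x → Dec (a ≡ x)) → ∑ xs (λ x → ⟦ a≟ x ⟧) ≈ 1#

    ∑-pick : ∀ (xs : List A) → Enumerates xs → ∀ a (a≟ : ∀ x → Dec (a ≡ x)) (f : A → Carrier) →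
             ∑ xs (λ x → ⟦ a≟ x ⟧ * f x) ≈ f a
    ∑-pick xs enum a a≟ f = begin
      ∑ xs (λ x → ⟦ a≟ x ⟧ * f x)  ≈⟨ ∑-cong xs (λ x → ⟦⟧-guard (a≟ x) λ { ≡.refl → refl }) ⟩
      ∑ xs (λ x → ⟦ a≟ x ⟧ * f a)  ≈⟨ ∑-* xs _ (f a) ⟨
      ∑ xs (λ x → ⟦ a≟ x ⟧) * f a  ≈⟨ *-congʳ (enum a a≟) ⟩
      1# * f a                     ≈⟨ *-identityˡ (f a) ⟩
      f a                          ∎

    Enumerates-product : ∀ (xs : List A) (ys : List B) → DecidableEquality A → DecidableEquality B →
                         Enumerates xs → Enumerates ys → Enumerates (cartesianProduct xs ys)
    Enumerates-product xs ys _≟₁_ _≟₂_ p q (a , b) ab≟ = begin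
      ∑ (cartesianProduct xs ys) (λ x → ⟦ ab≟ x ⟧)
        ≈⟨ ∑-product _,_ xs ys _ ⟩
      ∑ xs (λ x → ∑ ys λ y → ⟦ ab≟ (x , y) ⟧)
        ≈⟨ ∑-cong xs (λ x → trans
             (∑-cong ys λ y → trans
               (⟦⟧-cong (ab≟ (x , y)) ((a ≟₁ x) ×-dec (b ≟₂ y))
                 (λ eq → cong proj₁ eq , cong proj₂ eq) λ { (≡.refl , ≡.refl) → ≡.refl })
               (⟦⟧-× (a ≟₁ x) (b ≟₂ y)))
             (trans (sym (*-∑ ys _ _)) (trans (*-congˡ (q b (b ≟₂_))) (*-identityʳ _)))) ⟩
      ∑ xs (λ x → ⟦ a ≟₁ x ⟧)
        ≈⟨ p a (a ≟₁_) ⟩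
      1# ∎

    Enumerates-allVecs : ∀ {xs : List A} → DecidableEquality A → Enumerates xs →
                         ∀ n → Enumerates (allVecs xs n)
    Enumerates-allVecs {xs = xs} _≟_ p zero    []       d = trans (+-identityʳ _) (⟦⟧-yes (d []) ≡.refl)
    Enumerates-allVecs {xs = xs} _≟_ p (suc n) (a ∷ as) d = begin
      ∑ (cartesianProductWith _∷_ xs (allVecs xs n)) (λ x → ⟦ d x ⟧)
        ≈⟨ ∑-product _∷_ xs (allVecs xs n) _ ⟩
      ∑ xs (λ x → ∑ (allVecs xs n) λ v → ⟦ d (x ∷ v) ⟧)
        ≈⟨ ∑-cong xs (λ x → trans
             (∑-cong (allVecs xs n) λ v → trans
               (⟦⟧-cong (d (x ∷ v)) ((a ≟ x) ×-dec (as ≟ᵥ v))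
                 (λ { ≡.refl → ≡.refl , ≡.refl }) λ { (≡.refl , ≡.refl) → ≡.refl })
               (⟦⟧-× (a ≟ x) (as ≟ᵥ v)))
             (trans (sym (*-∑ (allVecs xs n) _ _))
               (trans (*-congˡ (Enumerates-allVecs _≟_ p n as (as ≟ᵥ_))) (*-identityʳ _)))) ⟩
      ∑ xs (λ x → ⟦ a ≟ x ⟧)
        ≈⟨ p a (a ≟_) ⟩
      1# ∎
      where _≟ᵥ_ = Vec.≡-dec _≟_

    bools : List Bool
    bools = true ∷ false ∷ []

    Enumerates-bools : Enumerates bools
    Enumerates-bools true  d = trans (+-cong (⟦⟧-yes (d true) ≡.refl)
      (trans (+-identityʳ _) (⟦⟧-no (d false) λ ()))) (+-identityʳ _)
    Enumerates-bools false d = trans (+-cong (⟦⟧-no (d true) λ ())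
      (trans (+-identityʳ _) (⟦⟧-yes (d false) ≡.refl))) (+-identityˡ _)

    -- Double counting of the graph of a bijection between P and Q: the sum over b of the indicator
    -- of `to` a = b is inserted, the two sums are exchanged, and the sum over a is collapsed. The
    -- two hypotheses state that P a with `to` a = b and Q b with `from` b = a describe the same
    -- pairs.
    ∑-reindex : ∀ (xs : List A) (ys : List B) {P : Pred A 0ℓ} {Q : Pred B 0ℓ} →
      DecidableEquality A → DecidableEquality B → Enumerates xs → Enumerates ys →
      (P? : Decidable P) (Q? : Decidable Q) (to : A → B) (from : B → A) →
      (∀ a b → P a × to a ≡ b → Q b × from b ≡ a) →
      (∀ a b → Q b × from b ≡ a → P a × to a ≡ b) →
      ∀ (f : A → Carrier) → ∑ xs (λ a → ⟦ P? a ⟧ * f a) ≈ ∑ ys (λ b → ⟦ Q? b ⟧ * f (from b))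
    ∑-reindex xs ys _≟₁_ _≟₂_ p q P? Q? to from ⇒ ⇐ f = begin
      ∑ xs (λ a → ⟦ P? a ⟧ * f a)
        ≈⟨ ∑-cong xs (λ a → ∑-pick ys q (to a) (to a ≟₂_) (λ _ → ⟦ P? a ⟧ * f a)) ⟨
      ∑ xs (λ a → ∑ ys λ b → ⟦ to a ≟₂ b ⟧ * (⟦ P? a ⟧ * f a))
        ≈⟨ ∑-cong xs (λ a → ∑-cong ys λ b → transfer a b) ⟩
      ∑ xs (λ a → ∑ ys λ b → ⟦ from b ≟₁ a ⟧ * (⟦ Q? b ⟧ * f a))
        ≈⟨ ∑-swap xs ys (λ a b → ⟦ from b ≟₁ a ⟧ * (⟦ Q? b ⟧ * f a)) ⟩
      ∑ ys (λ b → ∑ xs λ a → ⟦ from b ≟₁ a ⟧ * (⟦ Q? b ⟧ * f a))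
        ≈⟨ ∑-cong ys (λ b → ∑-pick xs p (from b) (from b ≟₁_) (λ a → ⟦ Q? b ⟧ * f a)) ⟩
      ∑ ys (λ b → ⟦ Q? b ⟧ * f (from b)) ∎
      where
      swap-× : ∀ {P Q : Set} → P × Q → Q × P
      swap-× (p , q) = q , p
      transfer : ∀ a b → ⟦ to a ≟₂ b ⟧ * (⟦ P? a ⟧ * f a) ≈ ⟦ from b ≟₁ a ⟧ * (⟦ Q? b ⟧ * f a)
      transfer a b = begin
        ⟦ to a ≟₂ b ⟧ * (⟦ P? a ⟧ * f a)      ≈⟨ *-assoc _ _ _ ⟨
        ⟦ to a ≟₂ b ⟧ * ⟦ P? a ⟧ * f a        ≈⟨ *-congʳ (⟦⟧-× (to a ≟₂ b) (P? a)) ⟨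
        ⟦ (to a ≟₂ b) ×-dec P? a ⟧ * f a      ≈⟨ *-congʳ (⟦⟧-cong ((to a ≟₂ b) ×-dec P? a) ((from b ≟₁ a) ×-dec Q? b)
          (swap-× ∘ ⇒ a b ∘ swap-×) (swap-× ∘ ⇐ a b ∘ swap-×)) ⟩
        ⟦ (from b ≟₁ a) ×-dec Q? b ⟧ * f a    ≈⟨ *-congʳ (⟦⟧-× (from b ≟₁ a) (Q? b)) ⟩
        ⟦ from b ≟₁ a ⟧ * ⟦ Q? b ⟧ * f a      ≈⟨ *-assoc _ _ _ ⟩
        ⟦ from b ≟₁ a ⟧ * (⟦ Q? b ⟧ * f a)    ∎

-- Splitting a finite set by a binary word.

-- A word τ of length n splits Fin n into the positions of its true and of its
-- false entries.
module Shuffle where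

  open import Data.Bool.Base using (Bool; true; false)
  open import Data.Fin.Base using (Fin; zero; suc; _<_)
  open import Data.Fin.Properties using (suc-injective)
  open import Data.Nat.Base using (ℕ; zero; suc; z≤n; s≤s; _+_)
  import Data.Nat.Properties as ℕ
  open import Data.Vec.Base using (Vec; []; _∷_; lookup)
  import Data.Vec.Properties as Vec
  open import Relation.Binary.PropositionalEquality

  private variable
    n : ℕ
    X Y : Set

  ones zeros : Vec Bool n → ℕ
  ones []          = 0
  ones (true ∷ τ)  = suc (ones τ)
  ones (false ∷ τ) = ones τ
  zeros []          = 0
  zeros (true ∷ τ)  = zeros τ
  zeros (false ∷ τ) = suc (zeros τ)

  ones+zeros : (τ : Vec Bool n) → ones τ + zeros τ ≡ n
  ones+zeros []          = refl
  ones+zeros (true ∷ τ)  = cong suc (ones+zeros τ)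
  ones+zeros (false ∷ τ) = trans (ℕ.+-suc (ones τ) (zeros τ)) (cong suc (ones+zeros τ))

  ι₁ : (τ : Vec Bool n) → Fin (ones τ) → Fin n
  ι₁ (true ∷ τ)  zero    = zero
  ι₁ (true ∷ τ)  (suc i) = suc (ι₁ τ i)
  ι₁ (false ∷ τ) i       = suc (ι₁ τ i)

  ι₂ : (τ : Vec Bool n) → Fin (zeros τ) → Fin n
  ι₂ (true ∷ τ)  i       = suc (ι₂ τ i)
  ι₂ (false ∷ τ) zero    = zero
  ι₂ (false ∷ τ) (suc i) = suc (ι₂ τ i)

  lookup-ι₁ : (τ : Vec Bool n) → ∀ i → lookup τ (ι₁ τ i) ≡ true
  lookup-ι₁ (true ∷ τ)  zero    = refl
  lookup-ι₁ (true ∷ τ)  (suc i) = lookup-ι₁ τ i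
  lookup-ι₁ (false ∷ τ) i       = lookup-ι₁ τ i

  lookup-ι₂ : (τ : Vec Bool n) → ∀ i → lookup τ (ι₂ τ i) ≡ false
  lookup-ι₂ (true ∷ τ)  i       = lookup-ι₂ τ i
  lookup-ι₂ (false ∷ τ) zero    = refl
  lookup-ι₂ (false ∷ τ) (suc i) = lookup-ι₂ τ i

  data Position (τ : Vec Bool n) : Fin n → Set where
    left  : ∀ i → Position τ (ι₁ τ i)
    right : ∀ i → Position τ (ι₂ τ i)

  position : (τ : Vec Bool n) → ∀ i → Position τ i
  position (true ∷ τ)  zero    = left zero
  position (true ∷ τ)  (suc i) with position τ i
  ... | left j  = left (suc j)
  ... | right j = right j
  position (false ∷ τ) zero    = right zero
  position (false ∷ τ) (suc i) with position τ i
  ... | left j  = left j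
  ... | right j = right (suc j)

  ι₁≢ι₂ : (τ : Vec Bool n) → ∀ i j → ι₁ τ i ≢ ι₂ τ j
  ι₁≢ι₂ τ i j eq with trans (sym (lookup-ι₁ τ i)) (trans (cong (lookup τ) eq) (lookup-ι₂ τ j))
  ... | ()

  ι₁-injective : (τ : Vec Bool n) → ∀ {i j} → ι₁ τ i ≡ ι₁ τ j → i ≡ j
  ι₁-injective (true ∷ τ)  {zero}  {zero}  eq = refl
  ι₁-injective (true ∷ τ)  {suc i} {suc j} eq = cong suc (ι₁-injective τ (suc-injective eq))
  ι₁-injective (false ∷ τ) eq = ι₁-injective τ (suc-injective eq)

  ι₂-injective : (τ : Vec Bool n) → ∀ {i j} → ι₂ τ i ≡ ι₂ τ j → i ≡ j
  ι₂-injective (true ∷ τ)  eq = ι₂-injective τ (suc-injective eq)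
  ι₂-injective (false ∷ τ) {zero}  {zero}  eq = refl
  ι₂-injective (false ∷ τ) {suc i} {suc j} eq = cong suc (ι₂-injective τ (suc-injective eq))

  -- An edge is counted once, at the pair with i < j; monotonicity keeps that count under the
  -- inclusions.
  ι₁-< : (τ : Vec Bool n) → ∀ {i j} → i < j → ι₁ τ i < ι₁ τ j
  ι₁-< (true ∷ τ)  {zero}  {suc j} lt       = s≤s z≤n
  ι₁-< (true ∷ τ)  {suc i} {suc j} (s≤s lt) = s≤s (ι₁-< τ lt)
  ι₁-< (false ∷ τ) lt                       = s≤s (ι₁-< τ lt)

  ι₂-< : (τ : Vec Bool n) → ∀ {i j} → i < j → ι₂ τ i < ι₂ τ j
  ι₂-< (true ∷ τ)  lt                       = s≤s (ι₂-< τ lt)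
  ι₂-< (false ∷ τ) {zero}  {suc j} lt       = s≤s z≤n
  ι₂-< (false ∷ τ) {suc i} {suc j} (s≤s lt) = s≤s (ι₂-< τ lt)

  merge : (τ : Vec Bool n) → Vec X (ones τ) → Vec X (zeros τ) → Vec X n
  merge []          _        _        = []
  merge (true ∷ τ)  (x ∷ xs) ys       = x ∷ merge τ xs ys
  merge (false ∷ τ) xs       (y ∷ ys) = y ∷ merge τ xs ys

  lookup-merge₁ : (τ : Vec Bool n) (u : Vec X (ones τ)) (v : Vec X (zeros τ)) →
                  ∀ i → lookup (merge τ u v) (ι₁ τ i) ≡ lookup u i
  lookup-merge₁ (true ∷ τ)  (x ∷ u) v       zero    = refl
  lookup-merge₁ (true ∷ τ)  (x ∷ u) v       (suc i) = lookup-merge₁ τ u v i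
  lookup-merge₁ (false ∷ τ) u       (y ∷ v) i       = lookup-merge₁ τ u v i

  lookup-merge₂ : (τ : Vec Bool n) (u : Vec X (ones τ)) (v : Vec X (zeros τ)) →
                  ∀ i → lookup (merge τ u v) (ι₂ τ i) ≡ lookup v i
  lookup-merge₂ (true ∷ τ)  (x ∷ u) v       i       = lookup-merge₂ τ u v i
  lookup-merge₂ (false ∷ τ) u       (y ∷ v) zero    = refl
  lookup-merge₂ (false ∷ τ) u       (y ∷ v) (suc i) = lookup-merge₂ τ u v i

  lookup-ext : {u v : Vec X n} → (∀ i → lookup u i ≡ lookup v i) → u ≡ v
  lookup-ext {u = u} {v} eq =
    trans (sym (Vec.tabulate∘lookup u)) (trans (Vec.tabulate-cong eq) (Vec.tabulate∘lookup v))

-- Induced subgraphs and disjoint unions.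

module GraphJoin where

  open import Defs
  open import Data.Bool.Base using (Bool; true; false; T)
  open import Data.Empty using (⊥-elim)
  open import Data.Fin.Base using (Fin)
  open import Data.Nat.Base using (ℕ)
  open import Data.Product.Base using (_×_; _,_; proj₁; ∃)
  open import Data.Unit.Base using (tt)
  open import Data.Vec.Base using (Vec; lookup; tabulate; replicate; map)
  import Data.Vec.Properties as Vec
  open import Function.Base using (_∘_)
  open import Relation.Binary.PropositionalEquality
  open import Relation.Binary.Construct.Closure.ReflexiveTransitive using (ε; _◅_; _◅◅_)
  open import Relation.Nullary using (¬_)
  open Shuffle

  private variable
    m n : ℕ

  adj : Graph n → Fin n → Fin n → Bool
  adj A i j = lookup (lookup A i) j

  T-ext : ∀ {p q} → (T p → T q) → (T q → T p) → p ≡ q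
  T-ext {false} {false} f g = refl
  T-ext {false} {true}  f g = ⊥-elim (g tt)
  T-ext {true}  {false} f g = ⊥-elim (f tt)
  T-ext {true}  {true}  f g = refl

  adj-ext : {A B : Graph n} → (∀ i j → adj A i j ≡ adj B i j) → A ≡ B
  adj-ext eq = lookup-ext λ i → lookup-ext (eq i)

  symmetric : (A : Graph n) → IsSimple A → ∀ i j → adj A i j ≡ adj A j i
  symmetric A (sym , _) i j = T-ext (sym i j) (sym j i)

  reverse : (A : Graph n) → IsSimple A → ∀ {i j} → Reachable A i j → Reachable A j i
  reverse A s ε        = ε
  reverse A s (e ◅ es) = reverse A s es ◅◅ (proj₁ s _ _ e ◅ ε)

  induced : (Fin m → Fin n) → Graph n → Graph m
  induced f A = tabulate λ i → tabulate λ j → adj A (f i) (f j)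

  adj-induced : ∀ (f : Fin m → Fin n) A i j → adj (induced f A) i j ≡ adj A (f i) (f j)
  adj-induced f A i j = trans (cong (λ r → lookup r j) (Vec.lookup∘tabulate _ i)) (Vec.lookup∘tabulate _ j)

  induced-simple : ∀ (f : Fin m → Fin n) A → IsSimple A → IsSimple (induced f A)
  induced-simple f A (sym′ , loop) =
    (λ i j e → subst T (sym (adj-induced f A j i)) (sym′ _ _ (subst T (adj-induced f A i j) e))) ,
    (λ i e → loop (f i) (subst T (adj-induced f A i i) e))

  induced-walk : ∀ (f : Fin m → Fin n) A {i j} → Reachable (induced f A) i j → Reachable A (f i) (f j)
  induced-walk f A ε        = ε
  induced-walk f A (e ◅ es) = subst T (adj-induced f A _ _) e ◅ induced-walk f A es

  -- No edge leaves the image, which is therefore a union of components; walks that start in it can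
  -- be pulled back.
  Closed : (Fin m → Fin n) → Graph n → Set
  Closed f A = ∀ i v → Adj A (f i) v → ∃ λ j → v ≡ f j

  closed-walk : ∀ (f : Fin m → Fin n) A → Closed f A → ∀ {i v} → Reachable A (f i) v →
                ∃ λ j → v ≡ f j × Reachable (induced f A) i j
  closed-walk f A closed ε            = _ , refl , ε
  closed-walk f A closed {i} (e ◅ es) with closed i _ e
  ... | j , refl with closed-walk f A closed es
  ...   | k , eq , w = k , eq , subst T (sym (adj-induced f A i j)) e ◅ w

  closed-reachable : ∀ (f : Fin m → Fin n) A → (∀ {i j} → f i ≡ f j → i ≡ j) → Closed f A →
                     ∀ {i j} → Reachable A (f i) (f j) → Reachable (induced f A) i j
  closed-reachable f A inj closed w with closed-walk f A closed w
  ... | k , eq , w′ rewrite inj eq = w′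

  join : (τ : Vec Bool n) → Graph (ones τ) → Graph (zeros τ) → Graph n
  join τ A B = merge τ (map (λ r → merge τ r (replicate _ false)) A)
                       (map (λ r → merge τ (replicate _ false) r) B)

  module _ (τ : Vec Bool n) (A : Graph (ones τ)) (B : Graph (zeros τ)) where

    private
      row₁ : ∀ i → lookup (join τ A B) (ι₁ τ i) ≡ merge τ (lookup A i) (replicate _ false)
      row₁ i = trans (lookup-merge₁ τ _ _ i) (Vec.lookup-map i _ A)

      row₂ : ∀ i → lookup (join τ A B) (ι₂ τ i) ≡ merge τ (replicate _ false) (lookup B i)
      row₂ i = trans (lookup-merge₂ τ _ _ i) (Vec.lookup-map i _ B)

    join₁₁ : ∀ i j → adj (join τ A B) (ι₁ τ i) (ι₁ τ j) ≡ adj A i j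
    join₁₁ i j = trans (cong (λ r → lookup r (ι₁ τ j)) (row₁ i)) (lookup-merge₁ τ _ _ j)

    join₂₂ : ∀ i j → adj (join τ A B) (ι₂ τ i) (ι₂ τ j) ≡ adj B i j
    join₂₂ i j = trans (cong (λ r → lookup r (ι₂ τ j)) (row₂ i)) (lookup-merge₂ τ _ _ j)

    join₁₂ : ∀ i j → adj (join τ A B) (ι₁ τ i) (ι₂ τ j) ≡ false
    join₁₂ i j = trans (cong (λ r → lookup r (ι₂ τ j)) (row₁ i))
      (trans (lookup-merge₂ τ _ _ j) (Vec.lookup-replicate j false))

    join₂₁ : ∀ i j → adj (join τ A B) (ι₂ τ i) (ι₁ τ j) ≡ false
    join₂₁ i j = trans (cong (λ r → lookup r (ι₁ τ j)) (row₂ i))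
      (trans (lookup-merge₁ τ _ _ j) (Vec.lookup-replicate j false))

    induced-join₁ : induced (ι₁ τ) (join τ A B) ≡ A
    induced-join₁ = adj-ext λ i j → trans (adj-induced (ι₁ τ) (join τ A B) i j) (join₁₁ i j)

    induced-join₂ : induced (ι₂ τ) (join τ A B) ≡ B
    induced-join₂ = adj-ext λ i j → trans (adj-induced (ι₂ τ) (join τ A B) i j) (join₂₂ i j)

    join-closed₁ : Closed (ι₁ τ) (join τ A B)
    join-closed₁ i v e with position τ v
    ... | left j  = j , refl
    ... | right j = ⊥-elim (subst T (join₁₂ i j) e)

    join-closed₂ : Closed (ι₂ τ) (join τ A B)
    join-closed₂ i v e with position τ v
    ... | left j  = ⊥-elim (subst T (join₂₁ i j) e)
    ... | right j = j , refl

    join-simple : IsSimple A → IsSimple B → IsSimple (join τ A B)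
    join-simple (symA , loopA) (symB , loopB) = symmetric′ , loopless
      where
      symmetric′ : ∀ i j → Adj (join τ A B) i j → Adj (join τ A B) j i
      symmetric′ i j e with position τ i | position τ j
      ... | left i′  | left j′  = subst T (sym (join₁₁ j′ i′)) (symA _ _ (subst T (join₁₁ i′ j′) e))
      ... | left i′  | right j′ = ⊥-elim (subst T (join₁₂ i′ j′) e)
      ... | right i′ | left j′  = ⊥-elim (subst T (join₂₁ i′ j′) e)
      ... | right i′ | right j′ = subst T (sym (join₂₂ j′ i′)) (symB _ _ (subst T (join₂₂ i′ j′) e))
      loopless : ∀ i → ¬ Adj (join τ A B) i i
      loopless i e with position τ i
      ... | left i′  = loopA i′ (subst T (join₁₁ i′ i′) e)
      ... | right i′ = loopB i′ (subst T (join₂₂ i′ i′) e)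

  -- Closedness of one part empties one mixed block of the adjacency matrix, and symmetry empties
  -- the other.
  join-induced : (τ : Vec Bool n) (A : Graph n) → IsSimple A → Closed (ι₁ τ) A →
                 join τ (induced (ι₁ τ) A) (induced (ι₂ τ) A) ≡ A
  join-induced τ A s closed = adj-ext go
    where
    no-edge : ∀ i j → ¬ Adj A (ι₁ τ i) (ι₂ τ j)
    no-edge i j e with closed i _ e
    ... | k , eq = ι₁≢ι₂ τ k j (sym eq)
    false≡ : ∀ {b} → ¬ T b → false ≡ b
    false≡ {false} ¬t = refl
    false≡ {true}  ¬t = ⊥-elim (¬t tt)
    A₁ = induced (ι₁ τ) A
    A₂ = induced (ι₂ τ) A
    go : ∀ i j → adj (join τ A₁ A₂) i j ≡ adj A i j
    go i j with position τ i | position τ j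
    ... | left i′  | left j′  = trans (join₁₁ τ A₁ A₂ i′ j′) (adj-induced (ι₁ τ) A i′ j′)
    ... | left i′  | right j′ = trans (join₁₂ τ A₁ A₂ i′ j′) (false≡ (no-edge i′ j′))
    ... | right i′ | left j′  = trans (join₂₁ τ A₁ A₂ i′ j′) (false≡ (no-edge j′ i′ ∘ proj₁ s _ _))
    ... | right i′ | right j′ = trans (join₂₂ τ A₁ A₂ i′ j′) (adj-induced (ι₂ τ) A i′ j′)

-- The exponential formula, by splitting off the component of vertex 0.

module ExponentialFormula where

  open import Defs
  open import Algebra.Bundles using (CommutativeSemiring)
  open import Data.Bool.Base using (Bool; true; false)
  import Data.Bool.Properties as Bool
  open import Data.Fin.Base using (zero; suc)
  open import Data.List.Base using (List; cartesianProduct)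
  open import Data.Nat.Base using (ℕ; zero; suc)
  open import Data.Product.Base using (_×_; _,_; proj₁; proj₂)
  import Data.Product.Properties as Product
  open import Data.Vec.Base using (Vec; []; _∷_; lookup; tabulate)
  import Data.Vec.Properties as Vec
  open import Level using (0ℓ)
  open import Relation.Binary.Definitions using (DecidableEquality)
  open import Relation.Binary.PropositionalEquality as ≡ using (_≡_; cong₂; subst)
  open import Relation.Binary.Construct.Closure.ReflexiveTransitive using (ε; _◅_; _◅◅_)
  open import Relation.Nullary using (¬_; Dec; yes; does)
  open import Relation.Nullary.Decidable using (_×-dec_; dec-true; dec-false)
  open Shuffle
  open GraphJoin

  private variable
    n : ℕ

  -- Vertex 0 is left out of the word as it always belongs to its own component; prefixing `true`
  -- gives the splitting. The sum over all words on the other n vertices is what later produces the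
  -- binomial coefficients C(n, m).
  component : Graph (suc n) → Vec Bool n
  component A = tabulate λ j → does (reachable? A zero (suc j))

  module _ (A : Graph (suc n)) (s : IsSimple A) where

    private
      σ = component A
      τ = true ∷ σ

    reachable⇒τ : ∀ j → Reachable A zero j → lookup τ j ≡ true
    reachable⇒τ zero    _ = ≡.refl
    reachable⇒τ (suc j) w = ≡.trans (Vec.lookup∘tabulate _ j) (dec-true (reachable? A zero (suc j)) w)

    τ⇒reachable : ∀ j → lookup τ j ≡ true → Reachable A zero j
    τ⇒reachable zero    _  = ε
    τ⇒reachable (suc j) eq = witness (reachable? A zero (suc j)) (≡.trans (≡.sym (Vec.lookup∘tabulate _ j)) eq)
      where
      witness : ∀ {P : Set} (d : Dec P) → does d ≡ true → P
      witness (yes p) _ = p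

    component-closed : Closed (ι₁ τ) A
    component-closed i v e with position τ v
    ... | left j  = j , ≡.refl
    ... | right j with ≡.trans (≡.sym (lookup-ι₂ τ j))
      (reachable⇒τ _ (τ⇒reachable _ (lookup-ι₁ τ i) ◅◅ (e ◅ ε)))
    ...   | ()

    component-connected : Connected (induced (ι₁ τ) A)
    component-connected i j = reverse (induced (ι₁ τ) A) (induced-simple (ι₁ τ) A s) (from-zero i) ◅◅ from-zero j
      where
      from-zero : ∀ i → Reachable (induced (ι₁ τ) A) zero i
      from-zero i = closed-reachable (ι₁ τ) A (ι₁-injective τ) component-closed (τ⇒reachable _ (lookup-ι₁ τ i))

  component-join : ∀ (σ : Vec Bool n) A B → Connected A → component (join (true ∷ σ) A B) ≡ σ
  component-join σ A B conn = lookup-ext λ j → ≡.trans (Vec.lookup∘tabulate _ j) (go (suc j))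
    where
    τ = true ∷ σ
    G = join τ A B
    go : ∀ j → does (reachable? G zero j) ≡ lookup τ j
    go j with position τ j
    ... | left i  = ≡.trans (dec-true (reachable? G zero (ι₁ τ i))
      (induced-walk (ι₁ τ) G (subst (λ H → Reachable H zero i) (≡.sym (induced-join₁ τ A B)) (conn zero i))))
      (≡.sym (lookup-ι₁ τ i))
    ... | right i = ≡.trans (dec-false (reachable? G zero (ι₂ τ i)) unreachable) (≡.sym (lookup-ι₂ τ i))
      where
      unreachable : ¬ Reachable G zero (ι₂ τ i)
      unreachable w with closed-walk (ι₁ τ) G (join-closed₁ τ A B) {zero} w
      ... | k , eq , _ = ι₁≢ι₂ τ k i (≡.sym eq)

  _≟ᵍ_ : DecidableEquality (Graph n)
  _≟ᵍ_ = Vec.≡-dec (Vec.≡-dec Bool._≟_)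

  module Formula (R : CommutativeSemiring 0ℓ 0ℓ) where

    open CommutativeSemiring R hiding (zero)
    open Enumeration.ListSum R
    open import Relation.Binary.Reasoning.Setoid setoid

    allGraphs : ∀ n → List (Graph n)
    allGraphs n = allVecs (allVecs bools n) n

    Enumerates-words : ∀ n → Enumerates (allVecs bools n)
    Enumerates-words = Enumerates-allVecs Bool._≟_ Enumerates-bools

    Enumerates-graphs : ∀ n → Enumerates (allGraphs n)
    Enumerates-graphs n = Enumerates-allVecs (Vec.≡-dec Bool._≟_) (Enumerates-words n) n

    -- A labelling of a disjoint union is a pair of labellings of the parts; this lets the
    -- exponential formula treat vertex colours, sides and trivial labels alike.
    ∑-merge : ∀ {X : Set} (xs : List X) (τ : Vec Bool n) f →
              ∑ (allVecs xs n) f ≈ ∑ (allVecs xs (ones τ)) λ u → ∑ (allVecs xs (zeros τ)) λ v → f (merge τ u v)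
    ∑-merge xs []          f = sym (+-identityʳ _)
    ∑-merge xs (true ∷ τ)  f = begin
      ∑ (allVecs xs (suc _)) f
        ≈⟨ ∑-product _∷_ xs (allVecs xs _) f ⟩
      ∑ xs (λ x → ∑ (allVecs xs _) λ w → f (x ∷ w))
        ≈⟨ ∑-cong xs (λ x → ∑-merge xs τ (λ w → f (x ∷ w))) ⟩
      ∑ xs (λ x → ∑ (allVecs xs (ones τ)) λ u → ∑ (allVecs xs (zeros τ)) λ v → f (x ∷ merge τ u v))
        ≈⟨ ∑-product _∷_ xs (allVecs xs (ones τ)) _ ⟨
      ∑ (allVecs xs (suc (ones τ))) (λ u → ∑ (allVecs xs (zeros τ)) λ v → f (merge (true ∷ τ) u v)) ∎
    ∑-merge xs (false ∷ τ) f = begin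
      ∑ (allVecs xs (suc _)) f
        ≈⟨ ∑-product _∷_ xs (allVecs xs _) f ⟩
      ∑ xs (λ x → ∑ (allVecs xs _) λ w → f (x ∷ w))
        ≈⟨ ∑-cong xs (λ x → ∑-merge xs τ (λ w → f (x ∷ w))) ⟩
      ∑ xs (λ x → ∑ (allVecs xs (ones τ)) λ u → ∑ (allVecs xs (zeros τ)) λ v → f (x ∷ merge τ u v))
        ≈⟨ ∑-swap xs (allVecs xs (ones τ)) (λ x u → ∑ (allVecs xs (zeros τ)) λ v → f (x ∷ merge τ u v)) ⟩
      ∑ (allVecs xs (ones τ)) (λ u → ∑ xs λ x → ∑ (allVecs xs (zeros τ)) λ v → f (x ∷ merge τ u v))
        ≈⟨ ∑-cong (allVecs xs (ones τ)) (λ u → ∑-product _∷_ xs (allVecs xs (zeros τ)) (λ v → f (merge (false ∷ τ) u v))) ⟨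
      ∑ (allVecs xs (ones τ)) (λ u → ∑ (allVecs xs (suc (zeros τ))) λ v → f (merge (false ∷ τ) u v)) ∎

    -- A graph on suc n vertices is the join of the component of the vertex 0
    -- with a graph on the remaining vertices.
    ∑-component : ∀ n (f : Graph (suc n) → Carrier) →
      ∑ (simpleGraphs (suc n)) f ≈
      ∑ (allVecs bools n) λ σ → ∑ (simpleGraphs (suc (ones σ))) λ A →
        ⟦ connected? A ⟧ * ∑ (simpleGraphs (zeros σ)) λ B → f (join (true ∷ σ) A B)
    ∑-component n f = begin
      ∑ (simpleGraphs (suc n)) f
        ≈⟨ ∑-filter isSimple? (allGraphs (suc n)) f ⟩
      ∑ (allGraphs (suc n)) (λ G → ⟦ isSimple? G ⟧ * f G)
        -- The graphs are sorted by the component of vertex 0: exactly one word is that of G, so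
        -- inserting the sum over all words changes nothing.
        ≈⟨ ∑-cong (allGraphs (suc n)) (λ G →
             ∑-pick words (Enumerates-words n) (component G) (component G ≟ʷ_) (λ _ → ⟦ isSimple? G ⟧ * f G)) ⟨
      ∑ (allGraphs (suc n)) (λ G → ∑ words λ σ → ⟦ component G ≟ʷ σ ⟧ * (⟦ isSimple? G ⟧ * f G))
        ≈⟨ ∑-swap (allGraphs (suc n)) words (λ G σ → ⟦ component G ≟ʷ σ ⟧ * (⟦ isSimple? G ⟧ * f G)) ⟩
      ∑ words (λ σ → ∑ (allGraphs (suc n)) λ G → ⟦ component G ≟ʷ σ ⟧ * (⟦ isSimple? G ⟧ * f G))
        ≈⟨ ∑-cong words fibre ⟩
      ∑ words (λ σ → ∑ (simpleGraphs (suc (ones σ))) λ A →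
        ⟦ connected? A ⟧ * ∑ (simpleGraphs (zeros σ)) λ B → f (join (true ∷ σ) A B)) ∎
      where
      words = allVecs bools n
      _≟ʷ_ = Vec.≡-dec Bool._≟_
      module _ (σ : Vec Bool n) where
        τ = true ∷ σ
        P? = λ G → (component G ≟ʷ σ) ×-dec isSimple? G
        Q? = λ ((A , B) : Graph (ones τ) × Graph (zeros τ)) → (isSimple? A ×-dec connected? A) ×-dec isSimple? B
        to : Graph (suc n) → Graph (ones τ) × Graph (zeros τ)
        to G = induced (ι₁ τ) G , induced (ι₂ τ) G
        from : Graph (ones τ) × Graph (zeros τ) → Graph (suc n)
        from (A , B) = join τ A B
        ⇒ : ∀ G AB → (component G ≡ σ × IsSimple G) × to G ≡ AB →
            ((IsSimple (proj₁ AB) × Connected (proj₁ AB)) × IsSimple (proj₂ AB)) × from AB ≡ G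
        ⇒ G _ ((≡.refl , s) , ≡.refl) =
          ((induced-simple (ι₁ τ) G s , component-connected G s) , induced-simple (ι₂ τ) G s) ,
          join-induced τ G s (component-closed G s)
        ⇐ : ∀ G AB → ((IsSimple (proj₁ AB) × Connected (proj₁ AB)) × IsSimple (proj₂ AB)) × from AB ≡ G →
            (component G ≡ σ × IsSimple G) × to G ≡ AB
        ⇐ _ (A , B) (((sA , conn) , sB) , ≡.refl) =
          (component-join σ A B conn , join-simple τ A B sA sB) ,
          cong₂ _,_ (induced-join₁ τ A B) (induced-join₂ τ A B)
        pairs = cartesianProduct (allGraphs (ones τ)) (allGraphs (zeros τ))
        fibre : ∑ (allGraphs (suc n)) (λ G → ⟦ component G ≟ʷ σ ⟧ * (⟦ isSimple? G ⟧ * f G)) ≈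
          ∑ (simpleGraphs (ones τ)) λ A → ⟦ connected? A ⟧ * ∑ (simpleGraphs (zeros τ)) λ B → f (join τ A B)
        fibre = begin
          ∑ (allGraphs (suc n)) (λ G → ⟦ component G ≟ʷ σ ⟧ * (⟦ isSimple? G ⟧ * f G))
            ≈⟨ ∑-cong (allGraphs (suc n)) (λ G →
                 trans (*-congʳ (⟦⟧-× (component G ≟ʷ σ) (isSimple? G))) (*-assoc _ _ _)) ⟨
          ∑ (allGraphs (suc n)) (λ G → ⟦ P? G ⟧ * f G)
            ≈⟨ ∑-reindex (allGraphs (suc n)) pairs _≟ᵍ_ (Product.≡-dec _≟ᵍ_ _≟ᵍ_) (Enumerates-graphs (suc n))
                 (Enumerates-product (allGraphs (ones τ)) (allGraphs (zeros τ)) _≟ᵍ_ _≟ᵍ_ (Enumerates-graphs (ones τ)) (Enumerates-graphs (zeros τ)))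
                 P? Q? to from ⇒ ⇐ f ⟩
          ∑ pairs (λ AB → ⟦ Q? AB ⟧ * f (from AB))
            ≈⟨ ∑-product _,_ (allGraphs (ones τ)) (allGraphs (zeros τ)) _ ⟩
          ∑ (allGraphs (ones τ)) (λ A → ∑ (allGraphs (zeros τ)) λ B → ⟦ Q? (A , B) ⟧ * f (join τ A B))
            ≈⟨ ∑-cong (allGraphs (ones τ)) (λ A → begin
                 ∑ (allGraphs (zeros τ)) (λ B → ⟦ Q? (A , B) ⟧ * f (join τ A B))
                   ≈⟨ ∑-cong (allGraphs (zeros τ)) (λ B → begin
                        ⟦ Q? (A , B) ⟧ * f (join τ A B)
                          ≈⟨ *-congʳ (trans (⟦⟧-× (isSimple? A ×-dec connected? A) (isSimple? B))
                                            (*-congʳ (⟦⟧-× (isSimple? A) (connected? A)))) ⟩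
                        (⟦ isSimple? A ⟧ * ⟦ connected? A ⟧ * ⟦ isSimple? B ⟧) * f (join τ A B)
                          ≈⟨ trans (*-assoc _ _ _) (*-assoc _ _ _) ⟩
                        ⟦ isSimple? A ⟧ * (⟦ connected? A ⟧ * (⟦ isSimple? B ⟧ * f (join τ A B))) ∎) ⟩
                 ∑ (allGraphs (zeros τ)) (λ B →
                   ⟦ isSimple? A ⟧ * (⟦ connected? A ⟧ * (⟦ isSimple? B ⟧ * f (join τ A B))))
                   ≈⟨ trans (sym (*-∑ (allGraphs (zeros τ)) _ _)) (*-congˡ (trans (sym (*-∑ (allGraphs (zeros τ)) _ _))
                        (*-congˡ (sym (∑-filter isSimple? (allGraphs (zeros τ)) (λ B → f (join τ A B))))))) ⟩
                 ⟦ isSimple? A ⟧ * (⟦ connected? A ⟧ * ∑ (simpleGraphs (zeros τ)) λ B → f (join τ A B)) ∎) ⟩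
          ∑ (allGraphs (ones τ)) (λ A →
            ⟦ isSimple? A ⟧ * (⟦ connected? A ⟧ * ∑ (simpleGraphs (zeros τ)) λ B → f (join τ A B)))
            ≈⟨ ∑-filter isSimple? (allGraphs (ones τ)) _ ⟨
          ∑ (simpleGraphs (ones τ)) (λ A → ⟦ connected? A ⟧ * ∑ (simpleGraphs (zeros τ)) λ B → f (join τ A B)) ∎

    ∑-simple-cong : ∀ n {f g : Graph n → Carrier} → (∀ A → IsSimple A → f A ≈ g A) →
                    ∑ (simpleGraphs n) f ≈ ∑ (simpleGraphs n) g
    ∑-simple-cong n p = trans (∑-filter isSimple? (allGraphs n) _)
      (trans (∑-cong (allGraphs n) λ A → ⟦⟧-guard (isSimple? A) (p A))
             (sym (∑-filter isSimple? (allGraphs n) _)))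

    module _ {X : Set} (xs : List X) (w : ∀ {n} → Graph n → Vec X n → Carrier) where

      Multiplicative : Set
      Multiplicative = ∀ {n} (τ : Vec Bool n) A B → IsSimple A → IsSimple B →
        ∀ u v → w (join τ A B) (merge τ u v) ≈ w A u * w B v

      total connectedTotal : ℕ → Carrier
      total n = ∑ (simpleGraphs n) λ A → ∑ (allVecs xs n) (w A)
      connectedTotal n = ∑ (simpleGraphs n) λ A → ⟦ connected? A ⟧ * ∑ (allVecs xs n) (w A)

      -- The recursion behind D T = D C · T. Distinguishing vertex 0 fixes the component to be split
      -- off, so no division by the number of components occurs.
      total-suc : Multiplicative → ∀ n → total (suc n) ≈
        ∑ (allVecs bools n) λ σ → connectedTotal (suc (ones σ)) * total (zeros σ)
      total-suc mult n = trans (∑-component n _) (∑-cong (allVecs bools n) λ σ → begin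
        ∑ (simpleGraphs (suc (ones σ))) (λ A → ⟦ connected? A ⟧ *
          ∑ (simpleGraphs (zeros σ)) λ B → ∑ (allVecs xs (suc n)) (w (join (true ∷ σ) A B)))
          ≈⟨ ∑-simple-cong (suc (ones σ)) (λ A sA → trans (*-congˡ (inner σ A sA)) (sym (*-assoc _ _ _))) ⟩
        ∑ (simpleGraphs (suc (ones σ))) (λ A → ⟦ connected? A ⟧ * ∑ (allVecs xs (suc (ones σ))) (w A) * total (zeros σ))
          ≈⟨ ∑-* (simpleGraphs (suc (ones σ))) _ _ ⟨
        connectedTotal (suc (ones σ)) * total (zeros σ) ∎)
        where
        inner : ∀ σ A → IsSimple A →
          ∑ (simpleGraphs (zeros σ)) (λ B → ∑ (allVecs xs (suc n)) (w (join (true ∷ σ) A B))) ≈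
          ∑ (allVecs xs (suc (ones σ))) (w A) * total (zeros σ)
        inner σ A sA = begin
          ∑ (simpleGraphs (zeros σ)) (λ B → ∑ (allVecs xs (suc n)) (w (join τ A B)))
            ≈⟨ ∑-simple-cong (zeros σ) (λ B sB → begin
                 ∑ (allVecs xs (suc n)) (w (join τ A B))
                   ≈⟨ ∑-merge xs τ _ ⟩
                 ∑ us (λ u → ∑ vs λ v → w (join τ A B) (merge τ u v))
                   ≈⟨ ∑-cong us (λ u → ∑-cong vs λ v → mult τ A B sA sB u v) ⟩
                 ∑ us (λ u → ∑ vs λ v → w A u * w B v)
                   ≈⟨ ∑-cong us (λ u → *-∑ vs (w A u) (w B)) ⟨
                 ∑ us (λ u → w A u * ∑ vs (w B))
                   ≈⟨ ∑-* us (w A) (∑ vs (w B)) ⟨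
                 ∑ us (w A) * ∑ vs (w B) ∎) ⟩
          ∑ (simpleGraphs (zeros σ)) (λ B → ∑ us (w A) * ∑ vs (w B))
            ≈⟨ *-∑ (simpleGraphs (zeros σ)) _ _ ⟨
          ∑ us (w A) * total (zeros σ) ∎
          where
          τ = true ∷ σ
          us = allVecs xs (ones τ)
          vs = allVecs xs (zeros τ)

-- Dimension bounds over the rationals.

module LinearAlgebra where

  open import Defs
  open import Algebra.Bundles using (CommutativeRing)
  open import Data.Empty using (⊥-elim)
  open import Data.Fin.Base as Fin using (Fin; zero; suc; punchIn; punchOut)
  import Data.Fin.Properties as Fin
  open import Data.List.Base as List using (List; []; _∷_; _++_; length)
  open import Data.List.Membership.Propositional.Properties using (∈-lookup)
  open import Data.List.Relation.Unary.All as All using (All; []; _∷_)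
  open import Data.List.Relation.Unary.AllPairs using (AllPairs; []; _∷_)
  import Data.List.Relation.Unary.All.Properties as All
  open import Data.List.Relation.Unary.Any using (index)
  open import Data.List.Relation.Unary.Any.Properties using (lookup-index)
  open import Data.Nat.Base as ℕ using (ℕ; zero; suc; _<_; z≤n; s≤s)
  import Data.Nat.Properties as ℕ
  open import Data.Product.Base using (∃; _×_; _,_)
  open import Data.Rational.Base
    using (ℚ; 0ℚ; 1ℚ; _+_; _*_; _-_; -_; 1/_; NonZero; ≢-nonZero; _≤_)
  import Data.Rational.Properties as ℚ
  open import Data.Rational.Solver using (module +-*-Solver)
  open import Data.Vec.Functional as Vector using (Vector)
  open import Function.Base using (_∘_)
  open import Relation.Binary.PropositionalEquality
  open import Relation.Nullary using (yes; no)
  open import Relation.Nullary.Decidable using (¬?)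
  open import Algebra.Properties.Semiring.Sum (CommutativeRing.semiring ℚ.+-*-commutativeRing)
    using (∑-distrib-+; ∑-comm; *-distribʳ-sum)

  private variable
    m n : ℕ

  zero-product : ∀ {p q} → p ≢ 0ℚ → p * q ≡ 0ℚ → q ≡ 0ℚ
  zero-product {p} {q} p≢0 pq≡0 = begin
    q                ≡⟨ ℚ.*-identityˡ q ⟨
    1ℚ * q           ≡⟨ cong (_* q) (ℚ.*-inverseˡ p) ⟨
    1/ p * p * q     ≡⟨ ℚ.*-assoc (1/ p) p q ⟩
    1/ p * (p * q)   ≡⟨ cong (1/ p *_) pq≡0 ⟩
    1/ p * 0ℚ        ≡⟨ ℚ.*-zeroʳ (1/ p) ⟩
    0ℚ               ∎
    where
    open ≡-Reasoning
    instance
      nz : NonZero p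
      nz = ≢-nonZero p≢0

  ∙-cong : {u v : Vector ℚ n} → (∀ i → u i ≡ v i) → ∀ x → u ∙ x ≡ v ∙ x
  ∙-cong eq x = sum-cong-≗ (λ i → cong (_* x i) (eq i))

  ∙-comm : (u v : Vector ℚ n) → u ∙ v ≡ v ∙ u
  ∙-comm u v = sum-cong-≗ (λ i → ℚ.*-comm (u i) (v i))

  ∙-+ˡ : (u v x : Vector ℚ n) → (λ i → u i + v i) ∙ x ≡ u ∙ x + v ∙ x
  ∙-+ˡ u v x = trans (sum-cong-≗ (λ i → ℚ.*-distribʳ-+ (x i) (u i) (v i)))
    (∑-distrib-+ (λ i → u i * x i) (λ i → v i * x i))

  coordinate-∙ : (i : Fin n) (x : Vector ℚ n) → coordinate i ∙ x ≡ x i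
  coordinate-∙ {suc n} zero    x = trans (cong₂ _+_ (ℚ.*-identityˡ (x zero)) (∙-zeroˡ (Vector.tail x)))
    (ℚ.+-identityʳ (x zero))
  coordinate-∙ {suc n} (suc i) x = trans (cong₂ _+_ (ℚ.*-zeroˡ (x zero)) (coordinate-∙ i (Vector.tail x)))
    (ℚ.+-identityˡ (x (suc i)))

  lincomb-∙ : (vs : List (Vector ℚ n)) (c : Vector ℚ (length vs)) (x : Vector ℚ n) →
              lincomb vs c ∙ x ≡ sum (λ j → c j * (List.lookup vs j ∙ x))
  lincomb-∙ {n} vs c x = begin
    sum (λ i → sum (λ j → v j i * c j) * x i)
      ≡⟨ sum-cong-≗ (λ i → *-distribʳ-sum (x i) (λ j → v j i * c j)) ⟩
    sum (λ i → sum (λ j → v j i * c j * x i))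
      ≡⟨ ∑-comm (λ i j → v j i * c j * x i) ⟩
    sum (λ j → sum (λ i → v j i * c j * x i))
      ≡⟨ sum-cong-≗ (λ j → sum-cong-≗ (λ i →
           solve 3 (λ v c x → v :* c :* x := c :* (v :* x)) refl (v j i) (c j) (x i))) ⟩
    sum (λ j → sum (λ i → c j * (v j i * x i)))
      ≡⟨ sum-cong-≗ (λ j → *-distribˡ-sum (c j) (λ i → v j i * x i)) ⟨
    sum (λ j → c j * (v j ∙ x)) ∎
    where
    open ≡-Reasoning
    open +-*-Solver
    v = List.lookup vs

  span-perp : ∀ (vs : List (Vector ℚ n)) {w} → Span vs w → ∀ x → All (λ v → v ∙ x ≡ 0ℚ) vs → w ∙ x ≡ 0ℚ
  span-perp vs {w} (c , eq) x perp = begin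
    w ∙ x                                         ≡⟨ ∙-cong eq x ⟨
    lincomb vs c ∙ x                              ≡⟨ lincomb-∙ vs c x ⟩
    sum (λ j → c j * (List.lookup vs j ∙ x))      ≡⟨ sum-cong-≗ (λ j →
      trans (cong (c j *_) (All.lookup perp (∈-lookup j))) (ℚ.*-zeroʳ (c j))) ⟩
    sum {length vs} (λ _ → 0ℚ)                    ≡⟨ sum-replicate-zero (length vs) ⟩
    0ℚ                                            ∎
    where open ≡-Reasoning

  -- Fewer equations than unknowns. Without a pivot in the first column the first unit vector is a
  -- solution; with a pivot in row l, eliminating with that row removes one equation and one
  -- unknown.
  kernel : (A : Fin m → Vector ℚ n) → m < n → ∃ λ x → (∃ λ j → x j ≢ 0ℚ) × (∀ i → A i ∙ x ≡ 0ℚ)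
  kernel {zero}  {suc n} A lt = (λ _ → 1ℚ) , (zero , λ ()) , λ ()
  kernel {suc m} {suc n} A (s≤s lt) with Fin.any? (λ i → ¬? (A i zero ℚ.≟ 0ℚ))
  ... | no ¬pivot = (1ℚ Vector.∷ λ _ → 0ℚ) , (zero , λ ()) , λ i → begin
    A i zero * 1ℚ + Vector.tail (A i) ∙ (λ _ → 0ℚ)
      ≡⟨ cong₂ _+_ (cong (_* 1ℚ) (col≡0 i)) (trans (∙-comm (Vector.tail (A i)) (λ _ → 0ℚ)) (∙-zeroˡ (Vector.tail (A i)))) ⟩
    0ℚ * 1ℚ + 0ℚ ≡⟨⟩
    0ℚ ∎
    where
    open ≡-Reasoning
    col≡0 : ∀ i → A i zero ≡ 0ℚ
    col≡0 i with A i zero ℚ.≟ 0ℚ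
    ... | yes eq = eq
    ... | no neq = ⊥-elim (¬pivot (i , neq))
  ... | yes (l , Al≢0) with kernel A′ lt
    where
    instance
      nz : NonZero (A l zero)
      nz = ≢-nonZero Al≢0
    A′ : Fin m → Vector ℚ n
    A′ k j = A (punchIn l k) (suc j) - (A (punchIn l k) zero * 1/ A l zero) * A l (suc j)
  ...   | x′ , (j , xj≢0) , eq = (x₀ Vector.∷ x′) , (suc j , xj≢0) , row
    where
    open ≡-Reasoning
    open +-*-Solver
    instance
      nz : NonZero (A l zero)
      nz = ≢-nonZero Al≢0
    q = 1/ A l zero
    S : Fin (suc m) → ℚ
    S i = Vector.tail (A i) ∙ x′
    -- The value that satisfies the pivot row; the remaining rows then hold by the eliminated
    -- system.
    x₀ = - (q * S l)
    row : ∀ i → A i zero * x₀ + S i ≡ 0ℚ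
    row i with l Fin.≟ i
    ... | yes refl = begin
      A l zero * x₀ + S l
        ≡⟨ solve 3 (λ a q s → a :* (:- (q :* s)) :+ s := (con 1ℚ :- q :* a) :* s) refl (A l zero) q (S l) ⟩
      (1ℚ - q * A l zero) * S l
        ≡⟨ cong (λ t → (1ℚ - t) * S l) (ℚ.*-inverseˡ (A l zero)) ⟩
      0ℚ * S l
        ≡⟨ ℚ.*-zeroˡ (S l) ⟩
      0ℚ ∎
    ... | no l≢i = subst (λ i → A i zero * x₀ + S i ≡ 0ℚ) (Fin.punchIn-punchOut l≢i) (begin
      A i′ zero * x₀ + S i′
        ≡⟨ solve 4 (λ a q s t → a :* (:- (q :* s)) :+ t := t :- (a :* q) :* s) refl (A i′ zero) q (S l) (S i′) ⟩
      S i′ - (A i′ zero * q) * S l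
        ≡⟨ ∙-elim (A i′ zero * q) (Vector.tail (A i′)) (Vector.tail (A l)) x′ ⟨
      (λ j → A i′ (suc j) - (A i′ zero * q) * A l (suc j)) ∙ x′
        ≡⟨ eq (punchOut l≢i) ⟩
      0ℚ ∎)
      where i′ = punchIn l (punchOut l≢i)

  independent-length : (vs : List (Vector ℚ n)) → Independent vs → length vs ℕ.≤ n
  independent-length {n} vs ind = ℕ.≮⇒≥ λ lt →
    let c , (j , cj≢0) , eq = kernel (λ i j → List.lookup vs j i) lt in cj≢0 (ind c eq j)

  -- The counterpart of `independent-length`: fewer than n vectors would have a common nonzero
  -- orthogonal vector, by the same `kernel` with the vectors as rows instead of columns.
  total-length : (vs : List (Vector ℚ n)) → (∀ x → All (λ v → v ∙ x ≡ 0ℚ) vs → ∀ i → x i ≡ 0ℚ) →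
                 n ℕ.≤ length vs
  total-length {n} vs total = ℕ.≮⇒≥ λ lt →
    let x , (i , xi≢0) , eq = kernel (List.lookup vs) lt in
    xi≢0 (total x (All.tabulate (λ v∈ → subst (λ v → v ∙ x ≡ 0ℚ) (sym (lookup-index v∈)) (eq (index v∈)))) i)

  -- A vector s orthogonal to all those after it cannot lie in their span, since then s would be
  -- orthogonal to itself.
  independent-orthogonal : (ss bs : List (Vector ℚ n)) → AllPairs (λ s t → s ∙ t ≡ 0ℚ) ss →
    All (λ s → s ∙ s ≢ 0ℚ) ss → All (λ s → All (λ b → b ∙ s ≡ 0ℚ) bs) ss →
    Independent bs → Independent (ss ++ bs)
  independent-orthogonal []       bs _          _          _          ind = ind
  independent-orthogonal (s ∷ ss) bs (s⊥ ∷ ap) (ss≢0 ∷ nz) (⊥b ∷ ps) ind =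
    extend s (ss ++ bs) (λ s∈ → ss≢0 (span-perp (ss ++ bs) s∈ s
        (All.++⁺ (All.map (λ {t} eq → trans (∙-comm t s) eq) s⊥) ⊥b)))
      (independent-orthogonal ss bs ap nz ps ind)

  sum-nonNegative : (f : Vector ℚ n) → (∀ i → 0ℚ ≤ f i) → 0ℚ ≤ sum f
  sum-nonNegative {zero}  f nn = ℚ.≤-refl
  sum-nonNegative {suc n} f nn = ℚ.+-mono-≤ (nn zero) (sum-nonNegative (f ∘ suc) (nn ∘ suc))

  sum-nonNegative-zero : (f : Vector ℚ n) → (∀ i → 0ℚ ≤ f i) → sum f ≡ 0ℚ → ∀ i → f i ≡ 0ℚ
  sum-nonNegative-zero {suc n} f nn eq = go
    where
    rest = sum (f ∘ suc)
    f₀≤0 : f zero ≤ 0ℚ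
    f₀≤0 = ℚ.≤-trans (ℚ.≤-reflexive (sym (ℚ.+-identityʳ (f zero))))
      (ℚ.≤-trans (ℚ.+-monoʳ-≤ (f zero) (sum-nonNegative (f ∘ suc) (nn ∘ suc))) (ℚ.≤-reflexive eq))
    f₀≡0 : f zero ≡ 0ℚ
    f₀≡0 = ℚ.≤-antisym f₀≤0 (nn zero)
    go : ∀ i → f i ≡ 0ℚ
    go zero    = f₀≡0
    go (suc i) = sum-nonNegative-zero (f ∘ suc) (nn ∘ suc)
      (trans (sym (ℚ.+-identityˡ rest)) (trans (cong (_+ rest) (sym f₀≡0)) eq)) i

  -- Rank is at most cardinality, which later bounds the number of edges of a connected graph from
  -- below.
  dimSpan≤length : (vs : List (Vector ℚ n)) → dimSpan vs ℕ.≤ length vs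
  dimSpan≤length []       = z≤n
  dimSpan≤length (v ∷ vs) with basisOfSpan vs | dimSpan≤length vs
  ... | record { basis = bs } | le with span? bs v
  ...   | yes _ = ℕ.m≤n⇒m≤1+n le
  ...   | no _  = s≤s le

-- The rank of the arrangement of a coloured graph.

module Arrangements where

  open import Defs
  open import Data.Bool.Base using (Bool; true; false; if_then_else_)
  import Data.Bool.Properties as Bool
  open import Data.Empty using (⊥; ⊥-elim)
  open import Data.Fin.Base as Fin using (Fin; zero; suc)
  import Data.Fin.Properties as Fin
  open import Data.Fin.Subset using (Subset; _∈_)
  open import Data.List.Base as List using (List; []; _∷_; _++_; length; filter; allFin; cartesianProduct)
  import Data.List.Properties as List
  import Data.List.Membership.Propositional as List using (_∈_)
  open import Data.List.Membership.Propositional.Properties using (∈-allFin; ∈-filter⁺; ∈-filter⁻; ∈-cartesianProduct⁺; ∈-cartesianProductWith⁺)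
  open import Data.List.Relation.Unary.All as All using (All; []; _∷_)
  import Data.List.Relation.Unary.All.Properties as All
  open import Data.List.Relation.Unary.AllPairs using (AllPairs; []; _∷_)
  open import Data.List.Relation.Unary.Any using (here; there)
  open import Data.List.Relation.Unary.Unique.Propositional using (Unique)
  import Data.List.Relation.Unary.Unique.Propositional.Properties as Unique
  open import Data.Nat.Base as ℕ using (ℕ; zero; suc)
  import Data.Nat.Properties as ℕ
  open import Data.Product.Base using (_×_; _,_; proj₁; proj₂)
  open import Data.Rational.Base using (ℚ; 0ℚ; 1ℚ; _+_; _*_; _-_; -_; _≤_)
  import Data.Rational.Properties as ℚ
  open import Data.Rational.Solver using (module +-*-Solver)
  open import Data.Vec.Base as Vec using (Vec; []; _∷_; lookup; tabulate)
  import Data.Vec.Properties as Vec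
  open import Data.Vec.Functional as Vector using (Vector)
  open import Data.Sum.Base using (_⊎_; inj₁; inj₂)
  open import Function.Base using (_∘_)
  open import Relation.Binary.Construct.Closure.ReflexiveTransitive using (ε; _◅_; _◅◅_)
  open import Relation.Binary.Definitions using (tri<; tri≈; tri>)
  open import Relation.Binary.PropositionalEquality
  open import Relation.Nullary using (¬_; Dec; yes; no; does)
  open import Relation.Nullary.Decidable using (dec-true; dec-false; _×-dec_)
  open LinearAlgebra
  open GraphJoin
  open Shuffle using (lookup-ext)
  open ColouredGraph
  open Hyperplane

  private variable
    n : ℕ

  All-arrangement⁺ : ∀ {P : Hyperplane n → Set} (G : ColouredGraph n) →
    (∀ i j → i Fin.< j → Adj (graph G) i j → P (edgeHyperplane (i , j))) →
    (∀ i → All P (vertexHyperplane G i)) → All P (arrangement G)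
  All-arrangement⁺ {n} {P} G e v = All.++⁺
    (All.map⁺ (All.tabulate λ {ij} ij∈ → edge ij (proj₂ (∈-filter⁻ edge? {xs = pairs} ij∈))))
    (All.concat⁺ (All.map⁺ (All.tabulate {xs = allFin n} λ {i} _ → v i)))
    where
    pairs = cartesianProduct (allFin n) (allFin n)
    edge? : ∀ ij → Dec (proj₁ ij Fin.< proj₂ ij × Adj (graph G) (proj₁ ij) (proj₂ ij))
    edge? (i , j) = (i Fin.<? j) ×-dec adj? (graph G) i j
    edge : ∀ ij → proj₁ ij Fin.< proj₂ ij × Adj (graph G) (proj₁ ij) (proj₂ ij) → P (edgeHyperplane ij)
    edge (i , j) (lt , a) = e i j lt a

  All-arrangement⁻ : ∀ {P : Hyperplane n → Set} (G : ColouredGraph n) → All P (arrangement G) →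
    (∀ i j → i Fin.< j → Adj (graph G) i j → P (edgeHyperplane (i , j))) ×
    (∀ i → All P (vertexHyperplane G i))
  All-arrangement⁻ {n} {P} G ps =
    (λ i j lt a → All.lookup (All.map⁻ (All.++⁻ˡ (List.map edgeHyperplane (edges (graph G))) ps))
      (∈-filter⁺ edge? (∈-cartesianProduct⁺ (∈-allFin i) (∈-allFin j)) (lt , a))) ,
    (λ i → All.lookup (All.map⁻ (All.concat⁻ (All.++⁻ʳ (List.map edgeHyperplane (edges (graph G))) ps))) (∈-allFin i))
    where
    edge? : ∀ ij → Dec (proj₁ ij Fin.< proj₂ ij × Adj (graph G) (proj₁ ij) (proj₂ ij))
    edge? (i , j) = (i Fin.<? j) ×-dec adj? (graph G) i j

  edge-∙ : ∀ (i j : Fin n) x → normal (edgeHyperplane (i , j)) ∙ x ≡ x i + x j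
  edge-∙ i j x = trans (∙-+ˡ (coordinate i) (coordinate j) x) (cong₂ _+_ (coordinate-∙ i x) (coordinate-∙ j x))

  adjacent-all : ∀ (A : Graph n) → IsSimple A → ∀ (x : Vector ℚ n) q →
    (∀ i j → i Fin.< j → Adj A i j → x i + x j ≡ q) → ∀ i j → Adj A i j → x i + x j ≡ q
  adjacent-all A (sym′ , loop) x q eq i j a with Fin.<-cmp i j
  ... | tri< lt _ _   = eq i j lt a
  ... | tri≈ _ refl _ = ⊥-elim (loop i a)
  ... | tri> _ _ gt   = trans (ℚ.+-comm (x i) (x j)) (eq j i gt (sym′ i j a))

  -- The orthogonal complement of the normals in graph terms: x changes sign along every edge and
  -- vanishes at coloured vertices.
  record Null (G : ColouredGraph n) (x : Vector ℚ n) : Set where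
    field
      edge   : ∀ i j → Adj (graph G) i j → x i + x j ≡ 0ℚ
      vertex : ∀ i → ¬ NonColoured G i → x i ≡ 0ℚ

  Normal : ColouredGraph n → Vector ℚ n → Set
  Normal G x = All (λ v → v ∙ x ≡ 0ℚ) (List.map normal (arrangement G))

  null⇒normal : ∀ (G : ColouredGraph n) x → Null G x → Normal G x
  null⇒normal G x null = All.map⁺ (All-arrangement⁺ {P = λ H → normal H ∙ x ≡ 0ℚ} G
    (λ i j _ a → trans (edge-∙ i j x) (Null.edge null i j a)) v)
    where
    v : ∀ i → All (λ H → normal H ∙ x ≡ 0ℚ) (vertexHyperplane G i)
    v i with lookup (colour G) i | Null.vertex null i
    ... | 𝟎 | x≡0 = trans (coordinate-∙ i x) (x≡0 λ ()) ∷ []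
    ... | 𝟏 | x≡0 = trans (coordinate-∙ i x) (x≡0 λ ()) ∷ []
    ... | ∗ | _   = []

  normal⇒null : ∀ (G : ColouredGraph n) x → IsSimple (graph G) → Normal G x → Null G x
  normal⇒null G x s nl = record
    { edge   = adjacent-all (graph G) s x 0ℚ λ i j lt a →
        trans (sym (edge-∙ i j x)) (proj₁ all i j lt a)
    ; vertex = λ i → v i (proj₂ all i)
    }
    where
    all = All-arrangement⁻ {P = λ H → normal H ∙ x ≡ 0ℚ} G (All.map⁻ nl)
    v : ∀ i → All (λ H → normal H ∙ x ≡ 0ℚ) (vertexHyperplane G i) → ¬ NonColoured G i → x i ≡ 0ℚ
    v i ps coloured with lookup (colour G) i
    v i (p ∷ []) coloured | 𝟎 = trans (sym (coordinate-∙ i x)) p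
    v i (p ∷ []) coloured | 𝟏 = trans (sym (coordinate-∙ i x)) p
    v i ps       coloured | ∗ = ⊥-elim (coloured refl)

  sign : Bool → ℚ
  sign true  = 1ℚ
  sign false = - 1ℚ

  sign² : ∀ b → sign b * sign b ≡ 1ℚ
  sign² true  = refl
  sign² false = refl

  sign-≢ : ∀ {b c} → b ≢ c → sign b + sign c ≡ 0ℚ
  sign-≢ {true}  {true}  b≢c = ⊥-elim (b≢c refl)
  sign-≢ {true}  {false} b≢c = refl
  sign-≢ {false} {true}  b≢c = refl
  sign-≢ {false} {false} b≢c = ⊥-elim (b≢c refl)

  -- Total in S, with value 0 where S is not bipartite, so that it can be mapped over the filtered
  -- list of components without carrying proofs.
  signVector : Graph n → Subset n → Vector ℚ n
  signVector A S i with bipartiteOn? A S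
  ... | yes (side , _) = if lookup S i then sign (lookup side i) else 0ℚ
  ... | no _           = 0ℚ

  -- Only what does not depend on which of the two bipartitions the decision procedure returned: the
  -- sign vector is determined up to a global sign.
  record IsSignVector (A : Graph n) (S : Subset n) (s : Vector ℚ n) : Set where
    field
      outside : ∀ i → lookup S i ≡ false → s i ≡ 0ℚ
      inside  : ∀ i → lookup S i ≡ true → s i * s i ≡ 1ℚ
      edge    : ∀ i j → lookup S i ≡ true → lookup S j ≡ true → Adj A i j → s i + s j ≡ 0ℚ

    square : ∀ i → s i * s i ≡ (if lookup S i then 1ℚ else 0ℚ)
    square i with lookup S i in eq
    ... | true  = inside i eq
    ... | false = trans (cong (λ t → t * t) (outside i eq)) refl

  signVector-isSignVector : ∀ (A : Graph n) S → BipartiteOn A S → IsSignVector A S (signVector A S)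
  signVector-isSignVector A S bip with bipartiteOn? A S
  ... | no ¬bip = ⊥-elim (¬bip bip)
  ... | yes (side , proper) = record
    { outside = λ i eq → cong (λ b → if b then sign (lookup side i) else 0ℚ) eq
    ; inside  = λ i eq → trans (cong (λ b → (if b then sign (lookup side i) else 0ℚ) * (if b then sign (lookup side i) else 0ℚ)) eq)
                               (sign² (lookup side i))
    ; edge    = λ i j eqᵢ eqⱼ a → trans
        (cong₂ (λ b c → (if b then sign (lookup side i) else 0ℚ) + (if c then sign (lookup side j) else 0ℚ)) eqᵢ eqⱼ)
        (sign-≢ (proper i (Vec.lookup⇒[]= i S eqᵢ) j (Vec.lookup⇒[]= j S eqⱼ) a))
    }

  module _ (A : Graph n) {S : Subset n} (comp : IsComponent A S) where

    component⇒reachable : ∀ {i j} → lookup S i ≡ true → lookup S j ≡ true → Reachable A i j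
    component⇒reachable {i} {j} eqᵢ eqⱼ =
      proj₁ (proj₂ comp i (Vec.lookup⇒[]= i S eqᵢ) j) (Vec.lookup⇒[]= j S eqⱼ)

    reachable⇒component : ∀ {i j} → lookup S i ≡ true → Reachable A i j → lookup S j ≡ true
    reachable⇒component {i} {j} eqᵢ w = Vec.[]=⇒lookup (proj₂ (proj₂ comp i (Vec.lookup⇒[]= i S eqᵢ) j) w)

  bool-ext : ∀ {b c} → (b ≡ true → c ≡ true) → (c ≡ true → b ≡ true) → b ≡ c
  bool-ext {true}  {true}  f g = refl
  bool-ext {true}  {false} f g = sym (f refl)
  bool-ext {false} {true}  f g = g refl
  bool-ext {false} {false} f g = refl

  components-disjoint : ∀ (A : Graph n) {S S′} → IsComponent A S → IsComponent A S′ →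
    ∀ {i} → lookup S i ≡ true → lookup S′ i ≡ true → S ≡ S′
  components-disjoint A c c′ i∈S i∈S′ = lookup-ext λ j → bool-ext
    (λ j∈S  → reachable⇒component A c′ i∈S′ (component⇒reachable A c i∈S j∈S))
    (λ j∈S′ → reachable⇒component A c i∈S (component⇒reachable A c′ i∈S′ j∈S′))

  ∈-subsets : (S : Subset n) → S List.∈ allVecs (true ∷ false ∷ []) n
  ∈-subsets []          = here refl
  ∈-subsets (true ∷ S)  = ∈-cartesianProductWith⁺ _∷_ {xs = true ∷ false ∷ []} (here refl) (∈-subsets S)
  ∈-subsets (false ∷ S) = ∈-cartesianProductWith⁺ _∷_ {xs = true ∷ false ∷ []} (there (here refl)) (∈-subsets S)

  subsets-unique : ∀ n → Unique (allVecs (true ∷ false ∷ []) n)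
  subsets-unique zero    = [] ∷ []
  subsets-unique (suc n) = Unique.cartesianProductWith⁺ _∷_ (λ { refl → refl , refl })
    (((λ ()) ∷ []) ∷ [] ∷ []) (subsets-unique n)

  module _ (G : ColouredGraph n) (simple : IsSimple (graph G)) where

    private
      A = graph G
      comps = filter (bipartiteComponent? G) (allVecs (true ∷ false ∷ []) n)
      sv = signVector A

      signs : ∀ {S} → BipartiteComponent G S → IsSignVector A S (sv S)
      signs {S} (_ , bip , _) = signVector-isSignVector A S bip

      sign-null : ∀ {S} → BipartiteComponent G S → Null G (sv S)
      sign-null {S} bc@(comp , bip , non) = record { edge = e ; vertex = v }
        where
        open IsSignVector (signs bc)
        e : ∀ i j → Adj A i j → sv S i + sv S j ≡ 0ℚ
        e i j a with lookup S i in eqᵢ | lookup S j in eqⱼ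
        ... | true  | true  = edge i j eqᵢ eqⱼ a
        ... | false | false = cong₂ _+_ (outside i eqᵢ) (outside j eqⱼ)
        ... | true  | false with trans (sym eqⱼ) (reachable⇒component A comp eqᵢ (a ◅ ε))
        ...   | ()
        e i j a | false | true with trans (sym eqᵢ) (reachable⇒component A comp eqⱼ (proj₁ simple i j a ◅ ε))
        ... | ()
        v : ∀ i → ¬ NonColoured G i → sv S i ≡ 0ℚ
        v i col with lookup S i in eq
        ... | false = outside i eq
        ... | true  = ⊥-elim (col (non i (Vec.lookup⇒[]= i S eq)))

      sign-nonzero : ∀ {S} → BipartiteComponent G S → sv S ∙ sv S ≢ 0ℚ
      sign-nonzero {S} bc@(((i , i∈) , _) , _) eq
        with trans (sym (inside i (Vec.[]=⇒lookup i∈)))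
                   (sum-nonNegative-zero (λ i → sv S i * sv S i) nonneg eq i)
        where
        open IsSignVector (signs bc)
        nonneg : ∀ i → 0ℚ ≤ sv S i * sv S i
        nonneg i rewrite square i with lookup S i
        ... | true  = ℚ.<⇒≤ (ℚ.positive⁻¹ 1ℚ)
        ... | false = ℚ.≤-refl
      ... | ()

      -- Distinct components are disjoint, so in every coordinate one of the two factors is 0.
      sign-orthogonal : ∀ {S S′} → BipartiteComponent G S → BipartiteComponent G S′ → S ≢ S′ → sv S ∙ sv S′ ≡ 0ℚ
      sign-orthogonal {S} {S′} bc bc′ S≢S′ = trans (sum-cong-≗ zero′) (sum-replicate-zero n)
        where
        zero′ : ∀ i → sv S i * sv S′ i ≡ 0ℚ
        zero′ i with lookup S i in eq | lookup S′ i in eq′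
        ... | true  | true  = ⊥-elim (S≢S′ (components-disjoint A (proj₁ bc) (proj₁ bc′) eq eq′))
        ... | false | _     = trans (cong (_* sv S′ i) (IsSignVector.outside (signs bc) i eq)) (ℚ.*-zeroˡ (sv S′ i))
        ... | true  | false = trans (cong (sv S i *_) (IsSignVector.outside (signs bc′) i eq′)) (ℚ.*-zeroʳ (sv S i))

      orthogonal : ∀ {xs} → Unique xs → All (BipartiteComponent G) xs → AllPairs (λ s t → s ∙ t ≡ 0ℚ) (List.map sv xs)
      orthogonal []       []         = []
      orthogonal (u ∷ us) (bc ∷ bcs) =
        All.map⁺ (All.zipWith (λ (S≢ , bc′) → sign-orthogonal bc bc′ S≢) (u , bcs)) ∷ orthogonal us bcs

      module _ (x : Vector ℚ n) (null : Null G x) (⊥comps : All (λ v → v ∙ x ≡ 0ℚ) (List.map sv comps))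
               (i : Fin n) (xi≢0 : x i ≢ 0ℚ) where

        -- x agrees with a multiple of the sign vector of C, to which it is
        -- orthogonal by assumption.
        C : Subset n
        C = tabulate (λ j → does (reachable? A i j))

        C⇒reachable : ∀ j → lookup C j ≡ true → Reachable A i j
        C⇒reachable j eq = witness (reachable? A i j) (trans (sym (Vec.lookup∘tabulate _ j)) eq)
          where
          witness : ∀ {P : Set} (d : Dec P) → does d ≡ true → P
          witness (yes p) _ = p

        reachable⇒C : ∀ j → Reachable A i j → lookup C j ≡ true
        reachable⇒C j w = trans (Vec.lookup∘tabulate _ j) (dec-true (reachable? A i j) w)

        neg-of-edge : ∀ {j k} → Adj A j k → x k ≡ - x j
        neg-of-edge {j} {k} a = trans (solve 2 (λ s t → t := (s :+ t) :- s) refl (x j) (x k))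
          (trans (cong (_- x j) (Null.edge null j k a)) (ℚ.+-identityˡ (- x j)))
          where open +-*-Solver

        nonzero-walk : ∀ {j k} → Reachable A j k → x j ≢ 0ℚ → x k ≢ 0ℚ
        nonzero-walk ε       xj≢0 = xj≢0
        nonzero-walk {j} (_◅_ {j = l} a w) xj≢0 = nonzero-walk w λ xl≡0 → xj≢0
          (trans (solve 1 (λ s → s := :- (:- s)) refl (x j)) (trans (cong -_ (trans (sym (neg-of-edge a)) xl≡0)) refl))
          where open +-*-Solver

        same-or-opposite : ∀ {j k} → Reachable A j k → x k ≡ x j ⊎ x k ≡ - x j
        same-or-opposite ε = inj₁ refl
        same-or-opposite {j} (a ◅ w) with same-or-opposite w
        ... | inj₁ eq = inj₂ (trans eq (neg-of-edge a))
        ... | inj₂ eq = inj₁ (trans eq (trans (cong -_ (neg-of-edge a)) (solve 1 (λ s → :- (:- s) := s) refl (x j))))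
          where open +-*-Solver

        self-opposite : ∀ {q} → q ≡ - q → q ≡ 0ℚ
        self-opposite {q} eq = zero-product {1ℚ + 1ℚ} (λ ())
          (trans (solve 1 (λ q → (con 1ℚ :+ con 1ℚ) :* q := q :- (:- q)) refl q)
            (trans (cong (_- (- q)) eq) (ℚ.+-inverseʳ (- q))))
          where open +-*-Solver

        C-component : IsComponent A C
        C-component = (i , Vec.lookup⇒[]= i C (reachable⇒C i ε)) , λ j j∈ k →
          let w = C⇒reachable j (Vec.[]=⇒lookup j∈) in
          (λ k∈ → reverse A simple w ◅◅ C⇒reachable k (Vec.[]=⇒lookup k∈)) ,
          (λ w′ → Vec.lookup⇒[]= k C (reachable⇒C k (w ◅◅ w′)))

        same : ℚ → Bool
        same q = does (q ℚ.≟ x i)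

        same-true : ∀ {q} → q ≡ x i → same q ≡ true
        same-true {q} eq = dec-true (q ℚ.≟ x i) eq

        same-false : ∀ {q} → q ≡ - x i → same q ≡ false
        same-false {q} eq = dec-false (q ℚ.≟ x i) λ eq′ → xi≢0 (self-opposite (trans (sym eq′) eq))

        true≢false : true ≢ false
        true≢false ()

        -- The sides are given by x j = x i and x j = - x i. An edge within a side would make x j
        -- its own negative, hence 0, whereas x stays nonzero along walks from i.
        C-bipartite : BipartiteOn A C
        C-bipartite = tabulate (same ∘ x) , λ j j∈ k k∈ a eq →
          let w = C⇒reachable j (Vec.[]=⇒lookup j∈) in
          proper w a (trans (sym (Vec.lookup∘tabulate (same ∘ x) j)) (trans eq (Vec.lookup∘tabulate (same ∘ x) k)))
            (same-or-opposite w) (same-or-opposite (w ◅◅ (a ◅ ε)))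
          where
          proper : ∀ {j k} → Reachable A i j → Adj A j k → same (x j) ≡ same (x k) →
                   x j ≡ x i ⊎ x j ≡ - x i → x k ≡ x i ⊎ x k ≡ - x i → ⊥
          proper w a eq (inj₁ xj) (inj₁ xk) = nonzero-walk w xi≢0 (self-opposite (trans xj (trans (sym xk) (neg-of-edge a))))
          proper w a eq (inj₂ xj) (inj₂ xk) = nonzero-walk w xi≢0 (self-opposite (trans xj (trans (sym xk) (neg-of-edge a))))
          proper w a eq (inj₁ xj) (inj₂ xk) = true≢false (trans (sym (same-true xj)) (trans eq (same-false xk)))
          proper w a eq (inj₂ xj) (inj₁ xk) = true≢false (trans (sym (same-true xk)) (trans (sym eq) (same-false xj)))

        C-nonColoured : ∀ j → j ∈ C → NonColoured G j
        C-nonColoured j j∈ with nonColoured? G j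
        ... | yes p = p
        ... | no ¬p = ⊥-elim (nonzero-walk (C⇒reachable j (Vec.[]=⇒lookup j∈)) xi≢0 (Null.vertex null j ¬p))

        bc : BipartiteComponent G C
        bc = C-component , C-bipartite , C-nonColoured

        -- Along an edge x and the sign vector s both change sign, so their product is a constant c
        -- on the component. Hence s ∙ x = c (s ∙ s); orthogonality forces c = 0, but c times s i is
        -- x i.
        contradiction : ⊥
        contradiction = xi≢0 (begin
          x i                       ≡⟨ ℚ.*-identityʳ (x i) ⟨
          x i * 1ℚ                  ≡⟨ cong (x i *_) (inside i i∈C) ⟨
          x i * (s i * s i)         ≡⟨ solve 2 (λ x s → x :* (s :* s) := x :* s :* s) refl (x i) (s i) ⟩
          c * s i                   ≡⟨ cong (_* s i) c≡0 ⟩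
          0ℚ * s i                  ≡⟨ ℚ.*-zeroˡ (s i) ⟩
          0ℚ                        ∎)
          where
          open ≡-Reasoning
          open +-*-Solver
          open IsSignVector (signs bc)
          s = sv C
          c = x i * s i
          i∈C = reachable⇒C i ε
          constant : ∀ {j k} → Reachable A i j → Reachable A j k → x k * s k ≡ x j * s j
          constant r ε = refl
          constant {j} r (_◅_ {j = l} a w) = trans (constant (r ◅◅ (a ◅ ε)) w) (begin
            x l * s l          ≡⟨ cong₂ _*_ (neg-of-edge a) sl ⟩
            - x j * - s j      ≡⟨ solve 2 (λ x s → (:- x) :* (:- s) := x :* s) refl (x j) (s j) ⟩
            x j * s j          ∎)
            where
            sl : s l ≡ - s j
            sl = trans (solve 2 (λ s t → t := (s :+ t) :- s) refl (s j) (s l))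
              (trans (cong (_- s j) (edge j l (reachable⇒C j r) (reachable⇒C l (r ◅◅ (a ◅ ε))) a)) (ℚ.+-identityˡ (- s j)))
          pointwise : ∀ j → s j * x j ≡ c * (s j * s j)
          pointwise j with lookup C j in eq
          ... | false rewrite outside j eq = trans (ℚ.*-zeroˡ (x j)) (sym (ℚ.*-zeroʳ c))
          ... | true  = begin
            s j * x j          ≡⟨ ℚ.*-comm (s j) (x j) ⟩
            x j * s j          ≡⟨ constant ε (C⇒reachable j eq) ⟩
            c                  ≡⟨ ℚ.*-identityʳ c ⟨
            c * 1ℚ             ≡⟨ cong (c *_) (inside j eq) ⟨
            c * (s j * s j)    ∎
          s∙x≡0 : s ∙ x ≡ 0ℚ
          s∙x≡0 = All.lookup (All.map⁻ ⊥comps) (∈-filter⁺ (bipartiteComponent? G) (∈-subsets C) bc)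
          c≡0 : c ≡ 0ℚ
          c≡0 = zero-product (sign-nonzero bc) (begin
            (s ∙ s) * c                       ≡⟨ ℚ.*-comm (s ∙ s) c ⟩
            c * (s ∙ s)                       ≡⟨ *-distribˡ-sum c (λ j → s j * s j) ⟩
            sum (λ j → c * (s j * s j))       ≡⟨ sum-cong-≗ pointwise ⟨
            s ∙ x                             ≡⟨ s∙x≡0 ⟩
            0ℚ                                ∎)

    -- The sign vectors followed by a basis of the span of the normals are independent, hence at
    -- most n in number; and only 0 is orthogonal to all of them, so there are at least n.
    rank+bipartiteComponents : rank G ℕ.+ bipartiteComponents G ≡ n
    rank+bipartiteComponents = trans (ℕ.+-comm (rank G) (length comps))
      (trans (cong (ℕ._+ rank G) (sym (List.length-map sv comps)))
        (trans (sym (List.length-++ (List.map sv comps)))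
          (ℕ.≤-antisym (independent-length ws independent) (total-length ws total))))
      where
      vs = List.map normal (arrangement G)
      open BasisOfSpan (basisOfSpan vs) renaming (independent to basis-independent)
      ws = List.map sv comps ++ basis
      bcs : All (BipartiteComponent G) comps
      bcs = All.all-filter (bipartiteComponent? G) (allVecs (true ∷ false ∷ []) n)
      independent : Independent ws
      independent = independent-orthogonal (List.map sv comps) basis
        (orthogonal (Unique.filter⁺ (bipartiteComponent? G) (subsets-unique n)) bcs)
        (All.map⁺ (All.map sign-nonzero bcs))
        (All.map⁺ (All.map (λ {S} bc → All.map (λ b∈ → span-perp vs b∈ (sv S) (null⇒normal G (sv S) (sign-null bc))) contained) bcs))
        basis-independent
      total : ∀ x → All (λ v → v ∙ x ≡ 0ℚ) ws → ∀ i → x i ≡ 0ℚ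
      total x ⊥ws i with x i ℚ.≟ 0ℚ
      ... | yes eq = eq
      ... | no neq = ⊥-elim (contradiction x
        (normal⇒null G x simple (All.map (λ v∈ → span-perp basis v∈ x (All.++⁻ʳ (List.map sv comps) ⊥ws)) spanning))
        (All.++⁻ˡ (List.map sv comps) ⊥ws) i neq)

-- Behaviour of the invariants under disjoint unions.

module JoinInvariants where

  open import Defs
  open import Data.Bool.Base using (Bool; true; false; T)
  import Data.Bool.Properties as Bool
  open import Data.Empty using (⊥-elim)
  open import Data.Fin.Base as Fin using (Fin; zero; suc)
  import Data.Fin.Properties as Fin
  open import Data.Fin.Subset using (Subset; _∈_)
  open import Data.List.Base as List using (List; []; _∷_; length; allFin; cartesianProduct; concatMap)
  import Data.List.Properties as List
  open import Data.List.Relation.Unary.All as All using (All; []; _∷_)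
  open import Data.Nat.Base as ℕ using (ℕ; zero; suc; _+_)
  import Data.Nat.Properties as ℕ
  open import Data.Product.Base using (∃; _×_; _,_; proj₁; proj₂)
  open import Data.Rational.Base as ℚ using (ℚ; 0ℚ; 1ℚ)
  import Data.Rational.Properties as ℚ
  open import Data.Sum.Base using (_⊎_; inj₁; inj₂)
  open import Data.Vec.Base as Vec using (Vec; []; _∷_; lookup; tabulate; replicate)
  import Data.Vec.Properties as Vec
  open import Data.Vec.Functional as Vector using (Vector)
  open import Function.Base using (_∘_)
  open import Level using (0ℓ)
  open import Relation.Binary.Definitions using (tri<; tri≈; tri>)
  open import Relation.Binary.PropositionalEquality hiding (J)
  open import Relation.Nullary using (¬_; Dec; yes; no)
  open import Relation.Nullary.Decidable using (_×-dec_)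
  open import Relation.Unary using (Pred; Decidable)
  open LinearAlgebra
  open GraphJoin
  open Shuffle
  open Arrangements
  open ColouredGraph
  open Hyperplane
  open Enumeration.ListSum ℕ.+-*-commutativeSemiring
  open ExponentialFormula.Formula ℕ.+-*-commutativeSemiring

  private variable
    m n : ℕ

  count-∑ : ∀ {X : Set} {P : Pred X 0ℓ} (P? : Decidable P) xs → count P? xs ≡ ∑ xs (λ x → ⟦ P? x ⟧)
  count-∑ P? []       = refl
  count-∑ P? (x ∷ xs) with P? x
  ... | yes _ = cong suc (count-∑ P? xs)
  ... | no _  = count-∑ P? xs

  length-concatMap : ∀ {X Y : Set} (f : X → List Y) xs → length (concatMap f xs) ≡ ∑ xs (length ∘ f)
  length-concatMap f []       = refl
  length-concatMap f (x ∷ xs) = trans (List.length-++ (f x)) (cong (length (f x) +_) (length-concatMap f xs))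

  ∑-allFin-shuffle : ∀ (τ : Vec Bool n) f →
    ∑ (allFin n) f ≡ ∑ (allFin (ones τ)) (f ∘ ι₁ τ) + ∑ (allFin (zeros τ)) (f ∘ ι₂ τ)
  ∑-allFin-shuffle []          f = refl
  ∑-allFin-shuffle (true ∷ τ)  f = begin
    ∑ (allFin (suc _)) f
      ≡⟨ ∑-allFin-suc _ f ⟩
    f zero + ∑ (allFin _) (f ∘ suc)
      ≡⟨ cong (f zero +_) (∑-allFin-shuffle τ (f ∘ suc)) ⟩
    f zero + (∑ (allFin (ones τ)) (f ∘ suc ∘ ι₁ τ) + ∑ (allFin (zeros τ)) (f ∘ suc ∘ ι₂ τ))
      ≡⟨ ℕ.+-assoc (f zero) _ _ ⟨
    f zero + ∑ (allFin (ones τ)) (f ∘ suc ∘ ι₁ τ) + ∑ (allFin (zeros τ)) (f ∘ suc ∘ ι₂ τ)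
      ≡⟨ cong (_+ ∑ (allFin (zeros τ)) (f ∘ suc ∘ ι₂ τ)) (∑-allFin-suc (ones τ) (f ∘ ι₁ (true ∷ τ))) ⟨
    ∑ (allFin (suc (ones τ))) (f ∘ ι₁ (true ∷ τ)) + ∑ (allFin (zeros τ)) (f ∘ ι₂ (true ∷ τ)) ∎
    where open ≡-Reasoning
  ∑-allFin-shuffle (false ∷ τ) f = begin
    ∑ (allFin (suc _)) f
      ≡⟨ ∑-allFin-suc _ f ⟩
    f zero + ∑ (allFin _) (f ∘ suc)
      ≡⟨ cong (f zero +_) (∑-allFin-shuffle τ (f ∘ suc)) ⟩
    f zero + (∑ (allFin (ones τ)) (f ∘ suc ∘ ι₁ τ) + ∑ (allFin (zeros τ)) (f ∘ suc ∘ ι₂ τ))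
      ≡⟨ x∙yz≈y∙xz (f zero) (∑ (allFin (ones τ)) (f ∘ suc ∘ ι₁ τ)) _ ⟩
    ∑ (allFin (ones τ)) (f ∘ suc ∘ ι₁ τ) + (f zero + ∑ (allFin (zeros τ)) (f ∘ suc ∘ ι₂ τ))
      ≡⟨ cong (∑ (allFin (ones τ)) (f ∘ suc ∘ ι₁ τ) +_) (∑-allFin-suc (zeros τ) (f ∘ ι₂ (false ∷ τ))) ⟨
    ∑ (allFin (ones τ)) (f ∘ ι₁ (false ∷ τ)) + ∑ (allFin (suc (zeros τ))) (f ∘ ι₂ (false ∷ τ)) ∎
    where
    open ≡-Reasoning
    open import Algebra.Properties.CommutativeSemigroup ℕ.+-commutativeSemigroup using (x∙yz≈y∙xz)

  edge? : (A : Graph n) → ∀ i j → Dec (i Fin.< j × Adj A i j)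
  edge? A i j = (i Fin.<? j) ×-dec adj? A i j

  size-∑ : (A : Graph n) → size A ≡ ∑ (allFin n) λ i → ∑ (allFin n) λ j → ⟦ edge? A i j ⟧
  size-∑ {n} A = trans (count-∑ _ (cartesianProduct (allFin n) (allFin n)))
    (∑-product _,_ (allFin n) (allFin n) _)

  -- The double sum over pairs i < j falls into four blocks, of which the two mixed ones contain no
  -- edges.
  size-join : ∀ (τ : Vec Bool n) A B → size (join τ A B) ≡ size A + size B
  size-join {n} τ A B = begin
    size J
      ≡⟨ size-∑ J ⟩
    ∑ (allFin n) (λ i → ∑ (allFin n) λ j → e i j)
      ≡⟨ ∑-allFin-shuffle τ _ ⟩
    ∑ os (λ i → ∑ (allFin n) λ j → e (ι₁ τ i) j) + ∑ zs (λ i → ∑ (allFin n) λ j → e (ι₂ τ i) j)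
      ≡⟨ cong₂ _+_ (∑-cong os λ i → ∑-allFin-shuffle τ _) (∑-cong zs λ i → ∑-allFin-shuffle τ _) ⟩
    ∑ os (λ i → ∑ os (λ j → e (ι₁ τ i) (ι₁ τ j)) + ∑ zs (λ j → e (ι₁ τ i) (ι₂ τ j))) +
    ∑ zs (λ i → ∑ os (λ j → e (ι₂ τ i) (ι₁ τ j)) + ∑ zs (λ j → e (ι₂ τ i) (ι₂ τ j)))
      ≡⟨ cong₂ _+_
           (∑-cong os λ i → trans (cong₂ _+_ (∑-cong os λ j → e₁₁ i j) (∑-zero zs λ j → e₁₂ i j)) (ℕ.+-identityʳ _))
           (∑-cong zs λ i → cong₂ _+_ (∑-zero os λ j → e₂₁ i j) (∑-cong zs λ j → e₂₂ i j)) ⟩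
    ∑ os (λ i → ∑ os λ j → ⟦ edge? A i j ⟧) + ∑ zs (λ i → ∑ zs λ j → ⟦ edge? B i j ⟧)
      ≡⟨ cong₂ _+_ (size-∑ A) (size-∑ B) ⟨
    size A + size B ∎
    where
    open ≡-Reasoning
    J = join τ A B
    os = allFin (ones τ)
    zs = allFin (zeros τ)
    e : Fin n → Fin n → ℕ
    e i j = ⟦ edge? J i j ⟧
    reflect₁ : ∀ {i j} → ι₁ τ i Fin.< ι₁ τ j → i Fin.< j
    reflect₁ {i} {j} lt with Fin.<-cmp i j
    ... | tri< lt′ _ _ = lt′

    ... | tri≈ _ refl _ = ⊥-elim (ℕ.<-irrefl refl lt)
    ... | tri> _ _ gt = ⊥-elim (ℕ.<-asym lt (ι₁-< τ gt))
    reflect₂ : ∀ {i j} → ι₂ τ i Fin.< ι₂ τ j → i Fin.< j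
    reflect₂ {i} {j} lt with Fin.<-cmp i j
    ... | tri< lt′ _ _ = lt′
    ... | tri≈ _ refl _ = ⊥-elim (ℕ.<-irrefl refl lt)
    ... | tri> _ _ gt = ⊥-elim (ℕ.<-asym lt (ι₂-< τ gt))
    e₁₁ : ∀ i j → e (ι₁ τ i) (ι₁ τ j) ≡ ⟦ edge? A i j ⟧
    e₁₁ i j = ⟦⟧-cong (edge? J (ι₁ τ i) (ι₁ τ j)) (edge? A i j)
      (λ (lt , a) → reflect₁ lt , subst T (join₁₁ τ A B i j) a)
      (λ (lt , a) → ι₁-< τ lt , subst T (sym (join₁₁ τ A B i j)) a)
    e₂₂ : ∀ i j → e (ι₂ τ i) (ι₂ τ j) ≡ ⟦ edge? B i j ⟧
    e₂₂ i j = ⟦⟧-cong (edge? J (ι₂ τ i) (ι₂ τ j)) (edge? B i j)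
      (λ (lt , a) → reflect₂ lt , subst T (join₂₂ τ A B i j) a)
      (λ (lt , a) → ι₂-< τ lt , subst T (sym (join₂₂ τ A B i j)) a)
    e₁₂ : ∀ i j → e (ι₁ τ i) (ι₂ τ j) ≡ 0
    e₁₂ i j = ⟦⟧-no (edge? J (ι₁ τ i) (ι₂ τ j)) (λ (_ , a) → subst T (join₁₂ τ A B i j) a)
    e₂₁ : ∀ i j → e (ι₂ τ i) (ι₁ τ j) ≡ 0
    e₂₁ i j = ⟦⟧-no (edge? J (ι₂ τ i) (ι₁ τ j)) (λ (_ , a) → subst T (join₂₁ τ A B i j) a)

  colouredness : Colour → ℕ
  colouredness 𝟎 = 1
  colouredness 𝟏 = 1
  colouredness ∗ = 0

  colouredVertices : Vec Colour n → ℕ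
  colouredVertices []       = 0
  colouredVertices (k ∷ ks) = colouredness k + colouredVertices ks

  colouredVertices-merge : ∀ (τ : Vec Bool n) u v →
    colouredVertices (merge τ u v) ≡ colouredVertices u + colouredVertices v
  colouredVertices-merge []          []      []      = refl
  colouredVertices-merge (true ∷ τ)  (k ∷ u) v       =
    trans (cong (colouredness k +_) (colouredVertices-merge τ u v)) (sym (ℕ.+-assoc (colouredness k) _ _))
  colouredVertices-merge (false ∷ τ) u       (k ∷ v) =
    trans (cong (colouredness k +_) (colouredVertices-merge τ u v)) (x∙yz≈y∙xz (colouredness k) (colouredVertices u) _)
    where open import Algebra.Properties.CommutativeSemigroup ℕ.+-commutativeSemigroup using (x∙yz≈y∙xz)

  cardinality-formula : (G : ColouredGraph n) → cardinality G ≡ size (graph G) + colouredVertices (colour G)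
  cardinality-formula {n} G = trans (List.length-++ (List.map edgeHyperplane (edges (graph G))))
    (cong₂ _+_ (List.length-map edgeHyperplane (edges (graph G)))
      (trans (length-concatMap (vertexHyperplane G) (allFin n)) (trans (∑-cong (allFin n) vertex) (by-vertex (colour G)))))
    where
    vertex : ∀ i → length (vertexHyperplane G i) ≡ colouredness (lookup (colour G) i)
    vertex i with lookup (colour G) i
    ... | 𝟎 = refl
    ... | 𝟏 = refl
    ... | ∗ = refl
    by-vertex : ∀ {n} (ks : Vec Colour n) → ∑ (allFin n) (λ i → colouredness (lookup ks i)) ≡ colouredVertices ks
    by-vertex []       = refl
    by-vertex (k ∷ ks) = trans (∑-allFin-suc _ (λ i → colouredness (lookup (k ∷ ks) i))) (cong (colouredness k +_) (by-vertex ks))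

  record Solution (G : ColouredGraph n) (x : Vector ℚ n) : Set where
    field
      edge : ∀ i j → Adj (graph G) i j → x i ℚ.+ x j ≡ 1ℚ
      colour-𝟎 : ∀ i → lookup (colour G) i ≡ 𝟎 → x i ≡ 0ℚ
      colour-𝟏 : ∀ i → lookup (colour G) i ≡ 𝟏 → x i ≡ 1ℚ

  central⇒solution : (G : ColouredGraph n) → IsSimple (graph G) → Central G → ∃ (Solution G)
  central⇒solution G s (x , on) = x , record
    { edge = adjacent-all (graph G) s x 1ℚ λ i j lt a → trans (sym (edge-∙ i j x)) (proj₁ all i j lt a)
    ; colour-𝟎 = λ i → zero′ i (proj₂ all i)
    ; colour-𝟏 = λ i → one′ i (proj₂ all i)
    }
    where
    all = All-arrangement⁻ {P = x OnHyperplane_} G on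
    zero′ : ∀ i → All (x OnHyperplane_) (vertexHyperplane G i) → lookup (colour G) i ≡ 𝟎 → x i ≡ 0ℚ
    zero′ i ps eq with lookup (colour G) i
    zero′ i (p ∷ []) refl | .𝟎 = trans (sym (coordinate-∙ i x)) p
    one′ : ∀ i → All (x OnHyperplane_) (vertexHyperplane G i) → lookup (colour G) i ≡ 𝟏 → x i ≡ 1ℚ
    one′ i ps eq with lookup (colour G) i
    one′ i (p ∷ []) refl | .𝟏 = trans (sym (coordinate-∙ i x)) p

  solution⇒central : (G : ColouredGraph n) → ∃ (Solution G) → Central G
  solution⇒central G (x , sol) = x , All-arrangement⁺ {P = x OnHyperplane_} G
    (λ i j _ a → trans (edge-∙ i j x) (Solution.edge sol i j a)) v
    where
    v : ∀ i → All (x OnHyperplane_) (vertexHyperplane G i)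
    v i with lookup (colour G) i | Solution.colour-𝟎 sol i | Solution.colour-𝟏 sol i
    ... | 𝟎 | z | _ = trans (coordinate-∙ i x) (z refl) ∷ []
    ... | 𝟏 | _ | o = trans (coordinate-∙ i x) (o refl) ∷ []
    ... | ∗ | _ | _ = []

  -- An isomorphism onto a union of components of G. Both parts of a disjoint union are of this
  -- kind, so facts about walks, colours and components are proved once.
  record Embedding {m n} (G₁ : ColouredGraph m) (G : ColouredGraph n) : Set where
    field
      f         : Fin m → Fin n
      injective : ∀ {i j} → f i ≡ f j → i ≡ j
      closed    : Closed f (graph G)
      induces   : induced f (graph G) ≡ graph G₁
      colours   : ∀ i → lookup (colour G) (f i) ≡ lookup (colour G₁) i

    adj≡ : ∀ i j → adj (graph G) (f i) (f j) ≡ adj (graph G₁) i j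
    adj≡ i j = trans (sym (adj-induced f (graph G) i j)) (cong (λ A → adj A i j) induces)

    reach⇒ : ∀ {i j} → Reachable (graph G₁) i j → Reachable (graph G) (f i) (f j)
    reach⇒ w = induced-walk f (graph G) (subst (λ A → Reachable A _ _) (sym induces) w)

    reach⇐ : ∀ {i j} → Reachable (graph G) (f i) (f j) → Reachable (graph G₁) i j
    reach⇐ w = subst (λ A → Reachable A _ _) induces (closed-reachable f (graph G) injective closed w)

    reach-image : ∀ {i v} → Reachable (graph G) (f i) v → ∃ λ j → v ≡ f j
    reach-image w with closed-walk f (graph G) closed w
    ... | j , eq , _ = j , eq

    nonIsolated⇒ : ∀ {i} → NonIsolated (graph G₁) i → NonIsolated (graph G) (f i)
    nonIsolated⇒ {i} (j , a) = f j , subst T (sym (adj≡ i j)) a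

    nonIsolated⇐ : ∀ {i} → NonIsolated (graph G) (f i) → NonIsolated (graph G₁) i
    nonIsolated⇐ {i} (v , a) with closed i v a
    ... | j , refl = j , subst T (adj≡ i j) a

    module _ (S : Subset n) (S₁ : Subset m) (on : ∀ i → lookup S (f i) ≡ lookup S₁ i)
             (support : ∀ v → lookup S v ≡ true → ∃ λ j → v ≡ f j) where

      private
        up : ∀ {i} → i ∈ S₁ → f i ∈ S
        up {i} i∈ = Vec.lookup⇒[]= (f i) S (trans (on i) (Vec.[]=⇒lookup i∈))
        down : ∀ {i} → f i ∈ S → i ∈ S₁
        down {i} i∈ = Vec.lookup⇒[]= i S₁ (trans (sym (on i)) (Vec.[]=⇒lookup i∈))

      component⇒ : BipartiteComponent G S → BipartiteComponent G₁ S₁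
      component⇒ (((v , v∈) , comp) , (side , proper) , non) =
        (nonempty , λ i i∈ j → (λ j∈ → reach⇐ (proj₁ (comp (f i) (up i∈) (f j)) (up j∈))) ,
                               (λ w → down (proj₂ (comp (f i) (up i∈) (f j)) (reach⇒ w)))) ,
        (tabulate (lookup side ∘ f) , λ i i∈ j j∈ a eq → proper (f i) (up i∈) (f j) (up j∈)
          (subst T (sym (adj≡ i j)) a)
          (trans (sym (Vec.lookup∘tabulate (lookup side ∘ f) i)) (trans eq (Vec.lookup∘tabulate (lookup side ∘ f) j)))) ,
        λ i i∈ → trans (sym (colours i)) (non (f i) (up i∈))
        where
        nonempty : ∃ (_∈ S₁)
        nonempty with support v (Vec.[]=⇒lookup v∈)
        ... | j , refl = j , down v∈

      component⇐ : BipartiteComponent G₁ S₁ → BipartiteComponent G S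
      component⇐ (((i , i∈) , comp) , (side , proper) , non) =
        ((f i , up i∈) , component) , (side′ , proper′) , non′
        where
        component : ∀ v → v ∈ S → ∀ w → (w ∈ S → Reachable (graph G) v w) × (Reachable (graph G) v w → w ∈ S)
        component v v∈ w with support v (Vec.[]=⇒lookup v∈)
        ... | i , refl = to , from
          where
          to : w ∈ S → Reachable (graph G) (f i) w
          to w∈ with support w (Vec.[]=⇒lookup w∈)
          ... | j , refl = reach⇒ (proj₁ (comp i (down v∈) j) (down w∈))
          from : Reachable (graph G) (f i) w → w ∈ S
          from r with reach-image r
          ... | j , refl = up (proj₂ (comp i (down v∈) j) (reach⇐ r))
        -- The sides are pushed forward along f; the default `false` off the image is harmless,
        -- since S is supported on the image.
        pull : Fin n → Bool
        pull v with Fin.any? (λ j → v Fin.≟ f j)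
        ... | yes (j , _) = lookup side j
        ... | no _        = false
        pull-f : ∀ j → pull (f j) ≡ lookup side j
        pull-f j with Fin.any? (λ k → f j Fin.≟ f k)
        ... | yes (k , eq) = cong (lookup side) (sym (injective eq))
        ... | no none      = ⊥-elim (none (j , refl))
        side′ = tabulate pull
        side′-f : ∀ j → lookup side′ (f j) ≡ lookup side j
        side′-f j = trans (Vec.lookup∘tabulate pull (f j)) (pull-f j)
        proper′ : ∀ v → v ∈ S → ∀ w → w ∈ S → Adj (graph G) v w → lookup side′ v ≢ lookup side′ w
        proper′ v v∈ w w∈ a eq with support v (Vec.[]=⇒lookup v∈) | support w (Vec.[]=⇒lookup w∈)
        ... | i , refl | j , refl = proper i (down v∈) j (down w∈) (subst T (adj≡ i j) a)
          (trans (sym (side′-f i)) (trans eq (side′-f j)))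
        non′ : ∀ v → v ∈ S → NonColoured G v
        non′ v v∈ with support v (Vec.[]=⇒lookup v∈)
        ... | i , refl = trans (colours i) (non i (down v∈))

  ⟦⟧-⊎ : ∀ {P Q R : Set} (p : Dec P) (q : Dec Q) (r : Dec R) →
          (P → Q ⊎ R) → (Q → P) → (R → P) → ¬ (Q × R) → ⟦ p ⟧ ≡ ⟦ q ⟧ + ⟦ r ⟧
  ⟦⟧-⊎ (yes p) (yes q) (yes r) f g h x = ⊥-elim (x (q , r))
  ⟦⟧-⊎ (yes p) (yes q) (no r)  f g h x = refl
  ⟦⟧-⊎ (yes p) (no q)  (yes r) f g h x = refl
  ⟦⟧-⊎ (yes p) (no q)  (no r)  f g h x with f p
  ... | inj₁ q′ = ⊥-elim (q q′)
  ... | inj₂ r′ = ⊥-elim (r r′)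
  ⟦⟧-⊎ (no p)  (yes q) r       f g h x = ⊥-elim (p (g q))
  ⟦⟧-⊎ (no p)  (no q)  (yes r) f g h x = ⊥-elim (p (h r))
  ⟦⟧-⊎ (no p)  (no q)  (no r)  f g h x = refl

  module _ (τ : Vec Bool n) (A : Graph (ones τ)) (B : Graph (zeros τ)) (u : Vec Colour (ones τ)) (v : Vec Colour (zeros τ)) where

    private
      G  = colouredGraph (join τ A B) (merge τ u v)
      G₁ = colouredGraph A u
      G₂ = colouredGraph B v

    embedding₁ : Embedding G₁ G
    embedding₁ = record
      { f = ι₁ τ ; injective = ι₁-injective τ ; closed = join-closed₁ τ A B
      ; induces = induced-join₁ τ A B ; colours = lookup-merge₁ τ u v }

    embedding₂ : Embedding G₂ G
    embedding₂ = record
      { f = ι₂ τ ; injective = ι₂-injective τ ; closed = join-closed₂ τ A B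
      ; induces = induced-join₂ τ A B ; colours = lookup-merge₂ τ u v }

    private
      module E₁ = Embedding embedding₁
      module E₂ = Embedding embedding₂

    noIsolated-join⇒ : NoIsolatedNonColoured G → NoIsolatedNonColoured G₁ × NoIsolatedNonColoured G₂
    noIsolated-join⇒ h = (λ i non → E₁.nonIsolated⇐ (h (ι₁ τ i) (trans (E₁.colours i) non))) ,
                         (λ i non → E₂.nonIsolated⇐ (h (ι₂ τ i) (trans (E₂.colours i) non)))

    noIsolated-join⇐ : NoIsolatedNonColoured G₁ → NoIsolatedNonColoured G₂ → NoIsolatedNonColoured G
    noIsolated-join⇐ h₁ h₂ i non with position τ i
    ... | left j  = E₁.nonIsolated⇒ (h₁ j (trans (sym (E₁.colours j)) non))
    ... | right j = E₂.nonIsolated⇒ (h₂ j (trans (sym (E₂.colours j)) non))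

    solution-restrict : ∀ {m} {H : ColouredGraph m} (e : Embedding H G) x → Solution G x → Solution H (x ∘ Embedding.f e)
    solution-restrict e x sol = record
      { edge = λ i j a → Solution.edge sol (f i) (f j) (subst T (sym (adj≡ i j)) a)
      ; colour-𝟎 = λ i eq → Solution.colour-𝟎 sol (f i) (trans (colours i) eq)
      ; colour-𝟏 = λ i eq → Solution.colour-𝟏 sol (f i) (trans (colours i) eq)
      }
      where open Embedding e

    solution-glue : ∀ x₁ x₂ → Solution G₁ x₁ → Solution G₂ x₂ → ∃ (Solution G)
    solution-glue x₁ x₂ s₁ s₂ = x , record { edge = edge ; colour-𝟎 = zero′ ; colour-𝟏 = one′ }
      where
      x : Vector ℚ n
      x = lookup (merge τ (tabulate x₁) (tabulate x₂))
      x-ι₁ : ∀ i → x (ι₁ τ i) ≡ x₁ i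
      x-ι₁ i = trans (lookup-merge₁ τ _ _ i) (Vec.lookup∘tabulate x₁ i)
      x-ι₂ : ∀ i → x (ι₂ τ i) ≡ x₂ i
      x-ι₂ i = trans (lookup-merge₂ τ _ _ i) (Vec.lookup∘tabulate x₂ i)
      edge : ∀ i j → Adj (graph G) i j → x i ℚ.+ x j ≡ 1ℚ
      edge i j a with position τ i | position τ j
      ... | left i′  | left j′  = trans (cong₂ ℚ._+_ (x-ι₁ i′) (x-ι₁ j′)) (Solution.edge s₁ i′ j′ (subst T (E₁.adj≡ i′ j′) a))
      ... | right i′ | right j′ = trans (cong₂ ℚ._+_ (x-ι₂ i′) (x-ι₂ j′)) (Solution.edge s₂ i′ j′ (subst T (E₂.adj≡ i′ j′) a))
      ... | left i′  | right j′ = ⊥-elim (subst T (join₁₂ τ A B i′ j′) a)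
      ... | right i′ | left j′  = ⊥-elim (subst T (join₂₁ τ A B i′ j′) a)
      zero′ : ∀ i → lookup (colour G) i ≡ 𝟎 → x i ≡ 0ℚ
      zero′ i eq with position τ i
      ... | left j  = trans (x-ι₁ j) (Solution.colour-𝟎 s₁ j (trans (sym (E₁.colours j)) eq))
      ... | right j = trans (x-ι₂ j) (Solution.colour-𝟎 s₂ j (trans (sym (E₂.colours j)) eq))
      one′ : ∀ i → lookup (colour G) i ≡ 𝟏 → x i ≡ 1ℚ
      one′ i eq with position τ i
      ... | left j  = trans (x-ι₁ j) (Solution.colour-𝟏 s₁ j (trans (sym (E₁.colours j)) eq))
      ... | right j = trans (x-ι₂ j) (Solution.colour-𝟏 s₂ j (trans (sym (E₂.colours j)) eq))

    cardinality-join : cardinality G ≡ cardinality G₁ + cardinality G₂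
    cardinality-join = begin
      cardinality G
        ≡⟨ cardinality-formula G ⟩
      size (join τ A B) + colouredVertices (merge τ u v)
        ≡⟨ cong₂ _+_ (size-join τ A B) (colouredVertices-merge τ u v) ⟩
      (size A + size B) + (colouredVertices u + colouredVertices v)
        ≡⟨ interchange (size A) (size B) (colouredVertices u) (colouredVertices v) ⟩
      (size A + colouredVertices u) + (size B + colouredVertices v)
        ≡⟨ cong₂ _+_ (cardinality-formula G₁) (cardinality-formula G₂) ⟨
      cardinality G₁ + cardinality G₂ ∎
      where
      open ≡-Reasoning
      open import Algebra.Properties.CommutativeSemigroup ℕ.+-commutativeSemigroup using (interchange)

    private
      true≢false : true ≢ false
      true≢false ()

      empty₁ : Subset (ones τ)
      empty₁ = replicate (ones τ) false
      empty₂ : Subset (zeros τ)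
      empty₂ = replicate (zeros τ) false
      _≟ˢ_ : ∀ {n} (S S′ : Subset n) → Dec (S ≡ S′)
      _≟ˢ_ = Vec.≡-dec Bool._≟_

      support₁ : ∀ S₁ w → lookup (merge τ S₁ empty₂) w ≡ true → ∃ λ j → w ≡ ι₁ τ j
      support₁ S₁ w eq with position τ w
      ... | left j  = j , refl
      ... | right j = ⊥-elim (true≢false (trans (sym eq) (trans (lookup-merge₂ τ S₁ empty₂ j) (Vec.lookup-replicate j false))))

      support₂ : ∀ S₂ w → lookup (merge τ empty₁ S₂) w ≡ true → ∃ λ j → w ≡ ι₂ τ j
      support₂ S₂ w eq with position τ w
      ... | right j = j , refl
      ... | left j  = ⊥-elim (true≢false (trans (sym eq) (trans (lookup-merge₁ τ empty₁ S₂ j) (Vec.lookup-replicate j false))))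

      bc? : ∀ {n} (G : ColouredGraph n) S → Dec (BipartiteComponent G S)
      bc? G S = bipartiteComponent? G S

      empty-ext : ∀ {n} (S : Subset n) → (∀ j → lookup S j ≢ true) → replicate n false ≡ S
      empty-ext S h = lookup-ext λ j → trans (Vec.lookup-replicate j false) (sym (Bool.¬-not (h j)))

      -- All vertices of a component are reachable from any one of them, and no walk crosses between
      -- the parts: the component lies on the side of its witness w and is empty on the other.
      split : ∀ S₁ S₂ → BipartiteComponent G (merge τ S₁ S₂) →
              (BipartiteComponent G₁ S₁ × empty₂ ≡ S₂) ⊎ (empty₁ ≡ S₁ × BipartiteComponent G₂ S₂)
      split S₁ S₂ bc@(((w , w∈) , comp) , _) with position τ w
      ... | left i  = inj₁ (E₁.component⇒ (merge τ S₁ empty₂) S₁ (lookup-merge₁ τ S₁ empty₂) (support₁ S₁)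
                        (subst (λ S → BipartiteComponent G (merge τ S₁ S)) (sym S₂≡) bc) , S₂≡)
        where
        S₂≡ : empty₂ ≡ S₂
        S₂≡ = empty-ext S₂ λ j eq →
          let k , eq′ = E₁.reach-image (proj₁ (comp (ι₁ τ i) w∈ (ι₂ τ j))
                          (Vec.lookup⇒[]= _ (merge τ S₁ S₂) (trans (lookup-merge₂ τ S₁ S₂ j) eq)))
          in ι₁≢ι₂ τ k j (sym eq′)
      ... | right i = inj₂ (S₁≡ , E₂.component⇒ (merge τ empty₁ S₂) S₂ (lookup-merge₂ τ empty₁ S₂) (support₂ S₂)
                        (subst (λ S → BipartiteComponent G (merge τ S S₂)) (sym S₁≡) bc))
        where
        S₁≡ : empty₁ ≡ S₁
        S₁≡ = empty-ext S₁ λ j eq →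
          let k , eq′ = E₂.reach-image (proj₁ (comp (ι₂ τ i) w∈ (ι₁ τ j))
                          (Vec.lookup⇒[]= _ (merge τ S₁ S₂) (trans (lookup-merge₁ τ S₁ S₂ j) eq)))
          in ι₁≢ι₂ τ j k eq′

      nonempty-false : ∀ {n} (G : ColouredGraph n) → ¬ BipartiteComponent G (replicate n false)
      nonempty-false G (((i , i∈) , _) , _) = true≢false (trans (sym (Vec.[]=⇒lookup i∈)) (Vec.lookup-replicate i false))

    -- Subsets of the union are pairs of subsets, and a pair is a component when one entry is a
    -- component and the other is empty. The two cases exclude each other because components are
    -- nonempty, so the indicators add.
    bipartiteComponents-join : bipartiteComponents G ≡ bipartiteComponents G₁ + bipartiteComponents G₂
    bipartiteComponents-join = begin
      bipartiteComponents G
        ≡⟨ count-∑ (bipartiteComponent? G) (allVecs bools n) ⟩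
      ∑ (allVecs bools n) (λ S → ⟦ bc? G S ⟧)
        ≡⟨ ∑-merge bools τ (λ S → ⟦ bc? G S ⟧) ⟩
      ∑ ss₁ (λ S₁ → ∑ ss₂ λ S₂ → ⟦ bc? G (merge τ S₁ S₂) ⟧)
        ≡⟨ ∑-cong ss₁ (λ S₁ → ∑-cong ss₂ λ S₂ → trans
             (⟦⟧-⊎ (bc? G (merge τ S₁ S₂)) (bc? G₁ S₁ ×-dec (empty₂ ≟ˢ S₂)) ((empty₁ ≟ˢ S₁) ×-dec bc? G₂ S₂)
               (split S₁ S₂)
               (λ { (bc , refl) → E₁.component⇐ (merge τ S₁ empty₂) S₁ (lookup-merge₁ τ S₁ empty₂) (support₁ S₁) bc })
               (λ { (refl , bc) → E₂.component⇐ (merge τ empty₁ S₂) S₂ (lookup-merge₂ τ empty₁ S₂) (support₂ S₂) bc })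
               (λ { ((bc , _) , (refl , _)) → nonempty-false G₁ bc }))
             (cong₂ _+_ (⟦⟧-× (bc? G₁ S₁) (empty₂ ≟ˢ S₂)) (⟦⟧-× (empty₁ ≟ˢ S₁) (bc? G₂ S₂)))) ⟩
      ∑ ss₁ (λ S₁ → ∑ ss₂ λ S₂ → p₁ S₁ ℕ.* d₂ S₂ + d₁ S₁ ℕ.* p₂ S₂)
        ≡⟨ ∑-cong ss₁ (λ S₁ → trans (∑-+ ss₂ _ _) (cong₂ _+_ (sym (*-∑ ss₂ (p₁ S₁) d₂)) (sym (*-∑ ss₂ (d₁ S₁) p₂)))) ⟩
      ∑ ss₁ (λ S₁ → p₁ S₁ ℕ.* ∑ ss₂ d₂ + d₁ S₁ ℕ.* ∑ ss₂ p₂)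
        ≡⟨ trans (∑-+ ss₁ _ _) (cong₂ _+_ (sym (∑-* ss₁ p₁ _)) (sym (∑-* ss₁ d₁ _))) ⟩
      ∑ ss₁ p₁ ℕ.* ∑ ss₂ d₂ + ∑ ss₁ d₁ ℕ.* ∑ ss₂ p₂
        -- Exactly one subset on each side is empty.
        ≡⟨ cong₂ _+_ (cong (∑ ss₁ p₁ ℕ.*_) (Enumerates-words (zeros τ) empty₂ (empty₂ ≟ˢ_)))
                     (cong (ℕ._* ∑ ss₂ p₂) (Enumerates-words (ones τ) empty₁ (empty₁ ≟ˢ_))) ⟩
      ∑ ss₁ p₁ ℕ.* 1 + 1 ℕ.* ∑ ss₂ p₂
        ≡⟨ cong₂ _+_ (ℕ.*-identityʳ (∑ ss₁ p₁)) (ℕ.*-identityˡ (∑ ss₂ p₂)) ⟩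
      ∑ ss₁ p₁ + ∑ ss₂ p₂
        ≡⟨ cong₂ _+_ (count-∑ (bipartiteComponent? G₁) ss₁) (count-∑ (bipartiteComponent? G₂) ss₂) ⟨
      bipartiteComponents G₁ + bipartiteComponents G₂ ∎
      where
      open ≡-Reasoning
      ss₁ = allVecs bools (ones τ)
      ss₂ = allVecs bools (zeros τ)
      p₁ = λ S → ⟦ bc? G₁ S ⟧
      p₂ = λ S → ⟦ bc? G₂ S ⟧
      d₁ = λ S → ⟦ empty₁ ≟ˢ S ⟧
      d₂ = λ S → ⟦ empty₂ ≟ˢ S ⟧

    module _ (sA : IsSimple A) (sB : IsSimple B) where

      central-join⇒ : Central G → Central G₁ × Central G₂
      central-join⇒ c with central⇒solution G (join-simple τ A B sA sB) c
      ... | x , sol = solution⇒central G₁ (_ , solution-restrict embedding₁ x sol) ,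
                      solution⇒central G₂ (_ , solution-restrict embedding₂ x sol)

      central-join⇐ : Central G₁ → Central G₂ → Central G
      central-join⇐ c₁ c₂ with central⇒solution G₁ sA c₁ | central⇒solution G₂ sB c₂
      ... | x₁ , s₁ | x₂ , s₂ = solution⇒central G (solution-glue x₁ x₂ s₁ s₂)

      -- No spans are compared: the rank is the order minus ν, and both of these are additive.
      rank-join : rank G ≡ rank G₁ + rank G₂
      rank-join = ℕ.+-cancelʳ-≡ (bipartiteComponents G) (rank G) (rank G₁ + rank G₂) (begin
        rank G + bipartiteComponents G
          ≡⟨ rank+bipartiteComponents G (join-simple τ A B sA sB) ⟩
        n
          ≡⟨ ones+zeros τ ⟨
        ones τ + zeros τ
          ≡⟨ cong₂ _+_ (rank+bipartiteComponents G₁ sA) (rank+bipartiteComponents G₂ sB) ⟨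
        (rank G₁ + bipartiteComponents G₁) + (rank G₂ + bipartiteComponents G₂)
          ≡⟨ interchange (rank G₁) (bipartiteComponents G₁) (rank G₂) (bipartiteComponents G₂) ⟩
        rank G₁ + rank G₂ + (bipartiteComponents G₁ + bipartiteComponents G₂)
          ≡⟨ cong (rank G₁ + rank G₂ +_) bipartiteComponents-join ⟨
        rank G₁ + rank G₂ + bipartiteComponents G ∎)
        where
        open ≡-Reasoning
        open import Algebra.Properties.CommutativeSemigroup ℕ.+-commutativeSemigroup using (interchange)

-- Edge enumerators of all graphs and of properly 2-coloured graphs.

module Counting where

  open import Defs
  open import Algebra.Bundles using (CommutativeSemiring)
  open import Data.Bool.Base using (Bool; true; false; T)
  import Data.Bool.Properties as Bool
  open import Data.Fin.Base as Fin using (Fin; zero; suc)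
  import Data.Fin.Properties as Fin
  open import Data.List.Base as List using ([]; _∷_; allFin; cartesianProduct)
  open import Data.Nat.Base as ℕ using (ℕ; zero; suc)
  open import Data.Nat.Combinatorics using (_C_; nCk+nC[k+1]≡[n+1]C[k+1]; nC1≡n)
  import Data.Nat.Properties as ℕ
  open import Data.Product.Base using (_×_; _,_; proj₂)
  import Data.Product.Properties as Product
  open import Data.Unit.Base using (⊤; tt)
  open import Data.Vec.Base as Vec using (Vec; []; _∷_; lookup; head; tail; map; zipWith)
  import Data.Vec.Properties as Vec
  open import Function.Base using (_∘_)
  open import Level using (0ℓ)
  open import Relation.Binary.PropositionalEquality as ≡ using (_≡_; _≢_; cong; cong₂; subst)
  open import Relation.Nullary using (¬_; Dec; yes)
  open import Relation.Nullary.Decidable using (_×-dec_; _→-dec_; ¬?)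
  open GraphJoin
  open Shuffle
  open ExponentialFormula using (_≟ᵍ_)
  open JoinInvariants using (size-∑; edge?)

  private variable
    n : ℕ

  -- Every simple graph on n + 1 vertices arises exactly once, from the neighbourhood r of vertex 0
  -- and the graph on the remaining vertices; the counts go by induction along this decomposition.
  cone : Vec Bool n → Graph n → Graph (suc n)
  cone r A = (false ∷ r) ∷ zipWith _∷_ r A

  cone-suc-zero : ∀ (r : Vec Bool n) A i → adj (cone r A) (suc i) zero ≡ lookup r i
  cone-suc-zero r A i = cong (λ v → lookup v zero) (Vec.lookup-zipWith _∷_ i r A)

  cone-suc-suc : ∀ (r : Vec Bool n) A i j → adj (cone r A) (suc i) (suc j) ≡ adj A i j
  cone-suc-suc r A i j = cong (λ v → lookup v (suc j)) (Vec.lookup-zipWith _∷_ i r A)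

  apex-row : Graph (suc n) → Vec Bool n
  apex-row A = tail (head A)

  base : Graph (suc n) → Graph n
  base A = map tail (tail A)

  lookup-tail : ∀ {X : Set} (v : Vec X (suc n)) i → lookup (tail v) i ≡ lookup v (suc i)
  lookup-tail (_ ∷ _) i = ≡.refl

  adj-base : ∀ (A : Graph (suc n)) i j → adj (base A) i j ≡ adj A (suc i) (suc j)
  adj-base (_ ∷ A) i j = ≡.trans (cong (λ v → lookup v j) (Vec.lookup-map i tail A)) (lookup-tail (lookup A i) j)

  lookup-apex-row : ∀ (A : Graph (suc n)) j → lookup (apex-row A) j ≡ adj A zero (suc j)
  lookup-apex-row ((_ ∷ _) ∷ _) j = ≡.refl

  cone-simple : ∀ (r : Vec Bool n) A → IsSimple A → IsSimple (cone r A)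
  cone-simple r A (sym′ , loop) = symmetric′ , loopless
    where
    symmetric′ : ∀ i j → Adj (cone r A) i j → Adj (cone r A) j i
    symmetric′ zero    (suc j) e = subst T (≡.sym (cone-suc-zero r A j)) e
    symmetric′ (suc i) zero    e = subst T (cone-suc-zero r A i) e
    symmetric′ (suc i) (suc j) e = subst T (≡.sym (cone-suc-suc r A j i)) (sym′ i j (subst T (cone-suc-suc r A i j) e))
    loopless : ∀ i → ¬ Adj (cone r A) i i
    loopless (suc i) e = loop i (subst T (cone-suc-suc r A i i) e)

  base-simple : ∀ (A : Graph (suc n)) → IsSimple A → IsSimple (base A)
  base-simple A (sym′ , loop) =
    (λ i j e → subst T (≡.sym (adj-base A j i)) (sym′ _ _ (subst T (adj-base A i j) e))) ,
    (λ i e → loop (suc i) (subst T (adj-base A i i) e))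

  base-cone : ∀ (r : Vec Bool n) A → base (cone r A) ≡ A
  base-cone r A = adj-ext λ i j → ≡.trans (adj-base (cone r A) i j) (cone-suc-suc r A i j)

  cone-base : ∀ (A : Graph (suc n)) → IsSimple A → cone (apex-row A) (base A) ≡ A
  cone-base A s@(sym′ , loop) = adj-ext go
    where
    go : ∀ i j → adj (cone (apex-row A) (base A)) i j ≡ adj A i j
    go zero    zero    = T-ext (λ ()) (loop zero)
    go zero    (suc j) = lookup-apex-row A j
    go (suc i) zero    = ≡.trans (cone-suc-zero (apex-row A) (base A) i)
                           (≡.trans (lookup-apex-row A i) (symmetric A s zero (suc i)))
    go (suc i) (suc j) = ≡.trans (cone-suc-suc (apex-row A) (base A) i j) (adj-base A i j)

  module _ where
    open Enumeration.ListSum ℕ.+-*-commutativeSemiring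

    size-cone : ∀ (r : Vec Bool n) A → size (cone r A) ≡ ones r ℕ.+ size A
    size-cone {n} r A = begin
      size G
        ≡⟨ size-∑ G ⟩
      ∑ (allFin (suc n)) (λ i → ∑ (allFin (suc n)) λ j → e i j)
        ≡⟨ ∑-allFin-suc n (λ i → ∑ (allFin (suc n)) λ j → e i j) ⟩
      ∑ (allFin (suc n)) (λ j → e zero j) ℕ.+ ∑ (allFin n) (λ i → ∑ (allFin (suc n)) λ j → e (suc i) j)
        ≡⟨ cong₂ ℕ._+_
             (≡.trans (∑-allFin-suc n (e zero)) (≡.trans (∑-cong (allFin n) first) (count-ones r)))
             (∑-cong (allFin n) λ i → ≡.trans (∑-allFin-suc n (e (suc i))) (∑-cong (allFin n) (rest i))) ⟩
      ones r ℕ.+ ∑ (allFin n) (λ i → ∑ (allFin n) λ j → ⟦ edge? A i j ⟧)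
        ≡⟨ cong (ones r ℕ.+_) (size-∑ A) ⟨
      ones r ℕ.+ size A ∎
      where
      open ≡.≡-Reasoning
      G = cone r A
      e : Fin (suc n) → Fin (suc n) → ℕ
      e i j = ⟦ edge? G i j ⟧
      first : ∀ j → e zero (suc j) ≡ ⟦ Bool.T? (lookup r j) ⟧
      first j = ⟦⟧-cong (edge? G zero (suc j)) (Bool.T? (lookup r j)) proj₂ (ℕ.s≤s ℕ.z≤n ,_)
      rest : ∀ i j → e (suc i) (suc j) ≡ ⟦ edge? A i j ⟧
      rest i j = ⟦⟧-cong (edge? G (suc i) (suc j)) (edge? A i j)
        (λ (lt , a) → ℕ.s≤s⁻¹ lt , subst T (cone-suc-suc r A i j) a)
        (λ (lt , a) → ℕ.s≤s lt , subst T (≡.sym (cone-suc-suc r A i j)) a)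
      count-ones : ∀ {n} (r : Vec Bool n) → ∑ (allFin n) (λ j → ⟦ Bool.T? (lookup r j) ⟧) ≡ ones r
      count-ones []          = ≡.refl
      count-ones (true ∷ r)  = ≡.trans (∑-allFin-suc _ (λ j → ⟦ Bool.T? (lookup (true ∷ r) j) ⟧)) (cong suc (count-ones r))
      count-ones (false ∷ r) = ≡.trans (∑-allFin-suc _ (λ j → ⟦ Bool.T? (lookup (false ∷ r) j) ⟧)) (count-ones r)

  Proper : Graph n → Vec Bool n → Set
  Proper A s = ∀ i j → Adj A i j → lookup s i ≢ lookup s j

  proper? : ∀ (A : Graph n) s → Dec (Proper A s)
  proper? A s = Fin.all? λ i → Fin.all? λ j → adj? A i j →-dec ¬? (lookup s i Bool.≟ lookup s j)

  -- The neighbours r of the apex avoid the vertices on side b.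
  Avoids : Bool → Vec Bool n → Vec Bool n → Set
  Avoids b []      []      = ⊤
  Avoids b (q ∷ r) (c ∷ s) = (T q → b ≢ c) × Avoids b r s

  avoids? : ∀ b (r s : Vec Bool n) → Dec (Avoids b r s)
  avoids? b []      []      = yes tt
  avoids? b (q ∷ r) (c ∷ s) = (Bool.T? q →-dec ¬? (b Bool.≟ c)) ×-dec avoids? b r s

  avoids-lookup : ∀ b (r s : Vec Bool n) → Avoids b r s → ∀ j → T (lookup r j) → b ≢ lookup s j
  avoids-lookup b (q ∷ r) (c ∷ s) (p , _)  zero    = p
  avoids-lookup b (q ∷ r) (c ∷ s) (_ , ps) (suc j) = avoids-lookup b r s ps j

  lookup-avoids : ∀ b (r s : Vec Bool n) → (∀ j → T (lookup r j) → b ≢ lookup s j) → Avoids b r s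
  lookup-avoids b []      []      h = tt
  lookup-avoids b (q ∷ r) (c ∷ s) h = h zero , lookup-avoids b r s (h ∘ suc)

  proper-cone⇒ : ∀ (r : Vec Bool n) A b s → Proper (cone r A) (b ∷ s) → Avoids b r s × Proper A s
  proper-cone⇒ r A b s p = lookup-avoids b r s (λ j t → p zero (suc j) t) ,
    λ i j a → p (suc i) (suc j) (subst T (≡.sym (cone-suc-suc r A i j)) a)

  proper-cone⇐ : ∀ (r : Vec Bool n) A b s → Avoids b r s → Proper A s → Proper (cone r A) (b ∷ s)
  proper-cone⇐ r A b s av p zero    (suc j) a = avoids-lookup b r s av j a
  proper-cone⇐ r A b s av p (suc i) zero    a =
    avoids-lookup b r s av i (subst T (cone-suc-zero r A i) a) ∘ ≡.sym
  proper-cone⇐ r A b s av p (suc i) (suc j) a = p i j (subst T (cone-suc-suc r A i j) a)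

  module _ (R : CommutativeSemiring 0ℓ 0ℓ) where

    open CommutativeSemiring R hiding (zero)
    open Enumeration.ListSum R
    open ExponentialFormula.Formula R
    open import Algebra.Properties.Semiring.Exp semiring using (_^_; ^-homo-*; ^-congʳ)
    open import Algebra.Properties.CommutativeSemigroup *-commutativeSemigroup using (interchange)
    open import Relation.Binary.Reasoning.Setoid setoid

    ∑-cone : ∀ n (f : Graph (suc n) → Carrier) →
      ∑ (simpleGraphs (suc n)) f ≈ ∑ (allVecs bools n) λ r → ∑ (simpleGraphs n) λ A → f (cone r A)
    ∑-cone n f = begin
      ∑ (simpleGraphs (suc n)) f
        ≈⟨ ∑-filter isSimple? (allGraphs (suc n)) f ⟩
      ∑ (allGraphs (suc n)) (λ A → ⟦ isSimple? A ⟧ * f A)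
        ≈⟨ ∑-reindex (allGraphs (suc n)) pairs _≟ᵍ_ (Product.≡-dec _≟ʷ_ _≟ᵍ_) (Enumerates-graphs (suc n))
             (Enumerates-product (allVecs bools n) (allGraphs n) _≟ʷ_ _≟ᵍ_ (Enumerates-words n) (Enumerates-graphs n))
             isSimple? (λ rA → isSimple? (proj₂ rA)) (λ A → apex-row A , base A) (λ (r , A) → cone r A)
             (λ { A _ (s , ≡.refl) → base-simple A s , cone-base A s })
             (λ { _ (r , A) (s , ≡.refl) → cone-simple r A s , cong (r ,_) (base-cone r A) }) f ⟩
      ∑ pairs (λ (r , A) → ⟦ isSimple? A ⟧ * f (cone r A))
        ≈⟨ ∑-product _,_ (allVecs bools n) (allGraphs n) _ ⟩
      ∑ (allVecs bools n) (λ r → ∑ (allGraphs n) λ A → ⟦ isSimple? A ⟧ * f (cone r A))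
        ≈⟨ ∑-cong (allVecs bools n) (λ r → ∑-filter isSimple? (allGraphs n) (λ A → f (cone r A))) ⟨
      ∑ (allVecs bools n) (λ r → ∑ (simpleGraphs n) λ A → f (cone r A)) ∎
      where
      _≟ʷ_ = Vec.≡-dec Bool._≟_
      pairs = cartesianProduct (allVecs bools n) (allGraphs n)

    module _ (y : Carrier) where

      ∑-words : ∀ n → ∑ (allVecs bools n) (λ r → y ^ ones r) ≈ (1# + y) ^ n
      ∑-words zero    = +-identityʳ 1#
      ∑-words (suc n) = begin
        ∑ (allVecs bools (suc n)) (λ r → y ^ ones r)
          ≈⟨ ∑-product _∷_ bools (allVecs bools n) _ ⟩
        ∑ (allVecs bools n) (λ r → y * y ^ ones r) + (∑ (allVecs bools n) (λ r → y ^ ones r) + 0#)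
          ≈⟨ +-cong (sym (*-∑ (allVecs bools n) y _)) (+-identityʳ _) ⟩
        y * ∑ (allVecs bools n) (λ r → y ^ ones r) + ∑ (allVecs bools n) (λ r → y ^ ones r)
          ≈⟨ +-cong (*-congˡ (∑-words n)) (∑-words n) ⟩
        y * (1# + y) ^ n + (1# + y) ^ n
          ≈⟨ trans (+-comm _ _) (trans (+-congʳ (sym (*-identityˡ _))) (sym (distribʳ _ _ _))) ⟩
        (1# + y) * (1# + y) ^ n ∎

      other : Bool → Vec Bool n → ℕ
      other true  s = zeros s
      other false s = ones s

      -- Each vertex on the side opposite to the apex may or may not be a neighbour, a factor 1 + y;
      -- each vertex on the same side is excluded, a factor 1.
      ∑-avoiding-words : ∀ b (s : Vec Bool n) →
        ∑ (allVecs bools n) (λ r → ⟦ avoids? b r s ⟧ * y ^ ones r) ≈ (1# + y) ^ other b s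
      ∑-avoiding-words true  []      = trans (+-identityʳ _) (*-identityˡ _)
      ∑-avoiding-words false []      = trans (+-identityʳ _) (*-identityˡ _)
      ∑-avoiding-words {suc n} b (c ∷ s) = begin
        ∑ (allVecs bools (suc n)) (λ r → ⟦ avoids? b r (c ∷ s) ⟧ * y ^ ones r)
          ≈⟨ ∑-product _∷_ bools (allVecs bools n) _ ⟩
        ∑ ws (λ r → ⟦ avoids? b (true ∷ r) (c ∷ s) ⟧ * (y * y ^ ones r)) +
        (∑ ws (λ r → ⟦ avoids? b (false ∷ r) (c ∷ s) ⟧ * y ^ ones r) + 0#)
          ≈⟨ +-cong
               (trans (∑-cong ws λ r → trans (*-congʳ (⟦⟧-× (Bool.T? true →-dec ¬? (b Bool.≟ c)) (avoids? b r s)))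
                         (interchange _ _ _ _))
                      (sym (*-∑ ws _ _)))
               (trans (+-identityʳ _) (∑-cong ws λ r → *-congʳ (⟦⟧-cong (avoids? b (false ∷ r) (c ∷ s)) (avoids? b r s)
                 proj₂ ((λ ()) ,_)))) ⟩
        ⟦ Bool.T? true →-dec ¬? (b Bool.≟ c) ⟧ * y * Z + Z
          ≈⟨ trans (+-congˡ (sym (*-identityˡ Z))) (sym (distribʳ _ _ _)) ⟩
        (⟦ Bool.T? true →-dec ¬? (b Bool.≟ c) ⟧ * y + 1#) * Z
          ≈⟨ *-congˡ (∑-avoiding-words b s) ⟩
        (⟦ Bool.T? true →-dec ¬? (b Bool.≟ c) ⟧ * y + 1#) * (1# + y) ^ other b s
          ≈⟨ finish b c ⟩
        (1# + y) ^ other b (c ∷ s) ∎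
        where
        ws = allVecs bools n
        Z = ∑ ws (λ r → ⟦ avoids? b r s ⟧ * y ^ ones r)
        unequal : (1# * y + 1#) ≈ 1# + y
        unequal = trans (+-comm _ _) (+-congˡ (*-identityˡ y))
        equal : (0# * y + 1#) ≈ 1#
        equal = trans (+-congʳ (zeroˡ y)) (+-identityˡ 1#)
        finish : ∀ b c → (⟦ Bool.T? true →-dec ¬? (b Bool.≟ c) ⟧ * y + 1#) * (1# + y) ^ other b s ≈ (1# + y) ^ other b (c ∷ s)
        finish true  true  = trans (*-congʳ equal) (*-identityˡ _)
        finish true  false = *-congʳ unequal
        finish false true  = *-congʳ unequal
        finish false false = trans (*-congʳ equal) (*-identityˡ _)

      -- A new apex adds n possible edges, and n + C(n, 2) = C(n + 1, 2).
      ∑-simple-graphs : ∀ n → ∑ (simpleGraphs n) (λ A → y ^ size A) ≈ (1# + y) ^ (n C 2)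
      ∑-simple-graphs zero    = +-identityʳ 1#
      ∑-simple-graphs (suc n) = begin
        ∑ (simpleGraphs (suc n)) (λ A → y ^ size A)
          ≈⟨ ∑-cone n _ ⟩
        ∑ (allVecs bools n) (λ r → ∑ (simpleGraphs n) λ A → y ^ size (cone r A))
          ≈⟨ ∑-cong (allVecs bools n) (λ r → trans
               (∑-cong (simpleGraphs n) λ A → trans (^-congʳ y (size-cone r A)) (^-homo-* y (ones r) (size A)))
               (sym (*-∑ (simpleGraphs n) _ _))) ⟩
        ∑ (allVecs bools n) (λ r → y ^ ones r * ∑ (simpleGraphs n) λ A → y ^ size A)
          ≈⟨ ∑-* (allVecs bools n) _ _ ⟨
        ∑ (allVecs bools n) (λ r → y ^ ones r) * ∑ (simpleGraphs n) (λ A → y ^ size A)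
          ≈⟨ *-cong (∑-words n) (∑-simple-graphs n) ⟩
        (1# + y) ^ n * (1# + y) ^ (n C 2)
          ≈⟨ ^-homo-* (1# + y) n (n C 2) ⟨
        (1# + y) ^ (n ℕ.+ n C 2)
          ≈⟨ ^-congʳ (1# + y) (≡.trans (cong (ℕ._+ n C 2) (≡.sym (nC1≡n n))) (nCk+nC[k+1]≡[n+1]C[k+1] n 1)) ⟩
        (1# + y) ^ (suc n C 2) ∎

      -- With the sides fixed, the possible edges are the pairs across them. A new apex adds one
      -- pair for every vertex of the other side.
      ∑-properly-coloured : ∀ (s : Vec Bool n) →
        ∑ (simpleGraphs n) (λ A → ⟦ proper? A s ⟧ * y ^ size A) ≈ (1# + y) ^ (ones s ℕ.* zeros s)
      ∑-properly-coloured []      = trans (+-identityʳ _) (*-identityˡ _)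
      ∑-properly-coloured {suc n} (b ∷ s) = begin
        ∑ (simpleGraphs (suc n)) (λ A → ⟦ proper? A (b ∷ s) ⟧ * y ^ size A)
          ≈⟨ ∑-cone n _ ⟩
        ∑ ws (λ r → ∑ (simpleGraphs n) λ A → ⟦ proper? (cone r A) (b ∷ s) ⟧ * y ^ size (cone r A))
          ≈⟨ ∑-cong ws (λ r → trans
               (∑-cong (simpleGraphs n) λ A → trans
                 (*-cong (trans (⟦⟧-cong (proper? (cone r A) (b ∷ s)) (avoids? b r s ×-dec proper? A s)
                                  (proper-cone⇒ r A b s) (λ (av , p) → proper-cone⇐ r A b s av p))
                                (⟦⟧-× (avoids? b r s) (proper? A s)))
                         (trans (^-congʳ y (size-cone r A)) (^-homo-* y (ones r) (size A))))
                 (interchange _ _ _ _))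
               (sym (*-∑ (simpleGraphs n) _ _))) ⟩
        ∑ ws (λ r → ⟦ avoids? b r s ⟧ * y ^ ones r * ∑ (simpleGraphs n) λ A → ⟦ proper? A s ⟧ * y ^ size A)
          ≈⟨ ∑-* ws _ _ ⟨
        ∑ ws (λ r → ⟦ avoids? b r s ⟧ * y ^ ones r) * ∑ (simpleGraphs n) (λ A → ⟦ proper? A s ⟧ * y ^ size A)
          ≈⟨ *-cong (∑-avoiding-words b s) (∑-properly-coloured s) ⟩
        (1# + y) ^ other b s * (1# + y) ^ (ones s ℕ.* zeros s)
          ≈⟨ ^-homo-* (1# + y) (other b s) (ones s ℕ.* zeros s) ⟨
        (1# + y) ^ (other b s ℕ.+ ones s ℕ.* zeros s)
          ≈⟨ ^-congʳ (1# + y) (pairs b) ⟩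
        (1# + y) ^ (ones (b ∷ s) ℕ.* zeros (b ∷ s)) ∎
        where
        ws = allVecs bools n
        pairs : ∀ b → other b s ℕ.+ ones s ℕ.* zeros s ≡ ones (b ∷ s) ℕ.* zeros (b ∷ s)
        pairs true  = ≡.refl
        pairs false = ≡.sym (ℕ.*-suc (ones s) (zeros s))

-- Central colourings of connected graphs.

module ConnectedGraphs where

  open import Defs
  open import Data.Bool.Base using (Bool; true; false; not; if_then_else_)
  import Data.Bool.Properties as Bool
  open import Data.Empty using (⊥-elim)
  open import Data.Fin.Base as Fin using (Fin; zero; suc)
  import Data.Fin.Properties as Fin
  open import Data.Fin.Subset as Subset using (Subset)
  import Data.Fin.Subset.Properties as Subset
  open import Data.Nat.Base as ℕ using (ℕ; zero; suc)
  import Data.Nat.Properties as ℕ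
  open import Data.Product.Base using (∃; _×_; _,_; proj₁; proj₂)
  open import Data.Rational.Base as ℚ using (ℚ; 0ℚ; 1ℚ; ½)
  import Data.Rational.Properties as ℚ
  open import Data.Rational.Solver using (module +-*-Solver)
  open import Data.Sum.Base using (_⊎_; inj₁; inj₂)
  open import Data.Unit.Base using (⊤; tt)
  open import Data.Vec.Base as Vec using (Vec; []; _∷_; lookup; replicate)
  import Data.Vec.Properties as Vec
  open import Data.Vec.Functional using (Vector)
  open import Function.Base using (_∘_)
  open import Relation.Binary.Construct.Closure.ReflexiveTransitive using (ε; _◅_)
  open import Relation.Binary.Definitions using (DecidableEquality)
  open import Relation.Binary.PropositionalEquality hiding (J)
  open import Relation.Nullary using (¬_; Dec; yes; no; does)
  open import Relation.Nullary.Decidable using (_×-dec_; ¬?; decidable-stable)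
  open GraphJoin
  open Shuffle
  open JoinInvariants
  open Counting
  open ColouredGraph

  private variable
    n : ℕ

  _≟ᵏ_ : DecidableEquality Colour
  𝟎 ≟ᵏ 𝟎 = yes refl
  𝟎 ≟ᵏ 𝟏 = no λ ()
  𝟎 ≟ᵏ ∗ = no λ ()
  𝟏 ≟ᵏ 𝟎 = no λ ()
  𝟏 ≟ᵏ 𝟏 = yes refl
  𝟏 ≟ᵏ ∗ = no λ ()
  ∗ ≟ᵏ 𝟎 = no λ ()
  ∗ ≟ᵏ 𝟏 = no λ ()
  ∗ ≟ᵏ ∗ = yes refl

  _≟ᶜ_ : DecidableEquality (Vec Colour n)
  _≟ᶜ_ = Vec.≡-dec _≟ᵏ_

  stars : Vec Colour n
  stars = replicate _ ∗

  stars-colour : ∀ (i : Fin n) → lookup stars i ≡ ∗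
  stars-colour i = Vec.lookup-replicate i ∗

  all-nonColoured : ∀ (ks : Vec Colour n) → (∀ i → lookup ks i ≡ ∗) → stars ≡ ks
  all-nonColoured ks h = lookup-ext λ i → trans (stars-colour i) (sym (h i))

  coloured-vertex : ∀ (ks : Vec Colour n) → stars ≢ ks → ∃ λ i → lookup ks i ≢ ∗
  coloured-vertex ks ≢ks with Fin.any? (λ i → ¬? (lookup ks i ≟ᵏ ∗))
  ... | yes p    = p
  ... | no none = ⊥-elim (≢ks (all-nonColoured ks λ i →
    decidable-stable (lookup ks i ≟ᵏ ∗) (λ neq → none (i , neq))))

  stars-uncoloured : ∀ n → colouredVertices (stars {n}) ≡ 0
  stars-uncoloured zero    = refl
  stars-uncoloured (suc n) = stars-uncoloured n

  walk-nonIsolated : ∀ (A : Graph n) {i j} → Reachable A i j → i ≢ j → NonIsolated A i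
  walk-nonIsolated A ε       i≢i = ⊥-elim (i≢i refl)
  walk-nonIsolated A (a ◅ _) _   = _ , a

  -- The sides `false` and `true` stand for the values 0 and 1 of a point in the intersection, so a
  -- coloured vertex prescribes its side and a non-coloured one leaves it open.
  Match : Bool → Colour → Set
  Match b 𝟎 = b ≡ false
  Match b 𝟏 = b ≡ true
  Match b ∗ = ⊤

  match? : ∀ b k → Dec (Match b k)
  match? b 𝟎 = b Bool.≟ false
  match? b 𝟏 = b Bool.≟ true
  match? b ∗ = yes tt

  Compatible : Vec Bool n → Vec Colour n → Set
  Compatible []      []       = ⊤
  Compatible (b ∷ s) (k ∷ ks) = Match b k × Compatible s ks

  compatible? : ∀ (s : Vec Bool n) ks → Dec (Compatible s ks)
  compatible? []      []       = yes tt
  compatible? (b ∷ s) (k ∷ ks) = match? b k ×-dec compatible? s ks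

  compatible-lookup : ∀ (s : Vec Bool n) ks → Compatible s ks → ∀ i → Match (lookup s i) (lookup ks i)
  compatible-lookup (b ∷ s) (k ∷ ks) (m , _) zero    = m
  compatible-lookup (b ∷ s) (k ∷ ks) (_ , c) (suc i) = compatible-lookup s ks c i

  lookup-compatible : ∀ (s : Vec Bool n) ks → (∀ i → Match (lookup s i) (lookup ks i)) → Compatible s ks
  lookup-compatible []      []       h = tt
  lookup-compatible (b ∷ s) (k ∷ ks) h = h zero , lookup-compatible s ks (h ∘ suc)

  stars-compatible : ∀ (s : Vec Bool n) → Compatible s stars
  stars-compatible []      = tt
  stars-compatible (b ∷ s) = tt , stars-compatible s

  -- The point with all coordinates ½ lies on every hyperplane of an edge.
  stars-central : (A : Graph n) → Central (colouredGraph A stars)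
  stars-central A = solution⇒central (colouredGraph A stars) ((λ _ → ½) , record
    { edge = λ i j a → refl
    ; colour-𝟎 = λ i eq → ⊥-elim (∗≢𝟎 (trans (sym (stars-colour i)) eq))
    ; colour-𝟏 = λ i eq → ⊥-elim (∗≢𝟏 (trans (sym (stars-colour i)) eq)) })
    where
    ∗≢𝟎 : ∗ ≢ 𝟎
    ∗≢𝟎 ()
    ∗≢𝟏 : ∗ ≢ 𝟏
    ∗≢𝟏 ()

  -- Both colourings flip along an edge, so agreement propagates; on a connected graph a proper
  -- 2-colouring is thus determined by its value at one vertex.
  proper-walk : ∀ (A : Graph n) s s′ → Proper A s → Proper A s′ → ∀ {i j} → Reachable A i j →
                lookup s i ≡ lookup s′ i → lookup s j ≡ lookup s′ j
  proper-walk A s s′ p p′ ε                     eq = eq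
  proper-walk A s s′ p p′ {i} (_◅_ {j = k} a w) eq = proper-walk A s s′ p p′ w (begin
    lookup s k         ≡⟨ Bool.¬-not (p i k a ∘ sym) ⟩
    not (lookup s i)   ≡⟨ cong not eq ⟩
    not (lookup s′ i)  ≡⟨ Bool.¬-not (p′ i k a ∘ sym) ⟨
    lookup s′ k        ∎)
    where open ≡-Reasoning

  proper-unique : ∀ (A : Graph n) s s′ → Connected A → Proper A s → Proper A s′ →
                  ∀ i → lookup s i ≡ lookup s′ i → s ≡ s′
  proper-unique A s s′ conn p p′ i eq = lookup-ext λ j → proper-walk A s s′ p p′ (conn i j) eq

  proper⇒bipartite : (A : Graph n) → ∃ (Proper A) → Bipartite A
  proper⇒bipartite A (s , p) = s , λ i _ j _ → p i j

  bipartite⇒proper : (A : Graph n) → Bipartite A → ∃ (Proper A)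
  bipartite⇒proper A (s , p) = s , λ i j → p i Subset.∈⊤ j Subset.∈⊤

  proper-not : ∀ (A : Graph n) s → Proper A s → Proper A (Vec.map not s)
  proper-not A s p i j a eq = p i j a (Bool.not-injective (trans (sym (Vec.lookup-map i not s))
    (trans eq (Vec.lookup-map j not s))))

  -- Either a given proper colouring or its complement has the prescribed value.
  proper-with : ∀ (A : Graph n) → Bipartite A → ∀ i b → ∃ λ s → Proper A s × lookup s i ≡ b
  proper-with A bip i b with bipartite⇒proper A bip
  ... | s , p with lookup s i Bool.≟ b
  ...   | yes eq = s , p , eq
  ...   | no neq = Vec.map not s , proper-not A s p , trans (Vec.lookup-map i not s) (sym (Bool.¬-not (neq ∘ sym)))

  module _ (A : Graph n) (simple : IsSimple A) (conn : Connected A) (ks : Vec Colour n) (coloured : stars ≢ ks) where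

    private
      G = colouredGraph A ks
      v = proj₁ (coloured-vertex ks coloured)
      v-coloured = proj₂ (coloured-vertex ks coloured)

      bit : ℚ → Bool
      bit q = does (q ℚ.≟ 1ℚ)

      module _ (x : Vector ℚ n) (sol : Solution G x) where

        -- An edge replaces the value q by 1 - q. One coloured vertex therefore makes the whole
        -- solution on a connected graph 0-1-valued, and its values form a proper 2-colouring.
        0-or-1 : ∀ {i j} → Reachable A i j → x i ≡ 0ℚ ⊎ x i ≡ 1ℚ → x j ≡ 0ℚ ⊎ x j ≡ 1ℚ
        0-or-1 ε       h = h
        0-or-1 {i} (_◅_ {j = k} a w) h = 0-or-1 w (step h)
          where
          open +-*-Solver
          other-end : x k ≡ 1ℚ ℚ.- x i
          other-end = trans (solve 2 (λ s t → t := (s :+ t) :- s) refl (x i) (x k)) (cong (λ q → q ℚ.- x i) (Solution.edge sol i k a))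
          step : x i ≡ 0ℚ ⊎ x i ≡ 1ℚ → x k ≡ 0ℚ ⊎ x k ≡ 1ℚ
          step (inj₁ eq) = inj₂ (trans other-end (cong (λ q → 1ℚ ℚ.- q) eq))
          step (inj₂ eq) = inj₁ (trans other-end (cong (λ q → 1ℚ ℚ.- q) eq))

        integral : ∀ i → x i ≡ 0ℚ ⊎ x i ≡ 1ℚ
        integral i = 0-or-1 (conn v i) start
          where
          start : x v ≡ 0ℚ ⊎ x v ≡ 1ℚ
          start with lookup ks v in eq
          ... | 𝟎 = inj₁ (Solution.colour-𝟎 sol v eq)
          ... | 𝟏 = inj₂ (Solution.colour-𝟏 sol v eq)
          ... | ∗ = ⊥-elim (v-coloured eq)

        sideᵛ : Vec Bool n
        sideᵛ = Vec.tabulate (bit ∘ x)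

        side-proper : Proper A sideᵛ
        side-proper i j a eq = differ (integral i) (integral j)
          (trans (sym (Vec.lookup∘tabulate (bit ∘ x) i)) (trans eq (Vec.lookup∘tabulate (bit ∘ x) j)))
          where
          sum1 = Solution.edge sol i j a
          differ : x i ≡ 0ℚ ⊎ x i ≡ 1ℚ → x j ≡ 0ℚ ⊎ x j ≡ 1ℚ → bit (x i) ≢ bit (x j)
          differ (inj₁ p) (inj₁ q) _ with trans (sym sum1) (cong₂ ℚ._+_ p q)
          ... | ()
          differ (inj₂ p) (inj₂ q) _ with trans (sym sum1) (cong₂ ℚ._+_ p q)
          ... | ()
          differ (inj₁ p) (inj₂ q) e with trans (sym (cong bit p)) (trans e (cong bit q))
          ... | ()
          differ (inj₂ p) (inj₁ q) e with trans (sym (cong bit p)) (trans e (cong bit q))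
          ... | ()

        side-compatible : Compatible sideᵛ ks
        side-compatible = lookup-compatible sideᵛ ks λ i →
          subst (λ b → Match b (lookup ks i)) (sym (Vec.lookup∘tabulate (bit ∘ x) i)) (matches i)
          where
          matches : ∀ i → Match (bit (x i)) (lookup ks i)
          matches i with lookup ks i in eq
          ... | 𝟎 = cong bit (Solution.colour-𝟎 sol i eq)
          ... | 𝟏 = cong bit (Solution.colour-𝟏 sol i eq)
          ... | ∗ = tt

    central⇒side : Central G → ∃ λ s → Proper A s × Compatible s ks
    central⇒side c with central⇒solution G simple c
    ... | x , sol = sideᵛ x sol , side-proper x sol , side-compatible x sol

    side⇒central : (∃ λ s → Proper A s × Compatible s ks) → Central G
    side⇒central (s , p , comp) = solution⇒central G (x , record
      { edge = λ i j a → edge′ (p i j a)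
      ; colour-𝟎 = λ i eq → cong value (subst (Match (lookup s i)) eq (compatible-lookup s ks comp i))
      ; colour-𝟏 = λ i eq → cong value (subst (Match (lookup s i)) eq (compatible-lookup s ks comp i)) })
      where
      value : Bool → ℚ
      value b = if b then 1ℚ else 0ℚ
      x : Vector ℚ n
      x i = value (lookup s i)
      edge′ : ∀ {b c} → b ≢ c → value b ℚ.+ value c ≡ 1ℚ
      edge′ {true}  {true}  b≢c = ⊥-elim (b≢c refl)
      edge′ {true}  {false} b≢c = refl
      edge′ {false} {true}  b≢c = refl
      edge′ {false} {false} b≢c = ⊥-elim (b≢c refl)

    -- The coloured vertex fixes its side and hence all sides. So a coloured connected graph is
    -- central exactly when the number of compatible proper 2-colourings is 1, the alternative being
    -- 0.
    side-unique : ∀ s s′ → Proper A s × Compatible s ks → Proper A s′ × Compatible s′ ks → s ≡ s′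
    side-unique s s′ (p , c) (p′ , c′) = proper-unique A s s′ conn p p′ v
      (agree (lookup ks v) v-coloured (compatible-lookup s ks c v) (compatible-lookup s′ ks c′ v))
      where
      agree : ∀ k → k ≢ ∗ → ∀ {b b′} → Match b k → Match b′ k → b ≡ b′
      agree 𝟎 _ eq eq′ = trans eq (sym eq′)
      agree 𝟏 _ eq eq′ = trans eq (sym eq′)
      agree ∗ k≢∗ _ _  = ⊥-elim (k≢∗ refl)

    coloured-noIsolated : NoIsolatedNonColoured G
    coloured-noIsolated i non = walk-nonIsolated A (conn i v) λ { refl → v-coloured non }

  module _ where
    open Enumeration.ListSum ℕ.+-*-commutativeSemiring
    open ExponentialFormula.Formula ℕ.+-*-commutativeSemiring

    -- The only component is the full vertex set, so ν is 1 or 0 according to whether the graph is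
    -- bipartite and entirely non-coloured. The order is positive because a component must be
    -- nonempty.
    connected-bipartiteComponents : (A : Graph (suc n)) (ks : Vec Colour (suc n)) → Connected A →
      bipartiteComponents (colouredGraph A ks) ≡ ⟦ bipartite? A ×-dec (stars ≟ᶜ ks) ⟧
    connected-bipartiteComponents {n} A ks conn = begin
      bipartiteComponents G
        ≡⟨ count-∑ (bipartiteComponent? G) (allVecs bools (suc n)) ⟩
      ∑ (allVecs bools (suc n)) (λ S → ⟦ bipartiteComponent? G S ⟧)
        ≡⟨ ∑-cong (allVecs bools (suc n)) (λ S → trans
             (⟦⟧-cong (bipartiteComponent? G S) ((Subset.⊤ ≟ˢ S) ×-dec bipartiteComponent? G S)
               (λ bc → full S (proj₁ bc) , bc) proj₂)
             (⟦⟧-× (Subset.⊤ ≟ˢ S) (bipartiteComponent? G S))) ⟩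
      ∑ (allVecs bools (suc n)) (λ S → ⟦ Subset.⊤ ≟ˢ S ⟧ ℕ.* ⟦ bipartiteComponent? G S ⟧)
        ≡⟨ ∑-pick (allVecs bools (suc n)) (Enumerates-words (suc n)) Subset.⊤ (Subset.⊤ ≟ˢ_) (λ S → ⟦ bipartiteComponent? G S ⟧) ⟩
      ⟦ bipartiteComponent? G Subset.⊤ ⟧
        ≡⟨ ⟦⟧-cong (bipartiteComponent? G Subset.⊤) (bipartite? A ×-dec (stars ≟ᶜ ks)) ⇒ ⇐ ⟩
      ⟦ bipartite? A ×-dec (stars ≟ᶜ ks) ⟧ ∎
      where
      open ≡-Reasoning
      G = colouredGraph A ks
      _≟ˢ_ : ∀ (S S′ : Subset (suc n)) → Dec (S ≡ S′)
      _≟ˢ_ = Vec.≡-dec Bool._≟_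
      full : ∀ S → IsComponent A S → Subset.⊤ ≡ S
      full S ((i , i∈) , comp) = lookup-ext λ j → trans (Vec.[]=⇒lookup (Subset.∈⊤ {x = j}))
        (sym (Vec.[]=⇒lookup (proj₂ (comp i i∈ j) (conn i j))))
      ⇒ : BipartiteComponent G Subset.⊤ → Bipartite A × stars ≡ ks
      ⇒ (_ , bip , non) = bip , all-nonColoured ks (λ i → non i Subset.∈⊤)
      ⇐ : Bipartite A × stars ≡ ks → BipartiteComponent G Subset.⊤
      ⇐ (bip , refl) = ((zero , Subset.∈⊤) , λ i _ j → (λ _ → conn i j) , (λ _ → Subset.∈⊤)) , bip ,
        λ i _ → stars-colour i

    bipartiteComponents-bipartite : (A : Graph (suc n)) → Connected A → Bipartite A →
      bipartiteComponents (colouredGraph A stars) ≡ 1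
    bipartiteComponents-bipartite {n} A conn bip = trans (connected-bipartiteComponents A stars conn)
      (⟦⟧-yes (bipartite? A ×-dec (stars {suc n} ≟ᶜ stars)) (bip , refl))

    bipartiteComponents-nonBipartite : (A : Graph (suc n)) → Connected A → ¬ Bipartite A → ∀ ks →
      bipartiteComponents (colouredGraph A ks) ≡ 0
    bipartiteComponents-nonBipartite A conn ¬bip ks = trans (connected-bipartiteComponents A ks conn)
      (⟦⟧-no (bipartite? A ×-dec (stars ≟ᶜ ks)) (¬bip ∘ proj₁))

    bipartiteComponents-coloured : (A : Graph (suc n)) → Connected A → ∀ ks → stars ≢ ks →
      bipartiteComponents (colouredGraph A ks) ≡ 0
    bipartiteComponents-coloured A conn ks ≢ks = trans (connected-bipartiteComponents A ks conn)
      (⟦⟧-no (bipartite? A ×-dec (stars ≟ᶜ ks)) (≢ks ∘ proj₂))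

-- Multiplicative weights and their sums over connected graphs.

module Weights where

  open import Defs
  open import Algebra.Bundles using (CommutativeRing)
  import Algebra.Properties.Ring as RingProperties
  open import Data.Bool.Base using (Bool; true; false; T)
  import Data.Bool.Properties as Bool
  open import Data.Fin.Base as Fin using (Fin; zero; suc)
  import Data.Fin.Properties as Fin
  open import Data.List.Base as List using (List; []; _∷_)
  open import Data.Nat.Base as ℕ using (ℕ; zero; suc)
  open import Data.Nat.Combinatorics using (_C_)
  import Data.Nat.Properties as ℕ
  open import Data.Product.Base using (_×_; _,_)
  open import Data.Unit.Base using (⊤; tt)
  open import Data.Vec.Base as Vec using (Vec; []; _∷_; lookup)
  import Data.Vec.Properties as Vec
  open import Level using (0ℓ)
  open import Relation.Binary.PropositionalEquality as ≡ using (_≡_; _≢_; cong; subst)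
  open import Relation.Nullary using (¬_; Dec; yes; no)
  open import Relation.Nullary.Decidable using (_×-dec_; _→-dec_; ¬?)
  open import Relation.Unary using (Pred; Decidable)
  open GraphJoin
  open Shuffle
  open Arrangements using (rank+bipartiteComponents)
  open JoinInvariants hiding (count-∑)
  open Counting
  open ConnectedGraphs
  open ColouredGraph

  colours : List Colour
  colours = 𝟎 ∷ 𝟏 ∷ ∗ ∷ []

  noIsolated? : ∀ {n} (G : ColouredGraph n) → Dec (NoIsolatedNonColoured G)
  noIsolated? G = Fin.all? λ i → nonColoured? G i →-dec nonIsolated? (graph G) i

  module Weighted (R : CommutativeRing 0ℓ 0ℓ) (x y z : CommutativeRing.Carrier R) where

    open CommutativeRing R hiding (zero; _-_)
    open CommutativeRing R using (_-_)
    open RingProperties ring using (+-cancelˡ)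
    open Enumeration.ListSum commutativeSemiring
    open ExponentialFormula.Formula commutativeSemiring
    open import Algebra.Properties.Semiring.Exp semiring using (_^_; ^-homo-*; ^-congʳ)
    open import Algebra.Properties.CommutativeSemigroup *-commutativeSemigroup using (interchange; x∙yz≈y∙xz)
    open import Relation.Binary.Reasoning.Setoid setoid

    private variable
      n : ℕ

    monomial : ℕ → ℕ → ℕ → Carrier
    monomial a b c = x ^ a * (y ^ b * z ^ c)

    monomial-cong : ∀ {a a′ b b′ c c′} → a ≡ a′ → b ≡ b′ → c ≡ c′ → monomial a b c ≈ monomial a′ b′ c′
    monomial-cong ≡.refl ≡.refl ≡.refl = refl

    monomial-* : ∀ a b c a′ b′ c′ →
      monomial (a ℕ.+ a′) (b ℕ.+ b′) (c ℕ.+ c′) ≈ monomial a b c * monomial a′ b′ c′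
    monomial-* a b c a′ b′ c′ = begin
      x ^ (a ℕ.+ a′) * (y ^ (b ℕ.+ b′) * z ^ (c ℕ.+ c′))
        ≈⟨ *-cong (^-homo-* x a a′) (*-cong (^-homo-* y b b′) (^-homo-* z c c′)) ⟩
      (x ^ a * x ^ a′) * ((y ^ b * y ^ b′) * (z ^ c * z ^ c′))
        ≈⟨ *-congˡ (interchange _ _ _ _) ⟩
      (x ^ a * x ^ a′) * ((y ^ b * z ^ c) * (y ^ b′ * z ^ c′))
        ≈⟨ interchange _ _ _ _ ⟩
      monomial a b c * monomial a′ b′ c′ ∎

    -- The trivial labels make counting graphs an instance of the exponential formula for labelled
    -- graphs; `sideWeight` uses sides and `centralWeight` colours as labels.
    plainWeight : Graph n → Vec ⊤ n → Carrier
    plainWeight {n} A _ = monomial n (size A) 0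

    sideWeight : Graph n → Vec Bool n → Carrier
    sideWeight {n} A s = ⟦ proper? A s ⟧ * monomial n (size A) 0

    guarded : ∀ {P Q : Set} → Dec P → Dec Q → ℕ → ℕ → ℕ → Carrier
    guarded p q a b c = ⟦ p ⟧ * (⟦ q ⟧ * monomial a b c)

    guarded-yes : ∀ {P Q : Set} (p : Dec P) (q : Dec Q) {a b c} → P → guarded p q a b c ≈ ⟦ q ⟧ * monomial a b c
    guarded-yes p q {a} {b} {c} hp = trans (*-congʳ (⟦⟧-yes p hp)) (*-identityˡ _)

    central? : (G : ColouredGraph n) → Dec (Central G)
    central? G = hasCommonPoint? (arrangement G)

    centralWeight : Graph n → Vec Colour n → Carrier
    centralWeight A ks = guarded (noIsolated? (colouredGraph A ks)) (central? (colouredGraph A ks)) (rank (colouredGraph A ks)) (cardinality (colouredGraph A ks)) (bipartiteComponents (colouredGraph A ks))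

    size-monomial : ∀ (τ : Vec Bool n) A B →
      monomial n (size (join τ A B)) 0 ≈ monomial (ones τ) (size A) 0 * monomial (zeros τ) (size B) 0
    size-monomial τ A B = trans (monomial-cong {c = 0} {c′ = 0} (≡.sym (ones+zeros τ)) (size-join τ A B) ≡.refl)
      (monomial-* (ones τ) (size A) 0 (zeros τ) (size B) 0)

    plainWeight-multiplicative : Multiplicative (tt ∷ []) plainWeight
    plainWeight-multiplicative τ A B _ _ u v = size-monomial τ A B

    proper-join⇒ : ∀ (τ : Vec Bool n) A B u v → Proper (join τ A B) (merge τ u v) → Proper A u × Proper B v
    proper-join⇒ τ A B u v p =
      (λ i j a eq → p (ι₁ τ i) (ι₁ τ j) (subst T (≡.sym (join₁₁ τ A B i j)) a)
        (≡.trans (lookup-merge₁ τ u v i) (≡.trans eq (≡.sym (lookup-merge₁ τ u v j))))) ,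
      (λ i j a eq → p (ι₂ τ i) (ι₂ τ j) (subst T (≡.sym (join₂₂ τ A B i j)) a)
        (≡.trans (lookup-merge₂ τ u v i) (≡.trans eq (≡.sym (lookup-merge₂ τ u v j)))))

    proper-join⇐ : ∀ (τ : Vec Bool n) A B u v → Proper A u → Proper B v → Proper (join τ A B) (merge τ u v)
    proper-join⇐ τ A B u v p q i j a eq with position τ i | position τ j
    ... | left i′  | left j′  = p i′ j′ (subst T (join₁₁ τ A B i′ j′) a)
      (≡.trans (≡.sym (lookup-merge₁ τ u v i′)) (≡.trans eq (lookup-merge₁ τ u v j′)))
    ... | right i′ | right j′ = q i′ j′ (subst T (join₂₂ τ A B i′ j′) a)
      (≡.trans (≡.sym (lookup-merge₂ τ u v i′)) (≡.trans eq (lookup-merge₂ τ u v j′)))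
    ... | left i′  | right j′ = subst T (join₁₂ τ A B i′ j′) a
    ... | right i′ | left j′  = subst T (join₂₁ τ A B i′ j′) a

    sideWeight-multiplicative : Multiplicative bools sideWeight
    sideWeight-multiplicative τ A B _ _ u v = trans
      (*-cong (trans (⟦⟧-cong (proper? (join τ A B) (merge τ u v)) (proper? A u ×-dec proper? B v)
                       (proper-join⇒ τ A B u v) (λ (p , q) → proper-join⇐ τ A B u v p q))
                     (⟦⟧-× (proper? A u) (proper? B v)))
              (size-monomial τ A B))
      (interchange _ _ _ _)

    centralWeight-multiplicative : Multiplicative colours centralWeight
    centralWeight-multiplicative τ A B sA sB u v = begin
      centralWeight (join τ A B) (merge τ u v)
        ≈⟨ *-cong
             (trans (⟦⟧-cong (noIsolated? G) (noIsolated? G₁ ×-dec noIsolated? G₂)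
                      (noIsolated-join⇒ τ A B u v) (λ (p , q) → noIsolated-join⇐ τ A B u v p q))
                    (⟦⟧-× (noIsolated? G₁) (noIsolated? G₂)))
             (*-cong
               (trans (⟦⟧-cong (central? G) (central? G₁ ×-dec central? G₂)
                        (central-join⇒ τ A B u v sA sB) (λ (p , q) → central-join⇐ τ A B u v sA sB p q))
                      (⟦⟧-× (central? G₁) (central? G₂)))
               (trans (monomial-cong (rank-join τ A B u v sA sB) (cardinality-join τ A B u v)
                                     (bipartiteComponents-join τ A B u v))
                      (monomial-* (rank G₁) (cardinality G₁) (bipartiteComponents G₁)
                                  (rank G₂) (cardinality G₂) (bipartiteComponents G₂)))) ⟩
      (⟦ noIsolated? G₁ ⟧ * ⟦ noIsolated? G₂ ⟧) * ((⟦ central? G₁ ⟧ * ⟦ central? G₂ ⟧) * (m G₁ * m G₂))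
        ≈⟨ trans (*-congˡ (interchange _ _ _ _)) (interchange _ _ _ _) ⟩
      centralWeight A u * centralWeight B v ∎
      where
      G  = colouredGraph (join τ A B) (merge τ u v)
      G₁ = colouredGraph A u
      G₂ = colouredGraph B v
      m : ∀ {n} → ColouredGraph n → Carrier
      m G = monomial (rank G) (cardinality G) (bipartiteComponents G)

    ∑-unique : ∀ {A : Set} (xs : List A) → Enumerates xs → (∀ (a b : A) → Dec (a ≡ b)) →
               ∀ {P : Pred A 0ℓ} (P? : Decidable P) a → P a → (∀ b → P b → a ≡ b) → ∑ xs (λ b → ⟦ P? b ⟧) ≈ 1#
    ∑-unique xs enum _≟_ {P} P? a pa unique = trans
      (∑-cong xs λ b → ⟦⟧-cong (P? b) (a ≟ b) (unique b) λ { ≡.refl → pa }) (enum a (a ≟_))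

    ∑-split : ∀ {A : Set} (xs : List A) {P : Pred A 0ℓ} (P? : Decidable P) (f : A → Carrier) →
              ∑ xs f ≈ ∑ xs (λ a → ⟦ P? a ⟧ * f a) + ∑ xs (λ a → ⟦ ¬? (P? a) ⟧ * f a)
    ∑-split xs P? f = trans (∑-cong xs λ a → go (P? a) (f a)) (∑-+ xs _ _)
      where
      go : ∀ {Q : Set} (d : Dec Q) r → r ≈ ⟦ d ⟧ * r + ⟦ ¬? d ⟧ * r
      go (yes _) r = sym (trans (+-cong (*-identityˡ r) (zeroˡ r)) (+-identityʳ r))
      go (no _)  r = sym (trans (+-cong (zeroˡ r) (*-identityˡ r)) (+-identityˡ r))

    ∑ᶜ : ∀ n → (Graph n → Carrier) → Carrier
    ∑ᶜ n f = ∑ (simpleGraphs n) λ A → ⟦ connected? A ⟧ * f A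

    ∑ᶜ-cong : ∀ n {f g : Graph n → Carrier} → (∀ A → IsSimple A → Connected A → f A ≈ g A) → ∑ᶜ n f ≈ ∑ᶜ n g
    ∑ᶜ-cong n eq = ∑-simple-cong n λ A s → ⟦⟧-guard (connected? A) (eq A s)

    ∑ᶜ-+ : ∀ n f g → ∑ᶜ n (λ A → f A + g A) ≈ ∑ᶜ n f + ∑ᶜ n g
    ∑ᶜ-+ n f g = trans (∑-cong (simpleGraphs n) λ A → distribˡ _ _ _) (∑-+ (simpleGraphs n) _ _)

    ∑ᶜ-* : ∀ n f r → ∑ᶜ n (λ A → f A * r) ≈ ∑ᶜ n f * r
    ∑ᶜ-* n f r = trans (∑-cong (simpleGraphs n) λ A → sym (*-assoc _ _ _)) (sym (∑-* (simpleGraphs n) _ r))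

    -- The exponents r and ν are parameters because the same graphs of order n enter with rank n - 1
    -- and ν = 1 when entirely non-coloured, but with exponents n and 0 in the logarithms and when
    -- some vertex is coloured.
    bipartiteTerm : ℕ → ℕ → Graph n → Carrier
    bipartiteTerm r ν A = ⟦ bipartite? A ⟧ * monomial r (size A) ν

    nonBipartiteTerm : Graph n → Carrier
    nonBipartiteTerm {n} A = ⟦ ¬? (bipartite? A) ⟧ * monomial n (size A) 0

    ∑-single : ∀ n r → ∑ (allVecs (tt ∷ []) n) (λ _ → r) ≈ r
    ∑-single zero    r = +-identityʳ r
    ∑-single (suc n) r = trans (∑-product _∷_ (tt ∷ []) (allVecs (tt ∷ []) n) (λ _ → r))
      (trans (+-identityʳ _) (∑-single n r))

    plain-total : ∀ n → total (tt ∷ []) plainWeight n ≈ x ^ n * (1# + y) ^ (n C 2)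
    plain-total n = begin
      total (tt ∷ []) plainWeight n
        ≈⟨ ∑-cong (simpleGraphs n) (λ A → trans (∑-single n (monomial n (size A) 0)) (*-congˡ (*-identityʳ _))) ⟩
      ∑ (simpleGraphs n) (λ A → x ^ n * y ^ size A)
        ≈⟨ *-∑ (simpleGraphs n) (x ^ n) _ ⟨
      x ^ n * ∑ (simpleGraphs n) (λ A → y ^ size A)
        ≈⟨ *-congˡ (∑-simple-graphs commutativeSemiring y n) ⟩
      x ^ n * (1# + y) ^ (n C 2) ∎

    side-total : ∀ n → total bools sideWeight n ≈ x ^ n * ∑ (allVecs bools n) λ s → (1# + y) ^ (ones s ℕ.* zeros s)
    side-total n = begin
      ∑ (simpleGraphs n) (λ A → ∑ (allVecs bools n) λ s → ⟦ proper? A s ⟧ * (x ^ n * (y ^ size A * 1#)))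
        ≈⟨ ∑-cong (simpleGraphs n) (λ A → ∑-cong (allVecs bools n) λ s →
             trans (*-congˡ (*-congˡ (*-identityʳ _))) (x∙yz≈y∙xz _ _ _)) ⟩
      ∑ (simpleGraphs n) (λ A → ∑ (allVecs bools n) λ s → x ^ n * (⟦ proper? A s ⟧ * y ^ size A))
        ≈⟨ ∑-swap (simpleGraphs n) (allVecs bools n) _ ⟩
      ∑ (allVecs bools n) (λ s → ∑ (simpleGraphs n) λ A → x ^ n * (⟦ proper? A s ⟧ * y ^ size A))
        ≈⟨ ∑-cong (allVecs bools n) (λ s → trans (sym (*-∑ (simpleGraphs n) (x ^ n) _))
             (*-congˡ (∑-properly-coloured commutativeSemiring y s))) ⟩
      ∑ (allVecs bools n) (λ s → x ^ n * (1# + y) ^ (ones s ℕ.* zeros s))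
        ≈⟨ *-∑ (allVecs bools n) (x ^ n) _ ⟨
      x ^ n * ∑ (allVecs bools n) (λ s → (1# + y) ^ (ones s ℕ.* zeros s)) ∎

    plain-connected : ∀ n → connectedTotal (tt ∷ []) plainWeight n ≈ ∑ᶜ n (bipartiteTerm n 0) + ∑ᶜ n nonBipartiteTerm
    plain-connected n = trans
      (∑ᶜ-cong n λ A _ _ → trans (∑-single n (monomial n (size A) 0)) (decide (bipartite? A) _)) (∑ᶜ-+ n _ _)
      where
      decide : ∀ {P : Set} (d : Dec P) r → r ≈ ⟦ d ⟧ * r + ⟦ ¬? d ⟧ * r
      decide (yes _) r = sym (trans (+-cong (*-identityˡ r) (zeroˡ r)) (+-identityʳ r))
      decide (no _)  r = sym (trans (+-cong (zeroˡ r) (*-identityˡ r)) (+-identityˡ r))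

    -- One proper 2-colouring for each value at vertex 0 if the graph is bipartite, and none
    -- otherwise.
    two-sides : (A : Graph (suc n)) → Connected A →
      ∑ (allVecs bools (suc n)) (λ s → ⟦ proper? A s ⟧) ≈ ⟦ bipartite? A ⟧ + ⟦ bipartite? A ⟧
    two-sides {n} A conn = begin
      ∑ ws (λ s → ⟦ proper? A s ⟧)
        ≈⟨ ∑-split ws (λ s → lookup s zero Bool.≟ true) _ ⟩
      ∑ ws (λ s → ⟦ lookup s zero Bool.≟ true ⟧ * ⟦ proper? A s ⟧) +
      ∑ ws (λ s → ⟦ ¬? (lookup s zero Bool.≟ true) ⟧ * ⟦ proper? A s ⟧)
        ≈⟨ +-cong (∑-cong ws λ s → sym (⟦⟧-× (lookup s zero Bool.≟ true) (proper? A s)))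
                  (∑-cong ws λ s → trans
                    (*-congʳ (⟦⟧-cong (¬? (lookup s zero Bool.≟ true)) (lookup s zero Bool.≟ false)
                      Bool.¬-not (λ eq eq′ → Bool.not-¬ eq eq′)))
                    (sym (⟦⟧-× (lookup s zero Bool.≟ false) (proper? A s)))) ⟩
      ∑ ws (λ s → ⟦ (lookup s zero Bool.≟ true) ×-dec proper? A s ⟧) +
      ∑ ws (λ s → ⟦ (lookup s zero Bool.≟ false) ×-dec proper? A s ⟧)
        ≈⟨ +-cong (one-side true) (one-side false) ⟩
      ⟦ bipartite? A ⟧ + ⟦ bipartite? A ⟧ ∎
      where
      ws = allVecs bools (suc n)
      one-side : ∀ b → ∑ ws (λ s → ⟦ (lookup s zero Bool.≟ b) ×-dec proper? A s ⟧) ≈ ⟦ bipartite? A ⟧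
      one-side b = by-cases (bipartite? A)
        where
        by-cases : (d : Dec (Bipartite A)) → ∑ ws (λ s → ⟦ (lookup s zero Bool.≟ b) ×-dec proper? A s ⟧) ≈ ⟦ d ⟧
        by-cases (yes bip) with proper-with A bip zero b
        ... | s , p , eq = ∑-unique ws (Enumerates-words (suc n)) (Vec.≡-dec Bool._≟_)
          (λ s → (lookup s zero Bool.≟ b) ×-dec proper? A s) s (eq , p)
          (λ s′ (eq′ , p′) → proper-unique A s s′ conn p p′ zero (≡.trans eq (≡.sym eq′)))
        by-cases (no ¬bip) = ∑-zero ws λ s → ⟦⟧-no ((lookup s zero Bool.≟ b) ×-dec proper? A s)
          λ (_ , p) → ¬bip (proper⇒bipartite A (s , p))

    -- The doubling here is what the factor ½ in front of the first logarithm undoes.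
    sides-connected : ∀ n → connectedTotal bools sideWeight (suc n) ≈
      ∑ᶜ (suc n) (bipartiteTerm (suc n) 0) + ∑ᶜ (suc n) (bipartiteTerm (suc n) 0)
    sides-connected n = trans
      (∑ᶜ-cong (suc n) λ A _ conn → trans (sym (∑-* (allVecs bools (suc n)) _ _))
        (trans (*-congʳ (two-sides A conn)) (distribʳ _ _ _)))
      (∑ᶜ-+ (suc n) _ _)

    -- Given the sides, a vertex is either non-coloured, weight 1, or has the one colour of its
    -- side, weight y.
    ∑-compatible : ∀ (s : Vec Bool n) →
      ∑ (allVecs colours n) (λ ks → ⟦ compatible? s ks ⟧ * y ^ colouredVertices ks) ≈ (1# + y) ^ n
    ∑-compatible []      = trans (+-identityʳ _) (*-identityˡ 1#)
    ∑-compatible {suc n} (b ∷ s) = begin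
      ∑ (allVecs colours (suc n)) (λ ks → ⟦ compatible? (b ∷ s) ks ⟧ * y ^ colouredVertices ks)
        ≈⟨ ∑-product _∷_ colours kss _ ⟩
      ∑ colours (λ k → ∑ kss λ ks → ⟦ compatible? (b ∷ s) (k ∷ ks) ⟧ * y ^ colouredVertices (k ∷ ks))
        ≈⟨ ∑-cong colours (λ k → trans
             (∑-cong kss λ ks → trans (*-cong (⟦⟧-× (match? b k) (compatible? s ks))
                                              (^-homo-* y (colouredness k) (colouredVertices ks)))
                                      (interchange _ _ _ _))
             (sym (*-∑ kss _ _))) ⟩
      ∑ colours (λ k → ⟦ match? b k ⟧ * y ^ colouredness k * ∑ kss λ ks → ⟦ compatible? s ks ⟧ * y ^ colouredVertices ks)
        ≈⟨ trans (sym (∑-* colours (λ k → ⟦ match? b k ⟧ * y ^ colouredness k) _)) (*-cong (vertex b) (∑-compatible s)) ⟩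
      (1# + y) * (1# + y) ^ n ∎
      where
      kss = allVecs colours n
      y¹ : 1# * (y * 1#) ≈ y
      y¹ = trans (*-identityˡ _) (*-identityʳ y)
      vertex : ∀ b → ∑ colours (λ k → ⟦ match? b k ⟧ * y ^ colouredness k) ≈ 1# + y
      vertex true  = trans (+-cong (zeroˡ _) (+-cong y¹ (trans (+-identityʳ _) (*-identityˡ 1#))))
        (trans (+-identityˡ _) (+-comm y 1#))
      vertex false = trans (+-cong y¹ (trans (+-cong (zeroˡ _) (trans (+-identityʳ _) (*-identityˡ 1#))) (+-identityˡ 1#)))
        (+-comm y 1#)

    Enumerates-colours : Enumerates colours
    Enumerates-colours 𝟎 d = trans (+-cong (⟦⟧-yes (d 𝟎) ≡.refl) (trans (+-cong (⟦⟧-no (d 𝟏) λ ())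
      (trans (+-identityʳ _) (⟦⟧-no (d ∗) λ ()))) (+-identityˡ 0#))) (+-identityʳ 1#)
    Enumerates-colours 𝟏 d = trans (+-cong (⟦⟧-no (d 𝟎) λ ()) (trans (+-cong (⟦⟧-yes (d 𝟏) ≡.refl)
      (trans (+-identityʳ _) (⟦⟧-no (d ∗) λ ()))) (+-identityʳ 1#))) (+-identityˡ 1#)
    Enumerates-colours ∗ d = trans (+-cong (⟦⟧-no (d 𝟎) λ ()) (trans (+-cong (⟦⟧-no (d 𝟏) λ ())
      (trans (+-identityʳ _) (⟦⟧-yes (d ∗) ≡.refl))) (+-identityˡ 1#))) (+-identityˡ 1#)

    ∑-stars : ∀ n (f : Vec Colour n → Carrier) → ∑ (allVecs colours n) (λ ks → ⟦ stars ≟ᶜ ks ⟧ * f ks) ≈ f stars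
    ∑-stars n f = ∑-pick (allVecs colours n) (Enumerates-allVecs _≟ᵏ_ Enumerates-colours n) stars (stars ≟ᶜ_) f

    -- Removing the colouring without coloured vertices, which is compatible with any sides,
    -- subtracts 1.
    ∑-compatible-coloured : ∀ (s : Vec Bool n) →
      ∑ (allVecs colours n) (λ ks → ⟦ ¬? (stars ≟ᶜ ks) ⟧ * (⟦ compatible? s ks ⟧ * y ^ colouredVertices ks)) ≈
      (1# + y) ^ n - 1#
    ∑-compatible-coloured {n} s = +-cancelˡ 1# _ _ (begin
      1# + ∑ kss (λ ks → ⟦ ¬? (stars ≟ᶜ ks) ⟧ * f ks)
        ≈⟨ +-congʳ (trans (∑-stars n f) (trans
             (*-cong (⟦⟧-yes (compatible? s stars) (stars-compatible s)) (^-congʳ y (stars-uncoloured n)))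
             (*-identityˡ 1#))) ⟨
      ∑ kss (λ ks → ⟦ stars ≟ᶜ ks ⟧ * f ks) + ∑ kss (λ ks → ⟦ ¬? (stars ≟ᶜ ks) ⟧ * f ks)
        ≈⟨ ∑-split kss (stars ≟ᶜ_) f ⟨
      ∑ kss f
        ≈⟨ ∑-compatible s ⟩
      (1# + y) ^ n
        ≈⟨ trans (+-congʳ (-‿inverseʳ 1#)) (+-identityˡ _) ⟨
      (1# - 1#) + (1# + y) ^ n
        ≈⟨ trans (+-assoc _ _ _) (+-congˡ (+-comm _ _)) ⟩
      1# + ((1# + y) ^ n - 1#) ∎)
      where
      kss = allVecs colours n
      f = λ ks → ⟦ compatible? s ks ⟧ * y ^ colouredVertices ks

    module _ (A : Graph (suc n)) (simple : IsSimple A) (conn : Connected A) where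

      private
        kss = allVecs colours (suc n)
        ws = allVecs bools (suc n)

      uncoloured-rank : ∀ ks → bipartiteComponents (colouredGraph A ks) ≡ 0 → rank (colouredGraph A ks) ≡ suc n
      uncoloured-rank ks eq = ≡.trans (≡.sym (ℕ.+-identityʳ _))
        (≡.trans (cong (rank (colouredGraph A ks) ℕ.+_) (≡.sym eq)) (rank+bipartiteComponents (colouredGraph A ks) simple))

      -- The indicator of centrality is rewritten as a count of sides, which is 0 or 1. In this form
      -- the sums over colourings and sides can be exchanged, after which the vertices are coloured
      -- independently.
      central-sides : ∀ ks → stars ≢ ks → ⟦ central? (colouredGraph A ks) ⟧ ≈
        ∑ ws λ s → ⟦ proper? A s ⟧ * ⟦ compatible? s ks ⟧
      central-sides ks ≢ks = sym (trans (∑-cong ws λ s → sym (⟦⟧-× (proper? A s) (compatible? s ks)))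
        (by-cases (central? (colouredGraph A ks))))
        where
        by-cases : (d : Dec (Central (colouredGraph A ks))) → ∑ ws (λ s → ⟦ proper? A s ×-dec compatible? s ks ⟧) ≈ ⟦ d ⟧
        by-cases (yes c) = let s , pc = central⇒side A simple conn ks ≢ks c in
          ∑-unique ws (Enumerates-words (suc n)) (Vec.≡-dec Bool._≟_)
            (λ s → proper? A s ×-dec compatible? s ks) s pc (λ s′ pc′ → side-unique A simple conn ks ≢ks s s′ pc pc′)
        by-cases (no ¬c) = ∑-zero ws λ s → ⟦⟧-no (proper? A s ×-dec compatible? s ks)
          λ pc → ¬c (side⇒central A simple conn ks ≢ks (s , pc))

      colouredWeight : ∀ ks → stars ≢ ks → centralWeight A ks ≈
        (∑ ws λ s → ⟦ proper? A s ⟧ * ⟦ compatible? s ks ⟧) * (monomial (suc n) (size A) 0 * y ^ colouredVertices ks)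
      colouredWeight ks ≢ks = begin
        centralWeight A ks
          ≈⟨ guarded-yes (noIsolated? (colouredGraph A ks)) (central? (colouredGraph A ks)) {rank (colouredGraph A ks)} {cardinality (colouredGraph A ks)} {bipartiteComponents (colouredGraph A ks)}
               (coloured-noIsolated A simple conn ks ≢ks) ⟩
        ⟦ central? (colouredGraph A ks) ⟧ * monomial (rank (colouredGraph A ks)) (cardinality (colouredGraph A ks)) (bipartiteComponents (colouredGraph A ks))
          ≈⟨ *-cong (central-sides ks ≢ks) (monomial-cong (uncoloured-rank ks bc≡0) (cardinality-formula (colouredGraph A ks)) bc≡0) ⟩
        Z * (x ^ suc n * (y ^ (size A ℕ.+ colouredVertices ks) * 1#))
          ≈⟨ *-congˡ (*-congˡ (*-congʳ (^-homo-* y (size A) (colouredVertices ks)))) ⟩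
        Z * (x ^ suc n * ((y ^ size A * y ^ colouredVertices ks) * 1#))
          ≈⟨ *-congˡ (trans (*-congˡ (trans (*-assoc _ _ _) (trans (*-congˡ (*-comm _ _)) (sym (*-assoc _ _ _))))) (sym (*-assoc _ _ _))) ⟩
        Z * (monomial (suc n) (size A) 0 * y ^ colouredVertices ks) ∎
        where
        Z = ∑ ws λ s → ⟦ proper? A s ⟧ * ⟦ compatible? s ks ⟧
        bc≡0 = bipartiteComponents-coloured A conn ks ≢ks

      -- Two choices of sides, and for each a nonempty set of vertices that receive the colour of
      -- their side: twice (1 + y)^n - 1 at order n, for bipartite graphs only.
      ∑-coloured : ∑ kss (λ ks → ⟦ ¬? (stars ≟ᶜ ks) ⟧ * centralWeight A ks) ≈
        (bipartiteTerm (suc n) 0 A + bipartiteTerm (suc n) 0 A) * ((1# + y) ^ suc n - 1#)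
      ∑-coloured = begin
        ∑ kss (λ ks → ⟦ ¬? (stars ≟ᶜ ks) ⟧ * centralWeight A ks)
          ≈⟨ ∑-cong kss (λ ks → begin
               ⟦ ¬? (stars ≟ᶜ ks) ⟧ * centralWeight A ks
                 ≈⟨ ⟦⟧-guard (¬? (stars ≟ᶜ ks)) (colouredWeight ks) ⟩
               ⟦ ¬? (stars ≟ᶜ ks) ⟧ * ((∑ ws λ s → p s * c s ks) * (M * κ ks))
                 ≈⟨ *-congˡ (trans (*-congˡ (*-comm M (κ ks))) (trans (sym (*-assoc _ _ _))
                      (trans (*-congʳ (∑-* ws _ (κ ks))) (∑-* ws _ M)))) ⟩
               ⟦ ¬? (stars ≟ᶜ ks) ⟧ * ∑ ws (λ s → p s * c s ks * κ ks * M)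
                 ≈⟨ *-∑ ws _ _ ⟩
               ∑ ws (λ s → ⟦ ¬? (stars ≟ᶜ ks) ⟧ * (p s * c s ks * κ ks * M))
                 ≈⟨ ∑-cong ws (λ s → shuffle ⟦ ¬? (stars ≟ᶜ ks) ⟧ (p s) (c s ks) (κ ks)) ⟩
               ∑ ws (λ s → p s * M * (⟦ ¬? (stars ≟ᶜ ks) ⟧ * (c s ks * κ ks))) ∎) ⟩
        ∑ kss (λ ks → ∑ ws λ s → p s * M * (⟦ ¬? (stars ≟ᶜ ks) ⟧ * (c s ks * κ ks)))
          ≈⟨ ∑-swap kss ws _ ⟩
        ∑ ws (λ s → ∑ kss λ ks → p s * M * (⟦ ¬? (stars ≟ᶜ ks) ⟧ * (c s ks * κ ks)))
          ≈⟨ ∑-cong ws (λ s → trans (sym (*-∑ kss (p s * M) _)) (*-congˡ (∑-compatible-coloured s))) ⟩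
        ∑ ws (λ s → p s * M * ((1# + y) ^ suc n - 1#))
          ≈⟨ trans (∑-cong ws λ s → *-assoc _ _ _) (sym (∑-* ws p _)) ⟩
        ∑ ws p * (M * ((1# + y) ^ suc n - 1#))
          ≈⟨ trans (*-congʳ (two-sides A conn)) (sym (*-assoc _ _ _)) ⟩
        (⟦ bipartite? A ⟧ + ⟦ bipartite? A ⟧) * M * ((1# + y) ^ suc n - 1#)
          ≈⟨ *-congʳ (distribʳ M _ _) ⟩
        (bipartiteTerm (suc n) 0 A + bipartiteTerm (suc n) 0 A) * ((1# + y) ^ suc n - 1#) ∎
        where
        M = monomial (suc n) (size A) 0
        p = λ s → ⟦ proper? A s ⟧
        c = λ s ks → ⟦ compatible? s ks ⟧
        κ = λ (ks : Vec Colour (suc n)) → y ^ colouredVertices ks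
        shuffle : ∀ d p c k → d * (p * c * k * M) ≈ p * M * (d * (c * k))
        shuffle d p c k = begin
          d * (p * c * k * M)      ≈⟨ *-congˡ (*-congʳ (*-assoc p c k)) ⟩
          d * (p * (c * k) * M)    ≈⟨ *-congˡ (trans (*-assoc _ _ _) (trans (*-congˡ (*-comm _ M)) (sym (*-assoc _ _ _)))) ⟩
          d * (p * M * (c * k))    ≈⟨ x∙yz≈y∙xz _ _ _ ⟩
          p * M * (d * (c * k))    ∎

      ∑-colourings : ∑ kss (centralWeight A) ≈ centralWeight A stars +
        (bipartiteTerm (suc n) 0 A + bipartiteTerm (suc n) 0 A) * ((1# + y) ^ suc n - 1#)
      ∑-colourings = trans (∑-split kss (stars ≟ᶜ_) (centralWeight A))
        (+-cong (∑-stars (suc n) (centralWeight A)) ∑-coloured)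

    -- A lone non-coloured vertex is isolated; this is the case that the terms - x account for.
    starsWeight-single : (A : Graph 1) → IsSimple A → centralWeight A stars ≈ 0#
    starsWeight-single A (_ , loop) = trans
      (*-congʳ (⟦⟧-no (noIsolated? (colouredGraph A stars)) λ h → lonely (h zero ≡.refl))) (zeroˡ _)
      where
      lonely : ¬ NonIsolated A zero
      lonely (zero , a) = loop zero a

    -- Such a graph is always central, and rank + ν is its order: bipartite graphs have ν = 1 and
    -- rank one less than the order, the others have ν = 0 and full rank.
    starsWeight : (A : Graph (suc (suc n))) → IsSimple A → Connected A →
      centralWeight A stars ≈ bipartiteTerm (suc n) 1 A + nonBipartiteTerm A
    starsWeight {n} A simple conn = begin
      centralWeight A stars
        ≈⟨ guarded-yes (noIsolated? (colouredGraph A stars)) (central? (colouredGraph A stars)) {rank (colouredGraph A stars)} {cardinality (colouredGraph A stars)} {bipartiteComponents (colouredGraph A stars)} noIsolated ⟩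
      ⟦ central? (colouredGraph A stars) ⟧ * monomial (rank (colouredGraph A stars)) (cardinality (colouredGraph A stars)) (bipartiteComponents (colouredGraph A stars))
        ≈⟨ trans (*-congʳ (⟦⟧-yes (central? (colouredGraph A stars)) (stars-central A))) (*-identityˡ _) ⟩
      monomial (rank (colouredGraph A stars)) (cardinality (colouredGraph A stars)) (bipartiteComponents (colouredGraph A stars))
        ≈⟨ by-cases (bipartite? A) ⟩
      bipartiteTerm (suc n) 1 A + nonBipartiteTerm A ∎
      where
      noIsolated : NoIsolatedNonColoured (colouredGraph A stars)
      noIsolated zero    _ = walk-nonIsolated A (conn zero (suc zero)) λ ()
      noIsolated (suc i) _ = walk-nonIsolated A (conn (suc i) zero) λ ()
      card : cardinality (colouredGraph A stars) ≡ size A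
      card = ≡.trans (cardinality-formula (colouredGraph A stars)) (≡.trans (cong (size A ℕ.+_) (stars-uncoloured (suc (suc n)))) (ℕ.+-identityʳ _))
      by-cases : (d : Dec (Bipartite A)) →
        monomial (rank (colouredGraph A stars)) (cardinality (colouredGraph A stars)) (bipartiteComponents (colouredGraph A stars)) ≈
        ⟦ d ⟧ * monomial (suc n) (size A) 1 + ⟦ ¬? d ⟧ * monomial (suc (suc n)) (size A) 0
      by-cases (yes bip) = trans (monomial-cong rank≡ card bc≡1)
        (sym (trans (+-cong (*-identityˡ _) (zeroˡ _)) (+-identityʳ _)))
        where
        bc≡1 : bipartiteComponents (colouredGraph A stars) ≡ 1
        bc≡1 = bipartiteComponents-bipartite A conn bip
        rank≡ : rank (colouredGraph A stars) ≡ suc n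
        rank≡ = ℕ.suc-injective (≡.trans (ℕ.+-comm 1 (rank (colouredGraph A stars)))
          (≡.trans (cong (rank (colouredGraph A stars) ℕ.+_) (≡.sym bc≡1)) (rank+bipartiteComponents (colouredGraph A stars) simple)))
      by-cases (no ¬bip) = trans (monomial-cong (uncoloured-rank A simple conn stars bc≡0) card bc≡0)
        (sym (trans (+-cong (zeroˡ _) (*-identityˡ _)) (+-identityˡ _)))
        where
        bc≡0 : bipartiteComponents (colouredGraph A stars) ≡ 0
        bc≡0 = bipartiteComponents-nonBipartite A conn ¬bip stars

    private
      coloured-part : ∀ n → Carrier
      coloured-part n = (∑ᶜ n (bipartiteTerm n 0) + ∑ᶜ n (bipartiteTerm n 0)) * ((1# + y) ^ n - 1#)

      connected-split : ∀ n → connectedTotal colours centralWeight (suc n) ≈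
        ∑ᶜ (suc n) (λ A → centralWeight A stars) + coloured-part (suc n)
      connected-split n = trans (∑ᶜ-cong (suc n) ∑-colourings)
        (trans (∑ᶜ-+ (suc n) _ _) (+-congˡ (trans (∑ᶜ-* (suc n) _ _) (*-congʳ (∑ᶜ-+ (suc n) _ _)))))

    central-connected₁ : connectedTotal colours centralWeight 1 ≈
      (∑ᶜ 1 (bipartiteTerm 1 0) + ∑ᶜ 1 (bipartiteTerm 1 0)) * ((1# + y) ^ 1 - 1#)
    central-connected₁ = trans (connected-split 0) (trans
      (+-congʳ (trans (∑ᶜ-cong 1 (λ A s _ → starsWeight-single A s)) (∑-zero (simpleGraphs 1) λ A → zeroʳ ⟦ connected? A ⟧)))
      (+-identityˡ _))

    central-connected : ∀ n → let m = suc (suc n) in connectedTotal colours centralWeight m ≈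
      (∑ᶜ m (bipartiteTerm (suc n) 1) + ∑ᶜ m nonBipartiteTerm) +
      (∑ᶜ m (bipartiteTerm m 0) + ∑ᶜ m (bipartiteTerm m 0)) * ((1# + y) ^ m - 1#)
    central-connected n = trans (connected-split (suc n))
      (+-congʳ (trans (∑ᶜ-cong (suc (suc n)) starsWeight) (∑ᶜ-+ (suc (suc n)) _ _)))

-- Exponential generating functions and coefficients of monomials.

module GeneratingFunctions where

  open import Defs
  open import Algebra.Bundles using (CommutativeRing)
  open import Data.Bool.Base using (Bool; true; false)
  open import Data.Empty using (⊥-elim)
  open import Data.Fin.Base as Fin using (Fin; toℕ)
  import Data.Fin.Properties as Fin
  open import Data.List.Base as List using (List; []; _∷_)
  open import Data.Nat.Base as ℕ using (ℕ; zero; suc; _∸_; _≤_; _<_; z≤n; s≤s; _!)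
  open import Data.Nat.Combinatorics using (_C_; nCk+nC[k+1]≡[n+1]C[k+1]; nCk≡n!/k![n-k]!; k![n∸k]!∣n!; k>n⇒nCk≡0)
  import Data.Nat.DivMod as ℕ
  import Data.Nat.Properties as ℕ
  open import Data.Product.Base using (_×_; _,_; proj₁)
  open import Data.Rational.Base using (ℚ; 0ℚ; 1ℚ; _+_; _*_)
  import Data.Rational.Properties as ℚ
  open import Data.Rational.Solver using (module +-*-Solver)
  open import Data.Vec.Base using (Vec; []; _∷_)
  open import Function.Base using (_∘_)
  open import Relation.Binary.PropositionalEquality hiding (J)
  open import Relation.Nullary using (Dec; yes; no)
  open import Relation.Nullary.Decidable using (_×-dec_)
  open Scalars
  open SeriesRing
  open SeriesCalculus
  open Shuffle
  module ℚ∑ = Enumeration.ListSum (CommutativeRing.commutativeSemiring ℚ.+-*-commutativeRing)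
  module S∑ = Enumeration.ListSum S.commutativeSemiring
  open import Algebra.Properties.Semiring.Exp S.semiring using (_^_)
  open import Algebra.Properties.Semiring.Sum (CommutativeRing.semiring ℚ.+-*-commutativeRing)
    using (∑-distrib-+)

  fromℕ-count : ∀ {X : Set} {P : X → Set} (P? : ∀ x → Dec (P x)) xs → fromℕ (count P? xs) ≡ ℚ∑.∑ xs (λ x → ℚ∑.⟦ P? x ⟧)
  fromℕ-count P? []       = refl
  fromℕ-count P? (x ∷ xs) with P? x
  ... | yes _ = trans (fromℕ-+ 1 (count P? xs)) (cong (1ℚ +_) (fromℕ-count P? xs))
  ... | no _  = trans (fromℕ-count P? xs) (sym (ℚ.+-identityˡ _))

  at-∑ : ∀ {X : Set} (xs : List X) (f : X → Series) a b c → S∑.∑ xs f a b c ≡ ℚ∑.∑ xs (λ x → f x a b c)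
  at-∑ []       f a b c = refl
  at-∑ (x ∷ xs) f a b c = cong (f x a b c +_) (at-∑ xs f a b c)

  at-⟦⟧ : ∀ {P : Set} (d : Dec P) F a b c → (S∑.⟦ d ⟧ ⊗ F) a b c ≡ ℚ∑.⟦ d ⟧ * F a b c
  at-⟦⟧ (yes _) F a b c = trans (at (S.*-identityˡ F) a b c) (sym (ℚ.*-identityˡ (F a b c)))
  at-⟦⟧ (no _)  F a b c = trans (at (S.zeroˡ F) a b c) (sym (ℚ.*-zeroˡ (F a b c)))

  sum-single : ∀ N p (g : ℕ → ℚ) → p < N → (∀ m → m ≢ p → g m ≡ 0ℚ) → ∑[ m < N ] g (toℕ m) ≡ g p
  sum-single (suc N) zero    g _        h = trans
    (cong (g 0 +_) (trans (sum-cong-≗ {N} λ m → h (suc (toℕ m)) λ ()) (sum-replicate-zero N))) (ℚ.+-identityʳ (g 0))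
  sum-single (suc N) (suc p) g (s≤s lt) h = trans
    (cong₂ _+_ (h 0 λ ()) (sum-single N p (g ∘ suc) lt λ m m≢p → h (suc m) (m≢p ∘ ℕ.suc-injective)))
    (ℚ.+-identityˡ (g (suc p)))

  sum-none : ∀ N (g : ℕ → ℚ) → (∀ m → g m ≡ 0ℚ) → ∑[ m < N ] g (toℕ m) ≡ 0ℚ
  sum-none N g h = trans (sum-cong-≗ {N} λ m → h (toℕ m)) (sum-replicate-zero N)

  ∑³-sum : ∀ N a b c (f : ℕ → ℕ → ℕ → ℕ → ℚ) →
    ∑[ m < N ] ∑³ a b c (f (toℕ m)) ≡ ∑³ a b c (λ i j k → ∑[ m < N ] f (toℕ m) i j k)
  ∑³-sum zero    a b c f = sym (∑³-zero a b c λ _ _ _ _ _ _ → refl)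
  ∑³-sum (suc N) a b c f = trans (cong (∑³ a b c (f 0) +_) (∑³-sum N a b c (f ∘ suc)))
    (sym (∑³-+ a b c (f 0) (λ i j k → ∑[ m < N ] f (suc (toℕ m)) i j k)))

  nCk*1/n! : ∀ {n k} → k ≤ n → fromℕ (n C k) * 1/! n ≡ 1/! k * 1/! (n ∸ k)
  nCk*1/n! {n} {k} k≤n = begin
    c * 1/! n
      ≡⟨ solve 2 (λ c i → c :* i := c :* con 1ℚ :* con 1ℚ :* i) refl c (1/! n) ⟩
    c * 1ℚ * 1ℚ * 1/! n
      ≡⟨ cong₂ (λ s t → c * s * t * 1/! n) (k!*1/k! k) (k!*1/k! (n ∸ k)) ⟨
    c * (f k * 1/! k) * (f (n ∸ k) * 1/! (n ∸ k)) * 1/! n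
      ≡⟨ solve 6 (λ c p i q j m → c :* (p :* i) :* (q :* j) :* m := (c :* (p :* q)) :* m :* (i :* j)) refl
           c (f k) (1/! k) (f (n ∸ k)) (1/! (n ∸ k)) (1/! n) ⟩
    (c * (f k * f (n ∸ k))) * 1/! n * (1/! k * 1/! (n ∸ k))
      ≡⟨ cong (λ t → t * 1/! n * (1/! k * 1/! (n ∸ k))) factorial ⟩
    f n * 1/! n * (1/! k * 1/! (n ∸ k))
      ≡⟨ cong (_* (1/! k * 1/! (n ∸ k))) (k!*1/k! n) ⟩
    1ℚ * (1/! k * 1/! (n ∸ k))
      ≡⟨ ℚ.*-identityˡ _ ⟩
    1/! k * 1/! (n ∸ k) ∎
    where
    open ≡-Reasoning
    open +-*-Solver
    c = fromℕ (n C k)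
    f : ℕ → ℚ
    f m = fromℕ (m !)
    instance
      nz : ℕ.NonZero (k ! ℕ.* (n ∸ k) !)
      nz = k ℕ.!* (n ∸ k) !≢0
    factorial : c * (f k * f (n ∸ k)) ≡ f n
    factorial = begin
      c * (f k * f (n ∸ k))                        ≡⟨ cong (c *_) (fromℕ-* (k !) ((n ∸ k) !)) ⟨
      c * fromℕ (k ! ℕ.* (n ∸ k) !)                ≡⟨ fromℕ-* (n C k) _ ⟨
      fromℕ ((n C k) ℕ.* (k ! ℕ.* (n ∸ k) !))        ≡⟨ cong fromℕ (trans
        (cong (ℕ._* (k ! ℕ.* (n ∸ k) !)) (nCk≡n!/k![n-k]! k≤n)) (ℕ.m/n*n≡m (k![n∸k]!∣n! k≤n))) ⟩
      f n ∎

  words : ∀ n → List (Vec Bool n)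
  words = allVecs (true ∷ false ∷ [])

  -- There are C(n, i) words with i true entries; the induction on the first letter is Pascal's
  -- rule.
  ∑-words-by-ones : ∀ n (h : ℕ → ℕ → ℚ) → ℚ∑.∑ (words n) (λ σ → h (ones σ) (zeros σ)) ≡
    ∑[ i < suc n ] (fromℕ (n C toℕ i) * h (toℕ i) (n ∸ toℕ i))
  ∑-words-by-ones zero    h = cong (_+ 0ℚ) (sym (ℚ.*-identityˡ (h 0 0)))
  ∑-words-by-ones (suc n) h = begin
    ℚ∑.∑ (words (suc n)) (λ σ → h (ones σ) (zeros σ))
      ≡⟨ ℚ∑.∑-product _∷_ (true ∷ false ∷ []) (words n) (λ σ → h (ones σ) (zeros σ)) ⟩
    ℚ∑.∑ (words n) (λ σ → h (suc (ones σ)) (zeros σ)) + (ℚ∑.∑ (words n) (λ σ → h (ones σ) (suc (zeros σ))) + 0ℚ)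
      ≡⟨ cong₂ (λ s t → s + (t + 0ℚ)) (∑-words-by-ones n (λ i j → h (suc i) j)) (∑-words-by-ones n (λ i j → h i (suc j))) ⟩
    X + ((1ℚ * h 0 (suc n) + ∑[ i < n ] p (toℕ i)) + 0ℚ)
      ≡⟨ cong (λ t → X + ((1ℚ * h 0 (suc n) + t) + 0ℚ)) extend-sum ⟩
    X + ((1ℚ * h 0 (suc n) + Y) + 0ℚ)
      ≡⟨ solve 3 (λ x y z → x :+ ((z :+ y) :+ con 0ℚ) := z :+ (x :+ y)) refl X Y (1ℚ * h 0 (suc n)) ⟩
    1ℚ * h 0 (suc n) + (X + Y)
      ≡⟨ cong (1ℚ * h 0 (suc n) +_) (∑-distrib-+ {suc n} (λ i → fromℕ (n C toℕ i) * g (toℕ i)) (λ i → fromℕ (n C suc (toℕ i)) * g (toℕ i))) ⟨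
    1ℚ * h 0 (suc n) + ∑[ i < suc n ] (fromℕ (n C toℕ i) * g (toℕ i) + fromℕ (n C suc (toℕ i)) * g (toℕ i))
      ≡⟨ cong (1ℚ * h 0 (suc n) +_) (sum-cong-≗ {suc n} λ i → trans
           (sym (ℚ.*-distribʳ-+ (g (toℕ i)) (fromℕ (n C toℕ i)) (fromℕ (n C suc (toℕ i)))))
           (cong (_* g (toℕ i)) (trans (sym (fromℕ-+ (n C toℕ i) (n C suc (toℕ i))))
             (cong fromℕ (nCk+nC[k+1]≡[n+1]C[k+1] n (toℕ i)))))) ⟩
    1ℚ * h 0 (suc n) + ∑[ i < suc n ] (fromℕ (suc n C suc (toℕ i)) * g (toℕ i)) ∎
    where
    open ≡-Reasoning
    open +-*-Solver
    g p q : ℕ → ℚ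
    g i = h (suc i) (n ∸ i)
    p i = fromℕ (n C suc i) * h (suc i) (suc (n ∸ suc i))
    q i = fromℕ (n C suc i) * g i
    X = ∑[ i < suc n ] (fromℕ (n C toℕ i) * g (toℕ i))
    Y = ∑[ i < suc n ] (fromℕ (n C suc (toℕ i)) * g (toℕ i))
    extend-sum : ∑[ i < n ] p (toℕ i) ≡ Y
    extend-sum = begin
      ∑[ i < n ] p (toℕ i)
        ≡⟨ sum-cong-≗ {n} (λ i → cong (λ t → fromℕ (n C suc (toℕ i)) * h (suc (toℕ i)) t)
             (sym (ℕ.+-∸-assoc 1 (Fin.toℕ<n i)))) ⟩
      ∑[ i < n ] q (toℕ i)
        ≡⟨ ℚ.+-identityʳ _ ⟨
      ∑[ i < n ] q (toℕ i) + 0ℚ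
        -- A last summand with coefficient C(n, n + 1) = 0 gives both sums of Pascal's rule the same
        -- range.
        ≡⟨ cong (∑[ i < n ] q (toℕ i) +_) (sym (trans
             (cong (λ t → fromℕ t * g n) (k>n⇒nCk≡0 (ℕ.n<1+n n))) (ℚ.*-zeroˡ (g n)))) ⟩
      ∑[ i < n ] q (toℕ i) + q n
        ≡⟨ sum-last n q ⟨
      Y ∎

  binomial : ℕ → ℕ → ℕ
  binomial n k = n C k

  -- T n collects the structures of order n, so the coefficient at (a, b, c) is read from T (a + c)
  -- and divided by (a + c)!. By homogeneity this loses nothing.
  EGF : (ℕ → Series) → Series
  EGF T a b c = T (a ℕ.+ c) a b c /! (a ℕ.+ c)

  Homogeneous : (ℕ → Series) → Set
  Homogeneous T = ∀ n a b c → n ≢ a ℕ.+ c → T n a b c ≡ 0ℚ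

  module _ (K T : ℕ → Series) (K-homogeneous : Homogeneous K) (T-homogeneous : Homogeneous T)
           (recursion : ∀ n → T (suc n) ≈ S∑.∑ (words n) λ σ → K (suc (ones σ)) ⊗ T (zeros σ)) where

    private
      term : (a b c : ℕ) → ℕ → ℕ → ℕ → ℕ → ℕ → ℚ
      term a b c n m i j k = (1/! m * 1/! (n ∸ m)) * (K (suc m) i j k * T (n ∸ m) (a ∸ i) (b ∸ j) (c ∸ k))

      expand : ∀ a b c n → T (suc n) a b c * 1/! n ≡ ∑³ a b c (λ i j k → ∑[ m < suc n ] term a b c n (toℕ m) i j k)
      expand a b c n = begin
        T (suc n) a b c * 1/! n
          ≡⟨ cong (_* 1/! n) (trans (at (recursion n) a b c) (at-∑ (words n) (λ σ → K (suc (ones σ)) ⊗ T (zeros σ)) a b c)) ⟩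
        ℚ∑.∑ (words n) (λ σ → (K (suc (ones σ)) ⊗ T (zeros σ)) a b c) * 1/! n
          ≡⟨ cong (_* 1/! n) (∑-words-by-ones n (λ p q → (K (suc p) ⊗ T q) a b c)) ⟩
        ∑[ m < suc n ] (choose m * prod m) * 1/! n
          ≡⟨ trans (ℚ.*-comm _ (1/! n)) (*-distribˡ-sum {suc n} (1/! n) (λ m → choose m * prod m)) ⟩
        ∑[ m < suc n ] (1/! n * (choose m * prod m))
          ≡⟨ sum-cong-≗ {suc n} (λ m → trans
               (solve 3 (λ i c p → i :* (c :* p) := (c :* i) :* p) refl (1/! n) (choose m) (prod m))
               (trans (cong (_* prod m) (nCk*1/n! (Fin.toℕ≤pred[n] m)))
                 (∑³-scale a b c (1/! (toℕ m) * 1/! (n ∸ toℕ m))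
                   (λ i j k → K (suc (toℕ m)) i j k * T (n ∸ toℕ m) (a ∸ i) (b ∸ j) (c ∸ k))))) ⟩
        ∑[ m < suc n ] ∑³ a b c (term a b c n (toℕ m))
          ≡⟨ ∑³-sum (suc n) a b c (term a b c n) ⟩
        ∑³ a b c (λ i j k → ∑[ m < suc n ] term a b c n (toℕ m) i j k) ∎
        where
        open ≡-Reasoning
        open +-*-Solver
        choose : Fin (suc n) → ℚ
        choose m = fromℕ (binomial n (toℕ m))
        prod : Fin (suc n) → ℚ
        prod m = (K (suc (toℕ m)) ⊗ T (n ∸ toℕ m)) a b c

      -- By homogeneity the indices i and k determine the order i + k of the component, and only the
      -- summand with m + 1 = i + k survives.
      collapse : ∀ a b c n → a ℕ.+ c ≡ suc n → ∀ i j k → i ≤ a → k ≤ c →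
        ∑[ m < suc n ] term a b c n (toℕ m) i j k ≡ D (EGF K) i j k * EGF T (a ∸ i) (b ∸ j) (c ∸ k)
      collapse a b c n eq i j k i≤a k≤c with i ℕ.+ k in order
      ... | zero = trans (sum-none (suc n) (λ m → term a b c n m i j k) λ m → trans
              (cong (λ t → (1/! m * 1/! (n ∸ m)) * (t * T (n ∸ m) (a ∸ i) (b ∸ j) (c ∸ k)))
                (K-homogeneous (suc m) i j k λ eq′ → ℕ.1+n≢0 (trans eq′ order)))
              (solve 2 (λ p t → p :* (con 0ℚ :* t) := con 0ℚ) refl (1/! m * 1/! (n ∸ m)) (T (n ∸ m) (a ∸ i) (b ∸ j) (c ∸ k))))
            (sym (solve 2 (λ u v → con 0ℚ :* u :* v := con 0ℚ) refl
              (K 0 i j k * 1/! 0) (EGF T (a ∸ i) (b ∸ j) (c ∸ k))))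
        where open +-*-Solver
      -- A component of order p + 1 carries the factor 1/p!, as vertex 0 is fixed; since 1/p! = (p +
      -- 1)/(p + 1)!, this is the coefficient of D applied to the generating function.
      ... | suc p = trans (sum-single (suc n) p (λ m → term a b c n m i j k) (s≤s p≤n) (λ m m≢p → trans
              (cong (λ t → (1/! m * 1/! (n ∸ m)) * (t * T (n ∸ m) (a ∸ i) (b ∸ j) (c ∸ k)))
                (K-homogeneous (suc m) i j k λ eq′ → m≢p (ℕ.suc-injective (trans eq′ order))))
              (solve 2 (λ p t → p :* (con 0ℚ :* t) := con 0ℚ) refl (1/! m * 1/! (n ∸ m)) (T (n ∸ m) (a ∸ i) (b ∸ j) (c ∸ k)))))
            (trans (cong (λ q → (1/! p * 1/! q) * (K (suc p) i j k * T q (a ∸ i) (b ∸ j) (c ∸ k))) rest)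
            (trans (cong (λ u → (u * 1/! r) * (K (suc p) i j k * t)) (sym (suc*1/! p)))
              (solve 5 (λ n u v c t → ((n :* u) :* v) :* (c :* t) := (n :* (c :* u)) :* (t :* v)) refl
                (fromℕ (suc p)) (1/! (suc p)) (1/! r) (K (suc p) i j k) t)))
        where
        open +-*-Solver
        r = (a ∸ i) ℕ.+ (c ∸ k)
        t = T r (a ∸ i) (b ∸ j) (c ∸ k)
        total : n ≡ p ℕ.+ r
        total = ℕ.suc-injective (trans (sym eq) (trans (split-order i≤a k≤c) (cong (ℕ._+ r) order)))
        p≤n : p ≤ n
        p≤n = subst (p ≤_) (sym total) (ℕ.m≤m+n p r)
        rest : n ∸ p ≡ r
        rest = trans (cong (_∸ p) total) (ℕ.m+n∸m≡n p r)

    -- The recursion on T divided by n!: pointing a vertex of a structure amounts to pointing a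
    -- vertex of one connected structure and adding an arbitrary remainder.
    D-EGF : D (EGF T) ≈ D (EGF K) ⊗ EGF T
    D-EGF = pointwise λ a b c → go a b c (a ℕ.+ c) refl
      where
      open ≡-Reasoning
      go : ∀ a b c n → a ℕ.+ c ≡ n → D (EGF T) a b c ≡ (D (EGF K) ⊗ EGF T) a b c
      go a b c zero eq = trans
        (trans (cong (λ m → fromℕ m * EGF T a b c) eq) (ℚ.*-zeroˡ (EGF T a b c)))
        (sym (⊗-zero-at (D (EGF K)) (EGF T) a b c λ i j k i≤a _ k≤c → trans
          (cong (_* EGF T (a ∸ i) (b ∸ j) (c ∸ k)) (trans
            (cong (λ m → fromℕ m * EGF K i j k) (ℕ.n≤0⇒n≡0 (subst (i ℕ.+ k ≤_) eq (ℕ.+-mono-≤ i≤a k≤c))))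
            (ℚ.*-zeroˡ (EGF K i j k))))
          (ℚ.*-zeroˡ (EGF T (a ∸ i) (b ∸ j) (c ∸ k)))))
      go a b c (suc n) eq = begin
        D (EGF T) a b c
          ≡⟨ cong (λ m → fromℕ m * (T m a b c * 1/! m)) eq ⟩
        fromℕ (suc n) * (T (suc n) a b c * 1/! (suc n))
          ≡⟨ trans (solve 3 (λ n t i → n :* (t :* i) := t :* (n :* i)) refl (fromℕ (suc n)) (T (suc n) a b c) (1/! (suc n)))
                   (cong (T (suc n) a b c *_) (suc*1/! n)) ⟩
        T (suc n) a b c * 1/! n
          ≡⟨ expand a b c n ⟩
        ∑³ a b c (λ i j k → ∑[ m < suc n ] term a b c n (toℕ m) i j k)
          ≡⟨ ∑³-cong a b c {λ i j k → ∑[ m < suc n ] term a b c n (toℕ m) i j k}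
               {λ i j k → D (EGF K) i j k * EGF T (a ∸ i) (b ∸ j) (c ∸ k)}
               (λ i j k i≤a _ k≤c → collapse a b c n eq i j k i≤a k≤c) ⟩
        (D (EGF K) ⊗ EGF T) a b c ∎
        where open +-*-Solver

  open Weights.Weighted seriesRing 𝕩 𝕪 𝕫 using () renaming (monomial to mono)

  delta? : ∀ a b c i j k → Dec (a ≡ i × b ≡ j × c ≡ k)
  delta? a b c i j k = (a ℕ.≟ i) ×-dec (b ℕ.≟ j) ×-dec (c ℕ.≟ k)

  delta-cong : ∀ {P Q : Set} (d : Dec P) (e : Dec Q) → (P → Q) → (Q → P) → ℚ∑.⟦ d ⟧ ≡ ℚ∑.⟦ e ⟧
  delta-cong = ℚ∑.⟦⟧-cong

  𝕫^ : ∀ c i j k → (𝕫 ^ c) i j k ≡ ℚ∑.⟦ delta? 0 0 c i j k ⟧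
  𝕫^ zero    zero    zero    zero    = refl
  𝕫^ zero    zero    zero    (suc k) = refl
  𝕫^ zero    zero    (suc j) k       = refl
  𝕫^ zero    (suc i) j       k       = refl
  𝕫^ (suc c) i       j       zero    = trans (𝕫-zero (𝕫 ^ c) i j) (sym (ℚ∑.⟦⟧-no (delta? 0 0 (suc c) i j 0) λ ()))
  𝕫^ (suc c) i       j       (suc k) = trans (𝕫-suc (𝕫 ^ c) i j k) (trans (𝕫^ c i j k)
    (delta-cong (delta? 0 0 c i j k) (delta? 0 0 (suc c) i j (suc k))
      (λ (p , q , r) → p , q , cong suc r) (λ (p , q , r) → p , q , ℕ.suc-injective r)))

  𝕪^𝕫^ : ∀ b c i j k → (𝕪 ^ b ⊗ 𝕫 ^ c) i j k ≡ ℚ∑.⟦ delta? 0 b c i j k ⟧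
  𝕪^𝕫^ zero    c i j       k = trans (at (S.*-identityˡ (𝕫 ^ c)) i j k) (𝕫^ c i j k)
  𝕪^𝕫^ (suc b) c i zero    k = trans (at (S.*-assoc 𝕪 (𝕪 ^ b) (𝕫 ^ c)) i 0 k)
    (trans (𝕪-zero (𝕪 ^ b ⊗ 𝕫 ^ c) i k) (sym (ℚ∑.⟦⟧-no (delta? 0 (suc b) c i 0 k) λ ())))
  𝕪^𝕫^ (suc b) c i (suc j) k = trans (at (S.*-assoc 𝕪 (𝕪 ^ b) (𝕫 ^ c)) i (suc j) k)
    (trans (𝕪-suc (𝕪 ^ b ⊗ 𝕫 ^ c) i j k) (trans (𝕪^𝕫^ b c i j k)
      (delta-cong (delta? 0 b c i j k) (delta? 0 (suc b) c i (suc j) k)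
        (λ (p , q , r) → p , cong suc q , r) (λ (p , q , r) → p , ℕ.suc-injective q , r))))

  𝕩^-hit : ∀ n F j k → (𝕩 ^ n ⊗ F) n j k ≡ F 0 j k
  𝕩^-hit zero    F j k = at (S.*-identityˡ F) 0 j k
  𝕩^-hit (suc n) F j k = trans (at (S.*-assoc 𝕩 (𝕩 ^ n) F) (suc n) j k)
    (trans (𝕩-suc (𝕩 ^ n ⊗ F) n j k) (𝕩^-hit n F j k))

  𝕩^-miss : ∀ n F → (∀ i j k → F (suc i) j k ≡ 0ℚ) → ∀ i j k → n ≢ i → (𝕩 ^ n ⊗ F) i j k ≡ 0ℚ
  𝕩^-miss zero    F F₀ zero    j k 0≢0 = ⊥-elim (0≢0 refl)
  𝕩^-miss zero    F F₀ (suc i) j k _   = trans (at (S.*-identityˡ F) (suc i) j k) (F₀ i j k)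
  𝕩^-miss (suc n) F F₀ zero    j k _   = trans (at (S.*-assoc 𝕩 (𝕩 ^ n) F) 0 j k) (𝕩-zero (𝕩 ^ n ⊗ F) j k)
  𝕩^-miss (suc n) F F₀ (suc i) j k n≢i = trans (at (S.*-assoc 𝕩 (𝕩 ^ n) F) (suc i) j k)
    (trans (𝕩-suc (𝕩 ^ n ⊗ F) i j k) (𝕩^-miss n F F₀ i j k (n≢i ∘ cong suc)))

  -- Extracting a coefficient from a sum of monomials thereby becomes counting the summands with
  -- given exponents.
  at-mono : ∀ a b c i j k → mono a b c i j k ≡ ℚ∑.⟦ delta? a b c i j k ⟧
  at-mono a b c i j k = by-cases (a ℕ.≟ i)
    where
    by-cases : Dec (a ≡ i) → mono a b c i j k ≡ ℚ∑.⟦ delta? a b c i j k ⟧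
    by-cases (yes refl) = trans (𝕩^-hit a (𝕪 ^ b ⊗ 𝕫 ^ c) j k) (trans (𝕪^𝕫^ b c 0 j k)
      (delta-cong (delta? 0 b c 0 j k) (delta? a b c a j k) (λ (_ , q) → refl , q) (λ (_ , q) → refl , q)))
    by-cases (no a≢i) = trans (𝕩^-miss a (𝕪 ^ b ⊗ 𝕫 ^ c)
        (λ i j k → trans (𝕪^𝕫^ b c (suc i) j k) (ℚ∑.⟦⟧-no (delta? 0 b c (suc i) j k) λ ())) i j k a≢i)
      (sym (ℚ∑.⟦⟧-no (delta? a b c i j k) (a≢i ∘ proj₁)))

  1+𝕪^ : ∀ N j → ((𝟙 ⊕ 𝕪) ^ N) 0 j 0 ≡ fromℕ (binomial N j)
  1+𝕪^ zero    zero    = refl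
  1+𝕪^ zero    (suc j) = cong fromℕ (sym (k>n⇒nCk≡0 (s≤s (z≤n {j}))))
  1+𝕪^ (suc N) zero    = trans (at (S.distribʳ ((𝟙 ⊕ 𝕪) ^ N) 𝟙 𝕪) 0 0 0)
    (trans (cong₂ _+_ (trans (at (S.*-identityˡ ((𝟙 ⊕ 𝕪) ^ N)) 0 0 0) (1+𝕪^ N 0)) (𝕪-zero ((𝟙 ⊕ 𝕪) ^ N) 0 0))
      (trans (ℚ.+-identityʳ (fromℕ (binomial N 0))) refl))
  1+𝕪^ (suc N) (suc j) = trans (at (S.distribʳ ((𝟙 ⊕ 𝕪) ^ N) 𝟙 𝕪) 0 (suc j) 0)
    (trans (cong₂ _+_ (trans (at (S.*-identityˡ ((𝟙 ⊕ 𝕪) ^ N)) 0 (suc j) 0) (1+𝕪^ N (suc j)))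
                      (trans (𝕪-suc ((𝟙 ⊕ 𝕪) ^ N) 0 j 0) (1+𝕪^ N j)))
      (trans (ℚ.+-comm (fromℕ (binomial N (suc j))) (fromℕ (binomial N j)))
        (trans (sym (fromℕ-+ (binomial N j) (binomial N (suc j)))) (cong fromℕ (nCk+nC[k+1]≡[n+1]C[k+1] N j)))))

  1+𝕪^-degree : ∀ N i j k → i ℕ.+ k ≢ 0 → ((𝟙 ⊕ 𝕪) ^ N) i j k ≡ 0ℚ
  1+𝕪^-degree zero    zero    j       zero    0≢0 = ⊥-elim (0≢0 refl)
  1+𝕪^-degree zero    zero    zero    (suc k) _   = refl
  1+𝕪^-degree zero    zero    (suc j) (suc k) _   = refl
  1+𝕪^-degree zero    (suc i) j       k       _   = refl
  1+𝕪^-degree (suc N) i       zero    k       nz  = trans (at (S.distribʳ ((𝟙 ⊕ 𝕪) ^ N) 𝟙 𝕪) i 0 k)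
    (cong₂ _+_ (trans (at (S.*-identityˡ ((𝟙 ⊕ 𝕪) ^ N)) i 0 k) (1+𝕪^-degree N i 0 k nz)) (𝕪-zero ((𝟙 ⊕ 𝕪) ^ N) i k))
  1+𝕪^-degree (suc N) i       (suc j) k       nz  = trans (at (S.distribʳ ((𝟙 ⊕ 𝕪) ^ N) 𝟙 𝕪) i (suc j) k)
    (cong₂ _+_ (trans (at (S.*-identityˡ ((𝟙 ⊕ 𝕪) ^ N)) i (suc j) k) (1+𝕪^-degree N i (suc j) k nz))
               (trans (𝕪-suc ((𝟙 ⊕ 𝕪) ^ N) i j k) (1+𝕪^-degree N i j k nz)))

-- Identification of the coefficients with the counted numbers.

module Coefficients where

  open import Defs
  open import Algebra.Bundles using (CommutativeRing)
  open import Data.Fin.Base as Fin using (Fin)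
  import Data.Fin.Properties as Fin
  import Data.Fin.Subset as Subset
  open import Data.List.Base as List using (List)
  import Data.List.Properties as List
  open import Data.Nat.Base as ℕ using (ℕ; zero; suc; _≤_; _<_; s≤s)
  import Data.Nat.Properties as ℕ
  open import Data.Product.Base using (_×_; _,_)
  open import Data.Rational.Base using (ℚ; 0ℚ; 1ℚ; _+_; _*_)
  import Data.Rational.Properties as ℚ
  open import Data.Rational.Solver using (module +-*-Solver)
  open import Data.Unit.Base using (⊤)
  open import Data.Vec.Base using (Vec)
  open import Function.Base using (id)
  open import Relation.Binary.PropositionalEquality hiding (J)
  open import Relation.Nullary using (¬_; Dec)
  open import Relation.Nullary.Decidable using (_×-dec_; ¬?)
  open Scalars
  open SeriesRing
  open SeriesCalculus
  open Shuffle
  open GraphJoin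
  open Hyperplane
  open ColouredGraph
  open Arrangements using (rank+bipartiteComponents)
  open LinearAlgebra using (dimSpan≤length)
  open JoinInvariants using (cardinality-formula)
  open ConnectedGraphs
  open Weights using (colours; noIsolated?)
  open Weights.Weighted seriesRing 𝕩 𝕪 𝕫 renaming (monomial to mono)
  open GeneratingFunctions
  open ℚ∑ using (⟦_⟧)
  module ℚF = ExponentialFormula.Formula (CommutativeRing.commutativeSemiring ℚ.+-*-commutativeRing)
  module SF = ExponentialFormula.Formula S.commutativeSemiring
  open SF using (total; connectedTotal)

  ∑-simple-zero : ∀ n {f : Graph n → ℚ} → (∀ A → IsSimple A → f A ≡ 0ℚ) → ℚ∑.∑ (simpleGraphs n) f ≡ 0ℚ
  ∑-simple-zero n h = trans (ℚF.∑-simple-cong n h) (ℚ∑.∑-zero (simpleGraphs n) λ _ → refl)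

  at-guarded : ∀ {P Q : Set} (p : Dec P) (q : Dec Q) r s t a b c →
    guarded p q r s t a b c ≡ ⟦ p ⟧ * (⟦ q ⟧ * ⟦ delta? r s t a b c ⟧)
  at-guarded p q r s t a b c = trans (at-⟦⟧ p (S∑.⟦ q ⟧ ⊗ mono r s t) a b c)
    (cong (⟦ p ⟧ *_) (trans (at-⟦⟧ q (mono r s t) a b c) (cong (⟦ q ⟧ *_) (at-mono r s t a b c))))

  at-∑ᶜ : ∀ n (f : Graph n → Series) a b c →
    ∑ᶜ n f a b c ≡ ℚ∑.∑ (simpleGraphs n) λ A → ⟦ connected? A ⟧ * f A a b c
  at-∑ᶜ n f a b c = trans (at-∑ (simpleGraphs n) (λ A → S∑.⟦ connected? A ⟧ ⊗ f A) a b c)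
    (ℚ∑.∑-cong (simpleGraphs n) λ A → at-⟦⟧ (connected? A) (f A) a b c)

  module _ {X : Set} (xs : List X) (w : ∀ {n} → Graph n → Vec X n → Series)
           (w-zero : ∀ {n} (A : Graph n) → IsSimple A → ∀ u a b c → n ≢ a ℕ.+ c → w A u a b c ≡ 0ℚ) where

    total-homogeneous : Homogeneous (total xs w)
    total-homogeneous n a b c n≢ = trans (at-∑ (simpleGraphs n) (λ A → S∑.∑ (allVecs xs n) (w A)) a b c)
      (∑-simple-zero n λ A s → trans (at-∑ (allVecs xs n) (w A) a b c)
        (ℚ∑.∑-zero (allVecs xs n) λ u → w-zero A s u a b c n≢))

    connectedTotal-homogeneous : Homogeneous (connectedTotal xs w)
    connectedTotal-homogeneous n a b c n≢ = trans (at-∑ᶜ n (λ A → S∑.∑ (allVecs xs n) (w A)) a b c)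
      (∑-simple-zero n λ A s → trans
        (cong (⟦ connected? A ⟧ *_) (trans (at-∑ (allVecs xs n) (w A) a b c)
          (ℚ∑.∑-zero (allVecs xs n) λ u → w-zero A s u a b c n≢)))
        (ℚ.*-zeroʳ ⟦ connected? A ⟧))

  monomial-zero : ∀ n k a b c → n ≢ a ℕ.+ c → mono n k 0 a b c ≡ 0ℚ
  monomial-zero n k a b c n≢ = trans (at-mono n k 0 a b c) (ℚ∑.⟦⟧-no (delta? n k 0 a b c)
    λ { (refl , _ , refl) → n≢ (sym (ℕ.+-identityʳ n)) })

  plainWeight-zero : ∀ {n} (A : Graph n) → IsSimple A → ∀ u a b c → n ≢ a ℕ.+ c → plainWeight A u a b c ≡ 0ℚ
  plainWeight-zero {n} A _ u a b c n≢ = monomial-zero n (size A) a b c n≢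

  sideWeight-zero : ∀ {n} (A : Graph n) → IsSimple A → ∀ u a b c → n ≢ a ℕ.+ c → sideWeight A u a b c ≡ 0ℚ
  sideWeight-zero {n} A _ u a b c n≢ = trans (at-⟦⟧ (Counting.proper? A u) (mono n (size A) 0) a b c)
    (trans (cong (⟦ Counting.proper? A u ⟧ *_) (monomial-zero n (size A) a b c n≢)) (ℚ.*-zeroʳ ⟦ Counting.proper? A u ⟧))

  -- Homogeneity of the central weight is exactly the identity rank + ν = order.
  centralWeight-zero : ∀ {n} (A : Graph n) → IsSimple A → ∀ ks a b c → n ≢ a ℕ.+ c → centralWeight A ks a b c ≡ 0ℚ
  centralWeight-zero {n} A s ks a b c n≢ = trans
    (at-guarded (noIsolated? (colouredGraph A ks)) (central? (colouredGraph A ks)) (rank (colouredGraph A ks))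
      (cardinality (colouredGraph A ks)) (bipartiteComponents (colouredGraph A ks)) a b c)
    (vanish ⟦ noIsolated? (colouredGraph A ks) ⟧ ⟦ central? (colouredGraph A ks) ⟧
      (ℚ∑.⟦⟧-no (delta? (rank (colouredGraph A ks)) (cardinality (colouredGraph A ks)) (bipartiteComponents (colouredGraph A ks)) a b c)
        λ (p , _ , q) → n≢ (trans (sym (rank+bipartiteComponents (colouredGraph A ks) s)) (cong₂ ℕ._+_ p q))))
    where
    vanish : ∀ p q {r} → r ≡ 0ℚ → p * (q * r) ≡ 0ℚ
    vanish p q refl = trans (cong (p *_) (ℚ.*-zeroʳ q)) (ℚ.*-zeroʳ p)

  -- The delta of the exponents together with the two guards is the predicate counted by `Γ`.
  Γ-coefficient : ∀ r c ν → total colours centralWeight (r ℕ.+ ν) r c ν ≡ fromℕ (Γ r c ν)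
  Γ-coefficient r c ν = begin
    total colours centralWeight (r ℕ.+ ν) r c ν
      ≡⟨ at-∑ (simpleGraphs (r ℕ.+ ν)) (λ A → S∑.∑ (allVecs colours (r ℕ.+ ν)) (centralWeight A)) r c ν ⟩
    ℚ∑.∑ (simpleGraphs (r ℕ.+ ν)) (λ A → S∑.∑ (allVecs colours (r ℕ.+ ν)) (centralWeight A) r c ν)
      ≡⟨ ℚ∑.∑-cong (simpleGraphs (r ℕ.+ ν)) (λ A → trans (at-∑ (allVecs colours (r ℕ.+ ν)) (centralWeight A) r c ν)
           (ℚ∑.∑-cong (allVecs colours (r ℕ.+ ν)) λ ks → weight (colouredGraph A ks))) ⟩
    ℚ∑.∑ (simpleGraphs (r ℕ.+ ν)) (λ A → ℚ∑.∑ (allVecs colours (r ℕ.+ ν)) λ ks → ⟦ isΓ? r c ν (colouredGraph A ks) ⟧)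
      ≡⟨ ℚ∑.∑-product colouredGraph (simpleGraphs (r ℕ.+ ν)) (allVecs colours (r ℕ.+ ν)) (λ G → ⟦ isΓ? r c ν G ⟧) ⟨
    ℚ∑.∑ (colouredGraphs (r ℕ.+ ν)) (λ G → ⟦ isΓ? r c ν G ⟧)
      ≡⟨ fromℕ-count (isΓ? r c ν) (colouredGraphs (r ℕ.+ ν)) ⟨
    fromℕ (Γ r c ν) ∎
    where
    open ≡-Reasoning
    guarded-⟦⟧ : ∀ {P Q R : Set} (p : Dec P) (q : Dec Q) (e : Dec R) → ⟦ p ⟧ * (⟦ q ⟧ * ⟦ e ⟧) ≡ ⟦ p ×-dec (q ×-dec e) ⟧
    guarded-⟦⟧ p q e = sym (trans (ℚ∑.⟦⟧-× p (q ×-dec e)) (cong (⟦ p ⟧ *_) (ℚ∑.⟦⟧-× q e)))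
    weight : (G : ColouredGraph (r ℕ.+ ν)) →
      guarded (noIsolated? G) (central? G) (rank G) (cardinality G) (bipartiteComponents G) r c ν ≡ ⟦ isΓ? r c ν G ⟧
    weight G = trans
      (at-guarded (noIsolated? G) (central? G) (rank G) (cardinality G) (bipartiteComponents G) r c ν)
      (trans (guarded-⟦⟧ (noIsolated? G) (central? G) (delta? (rank G) (cardinality G) (bipartiteComponents G) r c ν))
        (ℚ∑.⟦⟧-cong (noIsolated? G ×-dec (central? G ×-dec delta? (rank G) (cardinality G) (bipartiteComponents G) r c ν))
          (isΓ? r c ν G) id id))

  β : ℕ → ℕ → ℚ
  β n k = fromℕ (b̄ n k)

  β-∑ : ∀ n k → β n k ≡ ℚ∑.∑ (simpleGraphs n) λ A → ⟦ connected? A ×-dec bipartite? A ×-dec (size A ℕ.≟ k) ⟧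
  β-∑ n k = fromℕ-count (λ A → connected? A ×-dec bipartite? A ×-dec (size A ℕ.≟ k)) (simpleGraphs n)

  bipartite-hit : ∀ n r ν b → ∑ᶜ n (bipartiteTerm r ν) r b ν ≡ β n b
  bipartite-hit n r ν b = trans (at-∑ᶜ n (bipartiteTerm r ν) r b ν) (trans
    (ℚ∑.∑-cong (simpleGraphs n) λ A → trans
      (cong (⟦ connected? A ⟧ *_) (trans (at-⟦⟧ (bipartite? A) (mono r (size A) ν) r b ν)
        (cong (⟦ bipartite? A ⟧ *_) (trans (at-mono r (size A) ν r b ν)
          (ℚ∑.⟦⟧-cong (delta? r (size A) ν r b ν) (size A ℕ.≟ b) (λ (_ , q , _) → q) (λ q → refl , q , refl))))))
      (sym (trans (ℚ∑.⟦⟧-× (connected? A) (bipartite? A ×-dec (size A ℕ.≟ b)))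
        (cong (⟦ connected? A ⟧ *_) (ℚ∑.⟦⟧-× (bipartite? A) (size A ℕ.≟ b))))))
    (sym (β-∑ n b)))

  bipartite-miss : ∀ n r ν a b c → ¬ (r ≡ a × ν ≡ c) → ∑ᶜ n (bipartiteTerm r ν) a b c ≡ 0ℚ
  bipartite-miss n r ν a b c miss = trans (at-∑ᶜ n (bipartiteTerm r ν) a b c) (ℚ∑.∑-zero (simpleGraphs n) λ A →
    trans (cong (⟦ connected? A ⟧ *_) (trans (at-⟦⟧ (bipartite? A) (mono r (size A) ν) a b c)
      (trans (cong (⟦ bipartite? A ⟧ *_) (trans (at-mono r (size A) ν a b c)
        (ℚ∑.⟦⟧-no (delta? r (size A) ν a b c) λ (p , _ , q) → miss (p , q)))) (ℚ.*-zeroʳ ⟦ bipartite? A ⟧))))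
    (ℚ.*-zeroʳ ⟦ connected? A ⟧))

  nonBipartite-miss : ∀ n a b c → ¬ (n ≡ a × 0 ≡ c) → ∑ᶜ n nonBipartiteTerm a b c ≡ 0ℚ
  nonBipartite-miss n a b c miss = trans (at-∑ᶜ n nonBipartiteTerm a b c) (ℚ∑.∑-zero (simpleGraphs n) λ A →
    trans (cong (⟦ connected? A ⟧ *_) (trans (at-⟦⟧ (¬? (bipartite? A)) (mono n (size A) 0) a b c)
      (trans (cong (⟦ ¬? (bipartite? A) ⟧ *_) (trans (at-mono n (size A) 0 a b c)
        (ℚ∑.⟦⟧-no (delta? n (size A) 0 a b c) λ (p , _ , q) → miss (p , q)))) (ℚ.*-zeroʳ ⟦ ¬? (bipartite? A) ⟧))))
    (ℚ.*-zeroʳ ⟦ connected? A ⟧))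

  -- A single vertex without a loop is bipartite, so at order 1 the logarithm of the graph series is
  -- just x.
  nonBipartite-single : ∀ b → ∑ᶜ 1 nonBipartiteTerm 1 b 0 ≡ 0ℚ
  nonBipartite-single b = trans (at-∑ᶜ 1 nonBipartiteTerm 1 b 0) (∑-simple-zero 1 λ A s →
    trans (cong (⟦ connected? A ⟧ *_) (trans (at-⟦⟧ (¬? (bipartite? A)) (mono 1 (size A) 0) 1 b 0)
      (trans (cong (_* mono 1 (size A) 0 1 b 0) (ℚ∑.⟦⟧-no (¬? (bipartite? A)) λ ¬bip → ¬bip (bip A s)))
        (ℚ.*-zeroˡ (mono 1 (size A) 0 1 b 0)))))
    (ℚ.*-zeroʳ ⟦ connected? A ⟧))
    where
    bip : ∀ (A : Graph 1) → IsSimple A → Bipartite A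
    bip A (_ , loop) = Subset.⊤ , λ { Fin.zero _ Fin.zero _ a _ → loop Fin.zero a }

  -- The rank of the arrangement of a connected graph is at most its size.
  few-edges : ∀ n k → suc k < n → β n k ≡ 0ℚ
  few-edges (suc m) k lt = trans (β-∑ (suc m) k) (∑-simple-zero (suc m) λ A s →
    ℚ∑.⟦⟧-no (connected? A ×-dec bipartite? A ×-dec (size A ℕ.≟ k)) λ (conn , bip , eq) →
      ℕ.<⇒≱ lt (s≤s (subst (m ≤_) eq (bound A s conn bip))))
    where
    bound : ∀ (A : Graph (suc m)) → IsSimple A → Connected A → Bipartite A → m ≤ size A
    bound A s conn bip = begin
      m                                              ≡⟨ rank≡ ⟨
      rank (colouredGraph A stars)                   ≤⟨ dimSpan≤length (List.map normal (arrangement (colouredGraph A stars))) ⟩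
      List.length (List.map normal (arrangement (colouredGraph A stars)))
                                                     ≡⟨ List.length-map normal (arrangement (colouredGraph A stars)) ⟩
      cardinality (colouredGraph A stars)            ≡⟨ cardinality-formula (colouredGraph A stars) ⟩
      size A ℕ.+ JoinInvariants.colouredVertices (stars {suc m})
                                                     ≡⟨ cong (size A ℕ.+_) (stars-uncoloured (suc m)) ⟩
      size A ℕ.+ 0                                   ≡⟨ ℕ.+-identityʳ (size A) ⟩
      size A                                         ∎
      where
      open ℕ.≤-Reasoning
      rank≡ : rank (colouredGraph A stars) ≡ m
      rank≡ = ℕ.suc-injective (trans (ℕ.+-comm 1 (rank (colouredGraph A stars)))
        (trans (cong (rank (colouredGraph A stars) ℕ.+_) (sym (bipartiteComponents-bipartite A conn bip)))
          (rank+bipartiteComponents (colouredGraph A stars) s)))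

  -- Here `γ̄⁽⁰⁾` and `b̄` part ways: rank 0 would mean a lone vertex, which is isolated.
  γ̄-single : ∀ k → fromℕ (γ̄⁽⁰⁾ 0 k) ≡ 0ℚ
  γ̄-single k = trans (fromℕ-count (isγ̄? 0 k) (colouredGraphs 1))
    (trans (ℚ∑.∑-product colouredGraph (simpleGraphs 1) (allVecs colours 1) (λ G → ⟦ isγ̄? 0 k G ⟧))
      (∑-simple-zero 1 λ A s → ℚ∑.∑-zero (allVecs colours 1) λ ks →
        ℚ∑.⟦⟧-no (isγ̄? 0 k (colouredGraph A ks)) λ (_ , _ , _ , noniso , _) → lonely A s (noniso Fin.zero)))
    where
    lonely : ∀ (A : Graph 1) → IsSimple A → ¬ NonIsolated A Fin.zero
    lonely A (_ , loop) (Fin.zero , a) = loop Fin.zero a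

  -- From order 2 on a connected graph has no isolated vertex, the colouring is forced, and the rank
  -- is one less than the order.
  γ̄-β : ∀ r k → fromℕ (γ̄⁽⁰⁾ (suc r) k) ≡ β (suc (suc r)) k
  γ̄-β r k = begin
    fromℕ (γ̄⁽⁰⁾ (suc r) k)
      ≡⟨ fromℕ-count (isγ̄? (suc r) k) (colouredGraphs n) ⟩
    ℚ∑.∑ (colouredGraphs n) (λ G → ⟦ isγ̄? (suc r) k G ⟧)
      ≡⟨ ℚ∑.∑-product colouredGraph (simpleGraphs n) kss (λ G → ⟦ isγ̄? (suc r) k G ⟧) ⟩
    ℚ∑.∑ (simpleGraphs n) (λ A → ℚ∑.∑ kss λ ks → ⟦ isγ̄? (suc r) k (colouredGraph A ks) ⟧)
      ≡⟨ ℚF.∑-simple-cong n (λ A s → trans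
           (ℚ∑.∑-cong kss λ ks → trans
             (ℚ∑.⟦⟧-cong (isγ̄? (suc r) k (colouredGraph A ks)) ((stars ≟ᶜ ks) ×-dec plain? A) (⇒ A ks) (⇐ A s ks))
             (ℚ∑.⟦⟧-× (stars ≟ᶜ ks) (plain? A)))
           (ℚ∑.∑-pick kss (ℚ∑.Enumerates-allVecs {xs = colours} _≟ᵏ_ enumerates n) stars (stars ≟ᶜ_) (λ _ → ⟦ plain? A ⟧))) ⟩
    ℚ∑.∑ (simpleGraphs n) (λ A → ⟦ plain? A ⟧)
      ≡⟨ β-∑ n k ⟨
    β n k ∎
    where
    open ≡-Reasoning
    n = suc (suc r)
    kss = allVecs colours n
    enumerates = Weights.Weighted.Enumerates-colours ℚ.+-*-commutativeRing 0ℚ 0ℚ 0ℚ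
    plain? : (A : Graph n) → Dec (Connected A × Bipartite A × size A ≡ k)
    plain? A = connected? A ×-dec bipartite? A ×-dec (size A ℕ.≟ k)
    stars-size : (A : Graph n) → cardinality (colouredGraph A stars) ≡ size A
    stars-size A = trans (cardinality-formula (colouredGraph A stars))
      (trans (cong (size A ℕ.+_) (stars-uncoloured n)) (ℕ.+-identityʳ (size A)))
    ⇒ : ∀ A ks → Isγ̄ (suc r) k (colouredGraph A ks) → stars ≡ ks × (Connected A × Bipartite A × size A ≡ k)
    ⇒ A ks (conn , non , bip , _ , _ , card) with all-nonColoured ks non
    ... | refl = refl , conn , bip , trans (sym (stars-size A)) card
    ⇐ : ∀ A → IsSimple A → ∀ ks → stars ≡ ks × (Connected A × Bipartite A × size A ≡ k) → Isγ̄ (suc r) k (colouredGraph A ks)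
    ⇐ A s _ (refl , conn , bip , sz) = conn , stars-colour , bip , noniso , rank≡ , trans (stars-size A) sz
      where
      noniso : ∀ i → NonIsolated A i
      noniso Fin.zero    = walk-nonIsolated A (conn Fin.zero (Fin.suc Fin.zero)) λ ()
      noniso (Fin.suc i) = walk-nonIsolated A (conn (Fin.suc i) Fin.zero) λ ()
      rank≡ : rank (colouredGraph A stars) ≡ suc r
      rank≡ = ℕ.suc-injective (trans (ℕ.+-comm 1 (rank (colouredGraph A stars)))
        (trans (cong (rank (colouredGraph A stars) ℕ.+_) (sym (bipartiteComponents-bipartite A conn bip)))
          (rank+bipartiteComponents (colouredGraph A stars) s)))

  β-single-zero : β 1 0 ≡ 1ℚ
  β-single-zero = refl

  β-single-suc : ∀ k → β 1 (suc k) ≡ 0ℚ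
  β-single-suc k = refl

-- Comparison of the logarithmic derivatives.

module Assembly where

  open import Defs
  open import Data.Bool.Base using (Bool; true; false; if_then_else_)
  open import Data.Fin.Base as Fin using (Fin; toℕ)
  import Data.Fin.Properties as Fin
  open import Data.List.Base using ([]; _∷_)
  open import Data.Nat.Base as ℕ using (ℕ; zero; suc; _∸_; _≤_; _<_; z≤n; s≤s)
  open import Data.Nat.Combinatorics using (_C_; k>n⇒nCk≡0)
  import Data.Nat.Properties as ℕ
  open import Data.Product.Base using (_×_; _,_; proj₂)
  open import Data.Rational.Base using (ℚ; 0ℚ; 1ℚ; ½; _+_; _*_; _-_; -_)
  import Data.Rational.Properties as ℚ
  open import Data.Rational.Solver using (module +-*-Solver)
  open import Data.Unit.Base using (tt)
  open import Function.Base using (_∘_)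
  open import Relation.Binary.PropositionalEquality hiding (J)
  open import Relation.Nullary using (¬_; does)
  open Scalars
  open SeriesRing
  open SeriesCalculus
  open Shuffle
  open Weights using (colours)
  open Weights.Weighted seriesRing 𝕩 𝕪 𝕫
    using (plainWeight; sideWeight; centralWeight; ∑ᶜ; bipartiteTerm; nonBipartiteTerm; plain-total; side-total;
           plain-connected; sides-connected; central-connected₁; central-connected;
           plainWeight-multiplicative; sideWeight-multiplicative; centralWeight-multiplicative)
  open GeneratingFunctions
  open Coefficients
  open SF using (total; connectedTotal; total-suc)
  open S∑ using (bools)
  open import Algebra.Properties.Semiring.Exp S.semiring using (_^_)

  Tᵖ Kᵖ Tˢ Kˢ Tᶜ : ℕ → Series
  Tᵖ = total (tt ∷ []) plainWeight
  Kᵖ = connectedTotal (tt ∷ []) plainWeight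
  Tˢ = total bools sideWeight
  Kˢ = connectedTotal bools sideWeight
  Tᶜ = total colours centralWeight

  D-plain : D (EGF Tᵖ) ≈ D (EGF Kᵖ) ⊗ EGF Tᵖ
  D-plain = D-EGF Kᵖ Tᵖ (connectedTotal-homogeneous (tt ∷ []) plainWeight plainWeight-zero)
    (total-homogeneous (tt ∷ []) plainWeight plainWeight-zero)
    (total-suc (tt ∷ []) plainWeight plainWeight-multiplicative)

  D-side : D (EGF Tˢ) ≈ D (EGF Kˢ) ⊗ EGF Tˢ
  D-side = D-EGF Kˢ Tˢ (connectedTotal-homogeneous bools sideWeight sideWeight-zero)
    (total-homogeneous bools sideWeight sideWeight-zero)
    (total-suc bools sideWeight sideWeight-multiplicative)

  -- Sealed: at the orders 0 and 1 conversion would enumerate the graphs.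
  abstract
    Kᶜ Bip Bip⁻ Non : ℕ → Series
    Kᶜ     = connectedTotal colours centralWeight
    Bip n  = ∑ᶜ n (bipartiteTerm n 0)
    Bip⁻ n = ∑ᶜ n (bipartiteTerm (n ∸ 1) 1)
    Non n  = ∑ᶜ n nonBipartiteTerm

    D-central : D (EGF Tᶜ) ≈ D (EGF Kᶜ) ⊗ EGF Tᶜ
    D-central = D-EGF Kᶜ Tᶜ (connectedTotal-homogeneous colours centralWeight centralWeight-zero)
      (total-homogeneous colours centralWeight centralWeight-zero)
      (total-suc colours centralWeight centralWeight-multiplicative)

    Bip-hit : ∀ n b → Bip n n b 0 ≡ β n b
    Bip-hit n b = bipartite-hit n n 0 b

    Bip-miss : ∀ n a b c → ¬ (n ≡ a × 0 ≡ c) → Bip n a b c ≡ 0ℚ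
    Bip-miss n = bipartite-miss n n 0

    Bip⁻-hit : ∀ n b → Bip⁻ (suc n) n b 1 ≡ β (suc n) b
    Bip⁻-hit n b = bipartite-hit (suc n) n 1 b

    Bip⁻-miss : ∀ n a b c → 1 ≢ c → Bip⁻ n a b c ≡ 0ℚ
    Bip⁻-miss n a b c 1≢c = bipartite-miss n (n ∸ 1) 1 a b c (1≢c ∘ proj₂)

    Non-miss : ∀ n a b c → ¬ (n ≡ a × 0 ≡ c) → Non n a b c ≡ 0ℚ
    Non-miss = nonBipartite-miss

    Non-single : ∀ b → Non 1 1 b 0 ≡ 0ℚ
    Non-single = nonBipartite-single

    Kᵖ-value : ∀ n → Kᵖ n ≈ Bip n ⊕ Non n
    Kᵖ-value = plain-connected

    Kˢ-value : ∀ n → Kˢ (suc n) ≈ Bip (suc n) ⊕ Bip (suc n)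
    Kˢ-value = sides-connected

    Kᶜ-single : Kᶜ 1 ≈ (Bip 1 ⊕ Bip 1) ⊗ ((𝟙 ⊕ 𝕪) ^ 1 S.- 𝟙)
    Kᶜ-single = central-connected₁

    Kᶜ-value : ∀ m → let n = suc (suc m) in
      Kᶜ n ≈ (Bip⁻ n ⊕ Non n) ⊕ (Bip n ⊕ Bip n) ⊗ ((𝟙 ⊕ 𝕪) ^ n S.- 𝟙)
    Kᶜ-value = central-connected

  EGF-order : ∀ T {a c n} b → a ℕ.+ c ≡ n → EGF T a b c ≡ T n a b c * 1/! n
  EGF-order T b refl = refl

  𝟙-z : ∀ a b c → 𝟙 a b (suc c) ≡ 0ℚ
  𝟙-z zero    zero    c = refl
  𝟙-z zero    (suc b) c = refl
  𝟙-z (suc a) b       c = refl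

  𝕩-z : ∀ a b c → 𝕩 a b (suc c) ≡ 0ℚ
  𝕩-z zero          b       c = refl
  𝕩-z (suc zero)    zero    c = refl
  𝕩-z (suc zero)    (suc b) c = refl
  𝕩-z (suc (suc a)) b       c = refl

  𝕪-z : ∀ a b c → 𝕪 a b (suc c) ≡ 0ℚ
  𝕪-z zero    zero          c = refl
  𝕪-z zero    (suc zero)    c = refl
  𝕪-z zero    (suc (suc b)) c = refl
  𝕪-z (suc a) b             c = refl

  plain-series : (ℕ → ℕ → ℚ) → Series
  plain-series f = 𝟙 ⊕ ∑xⁿyᵏ 1 0 (λ n k → f n k /! n)

  -- The series of the statement write the term of order 0 as a separate 1 and start at n = 1; the
  -- last hypothesis restores that term.
  plain-series≈EGF : ∀ T f → (∀ n k → T n n k 0 ≡ f n k) → (∀ a b c → T (a ℕ.+ suc c) a b (suc c) ≡ 0ℚ) →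
                     (∀ b → f 0 b ≡ 𝟙 0 b 0) → plain-series f ≈ EGF T
  plain-series≈EGF T f hit miss start = pointwise λ where
    zero    b zero    → trans (ℚ.+-identityʳ (𝟙 0 b 0)) (sym (trans (cong (_* 1ℚ) (trans (hit 0 b) (start b))) (ℚ.*-identityʳ (𝟙 0 b 0))))
    (suc a) b zero    → trans (ℚ.+-identityˡ _) (sym (trans (EGF-order T b (ℕ.+-identityʳ (suc a))) (cong (_* 1/! (suc a)) (hit (suc a) b))))
    a       b (suc c) → trans (cong (_+ 0ℚ) (𝟙-z a b c)) (sym (trans (cong (_* 1/! (a ℕ.+ suc c)) (miss a b c)) (ℚ.*-zeroˡ (1/! (a ℕ.+ suc c)))))

  a≢a+1+c : ∀ a c → a ℕ.+ suc c ≢ a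
  a≢a+1+c a c eq = ℕ.m≢1+m+n a (sym (trans (sym (ℕ.+-suc a c)) eq))

  graphs : ℕ → ℕ → ℚ
  graphs n k = fromℕ ((n C 2) C k)

  sides : ℕ → ℕ → ℚ
  sides n k = ∑[ i < suc n ] fromℕ ((n C toℕ i) ℕ.* ((toℕ i ℕ.* (n ∸ toℕ i)) C k))

  graphs≈ : plain-series graphs ≈ EGF Tᵖ
  graphs≈ = plain-series≈EGF Tᵖ graphs
    (λ n k → trans (at (plain-total n) n k 0) (trans (𝕩^-hit n ((𝟙 ⊕ 𝕪) ^ (n C 2)) k 0) (1+𝕪^ (n C 2) k)))
    (λ a b c → trans (at (plain-total (a ℕ.+ suc c)) a b (suc c))
      (𝕩^-miss (a ℕ.+ suc c) ((𝟙 ⊕ 𝕪) ^ ((a ℕ.+ suc c) C 2))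
        (λ i j k → 1+𝕪^-degree ((a ℕ.+ suc c) C 2) (suc i) j k λ ()) a b (suc c) (a≢a+1+c a c)))
    λ { zero → refl ; (suc b) → refl }

  sideTotal : ℕ → Series
  sideTotal n = S∑.∑ (words n) λ s → (𝟙 ⊕ 𝕪) ^ (ones s ℕ.* zeros s)

  sides≈ : plain-series sides ≈ EGF Tˢ
  sides≈ = plain-series≈EGF Tˢ sides
    (λ n k → trans (at (side-total n) n k 0) (trans (𝕩^-hit n (sideTotal n) k 0) (begin
      sideTotal n 0 k 0
        ≡⟨ at-∑ (words n) (λ s → (𝟙 ⊕ 𝕪) ^ (ones s ℕ.* zeros s)) 0 k 0 ⟩
      ℚ∑.∑ (words n) (λ s → ((𝟙 ⊕ 𝕪) ^ (ones s ℕ.* zeros s)) 0 k 0)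
        ≡⟨ ℚ∑.∑-cong (words n) (λ s → 1+𝕪^ (ones s ℕ.* zeros s) k) ⟩
      ℚ∑.∑ (words n) (λ s → fromℕ (binomial (ones s ℕ.* zeros s) k))
        ≡⟨ ∑-words-by-ones n (λ i j → fromℕ (binomial (i ℕ.* j) k)) ⟩
      ∑[ i < suc n ] (fromℕ (n C toℕ i) * fromℕ (binomial (toℕ i ℕ.* (n ∸ toℕ i)) k))
        ≡⟨ sum-cong-≗ {suc n} (λ i → fromℕ-* (n C toℕ i) (binomial (toℕ i ℕ.* (n ∸ toℕ i)) k)) ⟨
      sides n k ∎)))
    (λ a b c → trans (at (side-total (a ℕ.+ suc c)) a b (suc c))
      (𝕩^-miss (a ℕ.+ suc c) (sideTotal (a ℕ.+ suc c))
        (λ i j k → trans (at-∑ (words (a ℕ.+ suc c)) (λ s → (𝟙 ⊕ 𝕪) ^ (ones s ℕ.* zeros s)) (suc i) j k)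
          (ℚ∑.∑-zero (words (a ℕ.+ suc c)) λ s → 1+𝕪^-degree (ones s ℕ.* zeros s) (suc i) j k λ ()))
        a b (suc c) (a≢a+1+c a c)))
    λ { zero → refl ; (suc b) → refl }
    where open ≡-Reasoning

  VanishesBelow-1 : ∀ {F} → F 0 0 0 ≡ 0ℚ → VanishesBelow 1 F
  VanishesBelow-1 eq zero    zero    zero    _         = eq
  VanishesBelow-1 eq zero    zero    (suc c) (s≤s ())
  VanishesBelow-1 eq zero    (suc b) c       (s≤s ())
  VanishesBelow-1 eq (suc a) b       c       (s≤s ())

  D-cancel : ∀ {F G} → D F ≈ D G → ∀ a b c m → a ℕ.+ c ≡ suc m → F a b c ≡ G a b c
  D-cancel {F} {G} eq a b c m order = cancel-suc m (begin
    fromℕ (suc m) * F a b c    ≡⟨ cong (λ n → fromℕ n * F a b c) order ⟨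
    D F a b c                  ≡⟨ at eq a b c ⟩
    D G a b c                  ≡⟨ cong (λ n → fromℕ n * G a b c) order ⟩
    fromℕ (suc m) * G a b c    ∎)
    where open ≡-Reasoning

  D-agree : ∀ F G → (∀ a b c m → a ℕ.+ c ≡ suc m → F a b c ≡ G a b c) → D F ≈ D G
  D-agree F G h = pointwise λ a b c → go a b c (a ℕ.+ c) refl
    where
    go : ∀ a b c n → a ℕ.+ c ≡ n → D F a b c ≡ D G a b c
    go a b c zero    eq = trans (trans (cong (λ n → fromℕ n * F a b c) eq) (ℚ.*-zeroˡ (F a b c)))
      (sym (trans (cong (λ n → fromℕ n * G a b c) eq) (ℚ.*-zeroˡ (G a b c))))
    go a b c (suc m) eq = cong (fromℕ (a ℕ.+ c) *_) (h a b c m eq)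

  -- The logarithm of the series of all structures is that of the connected ones, up to the terms of
  -- order 0 that D cannot see.
  log-EGF : ∀ H T K → H ≈ EGF T → D (EGF T) ≈ D (EGF K) ⊗ EGF T → H 0 0 0 ≡ 1ℚ → D (log H) ≈ D (EGF K)
  log-EGF H T K H≈ DT H₁ = D-log (D (EGF K)) (VanishesBelow-1 (cong (_- 1ℚ) H₁))
    (S.trans (D-cong H≈) (S.trans DT (S.*-congˡ {D (EGF K)} (S.sym H≈))))

  log-start : ∀ {F} → (∀ b → F 0 b 0 ≡ 𝟙 0 b 0) → ∀ b → log F 0 b 0 ≡ 0ℚ
  log-start {F} F₁ b = trans
    (sum-cong-≗ {b ℕ.+ 0} λ m → trans (cong (coefficient (toℕ m) *_) (power (toℕ m))) (ℚ.*-zeroʳ (coefficient (toℕ m))))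
    (sum-replicate-zero (b ℕ.+ 0))
    where
    import Data.Integer.Base as ℤ
    import Data.Rational.Base as Rat
    coefficient : ℕ → ℚ
    coefficient m = (ℤ.-1ℤ ℤ.^ m) Rat./ suc m
    U = F ⊖ 𝟙
    power : ∀ m → (U ^ˢ suc m) 0 b 0 ≡ 0ℚ
    power m = ⊗-zero-at U (U ^ˢ m) 0 b 0 λ { zero j zero _ _ _ → trans
      (cong (_* (U ^ˢ m) 0 (b ∸ j) 0) (trans (cong (_- 𝟙 0 j 0) (F₁ j)) (ℚ.+-inverseʳ (𝟙 0 j 0))))
      (ℚ.*-zeroˡ ((U ^ˢ m) 0 (b ∸ j) 0)) }

  log-graphs log-sides : Series
  log-graphs = log (plain-series graphs)
  log-sides  = log (plain-series sides)

  log-graphs-value : ∀ a b c m → a ℕ.+ c ≡ suc m → log-graphs a b c ≡ (Bip (suc m) a b c + Non (suc m) a b c) * 1/! (suc m)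
  log-graphs-value a b c m order = trans
    (D-cancel (log-EGF (plain-series graphs) Tᵖ Kᵖ graphs≈ D-plain refl) a b c m order)
    (trans (EGF-order Kᵖ b order) (cong (_* 1/! (suc m)) (at (Kᵖ-value (suc m)) a b c)))

  -- Half the logarithm counts connected bipartite graphs once each, since each was counted with its
  -- two proper 2-colourings.
  log-sides-value : ∀ a b c → ½ * log-sides (suc a) b c ≡ Bip (suc (a ℕ.+ c)) (suc a) b c * 1/! (suc (a ℕ.+ c))
  log-sides-value a b c = trans (cong (½ *_) (trans
    (D-cancel (log-EGF (plain-series sides) Tˢ Kˢ sides≈ D-side refl) (suc a) b c (a ℕ.+ c) refl)
    (cong (_* 1/! (suc (a ℕ.+ c))) (at (Kˢ-value (a ℕ.+ c)) (suc a) b c))))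
    (solve 2 (λ x i → con ½ :* ((x :+ x) :* i) := x :* i) refl (Bip (suc (a ℕ.+ c)) (suc a) b c) (1/! (suc (a ℕ.+ c))))
    where open +-*-Solver

  log-sides-order : ∀ a b → ½ * log-sides (suc a) b 0 ≡ β (suc a) b * 1/! (suc a)
  log-sides-order a b = trans (log-sides-value a b 0)
    (trans (cong (λ n → Bip (suc n) (suc a) b 0 * 1/! (suc n)) (ℕ.+-identityʳ a))
           (cong (_* 1/! (suc a)) (Bip-hit (suc a) b)))

  log-sides-z : ∀ a b c → ½ * log-sides (suc a) b (suc c) ≡ 0ℚ
  log-sides-z a b c = trans (log-sides-value a b (suc c))
    (trans (cong (_* 1/! (suc (a ℕ.+ suc c)))
      (Bip-miss (suc (a ℕ.+ suc c)) (suc a) b (suc c) λ ()))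
      (ℚ.*-zeroˡ (1/! (suc (a ℕ.+ suc c)))))

  log-graphs-z : ∀ a b c → log-graphs a b (suc c) ≡ 0ℚ
  log-graphs-z a b c = trans (log-graphs-value a b (suc c) (a ℕ.+ c) (ℕ.+-suc a c))
    (trans (cong₂ (λ p q → (p + q) * 1/! (suc (a ℕ.+ c)))
      (Bip-miss (suc (a ℕ.+ c)) a b (suc c) λ ())
      (Non-miss (suc (a ℕ.+ c)) a b (suc c) λ ()))
      (ℚ.*-zeroˡ (1/! (suc (a ℕ.+ c)))))

  log-graphs-order : ∀ a b → log-graphs (suc a) b 0 ≡ (β (suc a) b + Non (suc a) (suc a) b 0) * 1/! (suc a)
  log-graphs-order a b = trans (log-graphs-value (suc a) b 0 a (ℕ.+-identityʳ (suc a)))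
    (cong (λ p → (p + Non (suc a) (suc a) b 0) * 1/! (suc a)) (Bip-hit (suc a) b))

  Coloured : ℕ → Series
  Coloured n = (Bip n ⊕ Bip n) ⊗ ((𝟙 ⊕ 𝕪) ^ n S.- 𝟙)

  coloured-miss : ∀ n a b c → a < n → Coloured n a b c ≡ 0ℚ
  coloured-miss n a b c lt = ⊗-zero-at (Bip n ⊕ Bip n) ((𝟙 ⊕ 𝕪) ^ n S.- 𝟙) a b c λ i j k i≤a _ _ → trans
    (cong (λ p → (p + p) * ((𝟙 ⊕ 𝕪) ^ n S.- 𝟙) (a ∸ i) (b ∸ j) (c ∸ k))
      (Bip-miss n i j k λ (eq , _) → ℕ.<⇒≱ lt (subst (_≤ a) (sym eq) i≤a)))
    (ℚ.*-zeroˡ (((𝟙 ⊕ 𝕪) ^ n S.- 𝟙) (a ∸ i) (b ∸ j) (c ∸ k)))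

  colourings : ℕ → ℕ → ℕ → ℚ
  colourings n b s = fromℕ (n C suc s) * (β n (b ∸ suc s) + β n (b ∸ suc s))

  -- The factor (1 + y)^n - 1 involves neither x nor z and has no constant term. So only the product
  -- in y remains, and the number s + 1 of coloured vertices starts at 1.
  coloured-hit : ∀ n b → Coloured n n b 0 ≡ ∑[ s < b ] colourings n b (toℕ s)
  coloured-hit n b = begin
    Coloured n n b 0
      ≡⟨ ⊗-comm (Bip n ⊕ Bip n) X n b 0 ⟩
    (X ⊗ (Bip n ⊕ Bip n)) n b 0
      ≡⟨⟩
    slice 0 + ∑[ i < n ] slice (suc (toℕ i))
      ≡⟨ cong (slice 0 +_) (sum-none n (slice ∘ suc) λ i → trans
           (sum-cong-≗ {suc b} λ j → trans (ℚ.+-identityʳ _) (trans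
             (cong (_* (Bip n ⊕ Bip n) (n ∸ suc i) (b ∸ toℕ j) 0)
               (cong (_- 0ℚ) (1+𝕪^-degree n (suc i) (toℕ j) 0 λ ())))
             (ℚ.*-zeroˡ ((Bip n ⊕ Bip n) (n ∸ suc i) (b ∸ toℕ j) 0))))
           (sum-replicate-zero (suc b))) ⟩
    slice 0 + 0ℚ
      ≡⟨ ℚ.+-identityʳ (slice 0) ⟩
    slice 0
      ≡⟨ cong₂ _+_ (trans (ℚ.+-identityʳ _) (trans
           (cong (_* (Bip n ⊕ Bip n) n b 0) (cong (_- 1ℚ) (1+𝕪^ n 0)))
           (ℚ.*-zeroˡ ((Bip n ⊕ Bip n) n b 0))))
         (sum-cong-≗ {b} λ s → trans (ℚ.+-identityʳ _) (cong₂ _*_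
           (trans (cong (_- 0ℚ) (1+𝕪^ n (suc (toℕ s)))) (ℚ.+-identityʳ (fromℕ (n C suc (toℕ s)))))
           (cong (λ p → p + p) (Bip-hit n (b ∸ suc (toℕ s)))))) ⟩
    0ℚ + ∑[ s < b ] colourings n b (toℕ s)
      ≡⟨ ℚ.+-identityˡ _ ⟩
    ∑[ s < b ] colourings n b (toℕ s) ∎
    where
    open ≡-Reasoning
    X = (𝟙 ⊕ 𝕪) ^ n S.- 𝟙
    slice : ℕ → ℚ
    slice i = ∑[ j < suc b ] (X i (toℕ j) 0 * (Bip n ⊕ Bip n) (n ∸ i) (b ∸ toℕ j) 0 + 0ℚ)

  graphTerm : ℕ → ℕ → ℚ
  graphTerm n k = fromℕ (b̄ n k) /! n

  colouredTerm : ℕ → ℕ → ℚ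
  colouredTerm r c = (∑[ s < suc c ∸ r ] fromℕ (2 ℕ.* γ̄⁽⁰⁾ (r ∸ 1) (c ∸ suc (toℕ s)) ℕ.* (r C suc (toℕ s)))) /! r

  -- R is exp Q, but only D R ≈ D Q ⊗ R is needed.
  F₁ Q R F₃ F₄ : Series
  F₁ = ((½ · log-sides ⊖ 𝕩) ⊗ 𝕫) /𝕩
  Q  = fromℕ 2 · (𝕩 ⊗ 𝕪)
  R  = ∑xʳyʳ (λ r → fromℕ (2 ℕ.^ r) /! r)
  F₃ = ∑xⁿyᵏ 1 1 colouredTerm
  F₄ = (log-graphs ⊖ 𝕩) ⊖ ∑xⁿyᵏ 2 1 graphTerm

  F₁-zero : ∀ a b → F₁ a b 0 ≡ 0ℚ
  F₁-zero a b = trans (⊗-comm (½ · log-sides ⊖ 𝕩) 𝕫 (suc a) b 0) (𝕫-zero (½ · log-sides ⊖ 𝕩) (suc a) b)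

  F₁-suc : ∀ a b c → F₁ a b (suc c) ≡ ½ * log-sides (suc a) b c - 𝕩 (suc a) b c
  F₁-suc a b c = trans (⊗-comm (½ · log-sides ⊖ 𝕩) 𝕫 (suc a) b (suc c)) (𝕫-suc (½ · log-sides ⊖ 𝕩) (suc a) b c)

  Q-zero : ∀ b c → Q 0 b c ≡ 0ℚ
  Q-zero b c = trans (cong (fromℕ 2 *_) (𝕩-zero 𝕪 b c)) (ℚ.*-zeroʳ (fromℕ 2))

  Q-suc : ∀ a b c → Q (suc a) b c ≡ fromℕ 2 * 𝕪 a b c
  Q-suc a b c = cong (fromℕ 2 *_) (𝕩-suc 𝕪 a b c)

  Q-z : ∀ a b c → Q a b (suc c) ≡ 0ℚ
  Q-z zero    b c = Q-zero b (suc c)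
  Q-z (suc a) b c = trans (Q-suc a b (suc c)) (trans (cong (fromℕ 2 *_) (𝕪-z a b c)) (ℚ.*-zeroʳ (fromℕ 2)))

  F₄-z : ∀ a b c → F₄ a b (suc c) ≡ 0ℚ
  F₄-z a b c = cong₂ (λ p q → p - q - 0ℚ) (log-graphs-z a b c) (𝕩-z a b c)

  β-single : ∀ b → β 1 b ≡ 𝕩 1 b 0
  β-single zero    = β-single-zero
  β-single (suc b) = β-single-suc b

  sum-extend : ∀ {M N} (g : ℕ → ℚ) → M ≤ N → (∀ m → M ≤ m → m < N → g m ≡ 0ℚ) →
               ∑[ m < M ] g (toℕ m) ≡ ∑[ m < N ] g (toℕ m)
  sum-extend {zero}  {N} g _ h = sym (trans (sum-cong-≗ {N} λ m → h (toℕ m) z≤n (Fin.toℕ<n m)) (sum-replicate-zero N))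
  sum-extend {suc M} {suc N} g (s≤s le) h =
    cong (g 0 +_) (sum-extend (g ∘ suc) le λ m M≤m m<N → h (suc m) (s≤s M≤m) (s≤s m<N))

  -- A lone vertex of colour 0 or 1 contributes 2y; this is the source of `Q` = 2xy.
  coloured-single : ∀ b → ∑[ s < b ] colourings 1 b (toℕ s) ≡ fromℕ 2 * 𝕪 0 b 0
  coloured-single zero          = refl
  coloured-single (suc zero)    = cong (λ p → fromℕ 1 * (p + p) + 0ℚ) β-single-zero
  coloured-single (suc (suc b)) = sum-none (suc (suc b)) (colourings 1 (suc (suc b))) λ where
    zero    → cong (λ p → fromℕ 1 * (p + p)) (β-single-suc b)
    (suc s) → trans (cong (λ k → fromℕ k * (β 1 (b ∸ s) + β 1 (b ∸ s))) (k>n⇒nCk≡0 {1} {suc (suc s)} (s≤s (s≤s z≤n))))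
                    (ℚ.*-zeroˡ (β 1 (b ∸ s) + β 1 (b ∸ s)))

  F₃-single : ∀ b → F₃ 1 b 0 ≡ 0ℚ
  F₃-single zero    = refl
  F₃-single (suc b) = trans (cong (_* 1/! 1) (sum-none (suc b)
      (λ s → fromℕ (2 ℕ.* γ̄⁽⁰⁾ 0 (suc b ∸ suc s) ℕ.* (1 C suc s))) λ s → trans
        (fromℕ-* (2 ℕ.* γ̄⁽⁰⁾ 0 (b ∸ s)) (1 C suc s)) (trans
          (cong (_* fromℕ (1 C suc s)) (trans (fromℕ-* 2 (γ̄⁽⁰⁾ 0 (b ∸ s))) (cong (fromℕ 2 *_) (γ̄-single (b ∸ s)))))
          (ℚ.*-zeroˡ (fromℕ (1 C suc s))))))
    (ℚ.*-zeroˡ (1/! 1))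

  -- The summation bound c - r + 1 of the statement and the bound c of the product differ only in
  -- terms with fewer than r - 1 edges, where no connected graph exists.
  F₃-value : ∀ m b → let n = suc (suc m) in F₃ n b 0 ≡ ∑[ s < b ] colourings n b (toℕ s) * 1/! n
  F₃-value m zero    = sym (ℚ.*-zeroˡ (1/! (suc (suc m))))
  F₃-value m (suc b) = cong (_* 1/! (suc (suc m))) (trans
      (sum-cong-≗ {suc (suc b) ∸ n} λ s → term (toℕ s))
      -- With r = n, c = b + 1 and t = s + 1, the condition t ≤ c - r + 1 reads s < b + 2 - n.
      (sum-extend {suc (suc b) ∸ n} {suc b} (colourings n (suc b)) (ℕ.m≤n⇒m≤1+n (ℕ.m∸n≤m b m)) few))
    where
    n = suc (suc m)
    open +-*-Solver
    term : ∀ s → fromℕ (2 ℕ.* γ̄⁽⁰⁾ (suc m) (b ∸ s) ℕ.* (n C suc s)) ≡ colourings n (suc b) s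
    term s = trans (fromℕ-* (2 ℕ.* γ̄⁽⁰⁾ (suc m) (b ∸ s)) (n C suc s)) (trans
      (cong (_* fromℕ (n C suc s)) (trans (fromℕ-* 2 (γ̄⁽⁰⁾ (suc m) (b ∸ s))) (cong (fromℕ 2 *_) (γ̄-β m (b ∸ s)))))
      (solve 2 (λ p c → con (fromℕ 2) :* p :* c := c :* (p :+ p)) refl (β n (b ∸ s)) (fromℕ (n C suc s))))
    few : ∀ s → suc (suc b) ∸ n ≤ s → s < suc b → colourings n (suc b) s ≡ 0ℚ
    few s le lt = trans (cong (λ p → fromℕ (n C suc s) * (p + p)) (few-edges n (b ∸ s) bound))
      (ℚ.*-zeroʳ (fromℕ (n C suc s)))
      where
      bound : suc (b ∸ s) < n
      bound = s≤s (s≤s (ℕ.m≤n+o⇒m∸n≤o b s (subst (b ≤_) (ℕ.+-comm m s)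
        (ℕ.≤-trans (ℕ.m≤n+m∸n b m) (ℕ.+-monoʳ-≤ m le)))))

  F₄-single : ∀ b → F₄ 1 b 0 ≡ 0ℚ
  F₄-single b = trans (cong (λ p → p - 𝕩 1 b 0 - 0ℚ) (trans (log-graphs-order 0 b)
      (cong₂ (λ p q → (p + q) * 1ℚ) (β-single b) (Non-single b))))
    (solve 1 (λ x → (x :+ con 0ℚ) :* con 1ℚ :- x :- con 0ℚ := con 0ℚ) refl (𝕩 1 b 0))
    where open +-*-Solver

  -- Subtracting the series of `b̄` inside the exponential leaves precisely the connected
  -- non-bipartite graphs.
  F₄-value : ∀ m b → let n = suc (suc m) in F₄ n b 0 ≡ Non n n b 0 * 1/! n
  F₄-value m b = trans (cong₂ (λ p q → p - 0ℚ - q) (log-graphs-order (suc m) b) (subtracted b))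
    (solve 3 (λ p q i → (p :+ q) :* i :- con 0ℚ :- p :* i := q :* i) refl (β n b) (Non n n b 0) (1/! n))
    where
    n = suc (suc m)
    open +-*-Solver
    subtracted : ∀ b → ∑xⁿyᵏ 2 1 graphTerm n b 0 ≡ β n b * 1/! n
    -- The subtracted series starts at k = 1, in agreement with the absence of connected graphs of
    -- order at least 2 without edges.
    subtracted zero    = sym (trans (cong (_* 1/! n) (few-edges n 0 (s≤s (s≤s z≤n)))) (ℚ.*-zeroˡ (1/! n)))
    subtracted (suc b) = refl

  exponent : Series
  exponent = F₁ ⊕ Q ⊕ F₃ ⊕ F₄

  exponent-value : ∀ {p q r s t} a b c → F₁ a b c ≡ p → Q a b c ≡ q → F₃ a b c ≡ r → F₄ a b c ≡ s →
                   p + q + r + s ≡ t → exponent a b c ≡ t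
  exponent-value a b c refl refl refl refl eq = eq

  -- The exponent c of z sorts the connected central graphs: c = 1 gives the non-coloured bipartite
  -- ones, all in `F₁`; c = 0 the coloured ones, in `Q` at order 1 and in `F₃` above it, and the
  -- non-bipartite ones in `F₄`; a connected graph has no c above 1.
  exponent-agrees : ∀ a b c m → a ℕ.+ c ≡ suc m → exponent a b c ≡ EGF Kᶜ a b c
  exponent-agrees zero b zero m ()
  exponent-agrees (suc zero) b zero m _ = exponent-value 1 b 0 (F₁-zero 1 b) (Q-suc 0 b 0) (F₃-single b) (F₄-single b)
    (trans (solve 1 (λ q → con 0ℚ :+ q :+ con 0ℚ :+ con 0ℚ := q :* con 1ℚ) refl (fromℕ 2 * 𝕪 0 b 0))
      (cong (_* 1ℚ) (sym (trans (at Kᶜ-single 1 b 0) (trans (coloured-hit 1 b) (coloured-single b))))))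
    where open +-*-Solver
  exponent-agrees (suc (suc m)) b zero _ _ = exponent-value n b 0 (F₁-zero n b) (Q-suc (suc m) b 0) (F₃-value m b) (F₄-value m b)
    (trans (solve 3 (λ p q i → con 0ℚ :+ con (fromℕ 2) :* con 0ℚ :+ p :* i :+ q :* i := (con 0ℚ :+ q :+ p) :* i) refl
             (∑[ s < b ] colourings n b (toℕ s)) (Non n n b 0) (1/! n))
      (sym (trans (EGF-order Kᶜ b (ℕ.+-identityʳ n)) (cong (_* 1/! n) (trans (at (Kᶜ-value m) n b 0)
        (cong₂ (λ p q → p + Non n n b 0 + q) (Bip⁻-miss n n b 0 λ ()) (coloured-hit n b)))))))
    where
    open +-*-Solver
    n = suc (suc m)
  exponent-agrees zero b (suc zero) m _ = exponent-value 0 b 1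
    (trans (F₁-suc 0 b 0) (trans (cong (_- 𝕩 1 b 0) (trans (log-sides-order 0 b) (trans (ℚ.*-identityʳ (β 1 b)) (β-single b))))
      (ℚ.+-inverseʳ (𝕩 1 b 0))))
    (Q-zero b 1) refl (F₄-z 0 b 0)
    (sym (trans (cong (_* 1ℚ) (trans (at Kᶜ-single 0 b 1) (coloured-miss 1 0 b 1 (s≤s z≤n)))) refl))
  exponent-agrees (suc m) b (suc zero) _ _ = exponent-value (suc m) b 1
    (trans (F₁-suc (suc m) b 0) (trans (ℚ.+-identityʳ _) (log-sides-order (suc m) b)))
    (Q-z (suc m) b 0) refl (F₄-z (suc m) b 0)
    (trans (solve 2 (λ p i → p :* i :+ con 0ℚ :+ con 0ℚ :+ con 0ℚ := (p :+ con 0ℚ :+ con 0ℚ) :* i) refl (β n b) (1/! n))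
      (sym (trans (EGF-order Kᶜ b (ℕ.+-comm (suc m) 1)) (cong (_* 1/! n) (trans (at (Kᶜ-value m) (suc m) b 1)
        (cong₂ _+_ (cong₂ _+_ (Bip⁻-hit (suc m) b) (Non-miss n (suc m) b 1 λ ()))
                   (coloured-miss n (suc m) b 1 ℕ.≤-refl)))))))
    where
    open +-*-Solver
    n = suc (suc m)
  exponent-agrees a b (suc (suc c)) _ _ = exponent-value a b (suc (suc c))
    (trans (F₁-suc a b (suc c)) (cong₂ _-_ (log-sides-z a b c) (𝕩-z (suc a) b c)))
    (Q-z a b (suc c)) refl (F₄-z a b (suc c))
    (sym (trans (EGF-order Kᶜ b order) (trans (cong (_* 1/! n) (trans (at (Kᶜ-value (a ℕ.+ c)) a b (suc (suc c)))
      (cong₂ _+_ (cong₂ _+_ (Bip⁻-miss n a b (suc (suc c)) λ ()) (Non-miss n a b (suc (suc c)) λ ()))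
                 (coloured-miss n a b (suc (suc c)) (s≤s (ℕ.m≤n⇒m≤1+n (ℕ.m≤m+n a c)))))))
      (ℚ.*-zeroˡ (1/! n)))))
    where
    n = suc (suc (a ℕ.+ c))
    order : a ℕ.+ suc (suc c) ≡ n
    order = trans (ℕ.+-suc a (suc c)) (cong suc (ℕ.+-suc a c))

  D-Q : D Q ≈ Q
  D-Q = pointwise λ where
    zero    b c       → trans (trans (cong (fromℕ c *_) (Q-zero b c)) (ℚ.*-zeroʳ (fromℕ c))) (sym (Q-zero b c))
    (suc a) b (suc c) → trans (cong (fromℕ (suc a ℕ.+ suc c) *_) (Q-z (suc a) b c))
      (trans (ℚ.*-zeroʳ (fromℕ (suc a ℕ.+ suc c))) (sym (Q-z (suc a) b c)))
    (suc zero)    b zero → ℚ.*-identityˡ (Q 1 b 0)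
    (suc (suc a)) b zero → trans (cong (fromℕ (suc (suc a) ℕ.+ 0) *_) (Q-suc (suc a) b 0))
      (trans (ℚ.*-zeroʳ (fromℕ (suc (suc a) ℕ.+ 0))) (sym (Q-suc (suc a) b 0)))

  -- `Q` is homogeneous of order 1, so D Q = Q, and the equation is the recursion (a + 1)
  -- 2^(a+1)/(a+1)! = 2 · 2^a/a! along the diagonal.
  D-R : D R ≈ D Q ⊗ R
  D-R = S.trans (pointwise go) (S.*-congʳ {R} (S.sym D-Q))
    where
    open ≡-Reasoning
    open +-*-Solver
    Q⊗R : Q ⊗ R ≈ fromℕ 2 · (𝕩 ⊗ (𝕪 ⊗ R))
    Q⊗R = S.trans (·-⊗ (fromℕ 2) (𝕩 ⊗ 𝕪) R) (·-cong (fromℕ 2) (S.*-assoc 𝕩 𝕪 R))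
    diagonal : ∀ a (d : Bool) → fromℕ (suc a) * (if d then fromℕ (2 ℕ.^ suc a) /! suc a else 0ℚ) ≡
                                 fromℕ 2 * (if d then fromℕ (2 ℕ.^ a) /! a else 0ℚ)
    diagonal a false = ℚ.*-zeroʳ (fromℕ (suc a))
    diagonal a true  = begin
      fromℕ (suc a) * (fromℕ (2 ℕ.* 2 ℕ.^ a) * 1/! (suc a))
        ≡⟨ cong (λ p → fromℕ (suc a) * (p * 1/! (suc a))) (fromℕ-* 2 (2 ℕ.^ a)) ⟩
      fromℕ (suc a) * ((fromℕ 2 * fromℕ (2 ℕ.^ a)) * 1/! (suc a))
        ≡⟨ solve 4 (λ n t p i → n :* ((t :* p) :* i) := t :* (p :* (n :* i))) refl
             (fromℕ (suc a)) (fromℕ 2) (fromℕ (2 ℕ.^ a)) (1/! (suc a)) ⟩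
      fromℕ 2 * (fromℕ (2 ℕ.^ a) * (fromℕ (suc a) * 1/! (suc a)))
        ≡⟨ cong (λ i → fromℕ 2 * (fromℕ (2 ℕ.^ a) * i)) (suc*1/! a) ⟩
      fromℕ 2 * (fromℕ (2 ℕ.^ a) * 1/! a) ∎
    go : ∀ a b c → D R a b c ≡ (Q ⊗ R) a b c
    go zero b zero = trans (ℚ.*-zeroˡ (R 0 b 0)) (sym (trans (at Q⊗R 0 b 0)
      (trans (cong (fromℕ 2 *_) (𝕩-zero (𝕪 ⊗ R) b 0)) (ℚ.*-zeroʳ (fromℕ 2)))))
    go zero b (suc c) = trans (ℚ.*-zeroʳ (fromℕ (suc c))) (sym (trans (at Q⊗R 0 b (suc c))
      (trans (cong (fromℕ 2 *_) (𝕩-zero (𝕪 ⊗ R) b (suc c))) (ℚ.*-zeroʳ (fromℕ 2)))))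
    go (suc a) zero zero = trans (ℚ.*-zeroʳ (fromℕ (suc a ℕ.+ 0))) (sym (trans (at Q⊗R (suc a) 0 0)
      (trans (cong (fromℕ 2 *_) (trans (𝕩-suc (𝕪 ⊗ R) a 0 0) (𝕪-zero R a 0))) (ℚ.*-zeroʳ (fromℕ 2)))))
    go (suc a) zero (suc c) = trans (ℚ.*-zeroʳ (fromℕ (suc a ℕ.+ suc c))) (sym (trans (at Q⊗R (suc a) 0 (suc c))
      (trans (cong (fromℕ 2 *_) (trans (𝕩-suc (𝕪 ⊗ R) a 0 (suc c)) (𝕪-zero R a (suc c)))) (ℚ.*-zeroʳ (fromℕ 2)))))
    go (suc a) (suc b) (suc c) = trans (ℚ.*-zeroʳ (fromℕ (suc a ℕ.+ suc c))) (sym (trans (at Q⊗R (suc a) (suc b) (suc c))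
      (trans (cong (fromℕ 2 *_) (trans (𝕩-suc (𝕪 ⊗ R) a (suc b) (suc c)) (𝕪-suc R a b (suc c)))) (ℚ.*-zeroʳ (fromℕ 2)))))
    go (suc a) (suc b) zero = begin
      fromℕ (suc a ℕ.+ 0) * R (suc a) (suc b) 0
        ≡⟨ cong (λ n → fromℕ n * R (suc a) (suc b) 0) (ℕ.+-identityʳ (suc a)) ⟩
      fromℕ (suc a) * R (suc a) (suc b) 0
        ≡⟨ diagonal a (does (a ℕ.≟ b)) ⟩
      fromℕ 2 * R a b 0
        ≡⟨ cong (fromℕ 2 *_) (trans (𝕩-suc (𝕪 ⊗ R) a (suc b) 0) (𝕪-suc R a b 0)) ⟨
      fromℕ 2 * (𝕩 ⊗ (𝕪 ⊗ R)) (suc a) (suc b) 0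
        ≡⟨ at Q⊗R (suc a) (suc b) 0 ⟨
      (Q ⊗ R) (suc a) (suc b) 0 ∎

  rhs : Series
  rhs = exp F₁ ⊗ R ⊗ exp F₃ ⊗ exp F₄

  D-rhs : D rhs ≈ D (EGF Kᶜ) ⊗ rhs
  D-rhs = S.trans (D-product {exp F₁ ⊗ R ⊗ exp F₃} {exp F₄} {D F₁ ⊕ D Q ⊕ D F₃} {D F₄}
      (D-product {exp F₁ ⊗ R} {exp F₃} {D F₁ ⊕ D Q} {D F₃}
        (D-product {exp F₁} {R} {D F₁} {D Q} (D-exp {F₁} (VanishesBelow-1 (F₁-zero 0 0))) D-R)
        (D-exp {F₃} (VanishesBelow-1 {F₃} refl)))
      (D-exp {F₄} (VanishesBelow-1 (F₄-start 0))))
    (S.*-congʳ {rhs} (S.trans (S.sym D-exponent) (D-agree exponent (EGF Kᶜ) exponent-agrees)))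
    where
    F₄-start : ∀ b → F₄ 0 b 0 ≡ 0ℚ
    F₄-start b = cong (λ p → p - 0ℚ - 0ℚ) (log-start {plain-series graphs} (λ { zero → refl ; (suc b) → refl }) b)
    D-exponent : D exponent ≈ D F₁ ⊕ D Q ⊕ D F₃ ⊕ D F₄
    D-exponent = S.trans (D-⊕ (F₁ ⊕ Q ⊕ F₃) F₄) (S.+-congʳ {D F₄} (S.trans (D-⊕ (F₁ ⊕ Q) F₃) (S.+-congʳ {D F₃} (D-⊕ F₁ Q))))

  unital-rhs : Unital rhs
  unital-rhs = Unital-⊗ {exp F₁ ⊗ R ⊗ exp F₃} {exp F₄} (Unital-⊗ {exp F₁ ⊗ R} {exp F₃} (Unital-⊗ {exp F₁} {R}
      (Unital-exp {F₁} (F₁-zero 0)) (λ { zero → refl ; (suc b) → refl }))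
      (Unital-exp {F₃} λ b → refl))
      (Unital-exp {F₄} λ b → cong (λ p → p - 0ℚ - 0ℚ) (log-start {plain-series graphs} (λ { zero → refl ; (suc b) → refl }) b))

  -- In order 0 there is only the empty graph, which is central and has cardinality 0.
  unital-central : Unital (EGF Tᶜ)
  unital-central b = trans (cong (_* 1ℚ) (Γ-coefficient 0 b 0)) (trans (ℚ.*-identityʳ (fromℕ (Γ 0 b 0))) (empty b))
    where
    empty : ∀ b → fromℕ (Γ 0 b 0) ≡ 𝟙 0 b 0
    empty zero    = refl
    empty (suc b) = refl

  central≈rhs : EGF Tᶜ ≈ rhs
  central≈rhs = uniqueness (D (EGF Kᶜ)) {EGF Tᶜ} {rhs} (λ b → ℚ.*-zeroˡ (EGF Kᶜ 0 b 0)) D-central D-rhs unital-central unital-rhs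

  F₁-cong : ∀ {L} → log-sides ≡ L → F₁ ≡ ((½ · L ⊖ 𝕩) ⊗ 𝕫) /𝕩
  F₁-cong refl = refl

  central-series : ℕ → ℕ → ℕ → ℚ
  central-series r c ν = fromℕ (Γ r c ν) /! (r ℕ.+ ν)

  -- The Xᵢ are identified by ≡, since conversion would compare the products by
  -- unfolding their coefficients.
  factorisation : ∀ {X₀ X₁ X₂ X₃ X₄} → central-series ≡ X₀ → F₁ ≡ X₁ → R ≡ X₂ → F₃ ≡ X₃ → F₄ ≡ X₄ →
    ∑xʳyᶜzᵛ X₀ ≋ exp X₁ ⊗ X₂ ⊗ exp X₃ ⊗ exp X₄
  factorisation refl refl refl refl refl = ∑-id central-series λ r c ν →
    trans (cong (_/! (r ℕ.+ ν)) (sym (Γ-coefficient r c ν))) (at central≈rhs r c ν)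
    where
    ∑-id : ∀ X {G} → X ≋ G → ∑xʳyᶜzᵛ X ≋ G
    ∑-id X p = p

  theorem : ∀ {X₀ L X₂ X₃ X₄} → central-series ≡ X₀ → log-sides ≡ L → R ≡ X₂ → F₃ ≡ X₃ → F₄ ≡ X₄ →
    ∑xʳyᶜzᵛ X₀ ≋ exp (((½ · L ⊖ 𝕩) ⊗ 𝕫) /𝕩) ⊗ X₂ ⊗ exp X₃ ⊗ exp X₄
  theorem p q = factorisation p (F₁-cong q)

-- The factorisation with its series written out.

open import Defs
open import Data.Fin.Base using (toℕ)
open import Data.Nat.Base using (suc; _+_; _*_; _∸_; _^_)
open import Data.Nat.Combinatorics using (_C_)
open import Data.Rational.Base using (½)
open import Relation.Binary.PropositionalEquality using (_≡_; refl)

sides-expanded : Assembly.log-sides ≡ log (𝟙 ⊕ ∑xⁿyᵏ 1 0 (λ n k →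
    (∑[ i < suc n ] fromℕ ((n C toℕ i) * ((toℕ i * (n ∸ toℕ i)) C k))) /! n))
sides-expanded = refl

coloured-expanded : Assembly.F₃ ≡ ∑xⁿyᵏ 1 1 (λ r c →
    (∑[ s < suc c ∸ r ]
    fromℕ (2 * γ̄⁽⁰⁾ (r ∸ 1) (c ∸ suc (toℕ s)) * (r C suc (toℕ s)))) /! r)
coloured-expanded = refl

theorem1 : ∑xʳyᶜzᵛ (λ r c ν → fromℕ (Γ r c ν) /! (r + ν))
    ≋ exp (((½ · log (𝟙 ⊕ ∑xⁿyᵏ 1 0 (λ n k →
    (∑[ i < suc n ] fromℕ ((n C toℕ i) * ((toℕ i * (n ∸ toℕ i)) C k))) /! n)) ⊖ 𝕩) ⊗ 𝕫) /𝕩)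
    ⊗ ∑xʳyʳ (λ r → fromℕ (2 ^ r) /! r)
    ⊗ exp (∑xⁿyᵏ 1 1 (λ r c →
    (∑[ s < suc c ∸ r ]
    fromℕ (2 * γ̄⁽⁰⁾ (r ∸ 1) (c ∸ suc (toℕ s)) * (r C suc (toℕ s)))) /! r))
    ⊗ exp ((log (𝟙 ⊕ ∑xⁿyᵏ 1 0 (λ n k → fromℕ ((n C 2) C k) /! n)) ⊖ 𝕩)
    ⊖ ∑xⁿyᵏ 2 1 (λ n k → fromℕ (b̄ n k) /! n))
theorem1 = Assembly.theorem
  {X₀ = λ r c ν → fromℕ (Γ r c ν) /! (r + ν)}
  {X₂ = ∑xʳyʳ (λ r → fromℕ (2 ^ r) /! r)}
  {X₄ = (log (𝟙 ⊕ ∑xⁿyᵏ 1 0 (λ n k → fromℕ ((n C 2) C k) /! n)) ⊖ 𝕩) ⊖ ∑xⁿyᵏ 2 1 (λ n k → fromℕ (b̄ n k) /! n)}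
  refl sides-expanded refl coloured-expanded refl
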